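{- Let $\chi$ be an odd primitive Dirichlet character (i.e. $\chi(-1)=-1$) with conductor $q>1$. Then for every complex number $z\neq 1$, $$\prod_{k=2}^\infty\left(1-\chi(k)\frac{z}{k}\right)=\frac{2^{\varphi(q)/2}}{(1-z)\,\epsilon(q)}\cdot\prod_{\substack{1\le j\le \lfloor (q-1)/2\rfloor\\ \gcd(j,q)=1}}\sin\left(\pi\,\frac{j-\chi(j)z}{q}\right),$$ where $\varphi$ is Euler's totient function and $\epsilon(q)=\sqrt{p}$ if $q$ is a power of a prime $p$, and $\epsilon(q)=1$ otherwise.
   Context: The infinite product denotes $\lim_{N\to\infty}\prod_{k=2}^N$ (the value $0$ is allowed). -}

module Defs where

open import Data.Nat as ℕ using (ℕ; zero; suc)
import Data.Nat.Properties as ℕ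
import Data.Nat.Divisibility as ℕ
import Data.Nat.Coprimality as ℕC
open import Data.Nat.Primality using (Prime; prime?; prime⇒nonTrivial; prime⇒nonZero)
open import Data.Fin using (Fin; toℕ; fromℕ<)
open import Data.Fin.Properties using (any?; toℕ-fromℕ<)
open import Data.Integer as ℤ using (ℤ; -[1+_]; +[1+_])
import Data.Integer.Properties as ℤ
open import Data.Integer.Coprimality using (Coprime)
open import Data.Rational
open import Data.Rational.Properties
import Data.Rational.Unnormalised as ℚᵘ
import Data.Rational.Unnormalised.Properties as ℚᵘ
open import Data.Rational.Solver using (module +-*-Solver)
open import Data.List using (List; []; _∷_; map; filter; length; foldr; upTo)
open import Data.Product using (∃; _×_; _,_; proj₁; proj₂)
open import Data.Sum using (_⊎_; inj₁; inj₂)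
open import Relation.Nullary using (¬_; Dec; yes; no; contradiction)
open import Relation.Nullary.Decidable using (map′; _×-dec_)
open import Relation.Binary.PropositionalEquality
  using (_≡_; refl; sym; trans; cong; cong₂; subst; subst₂)

infixl 6 _+ℝ_ _-ℝ_ _+ℂ_ _-ℂ_
infixl 7 _*ℝ_ _*ℂ_ _/ℕ_ _÷ℂ_[_]
infix  8 -ℝ_ -ℂ_
infix  4 _<ℝ_ _≈ℝ_ _≈ℂ_ _#_ _⟶_

ι : ℕ → ℚ
ι n = ℤ.+ n / 1

1/suc : ℕ → ℚ
1/suc n = ℤ.+ 1 / suc n

0<1/suc : ∀ n → 0ℚ < 1/suc n
0<1/suc n = positive⁻¹ (1/suc n) {{normalize-pos 1 (suc n)}}

ι-suc : ∀ n → ι (suc n) ≡ 1ℚ + ι n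
ι-suc n = toℚᵘ-injective (ℚᵘ.≃-trans (toℚᵘ-fromℚᵘ (ℚᵘ.mkℚᵘ (ℤ.+ suc n) 0))
  (ℚᵘ.≃-trans step (ℚᵘ.≃-sym (ℚᵘ.≃-trans (toℚᵘ-homo-+ 1ℚ (ι n))
    (ℚᵘ.+-cong (ℚᵘ.≃-refl {toℚᵘ 1ℚ}) (toℚᵘ-fromℚᵘ (ℚᵘ.mkℚᵘ (ℤ.+ n) 0)))))))
  where
  step : ℚᵘ.mkℚᵘ (ℤ.+ suc n) 0 ℚᵘ.≃ ℚᵘ.mkℚᵘ (ℤ.+ 1) 0 ℚᵘ.+ ℚᵘ.mkℚᵘ (ℤ.+ n) 0
  step = ℚᵘ.*≡* (cong (λ i → (ℤ.+ 1 ℤ.+ i) ℤ.* ℤ.+ 1) (sym (ℤ.*-identityʳ (ℤ.+ n))))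

ι-+ : ∀ m n → ι (m ℕ.+ n) ≡ ι m + ι n
ι-+ zero    n = sym (+-identityˡ (ι n))
ι-+ (suc m) n = trans (ι-suc (m ℕ.+ n)) (trans (cong (1ℚ +_) (ι-+ m n))
  (trans (sym (+-assoc 1ℚ (ι m) (ι n))) (cong (_+ ι n) (sym (ι-suc m)))))

ι-* : ∀ m n → ι (m ℕ.* n) ≡ ι m * ι n
ι-* zero    n = sym (*-zeroˡ (ι n))
ι-* (suc m) n = trans (ι-+ n (m ℕ.* n)) (trans (cong (ι n +_) (ι-* m n))
  (trans (lem (ι n) (ι m)) (cong (_* ι n) (sym (ι-suc m)))))
  where
  open +-*-Solver
  lem : ∀ a b → a + b * a ≡ (1ℚ + b) * a
  lem = solve 2 (λ a b → a :+ b :* a := (con 1ℚ :+ b) :* a) refl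

0≤ι : ∀ n → 0ℚ ≤ ι n
0≤ι n = nonNegative⁻¹ (ι n) {{normalize-nonNeg n 1}}

0<ι-suc : ∀ n → 0ℚ < ι (suc n)
0<ι-suc n = positive⁻¹ (ι (suc n)) {{normalize-pos (suc n) 1}}

ι-mono-≤ : ∀ {m n} → m ℕ.≤ n → ι m ≤ ι n
ι-mono-≤ {m} {n} m≤n = subst₂ _≤_ (+-identityʳ (ι m))
  (trans (sym (ι-+ m (n ℕ.∸ m))) (cong ι (ℕ.m+[n∸m]≡n m≤n)))
  (+-monoʳ-≤ (ι m) (0≤ι (n ℕ.∸ m)))

ι-mono-< : ∀ {m n} → m ℕ.< n → ι m < ι n
ι-mono-< {m} {n} m<n = <-≤-trans
  (subst₂ _<_ (+-identityˡ (ι m)) (sym (ι-suc m)) (+-monoˡ-< (ι m) (0<ι-suc 0)))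
  (ι-mono-≤ m<n)

1/suc-inverse : ∀ n → 1/suc n * ι (suc n) ≡ 1ℚ
1/suc-inverse n = toℚᵘ-injective (ℚᵘ.≃-trans (toℚᵘ-homo-* (1/suc n) (ι (suc n)))
  (ℚᵘ.≃-trans (ℚᵘ.*-cong (toℚᵘ-fromℚᵘ (ℚᵘ.mkℚᵘ (ℤ.+ 1) n)) (toℚᵘ-fromℚᵘ (ℚᵘ.mkℚᵘ (ℤ.+ suc n) 0)))
    (ℚᵘ.*≡* (cong +[1+_] eq))))
  where
  eq : (n ℕ.+ 0) ℕ.* 1 ≡ n ℕ.* 1 ℕ.+ 0
  eq = trans (ℕ.*-identityʳ (n ℕ.+ 0))
    (sym (cong (ℕ._+ 0) (ℕ.*-identityʳ n)))

*-mono-≤ : ∀ {a b c d} → 0ℚ ≤ a → 0ℚ ≤ d → a ≤ b → c ≤ d → a * c ≤ b * d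
*-mono-≤ {a} {b} {c} {d} 0≤a 0≤d a≤b c≤d = ≤-trans
  (*-monoˡ-≤-nonNeg a {{nonNegative 0≤a}} c≤d)
  (*-monoʳ-≤-nonNeg d {{nonNegative 0≤d}} a≤b)

0≤* : ∀ {a b} → 0ℚ ≤ a → 0ℚ ≤ b → 0ℚ ≤ a * b
0≤* {a} {b} 0≤a 0≤b = nonNegative⁻¹ (a * b)
  {{nonNeg*nonNeg⇒nonNeg a {{nonNegative 0≤a}} b {{nonNegative 0≤b}}}}

0<* : ∀ {a b} → 0ℚ < a → 0ℚ < b → 0ℚ < a * b
0<* {a} {b} 0<a 0<b = positive⁻¹ (a * b) {{pos*pos⇒pos a {{positive 0<a}} b {{positive 0<b}}}}

0≤+ : ∀ {a b} → 0ℚ ≤ a → 0ℚ ≤ b → 0ℚ ≤ a + b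
0≤+ {a} {b} 0≤a 0≤b = subst (_≤ a + b) (+-identityˡ 0ℚ) (+-mono-≤ 0≤a 0≤b)

0<+ : ∀ {a b} → 0ℚ ≤ a → 0ℚ < b → 0ℚ < a + b
0<+ {a} {b} 0≤a 0<b = subst (_< a + b) (+-identityˡ 0ℚ) (+-mono-≤-< 0≤a 0<b)

archimedean : ∀ ε → 0ℚ < ε → ∃ λ n → 1/suc n < ε
archimedean (mkℚ (ℤ.+ zero) d c) 0<ε = contradiction 0<ε λ where (*<* (ℤ.+<+ ()))
archimedean (mkℚ -[1+ n ] d c) 0<ε = contradiction 0<ε λ where (*<* ())
archimedean (mkℚ (+[1+ n ]) d c) _ = suc d , toℚᵘ-cancel-<
  (ℚᵘ.<-respˡ-≃ (ℚᵘ.≃-sym (toℚᵘ-fromℚᵘ (ℚᵘ.mkℚᵘ (ℤ.+ 1) (suc d))))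
    (ℚᵘ.*<* (ℤ.+<+ (subst (ℕ._< suc n ℕ.* suc (suc d)) (sym (ℕ.*-identityˡ (suc d)))
      (ℕ.<-≤-trans (ℕ.n<1+n (suc d)) (ℕ.m≤n*m (suc (suc d)) (suc n)))))))

shrink : ∀ K → 0ℚ < K → ∀ ε → 0ℚ < ε → ∃ λ δ → 0ℚ < δ × K * δ < ε
shrink K 0<K ε 0<ε = δ , 0<* 0<½ε 0<K⁻¹ , subst (_< ε) (sym Kδ≡½ε) ½ε<ε
  where
  instance
    posK : Positive K
    posK = positive 0<K
    nzK : NonZero K
    nzK = pos⇒nonZero K
  δ = (½ * ε) * 1/ K
  0<½ε : 0ℚ < ½ * ε
  0<½ε = 0<* (0<1/suc 1) 0<ε
  0<K⁻¹ : 0ℚ < 1/ K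
  0<K⁻¹ = positive⁻¹ (1/ K) {{1/pos⇒pos K}}
  open +-*-Solver
  Kδ≡½ε : K * δ ≡ ½ * ε
  Kδ≡½ε = trans (solve 3 (λ k e i → k :* (e :* i) := e :* (k :* i)) refl K (½ * ε) (1/ K))
    (trans (cong ((½ * ε) *_) (*-inverseʳ K)) (*-identityʳ (½ * ε)))
  ½ε<ε : ½ * ε < ε
  ½ε<ε = subst₂ _<_ (+-identityʳ (½ * ε))
    (solve 1 (λ e → con ½ :* e :+ con ½ :* e := e) refl ε) (+-monoʳ-< (½ * ε) 0<½ε)

∣-∣-swap : ∀ a b → ∣ a - b ∣ ≡ ∣ b - a ∣
∣-∣-swap a b = trans (sym (∣-p∣≡∣p∣ (a - b)))
  (cong ∣_∣ (solve 2 (λ a b → :- (a :- b) := b :- a) refl a b))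
  where open +-*-Solver

p≤∣p∣ : ∀ p → p ≤ ∣ p ∣
p≤∣p∣ p with ∣p∣≡p∨∣p∣≡-p p
... | inj₁ eq = ≤-reflexive (sym eq)
... | inj₂ eq = ≤-trans
  (subst₂ _≤_ (neg-inv p) refl (neg-antimono-≤ (subst (0ℚ ≤_) eq (0≤∣p∣ p)))) (0≤∣p∣ p)
  where
  open +-*-Solver
  neg-inv : ∀ p → - (- p) ≡ p
  neg-inv = solve 1 (λ p → :- (:- p) := p) refl

Cauchy : (ℕ → ℚ) → Set
Cauchy x = ∀ ε → 0ℚ < ε → ∃ λ N → ∀ m n → N ℕ.≤ m → N ℕ.≤ n → ∣ x m - x n ∣ < ε

record ℝ : Set where
  constructor mkℝ
  field
    seq    : ℕ → ℚ
    cauchy : Cauchy seq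
open ℝ public

_<ℝ_ : ℝ → ℝ → Set
x <ℝ y = ∃ λ ε → 0ℚ < ε × ∃ λ N → ∀ n → N ℕ.≤ n → seq x n + ε ≤ seq y n

_≈ℝ_ : ℝ → ℝ → Set
x ≈ℝ y = ∀ ε → 0ℚ < ε → ∃ λ N → ∀ n → N ℕ.≤ n → ∣ seq x n - seq y n ∣ < ε

cauchy-from : ∀ {x} K → 0ℚ < K →
  (∀ ε → 0ℚ < ε → ∃ λ N → ∀ m n → N ℕ.≤ m → m ℕ.≤ n → ∣ x n - x m ∣ ≤ K * ε) → Cauchy x
cauchy-from {x} K 0<K h ε 0<ε =
  let δ , 0<δ , Kδ<ε = shrink K 0<K ε 0<ε
      N , b          = h δ 0<δ
  in N , λ m n N≤m N≤n → go b Kδ<ε m n N≤m N≤n (ℕ.≤-total m n)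
  where
  go : ∀ {N δ} → (∀ m n → N ℕ.≤ m → m ℕ.≤ n → ∣ x n - x m ∣ ≤ K * δ) → K * δ < ε →
    ∀ m n → N ℕ.≤ m → N ℕ.≤ n → m ℕ.≤ n ⊎ n ℕ.≤ m → ∣ x m - x n ∣ < ε
  go b Kδ<ε m n N≤m N≤n (inj₁ m≤n) =
    subst (_< ε) (∣-∣-swap (x n) (x m)) (≤-<-trans (b m n N≤m m≤n) Kδ<ε)
  go b Kδ<ε m n N≤m N≤n (inj₂ n≤m) = ≤-<-trans (b n m N≤n n≤m) Kδ<ε

cauchy-from′ : ∀ {x} K → 0ℚ < K →
  (∀ ε → 0ℚ < ε → ∃ λ N → ∀ m n → N ℕ.≤ m → N ℕ.≤ n → ∣ x m - x n ∣ ≤ K * ε) → Cauchy x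
cauchy-from′ {x} K 0<K h = cauchy-from {x} K 0<K λ ε 0<ε → let N , b = h ε 0<ε in
  N , λ m n N≤m m≤n → b n m (ℕ.≤-trans N≤m m≤n) N≤m

sum∣∣ : (ℕ → ℚ) → ℕ → ℚ
sum∣∣ x zero    = ∣ x 0 ∣
sum∣∣ x (suc n) = sum∣∣ x n + ∣ x (suc n) ∣

0≤sum∣∣ : ∀ x n → 0ℚ ≤ sum∣∣ x n
0≤sum∣∣ x zero    = 0≤∣p∣ (x 0)
0≤sum∣∣ x (suc n) = 0≤+ (0≤sum∣∣ x n) (0≤∣p∣ (x (suc n)))

≤sum∣∣ : ∀ x {m n} → m ℕ.≤′ n → ∣ x m ∣ ≤ sum∣∣ x n
≤sum∣∣ x {zero}  ℕ.≤′-refl = ≤-refl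
≤sum∣∣ x {suc m} ℕ.≤′-refl = subst (_≤ sum∣∣ x m + ∣ x (suc m) ∣) (+-identityˡ ∣ x (suc m) ∣)
  (+-monoˡ-≤ ∣ x (suc m) ∣ (0≤sum∣∣ x m))
≤sum∣∣ x {m} {suc n} (ℕ.≤′-step m≤n) = subst (_≤ sum∣∣ x n + ∣ x (suc n) ∣) (+-identityʳ ∣ x m ∣)
  (+-mono-≤ (≤sum∣∣ x m≤n) (0≤∣p∣ (x (suc n))))

bounded : ∀ {x} → Cauchy x → ∃ λ B → 0ℚ < B × ∀ n → ∣ x n ∣ ≤ B
bounded {x} c with c 1ℚ (0<ι-suc 0)
... | N , b = sum∣∣ x N + 1ℚ , 0<+ (0≤sum∣∣ x N) (0<ι-suc 0) , λ n → go n (ℕ.≤-total n N)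
  where
  open +-*-Solver
  go : ∀ n → n ℕ.≤ N ⊎ N ℕ.≤ n → ∣ x n ∣ ≤ sum∣∣ x N + 1ℚ
  go n (inj₁ n≤N) = subst (_≤ sum∣∣ x N + 1ℚ) (+-identityʳ ∣ x n ∣)
    (+-mono-≤ (≤sum∣∣ x (ℕ.≤⇒≤′ n≤N)) (<⇒≤ (0<ι-suc 0)))
  go n (inj₂ N≤n) = ≤-trans
    (subst (λ p → ∣ p ∣ ≤ ∣ x N ∣ + ∣ x n - x N ∣)
      (solve 2 (λ a b → b :+ (a :- b) := a) refl (x n) (x N))
      (∣p+q∣≤∣p∣+∣q∣ (x N) (x n - x N)))
    (+-mono-≤ (≤sum∣∣ x (ℕ.≤⇒≤′ ℕ.≤-refl)) (<⇒≤ (b n N N≤n ℕ.≤-refl)))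

constℝ : ℚ → ℝ
constℝ p = mkℝ (λ _ → p) λ ε 0<ε → 0 , λ _ _ _ _ →
  subst (_< ε) (sym (cong ∣_∣ (+-inverseʳ p))) 0<ε

0ℝ 1ℝ : ℝ
0ℝ = constℝ 0ℚ
1ℝ = constℝ 1ℚ

+-cauchy : ∀ {x y} → Cauchy x → Cauchy y → Cauchy (λ n → x n + y n)
+-cauchy {x} {y} cx cy =
  cauchy-from′ {λ n → x n + y n} (1ℚ + 1ℚ) (0<+ (0≤ι 1) (0<ι-suc 0)) prf
  where
  open +-*-Solver
  prf : ∀ ε → 0ℚ < ε → ∃ λ N → ∀ m n → N ℕ.≤ m → N ℕ.≤ n →
    ∣ (x m + y m) - (x n + y n) ∣ ≤ (1ℚ + 1ℚ) * ε
  prf ε 0<ε with cx ε 0<ε | cy ε 0<ε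
  ... | N₁ , b₁ | N₂ , b₂ = N₁ ℕ.⊔ N₂ , λ m n N≤m N≤n →
    subst₂ _≤_
      (cong ∣_∣ (solve 4 (λ a b c d → (a :- b) :+ (c :- d) := (a :+ c) :- (b :+ d)) refl
        (x m) (x n) (y m) (y n)))
      (solve 1 (λ e → e :+ e := (con 1ℚ :+ con 1ℚ) :* e) refl ε)
      (≤-trans (∣p+q∣≤∣p∣+∣q∣ (x m - x n) (y m - y n)) (+-mono-≤
        (<⇒≤ (b₁ m n (ℕ.m⊔n≤o⇒m≤o N₁ N₂ N≤m) (ℕ.m⊔n≤o⇒m≤o N₁ N₂ N≤n)))
        (<⇒≤ (b₂ m n (ℕ.m⊔n≤o⇒n≤o N₁ N₂ N≤m) (ℕ.m⊔n≤o⇒n≤o N₁ N₂ N≤n)))))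

_+ℝ_ : ℝ → ℝ → ℝ
x +ℝ y = mkℝ (λ n → seq x n + seq y n) (+-cauchy {seq x} {seq y} (cauchy x) (cauchy y))

-‿cauchy : ∀ {x} → Cauchy x → Cauchy (λ n → - x n)
-‿cauchy {x} cx ε 0<ε = let N , b = cx ε 0<ε in N , λ m n N≤m N≤n →
  subst (_< ε) (cong ∣_∣ (solve 2 (λ a b → b :- a := (:- a) :- (:- b)) refl (x m) (x n)))
    (b n m N≤n N≤m)
  where open +-*-Solver

-ℝ_ : ℝ → ℝ
-ℝ x = mkℝ (λ n → - seq x n) (-‿cauchy {seq x} (cauchy x))

_-ℝ_ : ℝ → ℝ → ℝ
x -ℝ y = x +ℝ (-ℝ y)

*-cauchy : ∀ {x y} → Cauchy x → Cauchy y → Cauchy (λ n → x n * y n)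
*-cauchy {x} {y} cx cy with bounded {x} cx | bounded {y} cy
... | Bx , 0<Bx , bx | By , 0<By , by = cauchy-from′ {λ n → x n * y n} (Bx + By) (0<+ (<⇒≤ 0<Bx) 0<By) prf
  where
  open +-*-Solver
  prf : ∀ ε → 0ℚ < ε → ∃ λ N → ∀ m n → N ℕ.≤ m → N ℕ.≤ n →
    ∣ x m * y m - x n * y n ∣ ≤ (Bx + By) * ε
  prf ε 0<ε with cx ε 0<ε | cy ε 0<ε
  ... | N₁ , b₁ | N₂ , b₂ = N₁ ℕ.⊔ N₂ , λ m n N≤m N≤n →
    subst₂ _≤_
      (cong ∣_∣ (solve 4 (λ a b c d → a :* (c :- d) :+ d :* (a :- b) := a :* c :- b :* d) refl
        (x m) (x n) (y m) (y n)))
      (sym (*-distribʳ-+ ε Bx By))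
      (≤-trans (∣p+q∣≤∣p∣+∣q∣ (x m * (y m - y n)) (y n * (x m - x n))) (+-mono-≤
        (subst (_≤ Bx * ε) (sym (∣p*q∣≡∣p∣*∣q∣ (x m) (y m - y n)))
          (*-mono-≤ (0≤∣p∣ (x m)) (<⇒≤ 0<ε) (bx m)
            (<⇒≤ (b₂ m n (ℕ.m⊔n≤o⇒n≤o N₁ N₂ N≤m) (ℕ.m⊔n≤o⇒n≤o N₁ N₂ N≤n)))))
        (subst (_≤ By * ε) (sym (∣p*q∣≡∣p∣*∣q∣ (y n) (x m - x n)))
          (*-mono-≤ (0≤∣p∣ (y n)) (<⇒≤ 0<ε) (by n)
            (<⇒≤ (b₁ m n (ℕ.m⊔n≤o⇒m≤o N₁ N₂ N≤m) (ℕ.m⊔n≤o⇒m≤o N₁ N₂ N≤n)))))))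

_*ℝ_ : ℝ → ℝ → ℝ
x *ℝ y = mkℝ (λ n → seq x n * seq y n) (*-cauchy {seq x} {seq y} (cauchy x) (cauchy y))

inv : ℚ → ℚ
inv p with p ≟ 0ℚ
... | yes _   = 0ℚ
... | no  p≢0 = (1/ p) {{≢-nonZero p≢0}}

inv-inverse : ∀ p → 0ℚ < p → inv p * p ≡ 1ℚ
inv-inverse p 0<p with p ≟ 0ℚ
... | yes p≡0 = contradiction (sym p≡0) (<⇒≢ 0<p)
... | no  p≢0 = *-inverseˡ p {{≢-nonZero p≢0}}

0≤inv : ∀ p → 0ℚ < p → 0ℚ ≤ inv p
0≤inv p 0<p with p ≟ 0ℚ
... | yes _   = ≤-refl
... | no  p≢0 = <⇒≤ (positive⁻¹ _ {{1/pos⇒pos p {{positive 0<p}}}})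

inv-antitone : ∀ {p q} → 0ℚ < p → p ≤ q → inv q ≤ inv p
inv-antitone {p} {q} 0<p p≤q = subst₂ _≤_ eq₁ eq₂
  (*-mono-≤ (0≤* (0≤inv q 0<q) (0≤inv p 0<p)) (<⇒≤ 0<q) ≤-refl p≤q)
  where
  open +-*-Solver
  0<q = <-≤-trans 0<p p≤q
  eq₁ : inv q * inv p * p ≡ inv q
  eq₁ = trans (*-assoc (inv q) (inv p) p)
    (trans (cong (inv q *_) (inv-inverse p 0<p)) (*-identityʳ (inv q)))
  eq₂ : inv q * inv p * q ≡ inv p
  eq₂ = trans (solve 3 (λ a b c → a :* b :* c := (a :* c) :* b) refl (inv q) (inv p) q)
    (trans (cong (_* inv p) (inv-inverse q 0<q)) (*-identityˡ (inv p)))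

inv-cauchy : ∀ {x} → Cauchy x → ∀ η → 0ℚ < η → ∀ N₀ → (∀ n → N₀ ℕ.≤ n → η ≤ x n) →
  Cauchy (λ n → inv (x n))
inv-cauchy {x} cx η 0<η N₀ η≤x = cauchy-from′ {λ n → inv (x n)} K 0<K λ ε 0<ε →
  let N , b = cx ε 0<ε in N₀ ℕ.⊔ N , λ m n N≤m N≤n → prf ε m n
    (ℕ.m⊔n≤o⇒m≤o N₀ N N≤m) (ℕ.m⊔n≤o⇒m≤o N₀ N N≤n)
    (b n m (ℕ.m⊔n≤o⇒n≤o N₀ N N≤n) (ℕ.m⊔n≤o⇒n≤o N₀ N N≤m))
  where
  K = inv η * inv η + 1ℚ
  0≤η⁻² : 0ℚ ≤ inv η * inv η
  0≤η⁻² = 0≤* (0≤inv η 0<η) (0≤inv η 0<η)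
  0<K : 0ℚ < K
  0<K = 0<+ 0≤η⁻² (0<ι-suc 0)
  open +-*-Solver
  identity : ∀ a b → 0ℚ < a → 0ℚ < b → inv a * inv b * (b - a) ≡ inv a - inv b
  identity a b 0<a 0<b = trans
    (solve 4 (λ i j a b → i :* j :* (b :- a) := i :* (j :* b) :- j :* (i :* a)) refl
      (inv a) (inv b) a b)
    (trans (cong₂ (λ s t → inv a * s - inv b * t) (inv-inverse b 0<b) (inv-inverse a 0<a))
      (cong₂ _-_ (*-identityʳ (inv a)) (*-identityʳ (inv b))))
  prf : ∀ ε m n → N₀ ℕ.≤ m → N₀ ℕ.≤ n → ∣ x n - x m ∣ < ε →
    ∣ inv (x m) - inv (x n) ∣ ≤ K * ε
  prf ε m n N₀≤m N₀≤n d<ε = subst (_≤ K * ε)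
    (trans (cong (_* ∣ x n - x m ∣) (sym (0≤p⇒∣p∣≡p 0≤ij)))
      (trans (sym (∣p*q∣≡∣p∣*∣q∣ (inv (x m) * inv (x n)) (x n - x m)))
        (cong ∣_∣ (identity (x m) (x n) 0<xm 0<xn))))
    (*-mono-≤ 0≤ij 0≤ε
      (≤-trans (*-mono-≤ 0≤i (0≤inv η 0<η) (inv-antitone 0<η (η≤x m N₀≤m))
        (inv-antitone 0<η (η≤x n N₀≤n)))
        (subst (_≤ K) (+-identityʳ (inv η * inv η)) (+-monoʳ-≤ (inv η * inv η) (0≤ι 1))))
      (<⇒≤ d<ε))
    where
    0<xm = <-≤-trans 0<η (η≤x m N₀≤m)
    0<xn = <-≤-trans 0<η (η≤x n N₀≤n)
    0≤i  = 0≤inv (x m) 0<xm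
    0≤ij = 0≤* 0≤i (0≤inv (x n) 0<xn)
    0≤ε  = ≤-trans (0≤∣p∣ (x n - x m)) (<⇒≤ d<ε)

_⁻¹[_] : (x : ℝ) → 0ℝ <ℝ x → ℝ
x ⁻¹[ η , 0<η , N , b ] = mkℝ (λ n → inv (seq x n))
  (inv-cauchy {seq x} (cauchy x) η 0<η N λ n N≤n → subst (_≤ seq x n) (+-identityˡ η) (b n N≤n))

isqrt-step : ℕ → ℕ → ℕ
isqrt-step a r with suc r ℕ.* suc r ℕ.≤? suc a
... | yes _ = suc r
... | no  _ = r

isqrt : ℕ → ℕ
isqrt zero    = 0
isqrt (suc a) = isqrt-step a (isqrt a)

isqrt-lower : ∀ a → isqrt a ℕ.* isqrt a ℕ.≤ a
isqrt-lower zero    = ℕ.z≤n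
isqrt-lower (suc a) with suc (isqrt a) ℕ.* suc (isqrt a) ℕ.≤? suc a
... | yes p = p
... | no  _ = ℕ.m≤n⇒m≤1+n (isqrt-lower a)

isqrt-upper : ∀ a → a ℕ.< suc (isqrt a) ℕ.* suc (isqrt a)
isqrt-upper zero    = ℕ.s≤s ℕ.z≤n
isqrt-upper (suc a) with suc (isqrt a) ℕ.* suc (isqrt a) ℕ.≤? suc a
... | yes _ = ℕ.≤-<-trans (isqrt-upper a)
  (ℕ.*-mono-< (ℕ.n<1+n (suc (isqrt a))) (ℕ.n<1+n (suc (isqrt a))))
... | no ¬p = ℕ.≰⇒> ¬p

-- ⌊√(a(n+1)²)⌋ / (n+1), which is within 1/(n+1) of √a.
√-seq : ℕ → ℕ → ℚ
√-seq a n = ι (isqrt (a ℕ.* (suc n ℕ.* suc n))) * 1/suc n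

square-cancel-< : ∀ {p q} → 0ℚ ≤ q → p * p < q * q → p < q
square-cancel-< {p} {q} 0≤q pp<qq with p <? q
... | yes p<q = p<q
... | no  p≮q = contradiction (≤-<-trans (*-mono-≤ 0≤q (≤-trans 0≤q q≤p) q≤p q≤p) pp<qq)
  (<-irrefl refl)
  where q≤p = ≮⇒≥ p≮q

1/suc-scale : ∀ n r → (ι r * 1/suc n) * (ι r * 1/suc n) ≡
  ι (r ℕ.* r) * (1/suc n * 1/suc n)
1/suc-scale n r = trans
  (solve 2 (λ a b → (a :* b) :* (a :* b) := (a :* a) :* (b :* b)) refl (ι r) (1/suc n))
  (cong (_* (1/suc n * 1/suc n)) (sym (ι-* r r)))
  where open +-*-Solver

1/suc-cancel : ∀ a n → ι (a ℕ.* (suc n ℕ.* suc n)) * (1/suc n * 1/suc n) ≡ ι a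
1/suc-cancel a n = trans
  (cong (_* (1/suc n * 1/suc n))
    (trans (ι-* a (suc n ℕ.* suc n)) (cong (ι a *_) (ι-* (suc n) (suc n)))))
  (trans (solve 3 (λ a b i → (a :* (b :* b)) :* (i :* i) := a :* ((i :* b) :* (i :* b))) refl
    (ι a) (ι (suc n)) (1/suc n))
    (trans (cong (λ t → ι a * (t * t)) (1/suc-inverse n)) (*-identityʳ (ι a))))
  where open +-*-Solver

√-lower : ∀ a n → √-seq a n * √-seq a n ≤ ι a
√-lower a n = subst₂ _≤_ (sym (1/suc-scale n r)) (1/suc-cancel a n)
  (*-mono-≤ (0≤ι (r ℕ.* r)) 0≤ii (ι-mono-≤ (isqrt-lower (a ℕ.* (suc n ℕ.* suc n)))) ≤-refl)
  where
  r = isqrt (a ℕ.* (suc n ℕ.* suc n))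
  0≤ii : 0ℚ ≤ 1/suc n * 1/suc n
  0≤ii = 0≤* (<⇒≤ (0<1/suc n)) (<⇒≤ (0<1/suc n))

√-upper : ∀ a n → ι a < (√-seq a n + 1/suc n) * (√-seq a n + 1/suc n)
√-upper a n = subst₂ _<_ (1/suc-cancel a n) eq
  (*-monoˡ-<-pos (1/suc n * 1/suc n) {{positive (0<* (0<1/suc n) (0<1/suc n))}}
    (ι-mono-< (isqrt-upper (a ℕ.* (suc n ℕ.* suc n)))))
  where
  r = isqrt (a ℕ.* (suc n ℕ.* suc n))
  open +-*-Solver
  sucr : ι (suc r) * 1/suc n ≡ √-seq a n + 1/suc n
  sucr = trans (cong (_* 1/suc n) (ι-suc r))
    (solve 2 (λ a i → (con 1ℚ :+ a) :* i := a :* i :+ i) refl (ι r) (1/suc n))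
  eq : ι (suc r ℕ.* suc r) * (1/suc n * 1/suc n) ≡ (√-seq a n + 1/suc n) * (√-seq a n + 1/suc n)
  eq = trans (sym (1/suc-scale n (suc r))) (cong₂ _*_ sucr sucr)

0≤√-seq : ∀ a n → 0ℚ ≤ √-seq a n
0≤√-seq a n = 0≤* (0≤ι (isqrt (a ℕ.* (suc n ℕ.* suc n)))) (<⇒≤ (0<1/suc n))

√-close : ∀ a m n → √-seq a m < √-seq a n + 1/suc n
√-close a m n = square-cancel-< (0≤+ (0≤√-seq a n) (<⇒≤ (0<1/suc n)))
  (≤-<-trans (√-lower a m) (√-upper a n))

1/suc-antitone : ∀ {m n} → m ℕ.≤ n → 1/suc n ≤ 1/suc m
1/suc-antitone {m} {n} m≤n = subst₂ _≤_
  (trans (*-assoc (1/suc n) (1/suc m) (ι (suc m)))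
    (trans (cong (1/suc n *_) (1/suc-inverse m)) (*-identityʳ (1/suc n))))
  (trans (solve 3 (λ i j k → i :* j :* k := (i :* k) :* j) refl (1/suc n) (1/suc m) (ι (suc n)))
    (trans (cong (_* 1/suc m) (1/suc-inverse n)) (*-identityˡ (1/suc m))))
  (*-mono-≤ (0≤* (<⇒≤ (0<1/suc n)) (<⇒≤ (0<1/suc m))) (0≤ι (suc n)) ≤-refl
    (ι-mono-≤ (ℕ.s≤s m≤n)))
  where open +-*-Solver

∣-∣-≤ : ∀ {a b c} → a ≤ b + c → b ≤ a + c → ∣ a - b ∣ ≤ c
∣-∣-≤ {a} {b} {c} a≤b+c b≤a+c with ∣p∣≡p∨∣p∣≡-p (a - b)
... | inj₁ eq = subst₂ _≤_ (sym eq) (solve 2 (λ b c → (b :+ c) :- b := c) refl b c)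
  (+-monoˡ-≤ (- b) a≤b+c)
  where open +-*-Solver
... | inj₂ eq = subst₂ _≤_
  (trans (solve 2 (λ a b → b :- a := :- (a :- b)) refl a b) (sym eq))
  (solve 2 (λ a c → (a :+ c) :- a := c) refl a c)
  (+-monoˡ-≤ (- a) b≤a+c)
  where open +-*-Solver

√-cauchy : ∀ a → Cauchy (√-seq a)
√-cauchy a = cauchy-from′ {√-seq a} 1ℚ (0<ι-suc 0) λ ε 0<ε →
  let N , 1/N<ε = archimedean ε 0<ε in N , λ m n N≤m N≤n →
    subst (∣ √-seq a m - √-seq a n ∣ ≤_) (sym (*-identityˡ ε))
      (∣-∣-≤ (bound m n N≤n (<⇒≤ 1/N<ε)) (bound n m N≤m (<⇒≤ 1/N<ε)))
  where
  bound : ∀ {N ε} m n → N ℕ.≤ n → 1/suc N ≤ ε → √-seq a m ≤ √-seq a n + ε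
  bound m n N≤n 1/N≤ε = ≤-trans (<⇒≤ (√-close a m n))
    (+-monoʳ-≤ (√-seq a n) (≤-trans (1/suc-antitone N≤n) 1/N≤ε))

√ : ℕ → ℝ
√ a = mkℝ (√-seq a) (√-cauchy a)

1≤√-seq : ∀ a n → 1ℚ ≤ √-seq (suc a) n
1≤√-seq a n = subst (_≤ √-seq (suc a) n)
  (trans (*-comm (ι (suc n)) (1/suc n)) (1/suc-inverse n))
  (*-mono-≤ (0≤ι (suc n)) (<⇒≤ (0<1/suc n)) (ι-mono-≤ sn≤r) ≤-refl)
  where
  r = isqrt (suc a ℕ.* (suc n ℕ.* suc n))
  sn≤r : suc n ℕ.≤ r
  sn≤r with suc n ℕ.≤? r
  ... | yes p = p
  ... | no ¬p = contradiction
    (ℕ.<-≤-trans (isqrt-upper (suc a ℕ.* (suc n ℕ.* suc n)))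
      (ℕ.≤-trans (ℕ.*-mono-≤ (ℕ.≰⇒> ¬p) (ℕ.≰⇒> ¬p))
        (ℕ.m≤n*m (suc n ℕ.* suc n) (suc a))))
    (ℕ.<-irrefl refl)

0<√ : ∀ a → 0 ℕ.< a → 0ℝ <ℝ √ a
0<√ (suc a) _ = 1ℚ , 0<ι-suc 0 , 0 , λ n _ → 1≤√-seq a n

∑ : (ℕ → ℚ) → ℕ → ℚ
∑ t zero    = 0ℚ
∑ t (suc n) = ∑ t n + t n

module Dominated (t g : ℕ → ℚ) (t≤g : ∀ k → ∣ t k ∣ ≤ g k)
                 (K : ℕ) (halves : ∀ k → K ℕ.≤ k → g (suc k) ≤ ½ * g k) where

  0≤g : ∀ k → 0ℚ ≤ g k
  0≤g k = ≤-trans (0≤∣p∣ (t k)) (t≤g k)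

  private
    open +-*-Solver

    double-half : ∀ a → ½ * a + ½ * a ≡ a
    double-half = solve 1 (λ a → con ½ :* a :+ con ½ :* a := a) refl

  tail : ∀ {m n} → K ℕ.≤ m → m ℕ.≤′ n → ∣ ∑ t n - ∑ t m ∣ + (g n + g n) ≤ g m + g m
  tail {m} K≤m ℕ.≤′-refl = ≤-reflexive
    (trans (cong (λ p → ∣ p ∣ + (g m + g m)) (+-inverseʳ (∑ t m))) (+-identityˡ (g m + g m)))
  tail {m} {suc n} K≤m (ℕ.≤′-step m≤n) = begin
    ∣ (∑ t n + t n) - ∑ t m ∣ + (g (suc n) + g (suc n))
      ≡⟨ cong (λ p → ∣ p ∣ + (g (suc n) + g (suc n)))
           (solve 3 (λ a b c → (a :+ b) :- c := (a :- c) :+ b) refl (∑ t n) (t n) (∑ t m)) ⟩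
    ∣ (∑ t n - ∑ t m) + t n ∣ + (g (suc n) + g (suc n))
      ≤⟨ +-mono-≤
           (≤-trans (∣p+q∣≤∣p∣+∣q∣ (∑ t n - ∑ t m) (t n)) (+-monoʳ-≤ ∣ ∑ t n - ∑ t m ∣ (t≤g n)))
           (≤-trans (+-mono-≤ (halves n K≤n) (halves n K≤n)) (≤-reflexive (double-half (g n)))) ⟩
    (∣ ∑ t n - ∑ t m ∣ + g n) + g n
      ≡⟨ +-assoc ∣ ∑ t n - ∑ t m ∣ (g n) (g n) ⟩
    ∣ ∑ t n - ∑ t m ∣ + (g n + g n)
      ≤⟨ tail K≤m m≤n ⟩
    g m + g m ∎
    where
    open ≤-Reasoning
    K≤n = ℕ.≤-trans K≤m (ℕ.≤′⇒≤ m≤n)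

  decay : ∀ j → g (K ℕ.+ j) * ι (suc j) ≤ g K
  decay zero = ≤-reflexive (trans (*-identityʳ (g (K ℕ.+ 0))) (cong g (ℕ.+-identityʳ K)))
  decay (suc j) = begin
    g (K ℕ.+ suc j) * ι (suc (suc j))
      ≡⟨ cong (λ k → g k * ι (suc (suc j))) (ℕ.+-suc K j) ⟩
    g (suc (K ℕ.+ j)) * ι (suc (suc j))
      ≤⟨ *-mono-≤ (0≤g (suc (K ℕ.+ j))) (0≤ι (suc j ℕ.+ suc j))
           (halves (K ℕ.+ j) (ℕ.m≤m+n K j)) (ι-mono-≤ (ℕ.s≤s (ℕ.m≤n+m (suc j) j))) ⟩
    ½ * g (K ℕ.+ j) * ι (suc j ℕ.+ suc j)
      ≡⟨ cong (½ * g (K ℕ.+ j) *_) (ι-+ (suc j) (suc j)) ⟩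
    ½ * g (K ℕ.+ j) * (ι (suc j) + ι (suc j))
      ≡⟨ solve 2 (λ a b → con ½ :* a :* (b :+ b) := a :* b) refl (g (K ℕ.+ j)) (ι (suc j)) ⟩
    g (K ℕ.+ j) * ι (suc j)
      ≤⟨ decay j ⟩
    g K ∎
    where open ≤-Reasoning

  vanish : ∀ j → g (K ℕ.+ j) ≤ g K * 1/suc j
  vanish j = subst (_≤ g K * 1/suc j)
    (trans (*-assoc (g (K ℕ.+ j)) (ι (suc j)) (1/suc j))
      (trans (cong (g (K ℕ.+ j) *_) (trans (*-comm (ι (suc j)) (1/suc j)) (1/suc-inverse j)))
        (*-identityʳ (g (K ℕ.+ j)))))
    (*-monoʳ-≤-nonNeg (1/suc j) {{nonNegative (<⇒≤ (0<1/suc j))}} (decay j))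

  from : ∀ j {n} → K ℕ.+ j ℕ.≤ n → ∣ ∑ t n - ∑ t (K ℕ.+ j) ∣ ≤ (g K + g K) * 1/suc j
  from j {n} K+j≤n = begin
    ∣ ∑ t n - ∑ t (K ℕ.+ j) ∣
      ≡⟨ +-identityʳ ∣ ∑ t n - ∑ t (K ℕ.+ j) ∣ ⟨
    ∣ ∑ t n - ∑ t (K ℕ.+ j) ∣ + 0ℚ
      ≤⟨ +-monoʳ-≤ ∣ ∑ t n - ∑ t (K ℕ.+ j) ∣ (0≤+ (0≤g n) (0≤g n)) ⟩
    ∣ ∑ t n - ∑ t (K ℕ.+ j) ∣ + (g n + g n)
      ≤⟨ tail (ℕ.m≤m+n K j) (ℕ.≤⇒≤′ K+j≤n) ⟩
    g (K ℕ.+ j) + g (K ℕ.+ j)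
      ≤⟨ +-mono-≤ (vanish j) (vanish j) ⟩
    g K * 1/suc j + g K * 1/suc j
      ≡⟨ *-distribʳ-+ (1/suc j) (g K) (g K) ⟨
    (g K + g K) * 1/suc j ∎
    where open ≤-Reasoning

  private
    C = g K + g K
    0≤C : 0ℚ ≤ C
    0≤C = 0≤+ (0≤g K) (0≤g K)

  ∑-cauchy : Cauchy (∑ t)
  ∑-cauchy = cauchy-from′ {∑ t} (C + C + 1ℚ) (0<+ (0≤+ 0≤C 0≤C) (0<ι-suc 0)) λ ε 0<ε →
    let j , 1/j<ε = archimedean ε 0<ε in K ℕ.+ j , λ m n N≤m N≤n → prf ε j (<⇒≤ 1/j<ε) m n N≤m N≤n
    where
    open ≤-Reasoning
    prf : ∀ ε j → 1/suc j ≤ ε → ∀ m n → K ℕ.+ j ℕ.≤ m → K ℕ.+ j ℕ.≤ n →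
      ∣ ∑ t m - ∑ t n ∣ ≤ (C + C + 1ℚ) * ε
    prf ε j 1/j≤ε m n N≤m N≤n = begin
      ∣ ∑ t m - ∑ t n ∣
        ≡⟨ cong ∣_∣ (solve 3 (λ a b c → a :- b := (a :- c) :- (b :- c)) refl
             (∑ t m) (∑ t n) (∑ t (K ℕ.+ j))) ⟩
      ∣ (∑ t m - ∑ t (K ℕ.+ j)) - (∑ t n - ∑ t (K ℕ.+ j)) ∣
        ≤⟨ ∣p-q∣≤∣p∣+∣q∣ (∑ t m - ∑ t (K ℕ.+ j)) (∑ t n - ∑ t (K ℕ.+ j)) ⟩
      ∣ ∑ t m - ∑ t (K ℕ.+ j) ∣ + ∣ ∑ t n - ∑ t (K ℕ.+ j) ∣
        ≤⟨ +-mono-≤ (from j N≤m) (from j N≤n) ⟩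
      C * 1/suc j + C * 1/suc j
        ≤⟨ +-mono-≤ (*-monoˡ-≤-nonNeg C {{nonNegative 0≤C}} 1/j≤ε)
             (*-monoˡ-≤-nonNeg C {{nonNegative 0≤C}} 1/j≤ε) ⟩
      C * ε + C * ε
        ≡⟨ +-identityʳ (C * ε + C * ε) ⟨
      C * ε + C * ε + 0ℚ
        ≤⟨ +-monoʳ-≤ (C * ε + C * ε) (≤-trans (<⇒≤ (0<1/suc j)) 1/j≤ε) ⟩
      C * ε + C * ε + ε
        ≡⟨ solve 2 (λ c e → c :* e :+ c :* e :+ e := (c :+ c :+ con 1ℚ) :* e) refl C ε ⟩
      (C + C + 1ℚ) * ε ∎

oddPower : ℚ → ℕ → ℚ
oddPower x zero    = x
oddPower x (suc k) = - (x * x) * oddPower x k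

-- (-1)ᵏ x²ᵏ⁺¹ / (2k+1)
arctanTerm : ℚ → ℕ → ℚ
arctanTerm x k = oddPower x k * 1/suc (2 ℕ.* k)

arctan : ∀ x → x * x ≤ ½ → ℝ
arctan x xx≤½ = mkℝ (∑ (arctanTerm x))
  (Dominated.∑-cauchy (arctanTerm x) (λ k → ∣ oddPower x k ∣) bound 0 λ k _ → halves k)
  where
  1/suc≤1 : ∀ n → 1/suc n ≤ 1ℚ
  1/suc≤1 n = 1/suc-antitone {0} {n} ℕ.z≤n
  bound : ∀ k → ∣ arctanTerm x k ∣ ≤ ∣ oddPower x k ∣
  bound k = subst₂ _≤_
    (trans (cong (∣ oddPower x k ∣ *_) (sym (0≤p⇒∣p∣≡p (<⇒≤ (0<1/suc (2 ℕ.* k))))))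
      (sym (∣p*q∣≡∣p∣*∣q∣ (oddPower x k) (1/suc (2 ℕ.* k)))))
    (*-identityʳ ∣ oddPower x k ∣)
    (*-mono-≤ (0≤∣p∣ (oddPower x k)) (0≤ι 1) ≤-refl (1/suc≤1 (2 ℕ.* k)))
  0≤xx : 0ℚ ≤ x * x
  0≤xx = subst (0ℚ ≤_)
    (trans (sym (∣p*q∣≡∣p∣*∣q∣ x x)) (abs-square x)) (0≤* (0≤∣p∣ x) (0≤∣p∣ x))
    where
    open +-*-Solver
    abs-square : ∀ x → ∣ x * x ∣ ≡ x * x
    abs-square x with ∣p∣≡p∨∣p∣≡-p x
    ... | inj₁ eq = trans (∣p*q∣≡∣p∣*∣q∣ x x) (cong₂ _*_ eq eq)
    ... | inj₂ eq = trans (∣p*q∣≡∣p∣*∣q∣ x x) (trans (cong₂ _*_ eq eq)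
      (solve 1 (λ a → (:- a) :* (:- a) := a :* a) refl x))
  halves : ∀ k → ∣ - (x * x) * oddPower x k ∣ ≤ ½ * ∣ oddPower x k ∣
  halves k = subst (_≤ ½ * ∣ oddPower x k ∣)
    (sym (trans (∣p*q∣≡∣p∣*∣q∣ (- (x * x)) (oddPower x k))
      (cong (_* ∣ oddPower x k ∣) (trans (∣-p∣≡∣p∣ (x * x)) (0≤p⇒∣p∣≡p 0≤xx)))))
    (*-monoʳ-≤-nonNeg ∣ oddPower x k ∣ {{∣-∣-nonNeg (oddPower x k)}} xx≤½)

-- Euler's formula π/4 = arctan ½ + arctan ⅓.
π : ℝ
π = constℝ (ι 4) *ℝ
  (arctan (ℤ.+ 1 / 2) (≤ᵇ⇒≤ _) +ℝ arctan (ℤ.+ 1 / 3) (≤ᵇ⇒≤ _))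

ℚ[i] : Set
ℚ[i] = ℚ × ℚ

infixl 6 _⊕_ _⊖_
infixl 7 _⊗_ _•_

_⊕_ _⊖_ _⊗_ : ℚ[i] → ℚ[i] → ℚ[i]
(a , b) ⊕ (c , d) = a + c , b + d
(a , b) ⊖ (c , d) = a - c , b - d
(a , b) ⊗ (c , d) = a * c - b * d , a * d + b * c

_•_ : ℚ → ℚ[i] → ℚ[i]
r • (a , b) = r * a , r * b

-- wᵏ/k!
expTerm : ℚ[i] → ℕ → ℚ[i]
expTerm w zero    = 1ℚ , 0ℚ
expTerm w (suc k) = 1/suc k • (expTerm w k ⊗ w)

expSum : ℚ[i] → ℕ → ℚ[i]
expSum w zero    = 0ℚ , 0ℚ
expSum w (suc n) = expSum w n ⊕ expTerm w n

‖_‖ : ℚ[i] → ℚ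
‖ a , b ‖ = ∣ a ∣ + ∣ b ∣

0≤‖‖ : ∀ w → 0ℚ ≤ ‖ w ‖
0≤‖‖ (a , b) = 0≤+ (0≤∣p∣ a) (0≤∣p∣ b)

‖⊕‖ : ∀ u v → ‖ u ⊕ v ‖ ≤ ‖ u ‖ + ‖ v ‖
‖⊕‖ (a , b) (c , d) = ≤-trans (+-mono-≤ (∣p+q∣≤∣p∣+∣q∣ a c) (∣p+q∣≤∣p∣+∣q∣ b d))
  (≤-reflexive (solve 4 (λ a b c d → (a :+ c) :+ (b :+ d) := (a :+ b) :+ (c :+ d)) refl
    (∣ a ∣) (∣ b ∣) (∣ c ∣) (∣ d ∣)))
  where open +-*-Solver

‖⊗‖ : ∀ u v → ‖ u ⊗ v ‖ ≤ ‖ u ‖ * ‖ v ‖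
‖⊗‖ (a , b) (c , d) = ≤-trans
  (+-mono-≤ (∣p-q∣≤∣p∣+∣q∣ (a * c) (b * d)) (∣p+q∣≤∣p∣+∣q∣ (a * d) (b * c)))
  (≤-reflexive (trans
    (cong₂ _+_ (cong₂ _+_ (∣p*q∣≡∣p∣*∣q∣ a c) (∣p*q∣≡∣p∣*∣q∣ b d))
               (cong₂ _+_ (∣p*q∣≡∣p∣*∣q∣ a d) (∣p*q∣≡∣p∣*∣q∣ b c)))
    (solve 4 (λ a b c d → (a :* c :+ b :* d) :+ (a :* d :+ b :* c) := (a :+ b) :* (c :+ d)) refl
      (∣ a ∣) (∣ b ∣) (∣ c ∣) (∣ d ∣))))
  where open +-*-Solver

‖•‖ : ∀ r w → 0ℚ ≤ r → ‖ r • w ‖ ≡ r * ‖ w ‖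
‖•‖ r (a , b) 0≤r = trans
  (cong₂ _+_ (trans (∣p*q∣≡∣p∣*∣q∣ r a) (cong (_* ∣ a ∣) (0≤p⇒∣p∣≡p 0≤r)))
             (trans (∣p*q∣≡∣p∣*∣q∣ r b) (cong (_* ∣ b ∣) (0≤p⇒∣p∣≡p 0≤r))))
  (sym (*-distribˡ-+ r ∣ a ∣ ∣ b ∣))

-- Bᵏ/k!
expBound : ℚ → ℕ → ℚ
expBound B zero    = 1ℚ
expBound B (suc k) = 1/suc k * (expBound B k * B)

-- The derivative of Bᵏ/k! in B.
expBound′ : ℚ → ℕ → ℚ
expBound′ B zero    = 0ℚ
expBound′ B (suc k) = expBound B k

module ExpEstimates (M : ℕ) where

  private
    open +-*-Solver
    B = ι (suc M)
    0≤B : 0ℚ ≤ B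
    0≤B = 0≤ι (suc M)
    b c : ℕ → ℚ
    b = expBound B
    c = expBound′ B
    K = suc M ℕ.+ suc M

  0≤b : ∀ k → 0ℚ ≤ b k
  0≤b zero    = 0≤ι 1
  0≤b (suc k) = 0≤* (<⇒≤ (0<1/suc k)) (0≤* (0≤b k) 0≤B)

  0≤c : ∀ k → 0ℚ ≤ c k
  0≤c zero    = ≤-refl
  0≤c (suc k) = 0≤b k

  b-halves : ∀ k → K ℕ.≤ k → b (suc k) ≤ ½ * b k
  b-halves k K≤k = begin
    1/suc k * (b k * B)
      ≡⟨ solve 3 (λ i b B → i :* (b :* B) := (con ½ :* b) :* (i :* (B :+ B))) refl (1/suc k) (b k) B ⟩
    ½ * b k * (1/suc k * (B + B))
      ≤⟨ *-monoˡ-≤-nonNeg (½ * b k) {{nonNegative (0≤* (<⇒≤ (0<1/suc 1)) (0≤b k))}}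
           (*-monoˡ-≤-nonNeg (1/suc k) {{nonNegative (<⇒≤ (0<1/suc k))}} 2B≤) ⟩
    ½ * b k * (1/suc k * ι (suc k))
      ≡⟨ trans (cong (½ * b k *_) (1/suc-inverse k)) (*-identityʳ (½ * b k)) ⟩
    ½ * b k ∎
    where
    open ≤-Reasoning
    2B≤ : B + B ≤ ι (suc k)
    2B≤ = subst (_≤ ι (suc k)) (ι-+ (suc M) (suc M)) (ι-mono-≤ (ℕ.m≤n⇒m≤1+n K≤k))

  c-halves : ∀ k → suc K ℕ.≤ k → c (suc k) ≤ ½ * c k
  c-halves (suc k) (ℕ.s≤s K≤k) = b-halves k K≤k

  ∑b-cauchy : Cauchy (∑ b)
  ∑b-cauchy = Dominated.∑-cauchy b b (λ k → ≤-reflexive (0≤p⇒∣p∣≡p (0≤b k))) K b-halves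

  ∑c-cauchy : Cauchy (∑ c)
  ∑c-cauchy = Dominated.∑-cauchy c c (λ k → ≤-reflexive (0≤p⇒∣p∣≡p (0≤c k))) (suc K) c-halves

  c*B : ∀ k → c k * B ≡ ι k * b k
  c*B zero    = trans (*-zeroˡ B) (sym (*-zeroˡ 1ℚ))
  c*B (suc k) = trans (sym (*-identityˡ (b k * B)))
    (trans (cong (_* (b k * B)) (sym (1/suc-inverse k)))
      (solve 3 (λ i n x → (i :* n) :* x := n :* (i :* x)) refl (1/suc k) (ι (suc k)) (b k * B)))

  module _ {w : ℚ[i]} (w≤B : ‖ w ‖ ≤ B) where

    term-bound : ∀ k → ‖ expTerm w k ‖ ≤ b k
    term-bound zero    = ≤-refl
    term-bound (suc k) = subst (_≤ b (suc k)) (sym (‖•‖ (1/suc k) (expTerm w k ⊗ w) (<⇒≤ (0<1/suc k))))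
      (*-monoˡ-≤-nonNeg (1/suc k) {{nonNegative (<⇒≤ (0<1/suc k))}}
        (≤-trans (‖⊗‖ (expTerm w k) w) (*-mono-≤ (0≤‖‖ (expTerm w k)) 0≤B (term-bound k) w≤B)))

    sum-tail : ∀ {m n} → m ℕ.≤′ n → ‖ expSum w n ⊖ expSum w m ‖ ≤ ∑ b n - ∑ b m
    sum-tail {m} ℕ.≤′-refl = ≤-reflexive (trans
      (cong₂ (λ p q → ∣ p ∣ + ∣ q ∣) (+-inverseʳ (proj₁ (expSum w m))) (+-inverseʳ (proj₂ (expSum w m))))
      (sym (+-inverseʳ (∑ b m))))
    sum-tail {m} {suc n} (ℕ.≤′-step m≤n) = begin
      ‖ (expSum w n ⊕ expTerm w n) ⊖ expSum w m ‖
        ≡⟨ cong₂ (λ p q → ∣ p ∣ + ∣ q ∣)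
             (shuffle (proj₁ (expSum w n)) (proj₁ (expTerm w n)) (proj₁ (expSum w m)))
             (shuffle (proj₂ (expSum w n)) (proj₂ (expTerm w n)) (proj₂ (expSum w m))) ⟩
      ‖ (expSum w n ⊖ expSum w m) ⊕ expTerm w n ‖
        ≤⟨ ‖⊕‖ (expSum w n ⊖ expSum w m) (expTerm w n) ⟩
      ‖ expSum w n ⊖ expSum w m ‖ + ‖ expTerm w n ‖
        ≤⟨ +-mono-≤ (sum-tail m≤n) (term-bound n) ⟩
      ∑ b n - ∑ b m + b n
        ≡⟨ shuffle (∑ b n) (b n) (∑ b m) ⟨
      ∑ b n + b n - ∑ b m ∎
      where
      open ≤-Reasoning
      shuffle : ∀ a b c → (a + b) - c ≡ (a - c) + b
      shuffle = solve 3 (λ a b c → (a :+ b) :- c := (a :- c) :+ b) refl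

  module _ {w v : ℚ[i]} (w≤B : ‖ w ‖ ≤ B) (v≤B : ‖ v ‖ ≤ B) where

    private d = ‖ w ⊖ v ‖

    ⊗-difference : ∀ s t → (s ⊗ w) ⊖ (t ⊗ v) ≡ ((s ⊖ t) ⊗ w) ⊕ (t ⊗ (w ⊖ v))
    ⊗-difference (s₁ , s₂) (t₁ , t₂) = cong₂ _,_
      (solve 8 (λ s₁ s₂ t₁ t₂ w₁ w₂ v₁ v₂ →
        (s₁ :* w₁ :- s₂ :* w₂) :- (t₁ :* v₁ :- t₂ :* v₂) :=
        ((s₁ :- t₁) :* w₁ :- (s₂ :- t₂) :* w₂) :+ (t₁ :* (w₁ :- v₁) :- t₂ :* (w₂ :- v₂))) refl
        s₁ s₂ t₁ t₂ (proj₁ w) (proj₂ w) (proj₁ v) (proj₂ v))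
      (solve 8 (λ s₁ s₂ t₁ t₂ w₁ w₂ v₁ v₂ →
        (s₁ :* w₂ :+ s₂ :* w₁) :- (t₁ :* v₂ :+ t₂ :* v₁) :=
        ((s₁ :- t₁) :* w₂ :+ (s₂ :- t₂) :* w₁) :+ (t₁ :* (w₂ :- v₂) :+ t₂ :* (w₁ :- v₁))) refl
        s₁ s₂ t₁ t₂ (proj₁ w) (proj₂ w) (proj₁ v) (proj₂ v))

    •-difference : ∀ r s t → (r • s) ⊖ (r • t) ≡ r • (s ⊖ t)
    •-difference r (s₁ , s₂) (t₁ , t₂) = cong₂ _,_ (lem r s₁ t₁) (lem r s₂ t₂)
      where
      lem : ∀ r s t → r * s - r * t ≡ r * (s - t)
      lem = solve 3 (λ r s t → r :* s :- r :* t := r :* (s :- t)) refl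

    term-lipschitz : ∀ k → ‖ expTerm w k ⊖ expTerm v k ‖ ≤ d * c k
    term-lipschitz zero = ≤-reflexive (sym (*-zeroʳ d))
    term-lipschitz (suc k) = begin
      ‖ (1/suc k • (s ⊗ w)) ⊖ (1/suc k • (t ⊗ v)) ‖
        ≡⟨ cong ‖_‖ (trans (•-difference (1/suc k) (s ⊗ w) (t ⊗ v))
             (cong (1/suc k •_) (⊗-difference s t))) ⟩
      ‖ 1/suc k • (((s ⊖ t) ⊗ w) ⊕ (t ⊗ (w ⊖ v))) ‖
        ≡⟨ ‖•‖ (1/suc k) (((s ⊖ t) ⊗ w) ⊕ (t ⊗ (w ⊖ v))) (<⇒≤ (0<1/suc k)) ⟩
      1/suc k * ‖ ((s ⊖ t) ⊗ w) ⊕ (t ⊗ (w ⊖ v)) ‖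
        ≤⟨ *-monoˡ-≤-nonNeg (1/suc k) {{nonNegative (<⇒≤ (0<1/suc k))}}
             (≤-trans (‖⊕‖ ((s ⊖ t) ⊗ w) (t ⊗ (w ⊖ v))) (+-mono-≤
               (≤-trans (‖⊗‖ (s ⊖ t) w) (*-mono-≤ (0≤‖‖ (s ⊖ t)) 0≤B (term-lipschitz k) w≤B))
               (≤-trans (‖⊗‖ t (w ⊖ v)) (*-mono-≤ (0≤‖‖ t) (0≤‖‖ (w ⊖ v)) (term-bound v≤B k) ≤-refl)))) ⟩
      1/suc k * (d * c k * B + b k * d)
        ≡⟨ cong (λ x → 1/suc k * (x + b k * d)) (trans (*-assoc d (c k) B) (cong (d *_) (c*B k))) ⟩
      1/suc k * (d * (ι k * b k) + b k * d)
        ≡⟨ solve 4 (λ i d n b → i :* (d :* (n :* b) :+ b :* d) := (i :* (con 1ℚ :+ n)) :* (d :* b)) refl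
             (1/suc k) d (ι k) (b k) ⟩
      1/suc k * (1ℚ + ι k) * (d * b k)
        ≡⟨ cong (_* (d * b k)) (trans (cong (1/suc k *_) (sym (ι-suc k))) (1/suc-inverse k)) ⟩
      1ℚ * (d * b k)
        ≡⟨ *-identityˡ (d * b k) ⟩
      d * b k ∎
      where
      open ≤-Reasoning
      s = expTerm w k
      t = expTerm v k

    sum-lipschitz : ∀ n → ‖ expSum w n ⊖ expSum v n ‖ ≤ d * ∑ c n
    sum-lipschitz zero = ≤-reflexive (sym (*-zeroʳ d))
    sum-lipschitz (suc n) = begin
      ‖ (expSum w n ⊕ expTerm w n) ⊖ (expSum v n ⊕ expTerm v n) ‖
        ≡⟨ cong₂ (λ p q → ∣ p ∣ + ∣ q ∣)
             (shuffle (proj₁ (expSum w n)) (proj₁ (expTerm w n)) (proj₁ (expSum v n)) (proj₁ (expTerm v n)))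
             (shuffle (proj₂ (expSum w n)) (proj₂ (expTerm w n)) (proj₂ (expSum v n)) (proj₂ (expTerm v n))) ⟩
      ‖ (expSum w n ⊖ expSum v n) ⊕ (expTerm w n ⊖ expTerm v n) ‖
        ≤⟨ ‖⊕‖ (expSum w n ⊖ expSum v n) (expTerm w n ⊖ expTerm v n) ⟩
      ‖ expSum w n ⊖ expSum v n ‖ + ‖ expTerm w n ⊖ expTerm v n ‖
        ≤⟨ +-mono-≤ (sum-lipschitz n) (term-lipschitz n) ⟩
      d * ∑ c n + d * c n
        ≡⟨ *-distribˡ-+ d (∑ c n) (c n) ⟨
      d * (∑ c n + c n) ∎
      where
      open ≤-Reasoning
      shuffle : ∀ a b c d → (a + b) - (c + d) ≡ (a - c) + (b - d)
      shuffle = solve 4 (λ a b c d → (a :+ b) :- (c :+ d) := (a :- c) :+ (b :- d)) refl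

ι-above : ∀ B → 0ℚ < B → ∃ λ M → B ≤ ι (suc M)
ι-above B 0<B = let M , 1/M<1/B = archimedean (inv B) 0<invB in M , prf M (<⇒≤ 1/M<1/B)
  where
  open +-*-Solver
  0<invB : 0ℚ < inv B
  0<invB = ≰⇒> λ invB≤0 → <-irrefl refl (<-≤-trans (0<ι-suc 0)
    (subst₂ _≤_ (inv-inverse B 0<B) (*-zeroˡ B)
      (*-monoʳ-≤-nonNeg B {{nonNegative (<⇒≤ 0<B)}} invB≤0)))
  prf : ∀ M → 1/suc M ≤ inv B → B ≤ ι (suc M)
  prf M h = subst₂ _≤_
    (trans (solve 3 (λ i n b → i :* (n :* b) := (i :* n) :* b) refl (1/suc M) (ι (suc M)) B)
      (trans (cong (_* B) (1/suc-inverse M)) (*-identityˡ B)))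
    (trans (solve 3 (λ j n b → j :* (n :* b) := n :* (j :* b)) refl (inv B) (ι (suc M)) B)
      (trans (cong (ι (suc M) *_) (inv-inverse B 0<B)) (*-identityʳ (ι (suc M)))))
    (*-monoʳ-≤-nonNeg (ι (suc M) * B) {{nonNegative (0≤* (0≤ι (suc M)) (<⇒≤ 0<B))}} h)

-- A diagonal sequence: the n-th partial sum of the exponential series is taken
-- at the n-th rational approximation. The series converges uniformly on bounded
-- sets, so the limit is the exponential of the limit of x n + i y n.
exp-seq : (ℕ → ℚ) → (ℕ → ℚ) → ℕ → ℚ[i]
exp-seq x y n = expSum (x n , y n) n

module ExpCauchy {x y : ℕ → ℚ} (cx : Cauchy x) (cy : Cauchy y) where

  private
    open +-*-Solver
    bx  = bounded {x} cx
    by  = bounded {y} cy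
    0<B : 0ℚ < proj₁ bx + proj₁ by
    0<B = 0<+ (<⇒≤ (proj₁ (proj₂ bx))) (proj₁ (proj₂ by))
    M : ℕ
    M = proj₁ (ι-above (proj₁ bx + proj₁ by) 0<B)
    open ExpEstimates M
    w : ℕ → ℚ[i]
    w n = x n , y n
    w≤B : ∀ n → ‖ w n ‖ ≤ ι (suc M)
    w≤B n = ≤-trans (+-mono-≤ (proj₂ (proj₂ bx) n) (proj₂ (proj₂ by) n))
      (proj₂ (ι-above (proj₁ bx + proj₁ by) 0<B))
    b c : ℕ → ℚ
    b = expBound (ι (suc M))
    c = expBound′ (ι (suc M))
    bc = bounded {∑ c} ∑c-cauchy
    L : ℚ
    L = proj₁ bc
    0<L : 0ℚ < L
    0<L = proj₁ (proj₂ bc)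

    K : ℚ
    K = 1ℚ + (L + L)

    estimate : ∀ {m n ε} → m ℕ.≤ n → ∣ ∑ b n - ∑ b m ∣ ≤ ε → ∣ x n - x m ∣ ≤ ε → ∣ y n - y m ∣ ≤ ε →
      ‖ exp-seq x y n ⊖ exp-seq x y m ‖ ≤ K * ε
    estimate {m} {n} {ε} m≤n hb hx hy = begin
      ‖ expSum (w n) n ⊖ expSum (w m) m ‖
        ≡⟨ cong₂ (λ p q → ∣ p ∣ + ∣ q ∣)
             (split (proj₁ (expSum (w n) n)) (proj₁ (expSum (w n) m)) (proj₁ (expSum (w m) m)))
             (split (proj₂ (expSum (w n) n)) (proj₂ (expSum (w n) m)) (proj₂ (expSum (w m) m))) ⟩
      ‖ (expSum (w n) n ⊖ expSum (w n) m) ⊕ (expSum (w n) m ⊖ expSum (w m) m) ‖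
        ≤⟨ ‖⊕‖ (expSum (w n) n ⊖ expSum (w n) m) (expSum (w n) m ⊖ expSum (w m) m) ⟩
      ‖ expSum (w n) n ⊖ expSum (w n) m ‖ + ‖ expSum (w n) m ⊖ expSum (w m) m ‖
        ≤⟨ +-mono-≤ (sum-tail (w≤B n) (ℕ.≤⇒≤′ m≤n)) (sum-lipschitz (w≤B n) (w≤B m) m) ⟩
      (∑ b n - ∑ b m) + ‖ w n ⊖ w m ‖ * ∑ c m
        ≤⟨ +-mono-≤ (≤-trans (p≤∣p∣ (∑ b n - ∑ b m)) hb)
             (*-mono-≤ (0≤‖‖ (w n ⊖ w m)) (<⇒≤ 0<L) (+-mono-≤ hx hy)
               (≤-trans (p≤∣p∣ (∑ c m)) (proj₂ (proj₂ bc) m))) ⟩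
      ε + (ε + ε) * L
        ≡⟨ solve 2 (λ e l → e :+ (e :+ e) :* l := (con 1ℚ :+ (l :+ l)) :* e) refl ε L ⟩
      K * ε ∎
      where
      open ≤-Reasoning
      split : ∀ a b c → a - c ≡ (a - b) + (b - c)
      split = solve 3 (λ a b c → a :- c := (a :- b) :+ (b :- c)) refl

    0<K : 0ℚ < K
    0<K = 0<+ (0≤ι 1) (0<+ (<⇒≤ 0<L) 0<L)

    combined : ∀ ε → 0ℚ < ε → ∃ λ N → ∀ m n → N ℕ.≤ m → m ℕ.≤ n →
      ‖ exp-seq x y n ⊖ exp-seq x y m ‖ ≤ K * ε
    combined ε 0<ε =
      let N₁ , h₁ = ∑b-cauchy ε 0<ε
          N₂ , h₂ = cx ε 0<ε
          N₃ , h₃ = cy ε 0<ε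
      in N₁ ℕ.+ (N₂ ℕ.+ N₃) , λ m n N≤m m≤n →
        let N₁≤m = ℕ.≤-trans (ℕ.m≤m+n N₁ (N₂ ℕ.+ N₃)) N≤m
            N₂≤m = ℕ.≤-trans (ℕ.≤-trans (ℕ.m≤m+n N₂ N₃) (ℕ.m≤n+m (N₂ ℕ.+ N₃) N₁)) N≤m
            N₃≤m = ℕ.≤-trans (ℕ.≤-trans (ℕ.m≤n+m N₃ N₂) (ℕ.m≤n+m (N₂ ℕ.+ N₃) N₁)) N≤m
        in estimate m≤n
             (<⇒≤ (h₁ n m (ℕ.≤-trans N₁≤m m≤n) N₁≤m))
             (<⇒≤ (h₂ n m (ℕ.≤-trans N₂≤m m≤n) N₂≤m))
             (<⇒≤ (h₃ n m (ℕ.≤-trans N₃≤m m≤n) N₃≤m))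

  exp-re-cauchy : Cauchy (λ n → proj₁ (exp-seq x y n))
  exp-re-cauchy = cauchy-from {λ n → proj₁ (exp-seq x y n)} K 0<K λ ε 0<ε →
    let N , h = combined ε 0<ε in N , λ m n N≤m m≤n → ≤-trans (left m n) (h m n N≤m m≤n)
    where
    left : ∀ m n → ∣ proj₁ (exp-seq x y n) - proj₁ (exp-seq x y m) ∣ ≤
      ‖ exp-seq x y n ⊖ exp-seq x y m ‖
    left m n = subst (_≤ ‖ exp-seq x y n ⊖ exp-seq x y m ‖) (+-identityʳ _)
      (+-monoʳ-≤ ∣ proj₁ (exp-seq x y n) - proj₁ (exp-seq x y m) ∣
        (0≤∣p∣ (proj₂ (exp-seq x y n) - proj₂ (exp-seq x y m))))

  exp-im-cauchy : Cauchy (λ n → proj₂ (exp-seq x y n))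
  exp-im-cauchy = cauchy-from {λ n → proj₂ (exp-seq x y n)} K 0<K λ ε 0<ε →
    let N , h = combined ε 0<ε in N , λ m n N≤m m≤n → ≤-trans (right m n) (h m n N≤m m≤n)
    where
    right : ∀ m n → ∣ proj₂ (exp-seq x y n) - proj₂ (exp-seq x y m) ∣ ≤
      ‖ exp-seq x y n ⊖ exp-seq x y m ‖
    right m n = subst (_≤ ‖ exp-seq x y n ⊖ exp-seq x y m ‖) (+-identityˡ _)
      (+-monoˡ-≤ ∣ proj₂ (exp-seq x y n) - proj₂ (exp-seq x y m) ∣
        (0≤∣p∣ (proj₁ (exp-seq x y n) - proj₁ (exp-seq x y m))))

record ℂ : Set where
  constructor _+i_
  field
    re : ℝ
    im : ℝ
open ℂ public

_≈ℂ_ : ℂ → ℂ → Set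
u ≈ℂ v = re u ≈ℝ re v × im u ≈ℝ im v

fromℝ : ℝ → ℂ
fromℝ x = x +i 0ℝ

fromℕ : ℕ → ℂ
fromℕ n = fromℝ (constℝ (ι n))

0ℂ 1ℂ i : ℂ
0ℂ = fromℝ 0ℝ
1ℂ = fromℝ 1ℝ
i  = 0ℝ +i 1ℝ

_+ℂ_ _-ℂ_ _*ℂ_ : ℂ → ℂ → ℂ
(a +i b) +ℂ (c +i d) = (a +ℝ c) +i (b +ℝ d)
(a +i b) -ℂ (c +i d) = (a -ℝ c) +i (b -ℝ d)
(a +i b) *ℂ (c +i d) = (a *ℝ c -ℝ b *ℝ d) +i (a *ℝ d +ℝ b *ℝ c)

-ℂ_ : ℂ → ℂ
-ℂ (a +i b) = (-ℝ a) +i (-ℝ b)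

normSq : ℂ → ℝ
normSq (a +i b) = a *ℝ a +ℝ b *ℝ b

-- Being nonzero is meant in the positive sense, so that it permits division.
Nonzero : ℂ → Set
Nonzero w = 0ℝ <ℝ normSq w

_#_ : ℂ → ℂ → Set
u # v = Nonzero (u -ℂ v)

_÷ℂ_[_] : ℂ → (w : ℂ) → Nonzero w → ℂ
u ÷ℂ w [ w≠0 ] = u *ℂ ((re w *ℝ r) +i (-ℝ (im w *ℝ r)))
  where r = normSq w ⁻¹[ w≠0 ]

_/ℕ_ : ℂ → (n : ℕ) .{{_ : ℕ.NonZero n}} → ℂ
w /ℕ n = w *ℂ fromℝ (constℝ (ℤ.+ 1 / n))

∏ : List ℂ → ℂ
∏ = foldr _*ℂ_ 1ℂ

exp : ℂ → ℂ
exp (x +i y) = mkℝ (λ n → proj₁ (exp-seq (seq x) (seq y) n)) exp-re-cauchy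
            +i mkℝ (λ n → proj₂ (exp-seq (seq x) (seq y) n)) exp-im-cauchy
  where open ExpCauchy {seq x} {seq y} (cauchy x) (cauchy y)

-- (exp(iw) - exp(-iw)) / 2i, where 1 / 2i = -i/2.
sin : ℂ → ℂ
sin w = (exp (i *ℂ w) -ℂ exp (-ℂ (i *ℂ w))) *ℂ ((-ℂ i) /ℕ 2)

-- |a n - L|² < ε² stands for |a n - L| < ε.
_⟶_ : (ℕ → ℂ) → ℂ → Set
a ⟶ L = ∀ ε → 0ℝ <ℝ ε → ∃ λ N → ∀ n → N ℕ.≤ n → normSq (a n -ℂ L) <ℝ ε *ℝ ε

Nonzero-* : ∀ u v → Nonzero u → Nonzero v → Nonzero (u *ℂ v)
Nonzero-* (a +i b) (c +i d) (ε , 0<ε , N₁ , h₁) (δ , 0<δ , N₂ , h₂) =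
  ε * δ , 0<* 0<ε 0<δ , N₁ ℕ.+ N₂ , λ n N≤n → subst₂ _≤_
    (sym (+-identityˡ (ε * δ)))
    (brahmagupta (seq a n) (seq b n) (seq c n) (seq d n))
    (*-mono-≤ (<⇒≤ 0<ε)
      (≤-trans (<⇒≤ 0<δ) (subst (_≤ _) (+-identityˡ δ) (h₂ n (ℕ.≤-trans (ℕ.m≤n+m N₂ N₁) N≤n))))
      (subst (_≤ _) (+-identityˡ ε) (h₁ n (ℕ.≤-trans (ℕ.m≤m+n N₁ N₂) N≤n)))
      (subst (_≤ _) (+-identityˡ δ) (h₂ n (ℕ.≤-trans (ℕ.m≤n+m N₂ N₁) N≤n))))
  where
  open +-*-Solver
  brahmagupta : ∀ a b c d → (a * a + b * b) * (c * c + d * d) ≡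
    (a * c - b * d) * (a * c - b * d) + (a * d + b * c) * (a * d + b * c)
  brahmagupta = solve 4 (λ a b c d → (a :* a :+ b :* b) :* (c :* c :+ d :* d) :=
    (a :* c :- b :* d) :* (a :* c :- b :* d) :+ (a :* d :+ b :* c) :* (a :* d :+ b :* c)) refl

#-sym : ∀ {u v} → u # v → v # u
#-sym {a +i b} {c +i d} (ε , 0<ε , N , h) = ε , 0<ε , N , λ n N≤n →
  subst (0ℚ + ε ≤_) (flip (seq a n) (seq b n) (seq c n) (seq d n)) (h n N≤n)
  where
  open +-*-Solver
  flip : ∀ a b c d → (a - c) * (a - c) + (b - d) * (b - d) ≡
    (c - a) * (c - a) + (d - b) * (d - b)
  flip = solve 4 (λ a b c d → (a :- c) :* (a :- c) :+ (b :- d) :* (b :- d) :=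
    (c :- a) :* (c :- a) :+ (d :- b) :* (d :- b)) refl

Nonzero-fromℝ : ∀ {x} → 0ℝ <ℝ x → Nonzero (fromℝ x)
Nonzero-fromℝ {x} (ε , 0<ε , N , h) = ε * ε , 0<* 0<ε 0<ε , N , λ n N≤n →
  let ε≤x = subst (_≤ seq x n) (+-identityˡ ε) (h n N≤n) in
  subst₂ _≤_ (sym (+-identityˡ (ε * ε))) (sym (+-identityʳ (seq x n * seq x n)))
    (*-mono-≤ (<⇒≤ 0<ε) (≤-trans (<⇒≤ 0<ε) ε≤x) ε≤x ε≤x)

record DirichletCharacter (q : ℕ) : Set where
  field
    _⟨_⟩             : ℤ → ℂ
    periodic         : ∀ n → _⟨_⟩ (n ℤ.+ ℤ.+ q) ≈ℂ _⟨_⟩ n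
    multiplicative   : ∀ m n → _⟨_⟩ (m ℤ.* n) ≈ℂ _⟨_⟩ m *ℂ _⟨_⟩ n
    coprime⇒nonzero  : ∀ n → Coprime n (ℤ.+ q) → Nonzero (_⟨_⟩ n)
    ¬coprime⇒zero    : ∀ n → ¬ Coprime n (ℤ.+ q) → _⟨_⟩ n ≈ℂ 0ℂ
open DirichletCharacter public using (_⟨_⟩)

Induces : ∀ {d q} → DirichletCharacter d → DirichletCharacter q → Set
Induces {d} {q} χ′ χ = d ℕ.∣ q × (∀ n → Coprime n (ℤ.+ q) → χ ⟨ n ⟩ ≈ℂ χ′ ⟨ n ⟩)

-- The conductor of χ is the least modulus of a character inducing χ; the
-- primitive characters are those whose conductor is their modulus.
Primitive : ∀ {q} → DirichletCharacter q → Set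
Primitive {q} χ = ∀ d (χ′ : DirichletCharacter d) → Induces χ′ χ → d ≡ q

Odd : ∀ {q} → DirichletCharacter q → Set
Odd χ = χ ⟨ ℤ.- ℤ.+ 1 ⟩ ≈ℂ -ℂ 1ℂ

partialProduct : ∀ {q} → DirichletCharacter q → ℂ → ℕ → ℂ
partialProduct χ z zero                = 1ℂ
partialProduct χ z (suc zero)          = 1ℂ
partialProduct χ z (suc k-1@(suc _)) =
  partialProduct χ z k-1 *ℂ (1ℂ -ℂ χ ⟨ ℤ.+ suc k-1 ⟩ *ℂ (z /ℕ suc k-1))

coprimesUpTo : ℕ → ℕ → List ℕ
coprimesUpTo n q = filter (λ j → ℕC.coprime? j q) (map suc (upTo n))

φ : ℕ → ℕ
φ q = length (coprimesUpTo q q)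

PrimePower : ℕ → Set
PrimePower q = ∃ λ p → Prime p × ∃ λ k → q ≡ p ℕ.^ suc k

n<m^n : ∀ {m} → 1 ℕ.< m → ∀ n → n ℕ.< m ℕ.^ n
n<m^n 1<m zero    = ℕ.s≤s ℕ.z≤n
n<m^n {m} 1<m (suc n) = ℕ.≤-trans (ℕ.+-mono-≤ (ℕ.≤-trans (ℕ.s≤s ℕ.z≤n) (n<m^n 1<m n)) (n<m^n 1<m n))
  (subst (ℕ._≤ m ℕ.* m ℕ.^ n) (cong (m ℕ.^ n ℕ.+_) (ℕ.+-identityʳ (m ℕ.^ n)))
    (ℕ.*-monoˡ-≤ (m ℕ.^ n) 1<m))

primePower? : ∀ q → Dec (PrimePower q)
primePower? q = map′ unbound bound
  (any? {n = suc q} λ p → prime? (toℕ p) ×-dec any? {n = q} λ k → q ℕ.≟ toℕ p ℕ.^ suc (toℕ k))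
  where
  Bounded : Set
  Bounded = ∃ λ (p : Fin (suc q)) → Prime (toℕ p) × ∃ λ (k : Fin q) → q ≡ toℕ p ℕ.^ suc (toℕ k)
  unbound : Bounded → PrimePower q
  unbound (p , pp , k , eq) = toℕ p , pp , toℕ k , eq
  bound : PrimePower q → Bounded
  bound (p , pp , k , eq) = fromℕ< p<1+q , subst Prime (sym (toℕ-fromℕ< p<1+q)) pp ,
    fromℕ< k<q , trans eq (cong₂ (λ a b → a ℕ.^ suc b) (sym (toℕ-fromℕ< p<1+q)) (sym (toℕ-fromℕ< k<q)))
    where
    1<p : 1 ℕ.< p
    1<p = ℕ.nonTrivial⇒n>1 p {{prime⇒nonTrivial pp}}
    instance
      nz : ℕ.NonZero p
      nz = prime⇒nonZero pp
    p<1+q : p ℕ.< suc q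
    p<1+q = ℕ.s≤s (subst (p ℕ.≤_) (sym eq) (ℕ.m≤m*n p (p ℕ.^ k) {{ℕ.m^n≢0 p k}}))
    k<q : k ℕ.< q
    k<q = subst (k ℕ.<_) (sym eq) (ℕ.<-trans (ℕ.n<1+n k) (n<m^n 1<p (suc k)))

ϵ : ℕ → ℝ
ϵ q with primePower? q
... | yes (p , _) = √ p
... | no  _       = 1ℝ

0<ϵ : ∀ q → 0ℝ <ℝ ϵ q
0<ϵ q with primePower? q
... | yes (p , pp , _) = 0<√ p (ℕ.>-nonZero⁻¹ p {{prime⇒nonZero pp}})
... | no  _            = 1ℚ , 0<ι-suc 0 , 0 , λ _ _ → ≤-refl

denominator-nonzero : ∀ q {z} → z # 1ℂ → Nonzero ((1ℂ -ℂ z) *ℂ fromℝ (ϵ q))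
denominator-nonzero q {z} z≠1 = Nonzero-* (1ℂ -ℂ z) (fromℝ (ϵ q))
  (#-sym {z} {1ℂ} z≠1) (Nonzero-fromℝ {ϵ q} (0<ϵ q))

-- Pairing k with the residues ±j modulo q turns (1 - z) ∏ (1 - χ(k) z / k),
-- over 2 ≤ k ≤ M q, into a product over j of quotients of symmetric partial
-- products of sin(πa), at a = (j - χ(j) z) / q and at a = j / q. These converge
-- by Euler's product for the sine, which comes from the factorisation of
-- 1 + X + … + Xⁿ⁻¹ over the n-th roots of unity: for odd n = 2r + 1,
-- sin(πa) = n sin(πa/n) ∏ (1 - sin²(πa/n) / sin²(πk/n)) over 1 ≤ k ≤ r, and each
-- factor differs from 1 - a²/k² by O(1/n²) uniformly in k.
-- That exp(iπ) = -1 for π defined by arctangents holds because the increments of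
-- exp(2i arctan t) (1 - it) / (1 + it) are quadratically small, so that it is
-- constant.
-- Finally the product of 2 sin(πj/q) over the j < q/2 coprime to q has square
-- Φ_q(1), which is p if q is a power of a prime p and 1 otherwise (seen by sieving
-- ∏ (1 - ζʲ) = n one prime at a time); it equals ε(q) because both are positive.

module Submission where

open import Level using (0ℓ)
open import Algebra.Bundles using (CommutativeRing; CommutativeMonoid)
import Algebra.Properties.CommutativeSemigroup
import Algebra.Properties.CommutativeSemiring.Exp
import Algebra.Properties.Semiring.Exp
import Algebra.Solver.Ring
import Algebra.Solver.Ring.AlmostCommutativeRing as ACR
import Algebra.Solver.Ring.Simple
open import Data.Integer as ℤ using (ℤ)
import Data.Integer.Properties as ℤ
open import Data.List using (List; []; _∷_; _++_; filter; foldr; length; map; upTo)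
open import Data.List.Properties using (upTo-∷ʳ; filter-++; filter-accept; filter-reject; map-++)
open import Data.List.Relation.Unary.All using (All; []; _∷_)
open import Data.Maybe using (Maybe; just; nothing)
open import Data.Nat as ℕ using (ℕ; zero; suc)
import Data.Nat.Coprimality as ℕC
open import Data.Nat.Coprimality using (Coprime)
import Data.Nat.Divisibility as ℕ
import Data.Nat.DivMod as ℕ
open import Data.Nat.ListAction using (product)
open import Data.Nat.Primality using (Prime; prime⇒nonZero; prime⇒nonTrivial; prime⇒irreducible; euclidsLemma)
open import Data.Nat.Primality.Factorisation using (PrimeFactorisation; factorise)
import Data.Nat.Properties as ℕ
open import Data.Product using (∃; _×_; _,_; proj₁; proj₂)
import Data.Product.Properties as ×
import Data.Rational as ℚ
import Data.Rational.Properties as ℚ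
import Data.Rational.Solver
open import Data.Sum using (_⊎_; inj₁; inj₂)
open import Relation.Binary.PropositionalEquality as ≡ using (_≡_; subst; subst₂; cong; cong₂)
import Relation.Binary.Reasoning.Setoid
open import Relation.Nullary using (¬_; Dec; yes; no; contradiction)
open import Relation.Nullary.Decidable using (from-yes)
import Defs

open Data.Rational.Solver.+-*-Solver using ()
  renaming (solve to solveᵠ; con to conᵠ; _:=_ to _:=ᵠ_; _:+_ to _:+ᵠ_; _:*_ to _:*ᵠ_; _:-_ to _:-ᵠ_)

-- Equality and order on `ℂ` are undecidable, so every division needs a witness, and the proof is
-- shaped by the need to produce inverses from explicit estimates. The chain of constants: four
-- terms of each arctangent series place π within 1/20 of 63/20; the cubic remainder of exp then
-- gives |sin(πx)/π - x| ≤ 25/8 |x|³ for |x| ≤ 1/2; the relative error is at most 25/32 < 1, so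
-- sin(πx) is invertible for rational 0 < x ≤ 1/2, and by reflection on (0, 1). This makes
-- differences of roots of unity cancellable, which the factorisation over them requires. The
-- quotient of symmetric products is never formed: the identity stays multiplied out, and the limit
-- is recovered from the invertibility of the limit of the denominator alone. Pairing j with q - j
-- has a fixed residue coprime to q when q = 2; there an odd character would force 1 = -1, so that
-- modulus is split off. The analysis runs over an abstract normed algebra whose norm is known only
-- through rational bounds; `ℂ` enters at the end as an instance.

-- Order estimates for rational numbers.

module Order where
  open import Defs using (0≤ι; 0<ι-suc; 0<1/suc; 0≤*; 0<*; shrink; p≤∣p∣)
  open import Data.Rational
  open import Data.Rational.Properties
  open import Data.Rational.Solver using (module +-*-Solver)
  open +-*-Solver

  ≤-diff : ∀ {a b} c → 0ℚ ≤ c → b ≡ a + c → a ≤ b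
  ≤-diff {a} c 0≤c ≡.refl = subst (_≤ a + c) (+-identityʳ a) (+-monoʳ-≤ a 0≤c)

  a≤a+b : ∀ a {b} → 0ℚ ≤ b → a ≤ a + b
  a≤a+b a {b} 0≤b = ≤-diff b 0≤b ≡.refl

  1-≤1 : ∀ {a} → 0ℚ ≤ a → 1ℚ - a ≤ 1ℚ
  1-≤1 {a} 0≤a = ≤-diff a 0≤a (solve 1 (λ a → con 1ℚ := con 1ℚ :- a :+ a) ≡.refl a)

  *-monoˡ : ∀ {a b c} → 0ℚ ≤ a → b ≤ c → a * b ≤ a * c
  *-monoˡ {a} 0≤a b≤c = *-monoˡ-≤-nonNeg a {{nonNegative 0≤a}} b≤c

  *-monoʳ : ∀ {a b c} → 0ℚ ≤ a → b ≤ c → b * a ≤ c * a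
  *-monoʳ {a} 0≤a b≤c = *-monoʳ-≤-nonNeg a {{nonNegative 0≤a}} b≤c

  0≤1 : 0ℚ ≤ 1ℚ
  0≤1 = 0≤ι 1

  0<1 : 0ℚ < 1ℚ
  0<1 = 0<ι-suc 0

  0<½ : 0ℚ < ½
  0<½ = 0<1/suc 1

  ½+½ : ∀ a → ½ * a + ½ * a ≡ a
  ½+½ = solve 1 (λ a → con ½ :* a :+ con ½ :* a := a) ≡.refl

  ½< : ∀ {a} → 0ℚ < a → ½ * a < a
  ½< {a} 0<a = subst₂ _<_ (+-identityʳ (½ * a)) (½+½ a) (+-monoʳ-< (½ * a) (0<* 0<½ 0<a))

  0<⊓ : ∀ {a b} → 0ℚ < a → 0ℚ < b → 0ℚ < a ⊓ b
  0<⊓ {a} {b} 0<a 0<b with ≤-total a b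
  ... | inj₁ a≤b = subst (0ℚ <_) (≡.sym (p≤q⇒p⊓q≡p a≤b)) 0<a
  ... | inj₂ b≤a = subst (0ℚ <_) (≡.sym (p≥q⇒p⊓q≡q b≤a)) 0<b

  shrink-unit : ∀ K → 0ℚ < K → ∀ ε → 0ℚ < ε → ∃ λ δ → 0ℚ < δ × δ ≤ 1ℚ × K * δ ≤ ε
  shrink-unit K 0<K ε 0<ε = cap (shrink K 0<K ε 0<ε)
    where
    cap : (∃ λ δ → 0ℚ < δ × K * δ < ε) → ∃ λ δ → 0ℚ < δ × δ ≤ 1ℚ × K * δ ≤ ε
    cap (δ , 0<δ , Kδ<ε) = δ ⊓ 1ℚ , 0<⊓ {δ} {1ℚ} 0<δ 0<1 , p⊓q≤q δ 1ℚ ,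
      ≤-trans (*-monoˡ {K} {δ ⊓ 1ℚ} {δ} (<⇒≤ 0<K) (p⊓q≤p δ 1ℚ)) (<⇒≤ Kδ<ε)

  ≤-closed : ∀ {a b} K → 0ℚ < K → (∀ ε → 0ℚ < ε → ε ≤ 1ℚ → a ≤ b + K * ε) → a ≤ b
  ≤-closed {a} {b} K 0<K h with a ≤? b
  ... | yes a≤b = a≤b
  ... | no  a≰b = contradiction (≤-<-trans a≤ (<-≤-trans gap-bound (≤-reflexive back))) (<-irrefl ≡.refl)
    where
    gap = a - b
    0<gap : 0ℚ < gap
    0<gap = subst (_< gap) (+-inverseʳ b) (+-monoˡ-< (- b) (≰⇒> a≰b))
    s = shrink-unit K 0<K (½ * gap) (0<* 0<½ 0<gap)
    a≤ : a ≤ b + ½ * gap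
    a≤ = ≤-trans (h (proj₁ s) (proj₁ (proj₂ s)) (proj₁ (proj₂ (proj₂ s))))
           (+-monoʳ-≤ b (proj₂ (proj₂ (proj₂ s))))
    gap-bound : b + ½ * gap < b + gap
    gap-bound = +-monoʳ-< b (½< 0<gap)
    back : b + gap ≡ a
    back = solve 2 (λ a b → b :+ (a :- b) := a) ≡.refl a b

  0≤x*x : ∀ x → 0ℚ ≤ x * x
  0≤x*x x with ≤-total 0ℚ x
  ... | inj₁ 0≤x = 0≤* 0≤x 0≤x
  ... | inj₂ x≤0 = subst (0ℚ ≤_) (solve 1 (λ x → (:- x) :* (:- x) := x :* x) ≡.refl x) (0≤* n n)
    where
    n : 0ℚ ≤ - x
    n = neg-antimono-≤ x≤0

  abs-square : ∀ x → ∣ x ∣ * ∣ x ∣ ≡ x * x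
  abs-square x = ≡.trans (≡.sym (∣p*q∣≡∣p∣*∣q∣ x x)) (0≤p⇒∣p∣≡p (0≤x*x x))

  ∣∣-upper : ∀ {a b} → ∣ a ∣ ≤ b → - b ≤ a
  ∣∣-upper {a} {b} h = ≤-trans (neg-antimono-≤ (≤-trans (p≤∣p∣ (- a)) (subst (_≤ b) (≡.sym (∣-p∣≡∣p∣ a)) h)))
    (≤-reflexive (solve 1 (λ a → :- (:- a) := a) ≡.refl a))

-- Abstract normed algebras, invertibility and the constancy principle.

module Theory where
  open import Defs using (ι; 1/suc; 1/suc-inverse; 0<1/suc; 1/suc-antitone; ι-suc; ι-+; ι-*; 0≤ι; 0<ι-suc; ι-mono-≤; ι-above;
    0≤*; 0<*; 0≤+; 0<+; *-mono-≤; archimedean; shrink; inv; inv-inverse; 0≤inv; PrimePower; coprimesUpTo; φ)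
  open import Data.Rational using (ℚ; 0ℚ; 1ℚ; ½; _≤_; _<_; ∣_∣)
    renaming (_+_ to _+ᵠ_; _*_ to _*ᵠ_; -_ to -ᵠ_; _-_ to _-ᵠ_)

  -- The norm is a relation to rational bounds, because the norm of a limit need not be rational;
  -- `≼-closed` replaces taking an infimum. `selfbound` and `neumann` are the two uses of 1 + h
  -- being invertible for a small h: an a priori bound and the existence of the inverse.
  record NormedAlgebra : Set₁ where
    infix 4 _≼_
    field
      ring : CommutativeRing 0ℓ 0ℓ
    open CommutativeRing ring public hiding (ring)
    field
      κ   : ℚ → Carrier
      κ-+ : ∀ p q → κ (p +ᵠ q) ≈ κ p + κ q
      κ-* : ∀ p q → κ (p *ᵠ q) ≈ κ p * κ q
      κ-‿ : ∀ p → κ (-ᵠ p) ≈ - κ p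
      κ-0 : κ 0ℚ ≈ 0#
      κ-1 : κ 1ℚ ≈ 1#
      -- x ≼ r: the norm of x is at most r
      _≼_      : Carrier → ℚ → Set
      ≼-resp   : ∀ {x y r} → x ≈ y → x ≼ r → y ≼ r
      ≼-+      : ∀ {x y r s} → x ≼ r → y ≼ s → x + y ≼ r +ᵠ s
      ≼-*      : ∀ {x y r s} → x ≼ r → y ≼ s → x * y ≼ r *ᵠ s
      ≼-‿      : ∀ {x r} → x ≼ r → - x ≼ r
      ≼-κ      : ∀ p → κ p ≼ ∣ p ∣
      ≼-mono   : ∀ {x r s} → r ≤ s → x ≼ r → x ≼ s
      ≼-closed : ∀ {x r} → (∀ ε → 0ℚ < ε → x ≼ r +ᵠ ε) → x ≼ r
      ≼⇒0≤     : ∀ {x r} → x ≼ r → 0ℚ ≤ r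
      ≼0⇒≈0    : ∀ {x} → x ≼ 0ℚ → x ≈ 0#
      bounded  : ∀ x → ∃ λ r → x ≼ r
      -- The norm of a solution of x = hx + c is at most ‖c‖ / (1 - ‖h‖).
      selfbound : ∀ {x h c ρ r s} → x ≈ h * x + c → h ≼ ρ → c ≼ r → 0ℚ ≤ s →
                  1ℚ ≤ s *ᵠ (1ℚ -ᵠ ρ) → x ≼ s *ᵠ r
      neumann  : ∀ {h ρ} → h ≼ ρ → ρ < 1ℚ → ∃ λ u → (1# + h) * u ≈ 1#

    almostCommutativeRing : ACR.AlmostCommutativeRing 0ℓ 0ℓ
    almostCommutativeRing = ACR.fromCommutativeRing ring

    κ-morphism : ℚ.+-*-rawRing ACR.-Raw-AlmostCommutative⟶ almostCommutativeRing
    κ-morphism = record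
      { ⟦_⟧ = κ ; +-homo = κ-+ ; *-homo = κ-* ; -‿homo = κ-‿ ; 0-homo = κ-0 ; 1-homo = κ-1 }

    κ-dec : ∀ p q → Maybe (κ p ≈ κ q)
    κ-dec p q with p ℚ.≟ q
    ... | yes p≡q = just (reflexive (≡.cong κ p≡q))
    ... | no  _   = nothing

  -- The coefficients are rationals, embedded by `κ`. Since `1#` is not literally `κ 1ℚ`, it is
  -- either rewritten by `κ-1` beforehand or passed as a variable `o`; in the latter case the
  -- identity carries a correction term with the factor `con 1ℚ :- o` or its negative, which is then
  -- shown to vanish.
  module Solver (N : NormedAlgebra) where
    open NormedAlgebra N
    open Algebra.Solver.Ring ℚ.+-*-rawRing almostCommutativeRing κ-morphism κ-dec public

  module Estimates (N : NormedAlgebra) where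
    open NormedAlgebra N hiding (zero)
    open Solver N using (solve; _:=_; _:*_; _:+_; _:-_; :-_)
    open Order

    ≼-≡ : ∀ {x r s} → r ≡ s → x ≼ r → x ≼ s
    ≼-≡ {x} = subst (x ≼_)

    ≼-- : ∀ {x y r s} → x ≼ r → y ≼ s → x - y ≼ r +ᵠ s
    ≼-- p q = ≼-+ p (≼-‿ q)

    κ≼ : ∀ {p q} → 0ℚ ≤ p → p ≤ q → κ p ≼ q
    κ≼ {p} 0≤p p≤q = ≼-mono p≤q (≼-≡ (ℚ.0≤p⇒∣p∣≡p 0≤p) (≼-κ p))

    1≼1 : 1# ≼ 1ℚ
    1≼1 = ≼-resp κ-1 (κ≼ 0≤1 ℚ.≤-refl)

    0≼0 : 0# ≼ 0ℚ
    0≼0 = ≼-resp κ-0 (κ≼ ℚ.≤-refl ℚ.≤-refl)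

    shorten : ∀ {p x r} → 0ℚ ≤ p → p ≤ 1ℚ → x ≼ r → κ p * x ≼ r
    shorten 0≤p p≤1 x≼r = ≼-≡ (ℚ.*-identityˡ _) (≼-* (κ≼ 0≤p p≤1) x≼r)

    ≈⇒≼0 : ∀ {x y} → x ≈ y → x - y ≼ 0ℚ
    ≈⇒≼0 {x} {y} x≈y = ≼-resp (sym (trans (+-congʳ x≈y) (-‿inverseʳ y))) 0≼0

    ≼0⇒≈ : ∀ {x y} → x - y ≼ 0ℚ → x ≈ y
    ≼0⇒≈ {x} {y} h = trans (solve 2 (λ x y → x := (x :- y) :+ y) refl x y)
      (trans (+-congʳ (≼0⇒≈0 h)) (+-identityˡ y))

    ≼-triangle : ∀ {x y z r s} → x - y ≼ r → y - z ≼ s → x - z ≼ r +ᵠ s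
    ≼-triangle {x} {y} {z} p q = ≼-resp (solve 3 (λ x y z → (x :- y) :+ (y :- z) := x :- z) refl x y z) (≼-+ p q)

    ≼-swap : ∀ {x y r} → x - y ≼ r → y - x ≼ r
    ≼-swap {x} {y} p = ≼-resp (solve 2 (λ x y → :- (x :- y) := y :- x) refl x y) (≼-‿ p)

    ≼-shift : ∀ {x y r s} → x - y ≼ r → y ≼ s → x ≼ r +ᵠ s
    ≼-shift {x} {y} p q = ≼-resp (solve 2 (λ x y → (x :- y) :+ y := x) refl x y) (≼-+ p q)

    ≼-archimedean : ∀ {x} C → 0ℚ ≤ C → (∀ n → x ≼ C *ᵠ 1/suc n) → x ≈ 0#
    ≼-archimedean {x} C 0≤C h = ≼0⇒≈0 (≼-closed λ ε 0<ε → go ε (shrink (C +ᵠ 1ℚ) (0<+ 0≤C 0<1) ε 0<ε))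
      where
      go : ∀ ε → (∃ λ δ → 0ℚ < δ × (C +ᵠ 1ℚ) *ᵠ δ < ε) → x ≼ 0ℚ +ᵠ ε
      go ε (δ , 0<δ , Cδ<ε) = fin (archimedean δ 0<δ)
        where
        fin : (∃ λ n → 1/suc n < δ) → x ≼ 0ℚ +ᵠ ε
        fin (n , lt) = ≼-mono (ℚ.≤-trans (*-mono-≤ 0≤C (ℚ.<⇒≤ 0<δ) (a≤a+b C 0≤1) (ℚ.<⇒≤ lt))
          (ℚ.≤-trans (ℚ.<⇒≤ Cδ<ε) (ℚ.≤-reflexive (≡.sym (ℚ.+-identityˡ ε))))) (h n)

    κ-inverse : ∀ {p q} → p *ᵠ q ≡ 1ℚ → κ p * κ q ≈ 1#
    κ-inverse {p} {q} e = trans (sym (κ-* p q)) (trans (reflexive (cong κ e)) κ-1)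

    κ-1/suc : ∀ n → κ (1/suc n) * κ (ι (suc n)) ≈ 1#
    κ-1/suc n = κ-inverse (1/suc-inverse n)

    -- The usable form of being nonzero: an inverse permits cancellation, whereas a mere negation of
    -- `x ≈ 0#` gives none constructively.
    Unit : Carrier → Set
    Unit x = ∃ λ y → x * y ≈ 1#

    Unit-resp : ∀ {x y} → x ≈ y → Unit x → Unit y
    Unit-resp x≈y (u , e) = u , trans (*-congʳ (sym x≈y)) e

    Unit-* : ∀ {x y} → Unit x → Unit y → Unit (x * y)
    Unit-* {x} {y} (u , e) (v , f) = u * v ,
      trans (solve 4 (λ x y u v → (x :* y) :* (u :* v) := (x :* u) :* (y :* v)) refl x y u v)
        (trans (*-cong e f) (*-identityˡ 1#))

    Unit-κ : ∀ {p} → 0ℚ < p → Unit (κ p)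
    Unit-κ {p} 0<p = κ (inv p) , trans (*-comm (κ p) (κ (inv p))) (κ-inverse (inv-inverse p 0<p))

    cancel : ∀ {x y z} → Unit x → x * y ≈ x * z → y ≈ z
    cancel {x} {y} {z} (u , e) h = trans (lemma y) (trans (*-congˡ h) (sym (lemma z)))
      where
      lemma : ∀ y → y ≈ u * (x * y)
      lemma y = trans (sym (*-identityˡ y)) (trans (*-congʳ (sym e))
        (solve 3 (λ x u y → x :* u :* y := u :* (x :* y)) refl x u y))

    cancel-0 : ∀ {x y} → Unit x → x * y ≈ 0# → y ≈ 0#
    cancel-0 {x} u h = cancel u (trans h (sym (zeroʳ x)))

    -- Cutting [0, x] into n equal steps gives a total change of at most n · C(x/n)² = Cx²/n for
    -- every n. This replaces the mean value theorem, with no derivative in sight.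
    constancy : ∀ (f : ℚ → Carrier) {x C} → 0ℚ ≤ x → 0ℚ ≤ C →
      (∀ t δ → 0ℚ ≤ t → 0ℚ ≤ δ → t +ᵠ δ ≤ x → f (t +ᵠ δ) - f t ≼ C *ᵠ (δ *ᵠ δ)) → f x ≈ f 0ℚ
    constancy f {x} {C} 0≤x 0≤C h = trans (solve 2 (λ a b → a := (a :- b) :+ b) refl (f x) (f 0ℚ))
      (trans (+-congʳ (≼-archimedean (C *ᵠ (x *ᵠ x)) (0≤* 0≤C (0≤* 0≤x 0≤x)) bound)) (+-identityˡ (f 0ℚ)))
      where
      module _ (n : ℕ) where
        δ : ℚ
        δ = x *ᵠ 1/suc n
        0≤δ : 0ℚ ≤ δ
        0≤δ = 0≤* 0≤x (ℚ.<⇒≤ (0<1/suc n))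
        nδ : ι (suc n) *ᵠ δ ≡ x
        nδ = ≡.trans (solveᵠ 3 (λ n x i → n :*ᵠ (x :*ᵠ i) :=ᵠ (i :*ᵠ n) :*ᵠ x) ≡.refl (ι (suc n)) x (1/suc n))
          (≡.trans (cong (_*ᵠ x) (1/suc-inverse n)) (ℚ.*-identityˡ x))
        kδ-suc : ∀ k → ι (suc k) *ᵠ δ ≡ ι k *ᵠ δ +ᵠ δ
        kδ-suc k = ≡.trans (cong (_*ᵠ δ) (ι-suc k))
          (solveᵠ 2 (λ k d → (conᵠ 1ℚ :+ᵠ k) :*ᵠ d :=ᵠ k :*ᵠ d :+ᵠ d) ≡.refl (ι k) δ)
        walk : ∀ k → k ℕ.≤ suc n → f (ι k *ᵠ δ) - f 0ℚ ≼ ι k *ᵠ (C *ᵠ (δ *ᵠ δ))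
        walk zero _ = ≼-≡ (≡.sym (ℚ.*-zeroˡ (C *ᵠ (δ *ᵠ δ)))) (≈⇒≼0 (reflexive (cong f (ℚ.*-zeroˡ δ))))
        walk (suc k) k<n = ≼-≡ (≡.trans (ℚ.+-comm (C *ᵠ (δ *ᵠ δ)) (ι k *ᵠ (C *ᵠ (δ *ᵠ δ)))) (≡.trans
            (solveᵠ 2 (λ k d → k :*ᵠ d :+ᵠ d :=ᵠ (conᵠ 1ℚ :+ᵠ k) :*ᵠ d) ≡.refl (ι k) (C *ᵠ (δ *ᵠ δ)))
            (cong (_*ᵠ (C *ᵠ (δ *ᵠ δ))) (≡.sym (ι-suc k)))))
          (≼-triangle (subst (λ t → f t - f (ι k *ᵠ δ) ≼ C *ᵠ (δ *ᵠ δ)) (≡.sym (kδ-suc k))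
              (h (ι k *ᵠ δ) δ (0≤* (0≤ι k) 0≤δ) 0≤δ
                (subst₂ _≤_ (kδ-suc k) nδ (*-monoʳ 0≤δ (ι-mono-≤ k<n)))))
            (walk k (ℕ.<⇒≤ k<n)))
        bound : f x - f 0ℚ ≼ C *ᵠ (x *ᵠ x) *ᵠ 1/suc n
        bound = ≼-≡ (≡.trans (solveᵠ 3 (λ n c d → n :*ᵠ (c :*ᵠ (d :*ᵠ d)) :=ᵠ c :*ᵠ (n :*ᵠ d) :*ᵠ d) ≡.refl (ι (suc n)) C δ)
            (≡.trans (cong (λ y → C *ᵠ y *ᵠ δ) nδ)
              (solveᵠ 3 (λ c x i → c :*ᵠ x :*ᵠ (x :*ᵠ i) :=ᵠ c :*ᵠ (x :*ᵠ x) :*ᵠ i) ≡.refl C x (1/suc n))))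
          (subst (λ t → f t - f 0ℚ ≼ ι (suc n) *ᵠ (C *ᵠ (δ *ᵠ δ))) nδ (walk (suc n) ℕ.≤-refl))

  -- The exponential has two Taylor estimates: `exp-taylor₁` holds on every ball with an unspecified
  -- constant and feeds `constancy`; `exp-taylor₂` is explicit, for the quantitative study of the
  -- sine near 0. Its radius 8/5 is half of the bound 16/5 for π.
  record Analysis : Set₁ where
    field
      algebra : NormedAlgebra
    open NormedAlgebra algebra public
    field
      ı     : Carrier
      ı*ı   : ı * ı ≈ - 1#
      ı≼1   : ı ≼ 1ℚ
      exp         : Carrier → Carrier
      exp-cong    : ∀ {w v} → w ≈ v → exp w ≈ exp v
      exp-bound   : ∀ B → ∃ λ E → ∀ {w} → w ≼ B → exp w ≼ E
      exp-taylor₁ : ∀ B → ∃ λ C → 0ℚ ≤ C × (∀ {w h r} → w ≼ B → w + h ≼ B → h ≼ r →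
                    exp (w + h) - (exp w + h * exp w) ≼ C *ᵠ (r *ᵠ r))
      exp-taylor₂ : ∀ {w r} → w ≼ r → r ≤ ℤ.+ 8 ℚ./ 5 →
                    exp w - (κ 1ℚ + w + κ ½ * (w * w)) ≼ (ℤ.+ 2 ℚ./ 7) *ᵠ (r *ᵠ r *ᵠ r)
      arctan        : ℚ → Carrier
      arctan-0      : arctan 0ℚ ≈ κ 0ℚ
      arctan-taylor : ∀ {t δ r} → 0ℚ ≤ t → 0ℚ ≤ δ → t +ᵠ δ ≤ ½ → r *ᵠ (1ℚ +ᵠ t *ᵠ t) ≡ 1ℚ →
                      arctan (t +ᵠ δ) - (arctan t + κ (δ *ᵠ r)) ≼ ι 8 *ᵠ (δ *ᵠ δ)
      π        : Carrier
      π-arctan : π ≈ κ (ι 4) * (arctan ½ + arctan (ℤ.+ 1 ℚ./ 3))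
      π-approx : π - κ (ℤ.+ 63 ℚ./ 20) ≼ ℤ.+ 1 ℚ./ 20

  -- The addition law of the exponential and exp(iπ) = -1.

  module Trigonometry (A : Analysis) where
    open Analysis A hiding (zero)
    open Solver algebra using (solve; _:=_; _:*_; _:+_; _:-_; :-_; con)
    open Estimates algebra
    open Order
    open Relation.Binary.Reasoning.Setoid setoid

    exp-0 : exp 0# ≈ 1#
    exp-0 = ≼0⇒≈ (≼-resp (trans (+-congˡ (-‿cong (solve 0 (con 1ℚ :+ con 0ℚ :+ con ½ :* (con 0ℚ :* con 0ℚ) := con 1ℚ) refl)))
        (+-cong (exp-cong κ-0) (-‿cong κ-1)))
      ((exp-taylor₂ {κ 0ℚ} {0ℚ} (κ≼ ℚ.≤-refl ℚ.≤-refl) (ℚ.≤ᵇ⇒≤ {0ℚ} {ℤ.+ 8 ℚ./ 5} _))))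

    -- The function t ↦ exp(u + (1 - t)v) exp(tv) joins the two sides. Over a step δ the first-order
    -- terms of its two factors cancel, leaving an increment of order δ², so `constancy` applies.
    exp-+ : ∀ u v → exp (u + v) ≈ exp u * exp v
    exp-+ u v = go (bounded u) (bounded v)
      where
      f : ℚ → Carrier
      f t = exp (u + κ (1ℚ -ᵠ t) * v) * exp (κ t * v)
      f-0 : f 0ℚ ≈ exp (u + v)
      f-0 = trans (*-cong (exp-cong (+-congˡ (trans (*-congʳ κ-1) (*-identityˡ v))))
                          (trans (exp-cong (trans (*-congʳ κ-0) (zeroˡ v))) exp-0)) (*-identityʳ (exp (u + v)))
      f-1 : f 1ℚ ≈ exp u * exp v
      f-1 = *-cong (exp-cong (trans (+-congˡ (trans (*-congʳ κ-0) (zeroˡ v))) (+-identityʳ u)))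
                   (exp-cong (trans (*-congʳ κ-1) (*-identityˡ v)))
      module _ {U V} (u≼U : u ≼ U) (v≼V : v ≼ V) where
        B : ℚ
        B = U +ᵠ V
        V≤B : V ≤ B
        V≤B = ≤-diff U (≼⇒0≤ u≼U) (ℚ.+-comm U V)
        fin : (∃ λ E → ∀ {w} → w ≼ B → exp w ≼ E) →
          (∃ λ C → 0ℚ ≤ C × (∀ {w h r} → w ≼ B → w + h ≼ B → h ≼ r → exp (w + h) - (exp w + h * exp w) ≼ C *ᵠ (r *ᵠ r))) →
          exp (u + v) ≈ exp u * exp v
        fin (E , exp≼E) (C , 0≤C , taylor) = trans (sym f-0) (trans (sym (constancy f 0≤1 0≤K step)) f-1)
          where
          0≤E : 0ℚ ≤ E
          0≤E = ≼⇒0≤ (exp≼E (κ≼ {0ℚ} ℚ.≤-refl (≼⇒0≤ (≼-+ u≼U v≼V))))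
          K : ℚ
          K = E *ᵠ (C *ᵠ (V *ᵠ V)) +ᵠ C *ᵠ (V *ᵠ V) *ᵠ E
          0≤CVV : 0ℚ ≤ C *ᵠ (V *ᵠ V)
          0≤CVV = 0≤* 0≤C (0≤* (≼⇒0≤ v≼V) (≼⇒0≤ v≼V))
          0≤K : 0ℚ ≤ K
          0≤K = 0≤+ (0≤* 0≤E 0≤CVV) (0≤* 0≤CVV 0≤E)
          step : ∀ t δ → 0ℚ ≤ t → 0ℚ ≤ δ → t +ᵠ δ ≤ 1ℚ → f (t +ᵠ δ) - f t ≼ K *ᵠ (δ *ᵠ δ)
          step t δ 0≤t 0≤δ s≤1 = ≼-≡
              (solveᵠ 4 (λ E C V d → E :*ᵠ (C :*ᵠ (d :*ᵠ V :*ᵠ (d :*ᵠ V))) :+ᵠ C :*ᵠ (d :*ᵠ V :*ᵠ (d :*ᵠ V)) :*ᵠ E :=ᵠ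
                (E :*ᵠ (C :*ᵠ (V :*ᵠ V)) :+ᵠ C :*ᵠ (V :*ᵠ V) :*ᵠ E) :*ᵠ (d :*ᵠ d)) ≡.refl E C V δ)
              (≼-resp (sym increment) (≼-- (≼-* (exp≼E w≼) (taylor y≼ y+h≼ h≼)) (≼-* (taylor w≼ w+h≼ h≼) (exp≼E y≼))))
            where
            s : ℚ
            s = t +ᵠ δ
            w y h : Carrier
            w = u + κ (1ℚ -ᵠ s) * v
            y = κ t * v
            h = κ δ * v
            t≤s : t ≤ s
            t≤s = a≤a+b t 0≤δ
            δ≤1 : δ ≤ 1ℚ
            δ≤1 = ℚ.≤-trans (≤-diff t 0≤t (ℚ.+-comm t δ)) s≤1
            0≤1-s : 0ℚ ≤ 1ℚ -ᵠ s
            0≤1-s = subst (_≤ 1ℚ -ᵠ s) (ℚ.+-inverseʳ s) (ℚ.+-monoˡ-≤ (-ᵠ s) s≤1)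
            w≼ : w ≼ B
            w≼ = ≼-+ u≼U (shorten 0≤1-s (1-≤1 (ℚ.≤-trans 0≤t t≤s)) v≼V)
            w+h≈ : w + h ≈ u + κ (1ℚ -ᵠ t) * v
            w+h≈ = trans (solve 4 (λ u v a d → u :+ a :* v :+ d :* v := u :+ (a :+ d) :* v) refl u v (κ (1ℚ -ᵠ s)) (κ δ))
              (+-congˡ (*-congʳ (trans (sym (κ-+ (1ℚ -ᵠ s) δ)) (reflexive (cong κ
                (solveᵠ 2 (λ t d → conᵠ 1ℚ :-ᵠ (t :+ᵠ d) :+ᵠ d :=ᵠ conᵠ 1ℚ :-ᵠ t) ≡.refl t δ))))))
            w+h≼ : w + h ≼ B
            w+h≼ = ≼-resp (sym w+h≈) (≼-+ u≼U (shorten (ℚ.≤-trans 0≤1-s (ℚ.+-monoʳ-≤ 1ℚ (ℚ.neg-antimono-≤ t≤s))) (1-≤1 0≤t) v≼V))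
            y≼ : y ≼ B
            y≼ = ≼-mono V≤B (shorten 0≤t (ℚ.≤-trans t≤s s≤1) v≼V)
            y+h≈ : y + h ≈ κ s * v
            y+h≈ = trans (sym (distribʳ v (κ t) (κ δ))) (*-congʳ (sym (κ-+ t δ)))
            y+h≼ : y + h ≼ B
            y+h≼ = ≼-resp (sym y+h≈) (≼-mono V≤B (shorten (ℚ.≤-trans 0≤t t≤s) s≤1 v≼V))
            h≼ : h ≼ δ *ᵠ V
            h≼ = ≼-* (κ≼ 0≤δ ℚ.≤-refl) v≼V
            increment : f s - f t ≈ exp w * (exp (y + h) - (exp y + h * exp y)) - (exp (w + h) - (exp w + h * exp w)) * exp y
            increment = trans (+-cong (*-congˡ (exp-cong (sym y+h≈))) (-‿cong (*-congʳ (exp-cong (sym w+h≈)))))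
              (solve 5 (λ ew ey ewh eyh h → ew :* eyh :- ewh :* ey :=
                ew :* (eyh :- (ey :+ h :* ey)) :- (ewh :- (ew :+ h :* ew)) :* ey) refl (exp w) (exp y) (exp (w + h)) (exp (y + h)) h)
      go : (∃ λ U → u ≼ U) → (∃ λ V → v ≼ V) → exp (u + v) ≈ exp u * exp v
      go (U , u≼U) (V , v≼V) = fin u≼U v≼V (exp-bound (U +ᵠ V)) (exp-taylor₁ (U +ᵠ V))

    module TangentHalf where
      r : ℚ → ℚ
      r t = inv (1ℚ +ᵠ t *ᵠ t)

      0<1+tt : ∀ t → 0ℚ < 1ℚ +ᵠ t *ᵠ t
      0<1+tt t = subst (0ℚ <_) (ℚ.+-comm (t *ᵠ t) 1ℚ) (0<+ (0≤x*x t) 0<1)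

      r-inverse : ∀ t → r t *ᵠ (1ℚ +ᵠ t *ᵠ t) ≡ 1ℚ
      r-inverse t = inv-inverse (1ℚ +ᵠ t *ᵠ t) (0<1+tt t)

      0≤r : ∀ t → 0ℚ ≤ r t
      0≤r t = 0≤inv (1ℚ +ᵠ t *ᵠ t) (0<1+tt t)

      r≤1 : ∀ t → r t ≤ 1ℚ
      r≤1 t = ℚ.≤-trans (a≤a+b (r t) (0≤* (0≤r t) (0≤x*x t))) (ℚ.≤-reflexive
        (≡.trans (solveᵠ 2 (λ r t → r :+ᵠ r :*ᵠ (t :*ᵠ t) :=ᵠ r :*ᵠ (conᵠ 1ℚ :+ᵠ t :*ᵠ t)) ≡.refl (r t) t) (r-inverse t)))

      κr-inverse : ∀ t → κ (r t) * (1# + κ t * κ t) ≈ 1#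
      κr-inverse t = trans (*-congˡ (trans (+-cong (sym κ-1) (sym (κ-* t t))) (sym (κ-+ 1ℚ (t *ᵠ t))))) (κ-inverse (r-inverse t))

      -- (1 - it) / (1 + it)
      g : ℚ → Carrier
      g t = κ (r t) * ((1# - ı * κ t) * (1# - ı * κ t))

      f : ℚ → Carrier
      f t = exp (κ (ι 2) * ı * arctan t) * g t

      conjugate : ∀ t → 1# + κ t * κ t ≈ (1# - ı * κ t) * (1# + 1# - (1# - ı * κ t))
      conjugate t = begin
        1# + κ t * κ t                          ≈⟨ solve 2 (λ o t → o :+ t :* t := o :- (:- con 1ℚ) :* (t :* t)) refl 1# (κ t) ⟩
        1# - (- κ 1ℚ) * (κ t * κ t)             ≈⟨ +-congˡ (-‿cong (*-congʳ (trans (-‿cong κ-1) (sym ı*ı)))) ⟩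
        1# - (ı * ı) * (κ t * κ t)              ≈⟨ +-congʳ (sym κ-1) ⟩
        κ 1ℚ - (ı * ı) * (κ t * κ t)            ≈⟨ solve 2 (λ j t → con 1ℚ :- j :* j :* (t :* t) := (con 1ℚ :- j :* t) :* (con 1ℚ :+ con 1ℚ :- (con 1ℚ :- j :* t))) refl ı (κ t) ⟩
        (κ 1ℚ - ı * κ t) * (κ 1ℚ + κ 1ℚ - (κ 1ℚ - ı * κ t)) ≈⟨ *-cong (+-congʳ κ-1) (+-cong (+-cong κ-1 κ-1) (-‿cong (+-congʳ κ-1))) ⟩
        (1# - ı * κ t) * (1# + 1# - (1# - ı * κ t)) ∎

      -- An exact discrete form of g′ = -2i g / (1 + t²). The denominators 1 + t² and 1 + (t + δ)²
      -- are cleared by `κr-inverse`, and the linear terms cancel, which leaves an explicit multiple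
      -- of δ².
      g-step : ∀ t δ → g (t +ᵠ δ) * (1# + κ (ι 2) * ı * κ (δ *ᵠ r t)) - g t ≈
        κ (ι 2) * κ (δ *ᵠ δ) * (κ (r (t +ᵠ δ)) * κ (r t) * (1# - ı * κ (t +ᵠ δ)))
      g-step t δ = begin
        p * (a * a) * (1# + κ (ι 2) * ı * κ (δ *ᵠ r t)) - q * (b * b)
          ≈⟨ +-cong (*-congˡ (+-cong (sym (κr-inverse t)) (*-congˡ (trans (κ-* δ (r t)) (*-congʳ δ≈)))))
               (-‿cong (trans (sym (*-identityˡ (q * (b * b)))) (*-congʳ (sym (κr-inverse (t +ᵠ δ)))))) ⟩
        p * (a * a) * (q * (1# + T * T) + κ (ι 2) * ı * ((S - T) * q)) - p * (1# + S * S) * (q * (b * b))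
          ≈⟨ +-cong (*-congˡ (+-congʳ (*-congˡ (conjugate t)))) (-‿cong (*-congʳ (*-congˡ (conjugate (t +ᵠ δ))))) ⟩
        p * (a * a) * (q * (b * (1# + 1# - b)) + κ (ι 2) * ı * ((S - T) * q)) - p * (a * (1# + 1# - a)) * (q * (b * b))
          ≈⟨ solve 6 (λ p q j S T o → let a = o :- j :* S ; b = o :- j :* T in
               p :* (a :* a) :* (q :* (b :* (o :+ o :- b)) :+ con (ι 2) :* j :* ((S :- T) :* q)) :- p :* (a :* (o :+ o :- a)) :* (q :* (b :* b))
               := con (ι 2) :* (:- (j :* j :* ((S :- T) :* (S :- T)))) :* (p :* q :* a)
                  :+ (o :- con 1ℚ) :* ((con (ι 2) :* (p :* q :* a :* a :* b)) :- con (ι 2) :* (p :* q :* a :* b :* b))) refl p q ı S T 1# ⟩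
        κ (ι 2) * (- (ı * ı * ((S - T) * (S - T)))) * (p * q * a) + (1# - κ 1ℚ) * (κ (ι 2) * (p * q * a * a * b) - κ (ι 2) * (p * q * a * b * b))
          ≈⟨ trans (+-congˡ (trans (*-congʳ (trans (+-congˡ (-‿cong κ-1)) (-‿inverseʳ 1#))) (zeroˡ _))) (+-identityʳ _) ⟩
        κ (ι 2) * (- (ı * ı * ((S - T) * (S - T)))) * (p * q * a)
          ≈⟨ *-congʳ (*-congˡ (-‿cong (*-cong (trans ı*ı (-‿cong (sym κ-1))) (trans (*-cong (sym δ≈) (sym δ≈)) (sym (κ-* δ δ)))))) ⟩
        κ (ι 2) * (- (- κ 1ℚ * κ (δ *ᵠ δ))) * (p * q * a)
          ≈⟨ solve 2 (λ d x → con (ι 2) :* (:- (:- con 1ℚ :* d)) :* x := con (ι 2) :* d :* x) refl (κ (δ *ᵠ δ)) (p * q * a) ⟩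
        κ (ι 2) * κ (δ *ᵠ δ) * (p * q * a) ∎
        where
        p q S T a b : Carrier
        p = κ (r (t +ᵠ δ))
        q = κ (r t)
        S = κ (t +ᵠ δ)
        T = κ t
        a = 1# - ı * S
        b = 1# - ı * T
        δ≈ : κ δ ≈ S - T
        δ≈ = trans (solve 2 (λ t d → d := (t :+ d) :- t) refl T (κ δ)) (+-congʳ (sym (κ-+ t δ)))

      one-minus≼ : ∀ {t} → 0ℚ ≤ t → t ≤ ½ → 1# - ı * κ t ≼ ι 2
      one-minus≼ {t} 0≤t t≤ = ≼-mono (ℚ.≤ᵇ⇒≤ {1ℚ +ᵠ 1ℚ *ᵠ ½} {ι 2} _) (≼-- 1≼1 (≼-* ı≼1 (κ≼ 0≤t t≤)))

      g≼ : ∀ {t} → 0ℚ ≤ t → t ≤ ½ → g t ≼ ι 4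
      g≼ {t} 0≤t t≤ = ≼-mono (ℚ.≤ᵇ⇒≤ {1ℚ *ᵠ (ι 2 *ᵠ ι 2)} {ι 4} _)
        (≼-* (κ≼ (0≤r t) (r≤1 t)) (≼-* (one-minus≼ 0≤t t≤) (one-minus≼ 0≤t t≤)))

      arctan-step : ∀ {t δ} → 0ℚ ≤ t → 0ℚ ≤ δ → t +ᵠ δ ≤ ½ → arctan (t +ᵠ δ) - arctan t ≼ ι 5 *ᵠ δ
      arctan-step {t} {δ} 0≤t 0≤δ s≤½ = ≼-mono bound (≼-resp rearrange
          (≼-+ (arctan-taylor 0≤t 0≤δ s≤½ (r-inverse t)) (κ≼ (0≤* 0≤δ (0≤r t)) (*-monoˡ 0≤δ (r≤1 t)))))
        where
        rearrange : (arctan (t +ᵠ δ) - (arctan t + κ (δ *ᵠ r t))) + κ (δ *ᵠ r t) ≈ arctan (t +ᵠ δ) - arctan t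
        rearrange = solve 3 (λ a b c → (a :- (b :+ c)) :+ c := a :- b) refl (arctan (t +ᵠ δ)) (arctan t) (κ (δ *ᵠ r t))
        δ≤½ : δ ≤ ½
        δ≤½ = ℚ.≤-trans (≤-diff t 0≤t (ℚ.+-comm t δ)) s≤½
        bound : ι 8 *ᵠ (δ *ᵠ δ) +ᵠ δ *ᵠ 1ℚ ≤ ι 5 *ᵠ δ
        bound = ℚ.≤-trans (ℚ.+-monoˡ-≤ (δ *ᵠ 1ℚ) (*-monoˡ (0≤ι 8) (*-monoˡ 0≤δ δ≤½)))
          (ℚ.≤-reflexive (solveᵠ 1 (λ d → conᵠ (ι 8) :*ᵠ (d :*ᵠ conᵠ ½) :+ᵠ d :*ᵠ conᵠ 1ℚ :=ᵠ conᵠ (ι 5) :*ᵠ d) ≡.refl δ))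

      arctan≼ : ∀ {t} → 0ℚ ≤ t → t ≤ ½ → arctan t ≼ ι 3
      arctan≼ {t} 0≤t t≤ = ≼-mono (ℚ.≤-trans (ℚ.+-monoˡ-≤ 0ℚ (*-monoˡ (0≤ι 5) t≤)) (ℚ.≤ᵇ⇒≤ {ι 5 *ᵠ ½ +ᵠ 0ℚ} {ι 3} _))
        (≼-shift (subst (λ s → arctan s - arctan 0ℚ ≼ ι 5 *ᵠ t) (ℚ.+-identityˡ t)
          (arctan-step {0ℚ} {t} ℚ.≤-refl 0≤t (subst (_≤ ½) (≡.sym (ℚ.+-identityˡ t)) t≤)))
          (≼-resp (sym arctan-0) (κ≼ ℚ.≤-refl ℚ.≤-refl)))

      2ı : Carrier
      2ı = κ (ι 2) * ı

      2ı≼ : 2ı ≼ ι 2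
      2ı≼ = ≼-mono (ℚ.≤ᵇ⇒≤ {ι 2 *ᵠ 1ℚ} {ι 2} _) (≼-* (κ≼ (0≤ι 2) ℚ.≤-refl) ı≼1)

      exp-arctan : ∀ {x} → 0ℚ ≤ x → x ≤ ½ → exp (2ı * arctan x) * g x ≈ 1#
      exp-arctan {x} 0≤x x≤½ = go (exp-bound (ι 6)) (exp-taylor₁ (ι 6))
        where
        f-0 : f 0ℚ ≈ 1#
        f-0 = trans (*-cong (trans (exp-cong (trans (*-congˡ (trans arctan-0 κ-0)) (zeroʳ 2ı))) exp-0)
            (trans (*-cong κ-1 (*-cong one one)) (trans (*-identityˡ _) (*-identityˡ 1#)))) (*-identityˡ 1#)
          where
          one : 1# - ı * κ 0ℚ ≈ 1#
          one = trans (+-congˡ (-‿cong (trans (*-congˡ κ-0) (zeroʳ ı)))) (trans (+-congˡ (trans (-‿cong (sym κ-0)) (trans (solve 0 (:- con 0ℚ := con 0ℚ) refl) κ-0))) (+-identityʳ 1#))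
        go : (∃ λ E → ∀ {w} → w ≼ ι 6 → exp w ≼ E) →
          (∃ λ C → 0ℚ ≤ C × (∀ {w h r} → w ≼ ι 6 → w + h ≼ ι 6 → h ≼ r → exp (w + h) - (exp w + h * exp w) ≼ C *ᵠ (r *ᵠ r))) →
          f x ≈ 1#
        go (E , exp≼E) (C , 0≤C , taylor) = trans (constancy f 0≤x 0≤K step) f-0
          where
          -- 400 = (2 · 5)² · 4 comes from `h≼` and `g≼`; 68 = 2 · 2 + 2 · 8 · 4 adds the remainder
          -- of `g-step` to that of `arctan-taylor`.
          K : ℚ
          K = C *ᵠ ι 400 +ᵠ E *ᵠ ι 68
          0≤E : 0ℚ ≤ E
          0≤E = ≼⇒0≤ (exp≼E (κ≼ {0ℚ} ℚ.≤-refl (0≤ι 6)))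
          0≤K : 0ℚ ≤ K
          0≤K = 0≤+ (0≤* 0≤C (0≤ι 400)) (0≤* 0≤E (0≤ι 68))
          step : ∀ t δ → 0ℚ ≤ t → 0ℚ ≤ δ → t +ᵠ δ ≤ x → f (t +ᵠ δ) - f t ≼ K *ᵠ (δ *ᵠ δ)
          step t δ 0≤t 0≤δ s≤x = ≼-≡
              (solveᵠ 3 (λ C E d → C :*ᵠ (conᵠ (ι 2) :*ᵠ (conᵠ (ι 5) :*ᵠ d) :*ᵠ (conᵠ (ι 2) :*ᵠ (conᵠ (ι 5) :*ᵠ d))) :*ᵠ conᵠ (ι 4)
                  :+ᵠ E :*ᵠ (conᵠ (ι 2) :*ᵠ (d :*ᵠ d) :*ᵠ (conᵠ 1ℚ :*ᵠ conᵠ 1ℚ :*ᵠ conᵠ (ι 2)) :+ᵠ conᵠ (ι 2) :*ᵠ (conᵠ (ι 8) :*ᵠ (d :*ᵠ d)) :*ᵠ conᵠ (ι 4))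
                  :=ᵠ (C :*ᵠ conᵠ (ι 400) :+ᵠ E :*ᵠ conᵠ (ι 68)) :*ᵠ (d :*ᵠ d)) ≡.refl C E δ)
              (≼-resp (sym increment) (≼-+ (≼-* (taylor w≼ w+h≼ h≼) (g≼ 0≤s s≤½))
                (≼-* (exp≼E w≼) (≼-+ (≼-* (≼-* (κ≼ (0≤ι 2) ℚ.≤-refl) (κ≼ (0≤* 0≤δ 0≤δ) ℚ.≤-refl))
                    (≼-* (≼-* (κ≼ (0≤r s) (r≤1 s)) (κ≼ (0≤r t) (r≤1 t))) (one-minus≼ 0≤s s≤½)))
                  (≼-* (≼-* 2ı≼ (≼-resp Δ (arctan-taylor 0≤t 0≤δ s≤½ (r-inverse t)))) (g≼ 0≤s s≤½))))))
            where
            s : ℚ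
            s = t +ᵠ δ
            s≤½ : s ≤ ½
            s≤½ = ℚ.≤-trans s≤x x≤½
            t≤s : t ≤ s
            t≤s = a≤a+b t 0≤δ
            0≤s : 0ℚ ≤ s
            0≤s = ℚ.≤-trans 0≤t t≤s
            w h D : Carrier
            w = 2ı * arctan t
            h = 2ı * (arctan s - arctan t)
            D = arctan s - arctan t
            Δ : arctan s - (arctan t + κ (δ *ᵠ r t)) ≈ D - κ (δ *ᵠ r t)
            Δ = solve 3 (λ a b c → a :- (b :+ c) := a :- b :- c) refl (arctan s) (arctan t) (κ (δ *ᵠ r t))
            w+h≈ : w + h ≈ 2ı * arctan s
            w+h≈ = solve 3 (λ j a b → j :* b :+ j :* (a :- b) := j :* a) refl 2ı (arctan s) (arctan t)
            6≤ : ι 2 *ᵠ ι 3 ≤ ι 6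
            6≤ = ℚ.≤ᵇ⇒≤ {ι 2 *ᵠ ι 3} {ι 6} _
            w≼ : w ≼ ι 6
            w≼ = ≼-mono 6≤ (≼-* 2ı≼ (arctan≼ 0≤t (ℚ.≤-trans t≤s s≤½)))
            w+h≼ : w + h ≼ ι 6
            w+h≼ = ≼-resp (sym w+h≈) (≼-mono 6≤ (≼-* 2ı≼ (arctan≼ 0≤s s≤½)))
            h≼ : h ≼ ι 2 *ᵠ (ι 5 *ᵠ δ)
            h≼ = ≼-* 2ı≼ (arctan-step 0≤t 0≤δ s≤½)
            increment : f s - f t ≈ (exp (w + h) - (exp w + h * exp w)) * g s
              + exp w * (κ (ι 2) * κ (δ *ᵠ δ) * (κ (r s) * κ (r t) * (1# - ı * κ s)) + 2ı * (D - κ (δ *ᵠ r t)) * g s)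
            increment = begin
              exp (2ı * arctan s) * g s - exp w * g t
                ≈⟨ +-congʳ (*-congʳ (exp-cong (sym w+h≈))) ⟩
              exp (w + h) * g s - exp w * g t
                ≈⟨ solve 8 (λ ewh ew gs gt j D d o → ewh :* gs :- ew :* gt :=
                     (ewh :- (ew :+ j :* D :* ew)) :* gs :+ ew :* ((gs :* (o :+ j :* d) :- gt) :+ j :* (D :- d) :* gs) :+ (con 1ℚ :- o) :* (ew :* gs)) refl
                     (exp (w + h)) (exp w) (g s) (g t) 2ı D (κ (δ *ᵠ r t)) 1# ⟩
              (exp (w + h) - (exp w + h * exp w)) * g s + exp w * ((g s * (1# + 2ı * κ (δ *ᵠ r t)) - g t) + 2ı * (D - κ (δ *ᵠ r t)) * g s) + (κ 1ℚ - 1#) * (exp w * g s)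
                ≈⟨ trans (+-congˡ (trans (*-congʳ (trans (+-congʳ κ-1) (-‿inverseʳ 1#))) (zeroˡ _))) (+-identityʳ _) ⟩
              (exp (w + h) - (exp w + h * exp w)) * g s + exp w * ((g s * (1# + 2ı * κ (δ *ᵠ r t)) - g t) + 2ı * (D - κ (δ *ᵠ r t)) * g s)
                ≈⟨ +-congˡ (*-congˡ (+-congʳ (g-step t δ))) ⟩
              (exp (w + h) - (exp w + h * exp w)) * g s
                + exp w * (κ (ι 2) * κ (δ *ᵠ δ) * (κ (r s) * κ (r t) * (1# - ı * κ s)) + 2ı * (D - κ (δ *ᵠ r t)) * g s) ∎

      -- This is (2 - i)(3 - i) = 5(1 - i), the identity behind the arctangent formula for π,
      -- squared and normalised. As polynomials in i the two sides differ by a multiple of i² + 1;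
      -- the quadratic in the proof is the cofactor.
      g-½ : g ½ * g (ℤ.+ 1 ℚ./ 3) ≈ - ı
      g-½ = begin
        κ (r ½) * ((1# - ı * κ ½) * (1# - ı * κ ½)) * (κ (r ⅓) * ((1# - ı * κ ⅓) * (1# - ı * κ ⅓)))
          ≈⟨ *-cong (*-congˡ (*-cong one½ one½)) (*-congˡ (*-cong one⅓ one⅓)) ⟩
        κ (r ½) * ((κ 1ℚ - ı * κ ½) * (κ 1ℚ - ı * κ ½)) * (κ (r ⅓) * ((κ 1ℚ - ı * κ ⅓) * (κ 1ℚ - ı * κ ⅓)))
          ≈⟨ solve 1 (λ j → con 4/5 :* ((con 1ℚ :- j :* con ½) :* (con 1ℚ :- j :* con ½)) :* (con 9/10 :* ((con 1ℚ :- j :* con ⅓) :* (con 1ℚ :- j :* con ⅓)))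
               := (j :* j :+ con 1ℚ) :* (con 1/50 :* (j :* j) :- con 1/5 :* j :+ con 18/25) :- j) refl ı ⟩
        (ı * ı + κ 1ℚ) * (κ 1/50 * (ı * ı) - κ 1/5 * ı + κ 18/25) - ı
          ≈⟨ +-congʳ (trans (*-congʳ (trans (+-cong ı*ı κ-1) (-‿inverseˡ 1#))) (zeroˡ _)) ⟩
        0# - ı
          ≈⟨ +-identityˡ (- ı) ⟩
        - ı ∎
        where
        ⅓ 4/5 9/10 1/50 1/5 18/25 : ℚ
        ⅓ = ℤ.+ 1 ℚ./ 3
        4/5 = ℤ.+ 4 ℚ./ 5
        9/10 = ℤ.+ 9 ℚ./ 10
        1/50 = ℤ.+ 1 ℚ./ 50
        1/5 = ℤ.+ 1 ℚ./ 5
        18/25 = ℤ.+ 18 ℚ./ 25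
        one½ : 1# - ı * κ ½ ≈ κ 1ℚ - ı * κ ½
        one½ = +-congʳ (sym κ-1)
        one⅓ : 1# - ı * κ ⅓ ≈ κ 1ℚ - ı * κ ⅓
        one⅓ = +-congʳ (sym κ-1)

      -- By the addition law the left side is (XY)², where `exp-arctan` makes X and Y the inverses
      -- of the two values of `g`. Their product G is -i, so (XY)² is the inverse of G² = -1.
      exp-π : exp (ı * π) ≈ - 1#
      exp-π = begin
        exp (ı * π)                    ≈⟨ exp-cong (*-congˡ π-arctan) ⟩
        exp (ı * (κ (ι 4) * (a + b)))  ≈⟨ exp-cong (solve 3 (λ j a b → j :* (con (ι 4) :* (a :+ b)) :=
                                            (con (ι 2) :* j :* a :+ con (ι 2) :* j :* b) :+ (con (ι 2) :* j :* a :+ con (ι 2) :* j :* b)) refl ı a b) ⟩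
        exp ((2ı * a + 2ı * b) + (2ı * a + 2ı * b)) ≈⟨ trans (exp-+ _ _) (*-cong (exp-+ _ _) (exp-+ _ _)) ⟩
        X * Y * (X * Y)                ≈⟨ cancel (- 1# , trans (*-congʳ square) (trans minus-one² refl)) key ⟩
        - 1#                           ∎
        where
        ⅓ : ℚ
        ⅓ = ℤ.+ 1 ℚ./ 3
        a b X Y : Carrier
        a = arctan ½
        b = arctan ⅓
        X = exp (2ı * a)
        Y = exp (2ı * b)
        minus-one² : - 1# * - 1# ≈ 1#
        minus-one² = trans (*-cong (-‿cong (sym κ-1)) (-‿cong (sym κ-1))) (trans (solve 0 (:- con 1ℚ :* :- con 1ℚ := con 1ℚ) refl) κ-1)
        G : Carrier
        G = g ½ * g ⅓
        square : G * G ≈ - 1#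
        square = trans (*-cong g-½ g-½) (trans (solve 1 (λ j → :- j :* :- j := j :* j) refl ı) ı*ı)
        key : G * G * (X * Y * (X * Y)) ≈ G * G * - 1#
        key = begin
          G * G * (X * Y * (X * Y))
            ≈⟨ solve 4 (λ x y g h → g :* h :* (g :* h) :* (x :* y :* (x :* y)) := (x :* g) :* (x :* g) :* ((y :* h) :* (y :* h))) refl X Y (g ½) (g ⅓) ⟩
          (X * g ½) * (X * g ½) * ((Y * g ⅓) * (Y * g ⅓))
            ≈⟨ *-cong (*-cong x1 x1) (*-cong y1 y1) ⟩
          1# * 1# * (1# * 1#)
            ≈⟨ *-cong (*-identityˡ 1#) (*-identityˡ 1#) ⟩
          1# * 1#
            ≈⟨ trans (*-identityˡ 1#) (sym minus-one²) ⟩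
          - 1# * - 1#
            ≈⟨ *-congʳ (sym square) ⟩
          G * G * - 1# ∎
          where
          x1 : X * g ½ ≈ 1#
          x1 = exp-arctan (ℚ.<⇒≤ 0<½) ℚ.≤-refl
          y1 : Y * g ⅓ ≈ 1#
          y1 = exp-arctan (ℚ.≤ᵇ⇒≤ {0ℚ} {⅓} _) (ℚ.≤ᵇ⇒≤ {⅓} {½} _)

    e : Carrier → Carrier
    e x = exp (ı * (π * x))

    e-cong : ∀ {x y} → x ≈ y → e x ≈ e y
    e-cong x≈y = exp-cong (*-congˡ (*-congˡ x≈y))

    e-+ : ∀ x y → e (x + y) ≈ e x * e y
    e-+ x y = trans (exp-cong (trans (*-congˡ (distribˡ π x y)) (distribˡ ı (π * x) (π * y)))) (exp-+ (ı * (π * x)) (ı * (π * y)))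

    e-0 : e 0# ≈ 1#
    e-0 = trans (exp-cong (trans (*-congˡ (zeroʳ π)) (zeroʳ ı))) exp-0

    e-neg : ∀ x → e x * e (- x) ≈ 1#
    e-neg x = trans (sym (e-+ x (- x))) (trans (e-cong (-‿inverseʳ x)) e-0)

    e-1 : e 1# ≈ - 1#
    e-1 = trans (exp-cong (*-congˡ (*-identityʳ π))) TangentHalf.exp-π

  -- Finite products over 1, ..., n in a commutative monoid.

  module Products (M : CommutativeMonoid 0ℓ 0ℓ) where
    open CommutativeMonoid M
    open Algebra.Properties.CommutativeSemigroup commutativeSemigroup using (interchange)
    open Relation.Binary.Reasoning.Setoid setoid

    -- Indices start at 1. The monoid is a parameter because the same reindexing lemmas serve the
    -- algebra, rational bounds, and, additively over the naturals, the counting of residues.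
    Π : (ℕ → Carrier) → ℕ → Carrier
    Π f zero    = ε
    Π f (suc n) = Π f n ∙ f (suc n)

    Π-cong : ∀ {f g} n → (∀ j → 1 ℕ.≤ j → j ℕ.≤ n → f j ≈ g j) → Π f n ≈ Π g n
    Π-cong zero    h = refl
    Π-cong (suc n) h = ∙-cong (Π-cong n λ j 1≤j j≤n → h j 1≤j (ℕ.m≤n⇒m≤1+n j≤n)) (h (suc n) (ℕ.s≤s ℕ.z≤n) ℕ.≤-refl)

    Π-∙ : ∀ f g n → Π (λ j → f j ∙ g j) n ≈ Π f n ∙ Π g n
    Π-∙ f g zero    = sym (identityˡ ε)
    Π-∙ f g (suc n) = trans (∙-congʳ (Π-∙ f g n)) (interchange (Π f n) (Π g n) (f (suc n)) (g (suc n)))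

    Π-ε : ∀ {f} n → (∀ j → 1 ℕ.≤ j → j ℕ.≤ n → f j ≈ ε) → Π f n ≈ ε
    Π-ε zero    h = refl
    Π-ε (suc n) h = trans (∙-cong (Π-ε n λ j 1≤j j≤n → h j 1≤j (ℕ.m≤n⇒m≤1+n j≤n)) (h (suc n) (ℕ.s≤s ℕ.z≤n) ℕ.≤-refl)) (identityˡ ε)

    Π-split : ∀ f m n → Π f (m ℕ.+ n) ≈ Π f m ∙ Π (λ j → f (m ℕ.+ j)) n
    Π-split f m zero    = trans (reflexive (cong (Π f) (ℕ.+-identityʳ m))) (sym (identityʳ (Π f m)))
    Π-split f m (suc n) = trans (reflexive (cong (Π f) (ℕ.+-suc m n)))
      (trans (∙-cong (Π-split f m n) (reflexive (cong f (≡.sym (ℕ.+-suc m n)))))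
        (assoc (Π f m) (Π (λ j → f (m ℕ.+ j)) n) (f (m ℕ.+ suc n))))

    Π-head : ∀ f n → Π f (suc n) ≈ f 1 ∙ Π (λ j → f (suc j)) n
    Π-head f n = trans (Π-split f 1 n) (∙-congʳ (identityˡ (f 1)))

    Π-reverse : ∀ f n → Π f n ≈ Π (λ j → f (suc n ℕ.∸ j)) n
    Π-reverse f zero    = refl
    Π-reverse f (suc n) = trans (comm (Π f n) (f (suc n)))
      (trans (∙-congˡ (Π-reverse f n)) (sym (Π-head (λ j → f (suc (suc n) ℕ.∸ j)) n)))

    Π-fold : ∀ f r → Π f (r ℕ.+ r) ≈ Π (λ j → f j ∙ f (suc (r ℕ.+ r) ℕ.∸ j)) r
    Π-fold f r = trans (Π-split f r r) (trans (∙-congˡ (trans (Π-reverse (λ j → f (r ℕ.+ j)) r)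
      (Π-cong r λ j _ j≤r → reflexive (cong f (≡.trans (≡.sym (ℕ.+-∸-assoc r (ℕ.m≤n⇒m≤1+n j≤r))) (cong (ℕ._∸ j) (ℕ.+-suc r r)))))))
      (sym (Π-∙ f (λ j → f (suc (r ℕ.+ r) ℕ.∸ j)) r)))

  -- Factorisation of monic polynomial functions over their roots.

  module Polynomials (N : NormedAlgebra) where
    open NormedAlgebra N hiding (zero)
    open Solver N using (solve; _:=_; _:*_; _:+_; _:-_; :-_; con)
    open Estimates N
    open Products *-commutativeMonoid public
    open Algebra.Properties.Semiring.Exp semiring using (_^_) public
    open Relation.Binary.Reasoning.Setoid setoid

    -- f is a monic polynomial function of degree d: its divided differences are
    -- monic of degree d - 1.
    Monic : ℕ → (Carrier → Carrier) → Set
    Monic zero    f = ∀ X → f X ≈ 1#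
    Monic (suc d) f = ∀ r → ∃ λ g → Monic d g × (∀ X → f X - f r ≈ (X - r) * g X)

    Monic-+ : ∀ d {f g} → Monic (suc d) f → Monic d g → ∀ c → Monic (suc d) (λ X → f X + c * g X)
    Monic-+ zero {f} {g} mf mg c r = step (mf r)
      where
      step : (∃ λ f′ → Monic 0 f′ × (∀ X → f X - f r ≈ (X - r) * f′ X)) →
        ∃ λ f′ → Monic 0 f′ × (∀ X → (f X + c * g X) - (f r + c * g r) ≈ (X - r) * f′ X)
      step (f′ , mf′ , div) = f′ , mf′ , λ X → begin
        (f X + c * g X) - (f r + c * g r) ≈⟨ +-cong (+-congˡ (*-congˡ (mg X))) (-‿cong (+-congˡ (*-congˡ (mg r)))) ⟩
        (f X + c * 1#) - (f r + c * 1#)   ≈⟨ solve 3 (λ a b c → (a :+ c) :- (b :+ c) := a :- b) refl (f X) (f r) (c * 1#) ⟩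
        f X - f r                         ≈⟨ div X ⟩
        (X - r) * f′ X                    ∎
    Monic-+ (suc d) {f} {g} mf mg c r = step (mf r) (mg r)
      where
      step : (∃ λ f′ → Monic (suc d) f′ × (∀ X → f X - f r ≈ (X - r) * f′ X)) →
        (∃ λ g′ → Monic d g′ × (∀ X → g X - g r ≈ (X - r) * g′ X)) →
        ∃ λ f′ → Monic (suc d) f′ × (∀ X → (f X + c * g X) - (f r + c * g r) ≈ (X - r) * f′ X)
      step (f′ , mf′ , divf) (g′ , mg′ , divg) = (λ X → f′ X + c * g′ X) , Monic-+ d mf′ mg′ c , λ X → begin
        (f X + c * g X) - (f r + c * g r)         ≈⟨ solve 5 (λ a b c x y → (a :+ c :* x) :- (b :+ c :* y) := (a :- b) :+ c :* (x :- y)) refl (f X) (f r) c (g X) (g r) ⟩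
        (f X - f r) + c * (g X - g r)             ≈⟨ +-cong (divf X) (*-congˡ (divg X)) ⟩
        (X - r) * f′ X + c * ((X - r) * g′ X)     ≈⟨ solve 4 (λ d a c b → d :* a :+ c :* (d :* b) := d :* (a :+ c :* b)) refl (X - r) (f′ X) c (g′ X) ⟩
        (X - r) * (f′ X + c * g′ X)               ∎

    Monic-horner : ∀ d {f} → Monic d f → ∀ c → Monic (suc d) (λ X → c + X * f X)
    Monic-horner zero {f} mf c r = f , mf , λ X → begin
      (c + X * f X) - (c + r * f r)  ≈⟨ +-cong (+-congˡ (*-congˡ (mf X))) (-‿cong (+-congˡ (*-congˡ (trans (mf r) (sym (mf X)))))) ⟩
      (c + X * 1#) - (c + r * f X)   ≈⟨ +-congʳ (+-congˡ (*-congˡ (sym (mf X)))) ⟩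
      (c + X * f X) - (c + r * f X)  ≈⟨ solve 4 (λ c x r f → (c :+ x :* f) :- (c :+ r :* f) := (x :- r) :* f) refl c X r (f X) ⟩
      (X - r) * f X                  ∎
    Monic-horner (suc d) {f} mf c r = step (mf r)
      where
      step : (∃ λ f′ → Monic d f′ × (∀ X → f X - f r ≈ (X - r) * f′ X)) →
        ∃ λ g → Monic (suc d) g × (∀ X → (c + X * f X) - (c + r * f r) ≈ (X - r) * g X)
      step (f′ , mf′ , div) = (λ X → f X + r * f′ X) , Monic-+ d mf mf′ r , λ X → begin
        (c + X * f X) - (c + r * f r)       ≈⟨ solve 5 (λ c x r a b → (c :+ x :* a) :- (c :+ r :* b) := (x :- r) :* a :+ r :* (a :- b)) refl c X r (f X) (f r) ⟩
        (X - r) * f X + r * (f X - f r)     ≈⟨ +-congˡ (*-congˡ (div X)) ⟩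
        (X - r) * f X + r * ((X - r) * f′ X) ≈⟨ solve 4 (λ d a r b → d :* a :+ r :* (d :* b) := d :* (a :+ r :* b)) refl (X - r) (f X) r (f′ X) ⟩
        (X - r) * (f X + r * f′ X)          ∎

    -- Divide by the last root; the other roots remain roots of the quotient because their
    -- differences from the last one are invertible and cancel. No absence of zero divisors is
    -- assumed, which is why the roots must differ by units.
    factor : ∀ d {f} → Monic d f → (x : ℕ → Carrier) → (∀ j → 1 ℕ.≤ j → j ℕ.≤ d → f (x j) ≈ 0#) →
      (∀ i j → 1 ℕ.≤ i → i ℕ.< j → j ℕ.≤ d → Unit (x i - x j)) → ∀ X → f X ≈ Π (λ j → X - x j) d
    factor zero    mf x root distinct = mf
    factor (suc d) {f} mf x root distinct = step (mf (x (suc d)))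
      where
      step : (∃ λ g → Monic d g × (∀ X → f X - f (x (suc d)) ≈ (X - x (suc d)) * g X)) → ∀ X → f X ≈ Π (λ j → X - x j) (suc d)
      step (g , mg , div) X = trans (divide X) (trans (*-comm (X - x (suc d)) (g X)) (*-congʳ (factor d mg x root′ distinct′ X)))
        where
        divide : ∀ X → f X ≈ (X - x (suc d)) * g X
        divide X = begin
          f X                      ≈⟨ solve 2 (λ a b → a := (a :- b) :+ b) refl (f X) (f (x (suc d))) ⟩
          f X - f (x (suc d)) + f (x (suc d)) ≈⟨ +-cong (div X) (root (suc d) (ℕ.s≤s ℕ.z≤n) ℕ.≤-refl) ⟩
          (X - x (suc d)) * g X + 0# ≈⟨ +-identityʳ _ ⟩
          (X - x (suc d)) * g X    ∎
        root′ : ∀ j → 1 ℕ.≤ j → j ℕ.≤ d → g (x j) ≈ 0#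
        root′ j 1≤j j≤d = cancel-0 (distinct j (suc d) 1≤j (ℕ.s≤s j≤d) ℕ.≤-refl)
          (trans (sym (divide (x j))) (root j 1≤j (ℕ.m≤n⇒m≤1+n j≤d)))
        distinct′ : ∀ i j → 1 ℕ.≤ i → i ℕ.< j → j ℕ.≤ d → Unit (x i - x j)
        distinct′ i j 1≤i i<j j≤d = distinct i j 1≤i i<j (ℕ.m≤n⇒m≤1+n j≤d)

    geometric : ℕ → Carrier → Carrier
    geometric zero    X = 1#
    geometric (suc d) X = 1# + X * geometric d X

    Monic-geometric : ∀ d → Monic d (geometric d)
    Monic-geometric zero    X = refl
    Monic-geometric (suc d) = Monic-horner d (Monic-geometric d) 1#

    geometric-sum : ∀ d X → (X - 1#) * geometric d X ≈ X ^ suc d - 1#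
    geometric-sum zero    X = trans (*-identityʳ (X - 1#)) (+-congʳ (sym (*-identityʳ X)))
    geometric-sum (suc d) X = begin
      (X - 1#) * (1# + X * geometric d X)     ≈⟨ distribˡ (X - 1#) 1# _ ⟩
      (X - 1#) * 1# + (X - 1#) * (X * geometric d X) ≈⟨ +-cong (*-identityʳ _) (solve 3 (λ x y g → y :* (x :* g) := x :* (y :* g)) refl X (X - 1#) (geometric d X)) ⟩
      (X - 1#) + X * ((X - 1#) * geometric d X) ≈⟨ +-congˡ (*-congˡ (geometric-sum d X)) ⟩
      (X - 1#) + X * (X ^ suc d - 1#)         ≈⟨ +-congˡ (trans (distribˡ X (X ^ suc d) (- 1#)) (+-congˡ (trans (*-congˡ (-‿cong (sym κ-1))) (solve 1 (λ x → x :* (:- con 1ℚ) := :- x) refl X)))) ⟩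
      (X - 1#) + (X * X ^ suc d - X)          ≈⟨ solve 3 (λ x p o → (x :- o) :+ (p :- x) := p :- o) refl X (X * X ^ suc d) 1# ⟩
      X * X ^ suc d - 1#                      ∎

    geometric-1 : ∀ d → geometric d 1# ≈ κ (ι (suc d))
    geometric-1 zero    = sym κ-1
    geometric-1 (suc d) = trans (+-cong (sym κ-1) (trans (*-identityˡ _) (geometric-1 d)))
      (trans (sym (κ-+ 1ℚ (ι (suc d)))) (reflexive (cong κ (≡.sym (ι-suc (suc d))))))

  -- Quantitative estimates and invertibility of the sine.

  module Sine (A : Analysis) where
    open Analysis A hiding (zero)
    open Solver algebra using (solve; _:=_; _:*_; _:+_; _:-_; :-_; con)
    open Estimates algebra
    open Trigonometry A
    open Polynomials algebra
    open Order
    open Relation.Binary.Reasoning.Setoid setoid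

    ⅓ 16/5 20/63 63/20 25/8 2/7 : ℚ
    ⅓     = ℤ.+ 1 ℚ./ 3
    16/5  = ℤ.+ 16 ℚ./ 5
    20/63 = ℤ.+ 20 ℚ./ 63
    63/20 = ℤ.+ 63 ℚ./ 20
    25/8  = ℤ.+ 25 ℚ./ 8
    2/7   = ℤ.+ 2 ℚ./ 7

    π≼ : π ≼ 16/5
    π≼ = ≼-mono (ℚ.≤ᵇ⇒≤ {ℤ.+ 1 ℚ./ 20 +ᵠ 63/20} {16/5} _) (≼-shift π-approx (κ≼ (ℚ.≤ᵇ⇒≤ {0ℚ} {63/20} _) ℚ.≤-refl))

    -- 20/63 · π lies within 1/63 of 1, so it is invertible with an inverse of norm at most 63/62,
    -- and 20/63 · 63/62 = 10/31 ≤ 1/3.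
    π⁻¹-∃ : ∃ λ u → π * u ≈ 1# × u ≼ ⅓
    π⁻¹-∃ = go (neumann h≼ (from-yes (1/63 ℚ.<? 1ℚ)))
      where
      1/63 63/62 : ℚ
      1/63  = 20/63 *ᵠ (ℤ.+ 1 ℚ./ 20)
      63/62 = ℤ.+ 63 ℚ./ 62
      h : Carrier
      h = κ 20/63 * (π - κ 63/20)
      h≼ : h ≼ 1/63
      h≼ = ≼-* (κ≼ (ℚ.≤ᵇ⇒≤ {0ℚ} {20/63} _) ℚ.≤-refl) π-approx
      π≈ : κ 20/63 * π ≈ 1# + h
      π≈ = trans (solve 1 (λ p → con 20/63 :* p := con 1ℚ :+ con 20/63 :* (p :- con 63/20)) refl π) (+-congʳ κ-1)
      go : (∃ λ u → (1# + h) * u ≈ 1#) → ∃ λ u → π * u ≈ 1# × u ≼ ⅓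
      go (u , e) = κ 20/63 * u , trans (solve 3 (λ p c u → p :* (c :* u) := c :* p :* u) refl π (κ 20/63) u) (trans (*-congʳ π≈) e) ,
        ≼-mono (ℚ.≤ᵇ⇒≤ {20/63 *ᵠ (63/62 *ᵠ 1ℚ)} {⅓} _) (≼-* (κ≼ (ℚ.≤ᵇ⇒≤ {0ℚ} {20/63} _) ℚ.≤-refl)
          (selfbound {u} { - h} {1#} u≈ (≼-‿ h≼) 1≼1 (ℚ.≤ᵇ⇒≤ {0ℚ} {63/62} _) (ℚ.≤ᵇ⇒≤ {1ℚ} {63/62 *ᵠ (1ℚ -ᵠ 1/63)} _)))
        where
        u≈ : u ≈ - h * u + 1#
        u≈ = trans (solve 3 (λ u h o → u := :- h :* u :+ (o :+ h) :* u :+ (con 1ℚ :- o) :* u) refl u h 1#)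
          (trans (+-cong (+-congˡ e) (trans (*-congʳ (trans (+-congʳ κ-1) (-‿inverseʳ 1#))) (zeroˡ u))) (+-identityʳ _))

    π⁻¹ : Carrier
    π⁻¹ = proj₁ π⁻¹-∃

    -- ω = 2πi
    ω ω⁻¹ : Carrier
    ω   = κ (ι 2) * (ı * π)
    ω⁻¹ = κ ½ * (- ı * π⁻¹)

    ω-inverse : ω * ω⁻¹ ≈ 1#
    ω-inverse = begin
      κ (ι 2) * (ı * π) * (κ ½ * (- ı * π⁻¹)) ≈⟨ solve 3 (λ j p q → con (ι 2) :* (j :* p) :* (con ½ :* (:- j :* q)) := :- (j :* j) :* (p :* q)) refl ı π π⁻¹ ⟩
      - (ı * ı) * (π * π⁻¹)                    ≈⟨ *-cong (-‿cong (trans ı*ı (-‿cong (sym κ-1)))) (proj₁ (proj₂ π⁻¹-∃)) ⟩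
      - - κ 1ℚ * 1#                            ≈⟨ trans (*-identityʳ _) (trans (solve 0 (:- :- con 1ℚ := con 1ℚ) refl) κ-1) ⟩
      1#                                       ∎

    ω⁻¹≼ : ω⁻¹ ≼ ½ *ᵠ (1ℚ *ᵠ ⅓)
    ω⁻¹≼ = ≼-* (κ≼ (ℚ.<⇒≤ 0<½) ℚ.≤-refl) (≼-* (≼-‿ ı≼1) (proj₂ (proj₂ π⁻¹-∃)))

    -- D x = 2i sin(πx) and σ x = sin(πx) / π
    D σ : Carrier → Carrier
    D x = e x - e (- x)
    σ x = D x * ω⁻¹

    D-cong : ∀ {x y} → x ≈ y → D x ≈ D y
    D-cong x≈y = +-cong (e-cong x≈y) (-‿cong (e-cong (-‿cong x≈y)))

    σ-cong : ∀ {x y} → x ≈ y → σ x ≈ σ y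
    σ-cong x≈y = *-congʳ (D-cong x≈y)

    D-σ : ∀ x → D x ≈ σ x * ω
    D-σ x = sym (trans (solve 3 (λ d w v → d :* v :* w := d :* (w :* v)) refl (D x) ω ω⁻¹) (trans (*-congˡ ω-inverse) (*-identityʳ (D x))))

    -- The quadratic terms at iπx and -iπx cancel, so only the two cubic remainders survive. Their
    -- bound is 2 · 2/7 · (16/5)³ · 1/6 = 8192/2625, just below 25/8; what matters later is that the
    -- constant is below 4.
    σ-taylor : ∀ {x r} → x ≼ r → r ≤ ½ → σ x - x ≼ 25/8 *ᵠ (r *ᵠ r *ᵠ r)
    σ-taylor {x} {r} x≼r r≤½ = ≼-mono bound (≼-resp combine (≼-* (≼-- (taylor x≼r) (taylor (≼-‿ x≼r))) ω⁻¹≼))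
      where
      R : Carrier → Carrier
      R y = e y - (κ 1ℚ + ı * (π * y) + κ ½ * (ı * (π * y) * (ı * (π * y))))
      ρ : ℚ
      ρ = 1ℚ *ᵠ (16/5 *ᵠ r)
      0≤r : 0ℚ ≤ r
      0≤r = ≼⇒0≤ x≼r
      taylor : ∀ {y} → y ≼ r → R y ≼ 2/7 *ᵠ (ρ *ᵠ ρ *ᵠ ρ)
      taylor y≼ = exp-taylor₂ (≼-* ı≼1 (≼-* π≼ y≼))
        (ℚ.≤-trans (*-monoˡ 0≤1 (*-monoˡ (ℚ.≤ᵇ⇒≤ {0ℚ} {16/5} _) r≤½)) (ℚ.≤ᵇ⇒≤ {1ℚ *ᵠ (16/5 *ᵠ ½)} {ℤ.+ 8 ℚ./ 5} _))
      combine : (R x - R (- x)) * ω⁻¹ ≈ σ x - x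
      combine = begin
        (R x - R (- x)) * ω⁻¹
          ≈⟨ solve 6 (λ a b j p x v →
               ((a :- (con 1ℚ :+ j :* (p :* x) :+ con ½ :* (j :* (p :* x) :* (j :* (p :* x))))) :-
                (b :- (con 1ℚ :+ j :* (p :* (:- x)) :+ con ½ :* (j :* (p :* (:- x)) :* (j :* (p :* (:- x))))))) :* v :=
               (a :- b) :* v :- con (ι 2) :* (j :* p) :* v :* x) refl (e x) (e (- x)) ı π x ω⁻¹ ⟩
        D x * ω⁻¹ - ω * ω⁻¹ * x  ≈⟨ +-congˡ (-‿cong (trans (*-congʳ ω-inverse) (*-identityˡ x))) ⟩
        σ x - x                   ∎
      bound : (2/7 *ᵠ (ρ *ᵠ ρ *ᵠ ρ) +ᵠ 2/7 *ᵠ (ρ *ᵠ ρ *ᵠ ρ)) *ᵠ (½ *ᵠ (1ℚ *ᵠ ⅓)) ≤ 25/8 *ᵠ (r *ᵠ r *ᵠ r)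
      bound = ℚ.≤-trans (ℚ.≤-reflexive (solveᵠ 1 (λ r → let ρ = conᵠ 1ℚ :*ᵠ (conᵠ 16/5 :*ᵠ r) in
          (conᵠ 2/7 :*ᵠ (ρ :*ᵠ ρ :*ᵠ ρ) :+ᵠ conᵠ 2/7 :*ᵠ (ρ :*ᵠ ρ :*ᵠ ρ)) :*ᵠ (conᵠ ½ :*ᵠ (conᵠ 1ℚ :*ᵠ conᵠ ⅓)) :=ᵠ
          conᵠ c :*ᵠ (r :*ᵠ r :*ᵠ r)) ≡.refl r))
        (*-monoʳ (0≤* (0≤* 0≤r 0≤r) 0≤r) (ℚ.≤ᵇ⇒≤ {c} {25/8} _))
        where
        c : ℚ
        c = ℤ.+ 8192 ℚ./ 2625

    -- u stands for πt / sin(πt).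
    σ-factor : ∀ t → 0ℚ < t → t ≤ ½ →
      ∃ λ u → σ (κ t) * u ≈ κ t × u ≼ ι 5 × u - 1# ≼ ι 16 *ᵠ (t *ᵠ t)
    σ-factor t 0<t t≤½ = go (neumann η≼ρ (from-yes (ρ ℚ.<? 1ℚ)))
      where
      -- 25/32 = 25/8 · (1/2)² bounds the relative error η of σ(t) against t on (0, 1/2]. As it is
      -- below 1, 1 + η has an inverse, of norm at most 32/7 ≤ 5; then 25/8 · 5 ≤ 16 gives the last
      -- bound.
      ρ : ℚ
      ρ = ℤ.+ 25 ℚ./ 32
      t⁻¹ : ℚ
      t⁻¹ = inv t
      t⁻¹t : t⁻¹ *ᵠ t ≡ 1ℚ
      t⁻¹t = inv-inverse t 0<t
      0≤t : 0ℚ ≤ t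
      0≤t = ℚ.<⇒≤ 0<t
      η : Carrier
      η = κ t⁻¹ * (σ (κ t) - κ t)
      η≼ : η ≼ 25/8 *ᵠ (t *ᵠ t)
      η≼ = ≼-≡ (≡.trans (solveᵠ 2 (λ i t → i :*ᵠ (conᵠ 25/8 :*ᵠ (t :*ᵠ t :*ᵠ t)) :=ᵠ (i :*ᵠ t) :*ᵠ (conᵠ 25/8 :*ᵠ (t :*ᵠ t))) ≡.refl t⁻¹ t)
          (≡.trans (cong (_*ᵠ (25/8 *ᵠ (t *ᵠ t))) t⁻¹t) (ℚ.*-identityˡ _)))
        (≼-* (κ≼ (0≤inv t 0<t) ℚ.≤-refl) (σ-taylor (κ≼ 0≤t ℚ.≤-refl) t≤½))
      η≼ρ : η ≼ ρ
      η≼ρ = ≼-mono (ℚ.≤-trans (*-monoˡ (ℚ.≤ᵇ⇒≤ {0ℚ} {25/8} _) (*-mono-≤ 0≤t (ℚ.<⇒≤ 0<½) t≤½ t≤½)) (ℚ.≤ᵇ⇒≤ {25/8 *ᵠ (½ *ᵠ ½)} {ρ} _)) η≼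
      σ≈ : σ (κ t) ≈ κ t * (1# + η)
      σ≈ = sym (begin
        κ t * (1# + η)                                  ≈⟨ solve 4 (λ t o i s → t :* (o :+ i :* s) := t :* o :+ (i :* t) :* s) refl (κ t) 1# (κ t⁻¹) (σ (κ t) - κ t) ⟩
        κ t * 1# + κ t⁻¹ * κ t * (σ (κ t) - κ t)        ≈⟨ +-cong (*-identityʳ (κ t)) (trans (*-congʳ (κ-inverse t⁻¹t)) (*-identityˡ _)) ⟩
        κ t + (σ (κ t) - κ t)                           ≈⟨ solve 2 (λ t s → t :+ (s :- t) := s) refl (κ t) (σ (κ t)) ⟩
        σ (κ t)                                         ∎)
      go : (∃ λ u → (1# + η) * u ≈ 1#) → ∃ λ u → σ (κ t) * u ≈ κ t × u ≼ ι 5 × u - 1# ≼ ι 16 *ᵠ (t *ᵠ t)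
      go (u , e) = u , trans (*-congʳ σ≈) (trans (*-assoc (κ t) (1# + η) u) (trans (*-congˡ e) (*-identityʳ (κ t)))) , u≼ ,
        ≼-mono bound (≼-resp (sym diff) (≼-* (≼-‿ η≼) u≼))
        where
        u≈ : u ≈ - η * u + 1#
        u≈ = trans (solve 3 (λ u h o → u := :- h :* u :+ (o :+ h) :* u :+ (con 1ℚ :- o) :* u) refl u η 1#)
          (trans (+-cong (+-congˡ e) (trans (*-congʳ (trans (+-congʳ κ-1) (-‿inverseʳ 1#))) (zeroˡ u))) (+-identityʳ _))
        diff : u - 1# ≈ - η * u
        diff = trans (+-congʳ u≈) (solve 2 (λ a o → (a :+ o) :- o := a) refl (- η * u) 1#)
        u≼ : u ≼ ι 5
        u≼ = selfbound {u} { - η} {1#} {ρ} {1ℚ} {ι 5} u≈ (≼-‿ η≼ρ) 1≼1 (0≤ι 5) (ℚ.≤ᵇ⇒≤ {1ℚ} {ι 5 *ᵠ (1ℚ -ᵠ ρ)} _)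
        bound : 25/8 *ᵠ (t *ᵠ t) *ᵠ ι 5 ≤ ι 16 *ᵠ (t *ᵠ t)
        bound = ≤-diff (⅜ *ᵠ (t *ᵠ t)) (0≤* (ℚ.≤ᵇ⇒≤ {0ℚ} {⅜} _) (0≤x*x t))
          (solveᵠ 1 (λ x → conᵠ (ι 16) :*ᵠ x :=ᵠ conᵠ 25/8 :*ᵠ x :*ᵠ conᵠ (ι 5) :+ᵠ conᵠ ⅜ :*ᵠ x) ≡.refl (t *ᵠ t))
          where
          ⅜ : ℚ
          ⅜ = ℤ.+ 3 ℚ./ 8

    -- A total form of the previous lemma, with the junk value 1 for t outside (0, ½].
    υ : ℚ → Carrier
    υ t = pick (0ℚ ℚ.<? t) (t ℚ.≤? ½)
      module υ where
      pick : Dec (0ℚ < t) → Dec (t ≤ ½) → Carrier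
      pick (yes p) (yes q) = proj₁ (σ-factor t p q)
      pick _       _       = 1#

    υ-spec : ∀ {t} → 0ℚ < t → t ≤ ½ → σ (κ t) * υ t ≈ κ t × υ t ≼ ι 5 × υ t - 1# ≼ ι 16 *ᵠ (t *ᵠ t)
    υ-spec {t} 0<t t≤½ = lemma (0ℚ ℚ.<? t) (t ℚ.≤? ½)
      where
      lemma : (p : Dec (0ℚ < t)) (q : Dec (t ≤ ½)) → let u = υ.pick t p q in
        σ (κ t) * u ≈ κ t × u ≼ ι 5 × u - 1# ≼ ι 16 *ᵠ (t *ᵠ t)
      lemma (yes p) (yes q) = proj₂ (σ-factor t p q)
      lemma (yes _) (no ¬q) = contradiction t≤½ ¬q
      lemma (no ¬p) _       = contradiction 0<t ¬p

    Unit-ω : Unit ω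
    Unit-ω = ω⁻¹ , ω-inverse

    Unit-e : ∀ x → Unit (e x)
    Unit-e x = e (- x) , e-neg x

    Unit-D½ : ∀ t → 0ℚ < t → t ≤ ½ → Unit (D (κ t))
    Unit-D½ t 0<t t≤½ = Unit-resp (sym (D-σ (κ t))) (Unit-* unit-σ Unit-ω)
      where
      unit-σ : Unit (σ (κ t))
      unit-σ = υ t * κ (inv t) , trans (sym (*-assoc (σ (κ t)) (υ t) (κ (inv t)))) (trans (*-congʳ (proj₁ (υ-spec 0<t t≤½)))
        (trans (*-comm (κ t) (κ (inv t))) (κ-inverse (inv-inverse t 0<t))))

    D-reflect : ∀ x → D (1# - x) ≈ D x
    D-reflect x = begin
      e (1# - x) - e (- (1# - x))    ≈⟨ +-cong (e-+ 1# (- x)) (-‿cong (trans (e-cong (solve 2 (λ o x → :- (o :- x) := :- o :+ x) refl 1# x)) (e-+ (- 1#) x))) ⟩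
      e 1# * e (- x) - e (- 1#) * e x ≈⟨ +-cong (*-congʳ e-1) (-‿cong (*-congʳ e--1)) ⟩
      - 1# * e (- x) - - 1# * e x    ≈⟨ +-cong (*-congʳ (-‿cong (sym κ-1))) (-‿cong (*-congʳ (-‿cong (sym κ-1)))) ⟩
      - κ 1ℚ * e (- x) - - κ 1ℚ * e x ≈⟨ solve 2 (λ a b → :- con 1ℚ :* b :- :- con 1ℚ :* a := a :- b) refl (e x) (e (- x)) ⟩
      e x - e (- x)                  ∎
      where
      e--1 : e (- 1#) ≈ - 1#
      e--1 = cancel (Unit-e 1#) (trans (e-neg 1#) (sym (trans (*-congʳ e-1) (trans (*-cong (-‿cong (sym κ-1)) (-‿cong (sym κ-1)))
        (trans (solve 0 (:- con 1ℚ :* :- con 1ℚ := con 1ℚ) refl) κ-1)))))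

    Unit-D : ∀ t → 0ℚ < t → t < 1ℚ → Unit (D (κ t))
    Unit-D t 0<t t<1 = go (ℚ.≤-total t ½)
      where
      go : t ≤ ½ ⊎ ½ ≤ t → Unit (D (κ t))
      go (inj₁ t≤½) = Unit-D½ t 0<t t≤½
      go (inj₂ ½≤t) = Unit-resp (trans (D-cong (trans (κ-+ 1ℚ (-ᵠ t)) (+-cong κ-1 (κ-‿ t)))) (D-reflect (κ t)))
        (Unit-D½ (1ℚ -ᵠ t) (subst (_< 1ℚ -ᵠ t) (ℚ.+-inverseʳ t) (ℚ.+-monoˡ-< (-ᵠ t) t<1))
          (ℚ.≤-trans (ℚ.+-monoʳ-≤ 1ℚ (ℚ.neg-antimono-≤ ½≤t)) (ℚ.≤ᵇ⇒≤ {1ℚ -ᵠ ½} {½} _)))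

  -- Roots of unity and the finite product for the sine.

  module Cyclotomy (A : Analysis) where
    open Analysis A hiding (zero)
    open Solver algebra using (solve; _:=_; _:*_; _:+_; _:-_; :-_; con)
    open Estimates algebra
    open Trigonometry A
    open Polynomials algebra
    open Sine A
    open Order
    open Algebra.Properties.Semiring.Exp semiring using (^-homo-*)
    open Algebra.Properties.CommutativeSemiring.Exp commutativeSemiring using (^-distrib-*)
    open Relation.Binary.Reasoning.Setoid setoid

    Unit-neg : ∀ {x} → Unit x → Unit (- x)
    Unit-neg {x} (u , h) = - u , trans (solve 2 (λ x u → :- x :* :- u := x :* u) refl x u) h

    e-^ : ∀ x m → e x ^ m ≈ e (κ (ι m) * x)
    e-^ x zero    = sym (trans (e-cong (trans (*-congʳ κ-0) (zeroˡ x))) e-0)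
    e-^ x (suc m) = trans (*-congˡ (e-^ x m)) (trans (sym (e-+ x (κ (ι m) * x))) (e-cong
      (trans (solve 2 (λ x m → x :+ m :* x := (con 1ℚ :+ m) :* x) refl x (κ (ι m)))
        (*-congʳ (trans (sym (κ-+ 1ℚ (ι m))) (reflexive (cong κ (≡.sym (ι-suc m)))))))))

    one-square : - 1# * - 1# ≈ 1#
    one-square = trans (*-cong (-‿cong (sym κ-1)) (-‿cong (sym κ-1))) (trans (solve 0 (:- con 1ℚ :* :- con 1ℚ := con 1ℚ) refl) κ-1)

    e-ι : ∀ j → e (κ (ι j)) * e (κ (ι j)) ≈ 1#
    e-ι zero    = trans (*-cong e0 e0) (*-identityˡ 1#)
      where
      e0 : e (κ (ι 0)) ≈ 1#
      e0 = trans (e-cong κ-0) e-0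
    e-ι (suc j) = trans (*-cong step step) (trans (solve 2 (λ a b → (a :* b) :* (a :* b) := (a :* a) :* (b :* b)) refl (e 1#) (e (κ (ι j))))
        (trans (*-cong (trans (*-cong e-1 e-1) one-square) (e-ι j)) (*-identityˡ 1#)))
      where
      step : e (κ (ι (suc j))) ≈ e 1# * e (κ (ι j))
      step = trans (e-cong (trans (reflexive (cong κ (ι-suc j))) (trans (κ-+ 1ℚ (ι j)) (+-congʳ κ-1)))) (e-+ 1# (κ (ι j)))

    -- The denominator is d + 1: throughout, a modulus n is carried as its predecessor d, which is
    -- also the degree of 1 + X + ... + Xⁿ⁻¹.
    frac : ℕ → ℕ → ℚ
    frac d j = ι j *ᵠ 1/suc d

    frac-+ : ∀ d i j → frac d (i ℕ.+ j) ≡ frac d i +ᵠ frac d j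
    frac-+ d i j = ≡.trans (cong (_*ᵠ 1/suc d) (ι-+ i j)) (ℚ.*-distribʳ-+ (1/suc d) (ι i) (ι j))

    frac-ι : ∀ d j → frac d j *ᵠ ι (suc d) ≡ ι j
    frac-ι d j = ≡.trans (ℚ.*-assoc (ι j) (1/suc d) (ι (suc d))) (≡.trans (cong (ι j *ᵠ_) (1/suc-inverse d)) (ℚ.*-identityʳ (ι j)))

    frac-n : ∀ d → frac d (suc d) ≡ 1ℚ
    frac-n d = ≡.trans (ℚ.*-comm (ι (suc d)) (1/suc d)) (1/suc-inverse d)

    0<frac : ∀ d {j} → 1 ℕ.≤ j → 0ℚ < frac d j
    0<frac d {suc j} _ = 0<* (0<ι-suc j) (0<1/suc d)

    frac<1 : ∀ d {j} → j ℕ.≤ d → frac d j < 1ℚ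
    frac<1 d {j} j≤d = subst (frac d j <_) (≡.trans (≡.sym (frac-+ d j (suc d ℕ.∸ j))) (≡.trans (cong (frac d) (ℕ.m+[n∸m]≡n (ℕ.m≤n⇒m≤1+n j≤d))) (frac-n d)))
      (subst (_< frac d j +ᵠ frac d (suc d ℕ.∸ j)) (ℚ.+-identityʳ (frac d j))
        (ℚ.+-monoʳ-< (frac d j) (0<frac d (ℕ.m<n⇒0<n∸m (ℕ.s≤s j≤d)))))

    j+j≤n⇒frac≤½ : ∀ d {j} → j ℕ.+ j ℕ.≤ suc d → frac d j ≤ ½
    j+j≤n⇒frac≤½ d {j} j+j≤n = ≤-diff (½ *ᵠ frac d rest) (0≤* (ℚ.<⇒≤ 0<½) (0≤* (0≤ι rest) (ℚ.<⇒≤ (0<1/suc d)))) split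
      where
      rest : ℕ
      rest = suc d ℕ.∸ (j ℕ.+ j)
      total : 1ℚ ≡ frac d (j ℕ.+ j ℕ.+ rest)
      total = ≡.sym (≡.trans (cong (frac d) (ℕ.m+[n∸m]≡n j+j≤n)) (frac-n d))
      split : ½ ≡ frac d j +ᵠ ½ *ᵠ frac d rest
      split = ≡.trans (≡.sym (ℚ.*-identityʳ ½)) (≡.trans (cong (½ *ᵠ_) (≡.trans total (≡.trans (frac-+ d (j ℕ.+ j) rest) (cong (_+ᵠ frac d rest) (frac-+ d j j)))))
        (solveᵠ 2 (λ a b → conᵠ ½ :*ᵠ (a :+ᵠ a :+ᵠ b) :=ᵠ a :+ᵠ conᵠ ½ :*ᵠ b) ≡.refl (frac d j) (frac d rest)))

    -- With n = d + 1, `E j` is exp(πij/n), `F j` its inverse and `ζ j` = exp(2πij/n). The half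
    -- angle is kept because 1 - ζ = -E(E - F), which reduces the invertibility of 1 - ζ to that of
    -- a sine.
    module Roots (d : ℕ) where
      E F ζ : ℕ → Carrier
      E j = e (κ (frac d j))
      F j = e (- κ (frac d j))
      ζ j = E j * E j

      EF : ∀ j → E j * F j ≈ 1#
      EF j = e-neg (κ (frac d j))

      E-+ : ∀ i j → E (i ℕ.+ j) ≈ E i * E j
      E-+ i j = trans (e-cong (trans (reflexive (cong κ (frac-+ d i j))) (κ-+ (frac d i) (frac d j)))) (e-+ (κ (frac d i)) (κ (frac d j)))

      E-n : E (suc d) ≈ - 1#
      E-n = trans (e-cong (trans (reflexive (cong κ (frac-n d))) κ-1)) e-1

      ζ-+ : ∀ i j → ζ (i ℕ.+ j) ≈ ζ i * ζ j
      ζ-+ i j = trans (*-cong (E-+ i j) (E-+ i j)) (solve 2 (λ a b → (a :* b) :* (a :* b) := (a :* a) :* (b :* b)) refl (E i) (E j))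

      one-minus-ζ : ∀ j → 1# - ζ j ≈ - (E j * D (κ (frac d j)))
      one-minus-ζ j = trans (+-congʳ (sym (EF j))) (solve 2 (λ a b → a :* b :- a :* a := :- (a :* (a :- b))) refl (E j) (F j))

      Unit-one-minus-ζ : ∀ j → 1 ℕ.≤ j → j ℕ.≤ d → Unit (1# - ζ j)
      Unit-one-minus-ζ j 1≤j j≤d = Unit-resp (sym (one-minus-ζ j))
        (Unit-neg (Unit-* (Unit-e (κ (frac d j))) (Unit-D (frac d j) (0<frac d 1≤j) (frac<1 d j≤d))))

      ζ-distinct : ∀ i j → 1 ℕ.≤ i → i ℕ.< j → j ℕ.≤ d → Unit (ζ i - ζ j)
      ζ-distinct i j 1≤i i<j j≤d = Unit-resp eq (Unit-* (Unit-* (Unit-e (κ (frac d i))) (Unit-e (κ (frac d i))))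
          (Unit-one-minus-ζ (j ℕ.∸ i) (ℕ.m<n⇒0<n∸m i<j) (ℕ.≤-trans (ℕ.m∸n≤m j i) j≤d)))
        where
        eq : ζ i * (1# - ζ (j ℕ.∸ i)) ≈ ζ i - ζ j
        eq = trans (solve 3 (λ a o b → a :* (o :- b) := a :* o :- a :* b) refl (ζ i) 1# (ζ (j ℕ.∸ i)))
          (+-cong (*-identityʳ (ζ i)) (-‿cong (trans (sym (ζ-+ i (j ℕ.∸ i))) (reflexive (cong ζ (ℕ.m+[n∸m]≡n (ℕ.<⇒≤ i<j)))))))

      ζ-n : ∀ j → ζ j ^ suc d ≈ 1#
      ζ-n j = trans (^-distrib-* (E j) (E j) (suc d)) (trans (*-cong E^n E^n) (e-ι j))
        where
        E^n : E j ^ suc d ≈ e (κ (ι j))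
        E^n = trans (e-^ (κ (frac d j)) (suc d)) (e-cong (trans (sym (κ-* (ι (suc d)) (frac d j)))
          (reflexive (cong κ (≡.trans (ℚ.*-comm (ι (suc d)) (frac d j)) (frac-ι d j))))))

      geometric-ζ : ∀ j → 1 ℕ.≤ j → j ℕ.≤ d → geometric d (ζ j) ≈ 0#
      geometric-ζ j 1≤j j≤d = cancel-0 (Unit-resp (solve 2 (λ o z → :- (o :- z) := z :- o) refl 1# (ζ j)) (Unit-neg (Unit-one-minus-ζ j 1≤j j≤d)))
        (trans (geometric-sum d (ζ j)) (trans (+-congʳ (ζ-n j)) (-‿inverseʳ 1#)))

      geometric-factor : ∀ X → geometric d X ≈ Π (λ j → X - ζ j) d
      geometric-factor = factor d (Monic-geometric d) ζ geometric-ζ ζ-distinct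

      Π-one-minus-ζ : Π (λ j → 1# - ζ j) d ≈ κ (ι (suc d))
      Π-one-minus-ζ = trans (sym (geometric-factor 1#)) (geometric-1 d)

      E-reflect : ∀ j → j ℕ.≤ suc d → E (suc d ℕ.∸ j) ≈ - F j
      E-reflect j j≤ = begin
        E (suc d ℕ.∸ j)                   ≈⟨ *-identityʳ _ ⟨
        E (suc d ℕ.∸ j) * 1#              ≈⟨ *-congˡ (EF j) ⟨
        E (suc d ℕ.∸ j) * (E j * F j)     ≈⟨ *-assoc _ (E j) (F j) ⟨
        E (suc d ℕ.∸ j) * E j * F j       ≈⟨ *-congʳ (trans (sym (E-+ (suc d ℕ.∸ j) j)) (trans (reflexive (cong E (ℕ.m∸n+n≡m j≤))) E-n)) ⟩
        - 1# * F j                        ≈⟨ *-congʳ (-‿cong (sym κ-1)) ⟩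
        - κ 1ℚ * F j                      ≈⟨ solve 1 (λ f → :- con 1ℚ :* f := :- f) refl (F j) ⟩
        - F j                             ∎

      ζ-reflect : ∀ j → j ℕ.≤ suc d → ζ (suc d ℕ.∸ j) ≈ F j * F j
      ζ-reflect j j≤ = trans (*-cong (E-reflect j j≤) (E-reflect j j≤)) (solve 1 (λ f → :- f :* :- f := f :* f) refl (F j))

    Π-scale : ∀ c f r → Π (λ j → c * f j) r ≈ c ^ r * Π f r
    Π-scale c f zero    = sym (*-identityˡ 1#)
    Π-scale c f (suc r) = trans (*-congʳ (Π-scale c f r))
      (solve 4 (λ p q c f → p :* q :* (c :* f) := c :* p :* (q :* f)) refl (c ^ r) (Π f r) c (f (suc r)))

    module FiniteProduct (r : ℕ) where
      n d : ℕ
      d = r ℕ.+ r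
      n = suc d
      open Roots d

      D′ : ℕ → Carrier
      D′ j = D (κ (frac d j))

      frac≤½ : ∀ {j} → j ℕ.≤ r → frac d j ≤ ½
      frac≤½ {j} j≤r = j+j≤n⇒frac≤½ d {j} (ℕ.m≤n⇒m≤1+n (ℕ.+-mono-≤ j≤r j≤r))

      -- Each root `ζ j` is paired with `ζ (n ∸ j)`, its inverse: (Y² - ζ)(Y² - ζ⁻¹) = Y²((Y - Y⁻¹)²
      -- - (E - F)²). Since n is odd, no root is left over.
      half-product : ∀ {Y Y′} → Y * Y′ ≈ 1# → geometric d (Y * Y) ≈ (Y * Y) ^ r * Π (λ j → (Y - Y′) * (Y - Y′) - D′ j * D′ j) r
      half-product {Y} {Y′} YY′ = trans (geometric-factor (Y * Y)) (trans (Π-fold (λ j → Y * Y - ζ j) r)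
          (trans (Π-cong r λ j _ j≤r → pair j (ℕ.m≤n⇒m≤1+n (ℕ.≤-trans j≤r (ℕ.m≤m+n r r)))) (Π-scale (Y * Y) _ r)))
        where
        pair : ∀ j → j ℕ.≤ n → (Y * Y - ζ j) * (Y * Y - ζ (n ℕ.∸ j)) ≈ Y * Y * ((Y - Y′) * (Y - Y′) - D′ j * D′ j)
        pair j j≤n = begin
          (Y * Y - ζ j) * (Y * Y - ζ (n ℕ.∸ j))
            ≈⟨ *-congˡ (+-congˡ (-‿cong (ζ-reflect j j≤n))) ⟩
          (Y * Y - E j * E j) * (Y * Y - F j * F j)
            ≈⟨ solve 4 (λ y y′ a b → (y :* y :- a :* a) :* (y :* y :- b :* b) :=
                 y :* y :* ((y :- y′) :* (y :- y′) :- (a :- b) :* (a :- b)) :+ (y :* y′ :- a :* b) :* (con (ι 2) :* (y :* y) :- (y :* y′ :+ a :* b))) refl Y Y′ (E j) (F j) ⟩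
          Y * Y * ((Y - Y′) * (Y - Y′) - D′ j * D′ j) + (Y * Y′ - E j * F j) * (κ (ι 2) * (Y * Y) - (Y * Y′ + E j * F j))
            ≈⟨ +-congˡ (trans (*-congʳ (trans (+-cong YY′ (-‿cong (EF j))) (-‿inverseʳ 1#))) (zeroˡ _)) ⟩
          Y * Y * ((Y - Y′) * (Y - Y′) - D′ j * D′ j) + 0#
            ≈⟨ +-identityʳ _ ⟩
          Y * Y * ((Y - Y′) * (Y - Y′) - D′ j * D′ j) ∎

      1^ : ∀ m → (1# * 1#) ^ m ≈ 1#
      1^ zero    = refl
      1^ (suc m) = trans (*-cong (*-identityˡ 1#) (1^ m)) (*-identityˡ 1#)

      -- The case Y = Y′ = 1 of `half-product`, hence the unsimplified zero. It supplies the
      -- constant by which `finite-product` is normalised.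
      Π-D′ : Π (λ j → (1# - 1#) * (1# - 1#) - D′ j * D′ j) r ≈ κ (ι n)
      Π-D′ = trans (sym (trans (half-product (*-identityˡ 1#)) (trans (*-congʳ (1^ r)) (*-identityˡ _))))
        (trans (geometric-cong {d} (*-identityˡ 1#)) (geometric-1 d))
        where
        geometric-cong : ∀ {m X Y} → X ≈ Y → geometric m X ≈ geometric m Y
        geometric-cong {zero}  X≈Y = refl
        geometric-cong {suc m} X≈Y = +-congˡ (*-cong X≈Y (geometric-cong {m} X≈Y))

      module _ (a : Carrier) where
        a/n Y Y′ δ : Carrier
        a/n = κ (1/suc d) * a
        Y   = e a/n
        Y′  = e (- a/n)
        δ   = D a/n

        Y^n : Y ^ n ≈ e a
        Y^n = trans (e-^ a/n n) (e-cong (trans (solve 3 (λ n i a → n :* (i :* a) := (i :* n) :* a) refl (κ (ι n)) (κ (1/suc d)) a)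
          (trans (*-congʳ (κ-1/suc d)) (*-identityˡ a))))

        -- Multiplied by e(a) = Yⁿ the left side is Y²ⁿ - 1 = (Y² - 1)(1 + Y² + ... + Y²⁽ⁿ⁻¹⁾), to
        -- which `half-product` applies; the powers of Y on the right again amount to Yⁿ.
        D-product : D a ≈ δ * Π (λ j → δ * δ - D′ j * D′ j) r
        D-product = cancel (Unit-e a) (begin
          e a * (e a - e (- a))              ≈⟨ solve 2 (λ a b → a :* (a :- b) := a :* a :- a :* b) refl (e a) (e (- a)) ⟩
          e a * e a - e a * e (- a)          ≈⟨ +-cong (*-cong (sym Y^n) (sym Y^n)) (-‿cong (e-neg a)) ⟩
          Y ^ n * Y ^ n - 1#                 ≈⟨ +-congʳ (sym (^-distrib-* Y Y n)) ⟩
          (Y * Y) ^ n - 1#                   ≈⟨ sym (geometric-sum d (Y * Y)) ⟩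
          (Y * Y - 1#) * geometric d (Y * Y) ≈⟨ *-cong (+-congˡ (-‿cong (sym (e-neg a/n)))) (half-product (e-neg a/n)) ⟩
          (Y * Y - Y * Y′) * ((Y * Y) ^ r * Π′) ≈⟨ solve 4 (λ y y′ p q → (y :* y :- y :* y′) :* (p :* q) := (y :* p) :* ((y :- y′) :* q)) refl Y Y′ ((Y * Y) ^ r) Π′ ⟩
          (Y * (Y * Y) ^ r) * (δ * Π′)       ≈⟨ *-congʳ (trans (*-congˡ (trans (^-distrib-* Y Y r) (sym (^-homo-* Y r r)))) Y^n) ⟩
          e a * (δ * Π′)                     ∎)
          where
          Π′ : Carrier
          Π′ = Π (λ j → δ * δ - D′ j * D′ j) r

        -- n sin(πa/n) / π, the approximation of a that replaces it at stage n.
        τ : Carrier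
        τ = κ (ι n) * σ a/n

        -- w j stands for (π / n) / sin(πj / n).
        w : ℕ → Carrier
        w j = υ (frac d j) * κ (inv (ι j))

        σ-w : ∀ j → 1 ℕ.≤ j → j ℕ.≤ r → σ (κ (frac d j)) * (κ (ι n) * w j) ≈ 1#
        σ-w j@(suc j-1) 1≤j j≤r = begin
          σ (κ (frac d j)) * (κ (ι n) * (υ (frac d j) * κ (inv (ι j)))) ≈⟨ solve 4 (λ s n u i → s :* (n :* (u :* i)) := i :* (s :* u :* n)) refl (σ (κ (frac d j))) (κ (ι n)) (υ (frac d j)) (κ (inv (ι j))) ⟩
          κ (inv (ι j)) * (σ (κ (frac d j)) * υ (frac d j) * κ (ι n))   ≈⟨ *-congˡ (*-congʳ (proj₁ (υ-spec (0<frac d 1≤j) (frac≤½ j≤r)))) ⟩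
          κ (inv (ι j)) * (κ (frac d j) * κ (ι n))                      ≈⟨ *-congˡ (trans (sym (κ-* (frac d j) (ι n))) (reflexive (cong κ (frac-ι d j)))) ⟩
          κ (inv (ι j)) * κ (ι j)                                       ≈⟨ κ-inverse (inv-inverse (ι j) (0<ι-suc j-1)) ⟩
          1#                                                            ∎

        -- Since `τ` · `w j` = sin(πa/n) / sin(πj/n), each factor is that of `D-product` divided by
        -- -D(j/n)². The product of these divisors is n by `Π-D′`, and this n is the one in `τ`.
        finite-product : σ a ≈ τ * Π (λ j → 1# - τ * τ * (w j * w j)) r
        finite-product = begin
          D a * ω⁻¹                             ≈⟨ *-congʳ D-product ⟩
          δ * Π (λ j → δ * δ - D′ j * D′ j) r * ω⁻¹ ≈⟨ *-congʳ (*-congˡ (trans (Π-cong r pair) (trans (Π-∙ _ _ r) (*-congʳ Π-D′)))) ⟩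
          δ * (κ (ι n) * P) * ω⁻¹               ≈⟨ solve 4 (λ d n p w → d :* (n :* p) :* w := n :* (d :* w) :* p) refl δ (κ (ι n)) P ω⁻¹ ⟩
          τ * P                                 ∎
          where
          P : Carrier
          P = Π (λ j → 1# - τ * τ * (w j * w j)) r
          pair : ∀ j → 1 ℕ.≤ j → j ℕ.≤ r → δ * δ - D′ j * D′ j ≈ ((1# - 1#) * (1# - 1#) - D′ j * D′ j) * (1# - τ * τ * (w j * w j))
          pair j 1≤j j≤r = sym (begin
            ((1# - 1#) * (1# - 1#) - D′ j * D′ j) * (1# - τ * τ * (w j * w j))
              ≈⟨ *-cong (+-congʳ (trans (*-congʳ (-‿inverseʳ 1#)) (zeroˡ _))) (+-congʳ (sym κ-1)) ⟩
            (0# - D′ j * D′ j) * (κ 1ℚ - τ * τ * (w j * w j))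
              ≈⟨ *-congʳ (+-identityˡ _) ⟩
            - (D′ j * D′ j) * (κ 1ℚ - τ * τ * (w j * w j))
              ≈⟨ solve 4 (λ d n s w → :- (d :* d) :* (con 1ℚ :- n :* s :* (n :* s) :* (w :* w)) := (d :* (n :* w) :* s) :* (d :* (n :* w) :* s) :- d :* d) refl (D′ j) (κ (ι n)) (σ a/n) (w j) ⟩
            (D′ j * (κ (ι n) * w j) * σ a/n) * (D′ j * (κ (ι n) * w j) * σ a/n) - D′ j * D′ j
              ≈⟨ +-congʳ (*-cong simplify simplify) ⟩
            δ * δ - D′ j * D′ j ∎)
            where
            simplify : D′ j * (κ (ι n) * w j) * σ a/n ≈ δ
            simplify = begin
              D′ j * (κ (ι n) * w j) * σ a/n                         ≈⟨ *-congʳ (*-congʳ (D-σ (κ (frac d j)))) ⟩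
              σ (κ (frac d j)) * ω * (κ (ι n) * w j) * σ a/n         ≈⟨ solve 4 (λ s o v t → s :* o :* v :* t := s :* v :* (t :* o)) refl (σ (κ (frac d j))) ω (κ (ι n) * w j) (σ a/n) ⟩
              σ (κ (frac d j)) * (κ (ι n) * w j) * (σ a/n * ω)       ≈⟨ *-cong (σ-w j 1≤j j≤r) (sym (D-σ a/n)) ⟩
              1# * δ                                                 ≈⟨ *-identityˡ δ ⟩
              δ                                                      ∎

  -- Limits of sequences in a normed algebra.

  module Limits (N : NormedAlgebra) where
    open NormedAlgebra N hiding (zero)
    open Solver N using (solve; _:=_; _:*_; _:+_; _:-_; :-_; con)
    open Estimates N
    open Order

    infix 4 _⇝_
    record _⇝_ (f : ℕ → Carrier) (L : Carrier) : Set where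
      constructor limit
      field converges : ∀ ε → 0ℚ < ε → ∃ λ N → ∀ n → N ℕ.≤ n → f n - L ≼ ε
    open _⇝_ public

    ⇝-resp : ∀ {f g L M} → (∃ λ N → ∀ n → N ℕ.≤ n → f n ≈ g n) → L ≈ M → f ⇝ L → g ⇝ M
    ⇝-resp {f} {g} {L} {M} (N₁ , f≈g) L≈M h = limit λ ε 0<ε → go ε (converges h ε 0<ε)
      where
      go : ∀ ε → (∃ λ N → ∀ n → N ℕ.≤ n → f n - L ≼ ε) → ∃ λ N → ∀ n → N ℕ.≤ n → g n - M ≼ ε
      go ε (N₂ , b) = N₁ ℕ.⊔ N₂ , λ n N≤n → ≼-resp (+-cong (f≈g n (ℕ.m⊔n≤o⇒m≤o N₁ N₂ N≤n)) (-‿cong L≈M)) (b n (ℕ.m⊔n≤o⇒n≤o N₁ N₂ N≤n))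

    ⇝-const : ∀ L → (λ _ → L) ⇝ L
    ⇝-const L = limit λ ε 0<ε → 0 , λ n _ → ≼-mono (ℚ.<⇒≤ 0<ε) (≈⇒≼0 refl)

    ⇝-from : ∀ {f L} K → 0ℚ < K → (∀ ε → 0ℚ < ε → ε ≤ 1ℚ → ∃ λ N → ∀ n → N ℕ.≤ n → f n - L ≼ K *ᵠ ε) → f ⇝ L
    ⇝-from {f} {L} K 0<K h = limit λ ε 0<ε → go ε (shrink-unit K 0<K ε 0<ε)
      where
      go : ∀ ε → (∃ λ δ → 0ℚ < δ × δ ≤ 1ℚ × K *ᵠ δ ≤ ε) → ∃ λ N → ∀ n → N ℕ.≤ n → f n - L ≼ ε
      go ε (δ , 0<δ , δ≤1 , Kδ≤ε) = fin (h δ 0<δ δ≤1)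
        where
        fin : (∃ λ N → ∀ n → N ℕ.≤ n → f n - L ≼ K *ᵠ δ) → ∃ λ N → ∀ n → N ℕ.≤ n → f n - L ≼ ε
        fin (N , b) = N , λ n N≤n → ≼-mono Kδ≤ε (b n N≤n)

    ⇝-rate : ∀ {f L} C → 0ℚ ≤ C → (∃ λ M → ∀ n → M ℕ.≤ n → f n - L ≼ C *ᵠ 1/suc n) → f ⇝ L
    ⇝-rate {f} {L} C 0≤C (M , rate) = ⇝-from (C +ᵠ 1ℚ) (0<+ 0≤C 0<1) λ ε 0<ε _ → go ε (ℚ.<⇒≤ 0<ε) (archimedean ε 0<ε)
      where
      go : ∀ ε → 0ℚ ≤ ε → (∃ λ N → 1/suc N < ε) → ∃ λ N → ∀ n → N ℕ.≤ n → f n - L ≼ (C +ᵠ 1ℚ) *ᵠ ε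
      go ε 0≤ε (N , lt) = M ℕ.⊔ N , λ n h → ≼-mono (*-mono-≤ 0≤C 0≤ε (a≤a+b C 0≤1) (ℚ.≤-trans (1/suc-antitone (ℕ.m⊔n≤o⇒n≤o M N h)) (ℚ.<⇒≤ lt)))
        (rate n (ℕ.m⊔n≤o⇒m≤o M N h))

    ⇝-* : ∀ {f g L M} → f ⇝ L → g ⇝ M → (λ n → f n * g n) ⇝ L * M
    ⇝-* {f} {g} {L} {M} hf hg = go (bounded L) (bounded M)
      where
      go : (∃ λ l → L ≼ l) → (∃ λ m → M ≼ m) → (λ n → f n * g n) ⇝ L * M
      go (l , L≼) (m , M≼) = ⇝-from (1ℚ +ᵠ l +ᵠ m) 0<K λ ε 0<ε ε≤1 → fin ε (ℚ.<⇒≤ 0<ε) ε≤1 (converges hf ε 0<ε) (converges hg ε 0<ε)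
        where
        0<K : 0ℚ < 1ℚ +ᵠ l +ᵠ m
        0<K = subst (0ℚ <_) (solveᵠ 2 (λ l m → (l :+ᵠ m) :+ᵠ conᵠ 1ℚ :=ᵠ conᵠ 1ℚ :+ᵠ l :+ᵠ m) ≡.refl l m)
          (0<+ (0≤+ (≼⇒0≤ L≼) (≼⇒0≤ M≼)) 0<1)
        fin : ∀ ε → 0ℚ ≤ ε → ε ≤ 1ℚ → (∃ λ N → ∀ n → N ℕ.≤ n → f n - L ≼ ε) → (∃ λ N → ∀ n → N ℕ.≤ n → g n - M ≼ ε) →
          ∃ λ N → ∀ n → N ℕ.≤ n → f n * g n - L * M ≼ (1ℚ +ᵠ l +ᵠ m) *ᵠ ε
        fin ε 0≤ε ε≤1 (N₁ , b₁) (N₂ , b₂) = N₁ ℕ.⊔ N₂ , λ n N≤n →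
          let p = b₁ n (ℕ.m⊔n≤o⇒m≤o N₁ N₂ N≤n)
              q = b₂ n (ℕ.m⊔n≤o⇒n≤o N₁ N₂ N≤n)
          in ≼-mono bound (≼-resp (solve 4 (λ f g l m → (f :- l) :* (g :- m) :+ l :* (g :- m) :+ (f :- l) :* m := f :* g :- l :* m) refl (f n) (g n) L M)
               (≼-+ (≼-+ (≼-* p q) (≼-* L≼ q)) (≼-* p M≼)))
          where
          bound : ε *ᵠ ε +ᵠ l *ᵠ ε +ᵠ ε *ᵠ m ≤ (1ℚ +ᵠ l +ᵠ m) *ᵠ ε
          bound = ℚ.≤-trans (ℚ.+-monoˡ-≤ (ε *ᵠ m) (ℚ.+-monoˡ-≤ (l *ᵠ ε) (*-monoʳ 0≤ε ε≤1)))
            (ℚ.≤-reflexive (solveᵠ 3 (λ e l m → conᵠ 1ℚ :*ᵠ e :+ᵠ l :*ᵠ e :+ᵠ e :*ᵠ m :=ᵠ (conᵠ 1ℚ :+ᵠ l :+ᵠ m) :*ᵠ e) ≡.refl ε l m))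

    ⇝-bounded : ∀ {f L} → f ⇝ L → ∃ λ b → ∃ λ N → ∀ n → N ℕ.≤ n → f n ≼ b
    ⇝-bounded {f} {L} h = go (bounded L) (converges h 1ℚ 0<1)
      where
      go : (∃ λ l → L ≼ l) → (∃ λ N → ∀ n → N ℕ.≤ n → f n - L ≼ 1ℚ) → ∃ λ b → ∃ λ N → ∀ n → N ℕ.≤ n → f n ≼ b
      go (l , L≼) (N , b) = 1ℚ +ᵠ l , N , λ n N≤n → ≼-shift (b n N≤n) L≼

    ⇝-to-0 : ∀ {f L} → f ⇝ L → (λ n → L - f n) ⇝ 0#
    ⇝-to-0 {f} {L} h = limit λ ε 0<ε → go ε (converges h ε 0<ε)
      where
      go : ∀ ε → (∃ λ N → ∀ n → N ℕ.≤ n → f n - L ≼ ε) → ∃ λ N → ∀ n → N ℕ.≤ n → (L - f n) - 0# ≼ ε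
      go ε (N , b) = N , λ n N≤n → ≼-resp (trans (solve 2 (λ f l → :- (f :- l) := (l :- f) :- con 0ℚ) refl (f n) L) (+-congˡ (-‿cong κ-0))) (≼-‿ (b n N≤n))

    bounded-*-⇝0 : ∀ {f g : ℕ → Carrier} → (∃ λ b → ∃ λ N → ∀ n → N ℕ.≤ n → g n ≼ b) → f ⇝ 0# → (λ n → f n * g n) ⇝ 0#
    bounded-*-⇝0 {f} {g} (b , N₁ , g≼) h = ⇝-from (b +ᵠ 1ℚ) (0<+ (≼⇒0≤ (g≼ N₁ ℕ.≤-refl)) 0<1) λ ε 0<ε _ → go ε (ℚ.<⇒≤ 0<ε) (converges h ε 0<ε)
      where
      drop-0 : ∀ {x r} → x - 0# ≼ r → x ≼ r
      drop-0 {x} = ≼-resp (trans (+-congˡ (-‿cong (sym κ-0))) (solve 1 (λ x → x :- con 0ℚ := x) refl x))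
      add-0 : ∀ {x r} → x ≼ r → x - 0# ≼ r
      add-0 {x} = ≼-resp (sym (trans (+-congˡ (-‿cong (sym κ-0))) (solve 1 (λ x → x :- con 0ℚ := x) refl x)))
      go : ∀ ε → 0ℚ ≤ ε → (∃ λ N → ∀ n → N ℕ.≤ n → f n - 0# ≼ ε) → ∃ λ N → ∀ n → N ℕ.≤ n → f n * g n - 0# ≼ (b +ᵠ 1ℚ) *ᵠ ε
      go ε 0≤ε (N₂ , f≼) = N₁ ℕ.⊔ N₂ , λ n N≤n → add-0 (≼-mono (ℚ.≤-trans (ℚ.≤-reflexive (ℚ.*-comm ε b)) (*-monoʳ 0≤ε (a≤a+b b 0≤1)))
        (≼-* (drop-0 (f≼ n (ℕ.m⊔n≤o⇒n≤o N₁ N₂ N≤n))) (g≼ n (ℕ.m⊔n≤o⇒m≤o N₁ N₂ N≤n))))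

    ⇝-+ : ∀ {f g L M} → f ⇝ L → g ⇝ M → (λ n → f n + g n) ⇝ L + M
    ⇝-+ {f} {g} {L} {M} hf hg = ⇝-from (1ℚ +ᵠ 1ℚ) (0<ι-suc 1) λ ε 0<ε _ → go ε (converges hf ε 0<ε) (converges hg ε 0<ε)
      where
      go : ∀ ε → (∃ λ N → ∀ n → N ℕ.≤ n → f n - L ≼ ε) → (∃ λ N → ∀ n → N ℕ.≤ n → g n - M ≼ ε) →
        ∃ λ N → ∀ n → N ℕ.≤ n → (f n + g n) - (L + M) ≼ (1ℚ +ᵠ 1ℚ) *ᵠ ε
      go ε (N₁ , b₁) (N₂ , b₂) = N₁ ℕ.⊔ N₂ , λ n N≤n → ≼-≡ (solveᵠ 1 (λ e → e :+ᵠ e :=ᵠ (conᵠ 1ℚ :+ᵠ conᵠ 1ℚ) :*ᵠ e) ≡.refl ε)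
        (≼-resp (solve 4 (λ f g l m → (f :- l) :+ (g :- m) := (f :+ g) :- (l :+ m)) refl (f n) (g n) L M)
          (≼-+ (b₁ n (ℕ.m⊔n≤o⇒m≤o N₁ N₂ N≤n)) (b₂ n (ℕ.m⊔n≤o⇒n≤o N₁ N₂ N≤n))))

    -- No term of g has to be inverted. The relation f = (M - g)u f + hu has an eventually small
    -- coefficient, so `selfbound` first bounds f; then the first summand tends to 0 and the second
    -- to Hu.
    ⇝-quotient : ∀ {f g h M H u} → (∀ n → f n * g n ≈ h n) → g ⇝ M → M * u ≈ 1# → h ⇝ H → f ⇝ H * u
    ⇝-quotient {f} {g} {h} {M} {H} {u} fg≈h hg Mu hh = ⇝-resp (0 , λ n _ → sym (fixpoint n)) (+-identityˡ (H * u))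
        (⇝-+ (bounded-*-⇝0 f-bounded small) (⇝-* hh (⇝-const u)))
      where
      fixpoint : ∀ n → f n ≈ (M - g n) * u * f n + h n * u
      fixpoint n = sym (trans (+-congˡ (*-congʳ (sym (fg≈h n))))
        (trans (solve 4 (λ f g m u → (m :- g) :* u :* f :+ f :* g :* u := f :* (m :* u)) refl (f n) (g n) M u)
          (trans (*-congˡ Mu) (*-identityʳ (f n)))))
      small : (λ n → (M - g n) * u) ⇝ 0#
      small = ⇝-resp (0 , λ n _ → refl) (zeroˡ u) (⇝-* (⇝-to-0 hg) (⇝-const u))
      f-bounded : ∃ λ b → ∃ λ N → ∀ n → N ℕ.≤ n → f n ≼ b
      f-bounded = go (⇝-bounded (⇝-* hh (⇝-const u))) (converges small ½ 0<½)
        where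
        go : (∃ λ b → ∃ λ N → ∀ n → N ℕ.≤ n → h n * u ≼ b) → (∃ λ N → ∀ n → N ℕ.≤ n → (M - g n) * u - 0# ≼ ½) →
          ∃ λ b → ∃ λ N → ∀ n → N ℕ.≤ n → f n ≼ b
        go (b , N₁ , c≼) (N₂ , s≼) = ι 2 *ᵠ b , N₁ ℕ.⊔ N₂ , λ n N≤n →
          selfbound (fixpoint n) (≼-resp (trans (+-congˡ (-‿cong (sym κ-0))) (solve 1 (λ x → x :- con 0ℚ := x) refl _)) (s≼ n (ℕ.m⊔n≤o⇒n≤o N₁ N₂ N≤n)))
            (c≼ n (ℕ.m⊔n≤o⇒m≤o N₁ N₂ N≤n)) (0≤ι 2) (ℚ.≤ᵇ⇒≤ {1ℚ} {ι 2 *ᵠ (1ℚ -ᵠ ½)} _)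

  -- Uniform bounds for the products of 1 + c/j².

  module RationalProducts where
    open Products ℚ.*-1-commutativeMonoid public renaming (Π to Πᵠ) using (Π-∙)
    open Order

    ι⁻¹ : ℕ → ℚ
    ι⁻¹ j = inv (ι j)

    ι⁻¹-inverse : ∀ j → ι⁻¹ (suc j) *ᵠ ι (suc j) ≡ 1ℚ
    ι⁻¹-inverse j = inv-inverse (ι (suc j)) (0<ι-suc j)

    ι⁻¹-suc : ∀ j → ι⁻¹ (suc j) ≡ 1/suc j
    ι⁻¹-suc j = ≡.trans (≡.sym (ℚ.*-identityʳ (ι⁻¹ (suc j)))) (≡.trans (cong (ι⁻¹ (suc j) *ᵠ_) (≡.sym (1/suc-inverse j)))
      (≡.trans (solveᵠ 3 (λ a b c → a :*ᵠ (b :*ᵠ c) :=ᵠ (a :*ᵠ c) :*ᵠ b) ≡.refl (ι⁻¹ (suc j)) (1/suc j) (ι (suc j)))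
        (≡.trans (cong (_*ᵠ 1/suc j) (ι⁻¹-inverse j)) (ℚ.*-identityˡ (1/suc j)))))

    ι⁻² : ℕ → ℚ
    ι⁻² j = ι⁻¹ j *ᵠ ι⁻¹ j

    0≤ι⁻² : ∀ j → 0ℚ ≤ ι⁻² j
    0≤ι⁻² j = 0≤x*x (ι⁻¹ j)

    0≤ι⁻¹ : ∀ j → 1 ℕ.≤ j → 0ℚ ≤ ι⁻¹ j
    0≤ι⁻¹ (suc j) _ = 0≤inv (ι (suc j)) (0<ι-suc j)

    ι⁻²≤1 : ∀ j → 1 ℕ.≤ j → ι⁻² j ≤ 1ℚ
    ι⁻²≤1 (suc j) _ = subst (λ y → y *ᵠ y ≤ 1ℚ) (≡.sym (ι⁻¹-suc j))
      (*-mono-≤ (ℚ.<⇒≤ (0<1/suc j)) 0≤1 (1/suc-antitone {0} {j} ℕ.z≤n) (1/suc-antitone {0} {j} ℕ.z≤n))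

    Πᵠ-nonneg : ∀ {f} → (∀ j → 0ℚ ≤ f j) → ∀ k → 0ℚ ≤ Πᵠ f k
    Πᵠ-nonneg 0≤f zero    = 0≤1
    Πᵠ-nonneg 0≤f (suc k) = 0≤* (Πᵠ-nonneg 0≤f k) (0≤f (suc k))

    Πᵠ-mono : ∀ {f g} → (∀ j → 0ℚ ≤ f j) → (∀ j → f j ≤ g j) → ∀ k → Πᵠ f k ≤ Πᵠ g k
    Πᵠ-mono 0≤f f≤g zero    = ℚ.≤-refl
    Πᵠ-mono 0≤f f≤g (suc k) = *-mono-≤ (Πᵠ-nonneg 0≤f k) (ℚ.≤-trans (0≤f (suc k)) (f≤g (suc k))) (Πᵠ-mono 0≤f f≤g k) (f≤g (suc k))

    growth : ℕ → ℕ → ℚ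
    growth c j = 1ℚ +ᵠ ι c *ᵠ ι⁻² j

    0≤growth : ∀ c j → 0ℚ ≤ growth c j
    0≤growth c j = 0≤+ 0≤1 (0≤* (0≤ι c) (0≤ι⁻² j))

    -- The factor 1 + 1/j² is compared with j²/(j² - 1), whose product telescopes.
    Π-growth-1 : ∀ k → Πᵠ (growth 1) (suc k) ≤ ι 4 *ᵠ (1ℚ -ᵠ 1/suc (suc k))
    Π-growth-1 zero = ℚ.≤ᵇ⇒≤ {1ℚ *ᵠ (1ℚ +ᵠ ι 1 *ᵠ (inv (ι 1) *ᵠ inv (ι 1)))} {ι 4 *ᵠ (1ℚ -ᵠ 1/suc 1)} _
    Π-growth-1 (suc k) = ℚ.≤-trans (*-monoʳ (0≤growth 1 (suc (suc k))) (Π-growth-1 k)) (begin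
      ι 4 *ᵠ (1ℚ -ᵠ y) *ᵠ (1ℚ +ᵠ ι 1 *ᵠ ι⁻² (suc (suc k))) ≡⟨ cong (λ v → ι 4 *ᵠ (1ℚ -ᵠ y) *ᵠ (1ℚ +ᵠ ι 1 *ᵠ (v *ᵠ v))) (ι⁻¹-suc (suc k)) ⟩
      ι 4 *ᵠ (1ℚ -ᵠ y) *ᵠ (1ℚ +ᵠ ι 1 *ᵠ (y *ᵠ y))          ≡⟨ solveᵠ 1 (λ y → conᵠ (ι 4) :*ᵠ (conᵠ 1ℚ :-ᵠ y) :*ᵠ (conᵠ 1ℚ :+ᵠ conᵠ (ι 1) :*ᵠ (y :*ᵠ y)) :=ᵠ
                                                               conᵠ (ι 4) :*ᵠ (conᵠ 1ℚ :*ᵠ ((conᵠ 1ℚ :-ᵠ y) :*ᵠ (conᵠ 1ℚ :+ᵠ y :*ᵠ y)))) ≡.refl y ⟩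
      ι 4 *ᵠ (1ℚ *ᵠ Y)                                      ≤⟨ *-monoˡ (0≤ι 4) (ℚ.≤-trans (ℚ.≤-reflexive (cong (_*ᵠ Y) (≡.sym (1/suc-inverse (suc (suc k))))))
                                                               (ℚ.≤-trans (ℚ.≤-reflexive bring) (ℚ.≤-trans (*-monoˡ 0≤zN 1-y⁴≤1) (ℚ.≤-reflexive (≡.trans (ℚ.*-identityʳ (z *ᵠ N)) zN))))) ⟩
      ι 4 *ᵠ (1ℚ -ᵠ z)                                      ∎)
      where
      open ℚ.≤-Reasoning
      y z N Y : ℚ
      y = 1/suc (suc k)
      z = 1/suc (suc (suc k))
      N = ι (suc (suc k))
      Y = (1ℚ -ᵠ y) *ᵠ (1ℚ +ᵠ y *ᵠ y)
      0≤y : 0ℚ ≤ y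
      0≤y = ℚ.<⇒≤ (0<1/suc (suc k))
      0≤zN : 0ℚ ≤ z *ᵠ N
      0≤zN = 0≤* (ℚ.<⇒≤ (0<1/suc (suc (suc k)))) (0≤ι (suc (suc k)))
      zN : z *ᵠ N ≡ 1ℚ -ᵠ z
      zN = ≡.trans (solveᵠ 2 (λ z n → z :*ᵠ n :=ᵠ z :*ᵠ (conᵠ 1ℚ :+ᵠ n) :-ᵠ z) ≡.refl z N)
        (cong (_-ᵠ z) (≡.trans (cong (z *ᵠ_) (≡.sym (ι-suc (suc (suc k))))) (1/suc-inverse (suc (suc k)))))
      bring : z *ᵠ ι (suc (suc (suc k))) *ᵠ Y ≡ z *ᵠ N *ᵠ (1ℚ -ᵠ y *ᵠ y *ᵠ (y *ᵠ y))
      bring = ≡.trans (cong (λ m → z *ᵠ m *ᵠ Y) (≡.trans (ι-suc (suc (suc k))) (cong (_+ᵠ N) (≡.sym (1/suc-inverse (suc k))))))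
        (solveᵠ 3 (λ z y n → z :*ᵠ (y :*ᵠ n :+ᵠ n) :*ᵠ ((conᵠ 1ℚ :-ᵠ y) :*ᵠ (conᵠ 1ℚ :+ᵠ y :*ᵠ y)) :=ᵠ
          z :*ᵠ n :*ᵠ (conᵠ 1ℚ :-ᵠ y :*ᵠ y :*ᵠ (y :*ᵠ y))) ≡.refl z y N)
      1-y⁴≤1 : 1ℚ -ᵠ y *ᵠ y *ᵠ (y *ᵠ y) ≤ 1ℚ
      1-y⁴≤1 = 1-≤1 (0≤x*x (y *ᵠ y))

    Π-growth-1≤4 : ∀ k → Πᵠ (growth 1) k ≤ ι 4
    Π-growth-1≤4 zero    = ℚ.≤ᵇ⇒≤ {1ℚ} {ι 4} _
    Π-growth-1≤4 (suc k) = ℚ.≤-trans (Π-growth-1 k) (ℚ.≤-trans (*-monoˡ (0≤ι 4)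
      (1-≤1 (ℚ.<⇒≤ (0<1/suc (suc k)))))
      (ℚ.≤-reflexive (ℚ.*-identityʳ (ι 4))))

    4^ : ℕ → ℚ
    4^ zero    = 1ℚ
    4^ (suc c) = 4^ c *ᵠ ι 4

    0≤4^ : ∀ c → 0ℚ ≤ 4^ c
    0≤4^ zero    = 0≤1
    0≤4^ (suc c) = 0≤* (0≤4^ c) (0≤ι 4)

    -- Induction on c by 1 + (c + 1)x ≤ (1 + cx)(1 + x), from the telescoping case c = 1. Only the
    -- independence of k matters; the value 4ᶜ is crude.
    Π-growth : ∀ c k → Πᵠ (growth c) k ≤ 4^ c
    Π-growth zero k = ℚ.≤-reflexive (trivial k)
      where
      trivial : ∀ k → Πᵠ (growth 0) k ≡ 1ℚ
      trivial zero    = ≡.refl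
      trivial (suc k) = ≡.trans (cong₂ _*ᵠ_ (trivial k) (≡.trans (cong (1ℚ +ᵠ_) (ℚ.*-zeroˡ (ι⁻² (suc k)))) (ℚ.+-identityʳ 1ℚ))) (ℚ.*-identityˡ 1ℚ)
    Π-growth (suc c) k = ℚ.≤-trans (Πᵠ-mono (0≤growth (suc c)) bernoulli k) (ℚ.≤-trans (ℚ.≤-reflexive (Π-∙ (growth c) (growth 1) k))
        (*-mono-≤ (Πᵠ-nonneg (0≤growth c) k) (0≤ι 4) (Π-growth c k) (Π-growth-1≤4 k)))
      where
      bernoulli : ∀ j → growth (suc c) j ≤ growth c j *ᵠ growth 1 j
      bernoulli j = ≤-diff (ι c *ᵠ (x *ᵠ x)) (0≤* (0≤ι c) (0≤x*x x)) (≡.trans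
        (solveᵠ 2 (λ c x → (conᵠ 1ℚ :+ᵠ c :*ᵠ x) :*ᵠ (conᵠ 1ℚ :+ᵠ conᵠ (ι 1) :*ᵠ x) :=ᵠ
          conᵠ 1ℚ :+ᵠ (conᵠ 1ℚ :+ᵠ c) :*ᵠ x :+ᵠ c :*ᵠ (x :*ᵠ x)) ≡.refl (ι c) x)
        (cong (λ n → 1ℚ +ᵠ n *ᵠ x +ᵠ ι c *ᵠ (x *ᵠ x)) (≡.sym (ι-suc c))))
        where
        x : ℚ
        x = ι⁻² j

  -- Euler's product for the sine.

  module EulerProduct (A : Analysis) where
    open Analysis A hiding (zero)
    open Solver algebra using (solve; _:=_; _:*_; _:+_; _:-_; :-_; con)
    open Estimates algebra
    open Trigonometry A
    open Polynomials algebra hiding (Π-∙; Π-cong)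
    open Limits algebra
    open Sine A
    open Cyclotomy A using (frac; 0<frac; module FiniteProduct)
    open RationalProducts hiding (Π-∙)
    open Order

    Π-≼ : ∀ {x g} → (∀ j → 0ℚ ≤ g j) → ∀ k → (∀ j → 1 ℕ.≤ j → j ℕ.≤ k → x j ≼ g j) → Π x k ≼ Πᵠ g k
    Π-≼ 0≤g zero    x≼ = 1≼1
    Π-≼ 0≤g (suc k) x≼ = ≼-* (Π-≼ 0≤g k λ j 1≤j j≤k → x≼ j 1≤j (ℕ.m≤n⇒m≤1+n j≤k)) (x≼ (suc k) (ℕ.s≤s ℕ.z≤n) ℕ.≤-refl)

    -- Exchanging one factor at a time costs at most δ times the other bounds; as every g j is at
    -- least 1, the missing bound can be restored, so that each of the k exchanges costs at most δ
    -- times the full product.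
    Π-difference : ∀ {x y g δ} → (∀ j → 1ℚ ≤ g j) → 0ℚ ≤ δ → ∀ k →
      (∀ j → 1 ℕ.≤ j → j ℕ.≤ k → x j ≼ g j) → (∀ j → 1 ℕ.≤ j → j ℕ.≤ k → y j ≼ g j) →
      (∀ j → 1 ℕ.≤ j → j ℕ.≤ k → x j - y j ≼ δ) → Π x k - Π y k ≼ ι k *ᵠ δ *ᵠ Πᵠ g k
    Π-difference {δ = δ} 1≤g 0≤δ zero x≼ y≼ d≼ = ≼-≡ (solveᵠ 1 (λ d → conᵠ 0ℚ :=ᵠ conᵠ 0ℚ :*ᵠ d :*ᵠ conᵠ 1ℚ) ≡.refl δ) (≈⇒≼0 refl)
    Π-difference {x} {y} {g} {δ} 1≤g 0≤δ (suc k) x≼ y≼ d≼ = ≼-mono bound (≼-resp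
        (solve 4 (λ p q a b → (p :- q) :* a :+ q :* (a :- b) := p :* a :- q :* b) refl (Π x k) (Π y k) (x (suc k)) (y (suc k)))
        (≼-+ (≼-* (Π-difference 1≤g 0≤δ k (down x≼) (down y≼) (down d≼)) (x≼ (suc k) 1≤ ℕ.≤-refl))
          (≼-* (Π-≼ 0≤g k (down y≼)) (d≼ (suc k) 1≤ ℕ.≤-refl))))
      where
      1≤ : 1 ℕ.≤ suc k
      1≤ = ℕ.s≤s ℕ.z≤n
      down : ∀ {P : ℕ → Set} → (∀ j → 1 ℕ.≤ j → j ℕ.≤ suc k → P j) → ∀ j → 1 ℕ.≤ j → j ℕ.≤ k → P j
      down h j 1≤j j≤k = h j 1≤j (ℕ.m≤n⇒m≤1+n j≤k)
      0≤g : ∀ j → 0ℚ ≤ g j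
      0≤g j = ℚ.≤-trans 0≤1 (1≤g j)
      P : ℚ
      P = Πᵠ g k
      0≤P : 0ℚ ≤ P
      0≤P = Πᵠ-nonneg 0≤g k
      bound : ι k *ᵠ δ *ᵠ P *ᵠ g (suc k) +ᵠ P *ᵠ δ ≤ ι (suc k) *ᵠ δ *ᵠ (P *ᵠ g (suc k))
      bound = ℚ.≤-trans (ℚ.+-monoʳ-≤ (ι k *ᵠ δ *ᵠ P *ᵠ g (suc k)) (ℚ.≤-trans (ℚ.≤-reflexive (≡.sym (ℚ.*-identityʳ (P *ᵠ δ)))) (*-monoˡ (0≤* 0≤P 0≤δ) (1≤g (suc k)))))
        (ℚ.≤-reflexive (≡.trans (solveᵠ 4 (λ n d p g → n :*ᵠ d :*ᵠ p :*ᵠ g :+ᵠ p :*ᵠ d :*ᵠ g :=ᵠ (conᵠ 1ℚ :+ᵠ n) :*ᵠ d :*ᵠ (p :*ᵠ g)) ≡.refl (ι k) δ P (g (suc k)))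
          (cong (λ n → n *ᵠ δ *ᵠ (P *ᵠ g (suc k))) (≡.sym (ι-suc k)))))

    euler : Carrier → ℕ → Carrier
    euler a r = a * Π (λ j → 1# - a * a * (κ (ι⁻¹ j) * κ (ι⁻¹ j))) r

    -- At stage r the error is (τ - a) times a bounded product, plus a times a difference of
    -- products. Each of the r factors is off by O(1/n²) with n = 2r + 1, and `Π-growth` bounds the
    -- products uniformly, so the total is O(1/n).
    euler⇝σ : ∀ a → euler a ⇝ σ a
    euler⇝σ a = go (bounded a)
      where
      module Bounds (R : ℚ) (a≼R : a ≼ R) where
        0≤R : 0ℚ ≤ R
        0≤R = ≼⇒0≤ a≼R
        -- `C₁`/n² bounds τ - a, being n · 25/8 · (R/n)³; `T` bounds τ; `C₂`/n² bounds the
        -- difference of two factors, with 25 = 5² and 96 = 16 · (5 + 1) from `υ-spec`.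
        C₁ T C₂ : ℚ
        C₁ = 25/8 *ᵠ (R *ᵠ R *ᵠ R)
        T  = C₁ +ᵠ R
        C₂ = ι 25 *ᵠ (C₁ *ᵠ (T +ᵠ R)) +ᵠ ι 96 *ᵠ (R *ᵠ R)
        0≤C₁ : 0ℚ ≤ C₁
        0≤C₁ = 0≤* (ℚ.≤ᵇ⇒≤ {0ℚ} {25/8} _) (0≤* (0≤* 0≤R 0≤R) 0≤R)
        0≤T : 0ℚ ≤ T
        0≤T = 0≤+ 0≤C₁ 0≤R
        R≤T : R ≤ T
        R≤T = ≤-diff C₁ 0≤C₁ (ℚ.+-comm C₁ R)
        0≤C₂ : 0ℚ ≤ C₂
        0≤C₂ = 0≤+ (0≤* (0≤ι 25) (0≤* 0≤C₁ (0≤+ 0≤T 0≤R))) (0≤* (0≤ι 96) (0≤* 0≤R 0≤R))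

        module AtStage (c : ℕ) (c≥ : ι 25 *ᵠ (T *ᵠ T) ≤ ι c) (r : ℕ) (R≤n : R +ᵠ R ≤ ι (suc (r ℕ.+ r))) where
          open FiniteProduct r
          i : ℚ
          i = 1/suc d
          0≤i : 0ℚ ≤ i
          0≤i = ℚ.<⇒≤ (0<1/suc d)
          i≤1 : i ≤ 1ℚ
          i≤1 = 1/suc-antitone {0} {d} ℕ.z≤n
          in≡1 : i *ᵠ ι n ≡ 1ℚ
          in≡1 = 1/suc-inverse d
          s τ′ : Carrier
          s  = a/n a
          τ′ = τ a
          s≼ : s ≼ i *ᵠ R
          s≼ = ≼-* (κ≼ 0≤i ℚ.≤-refl) a≼R
          iR≤½ : i *ᵠ R ≤ ½
          iR≤½ = ℚ.≤-trans (ℚ.≤-reflexive (solveᵠ 2 (λ i R → i :*ᵠ R :=ᵠ conᵠ ½ :*ᵠ (i :*ᵠ (R :+ᵠ R))) ≡.refl i R))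
            (ℚ.≤-trans (*-monoˡ (ℚ.<⇒≤ 0<½) (ℚ.≤-trans (*-monoˡ 0≤i R≤n) (ℚ.≤-reflexive in≡1))) (ℚ.≤-reflexive (ℚ.*-identityʳ ½)))
          ns≈a : κ (ι n) * s ≈ a
          ns≈a = trans (solve 3 (λ n i a → n :* (i :* a) := i :* n :* a) refl (κ (ι n)) (κ i) a) (trans (*-congʳ (κ-inverse in≡1)) (*-identityˡ a))
          τ-a : τ′ - a ≼ C₁ *ᵠ (i *ᵠ i)
          τ-a = ≼-≡ (≡.trans (solveᵠ 3 (λ n i R → n :*ᵠ (conᵠ 25/8 :*ᵠ (i :*ᵠ R :*ᵠ (i :*ᵠ R) :*ᵠ (i :*ᵠ R))) :=ᵠ
                (i :*ᵠ n) :*ᵠ (conᵠ 25/8 :*ᵠ (R :*ᵠ R :*ᵠ R) :*ᵠ (i :*ᵠ i))) ≡.refl (ι n) i R)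
              (≡.trans (cong (_*ᵠ (C₁ *ᵠ (i *ᵠ i))) in≡1) (ℚ.*-identityˡ _)))
            (≼-resp (trans (solve 3 (λ n x y → n :* (x :- y) := n :* x :- n :* y) refl (κ (ι n)) (σ s) s) (+-congˡ (-‿cong ns≈a)))
              (≼-* (κ≼ (0≤ι n) ℚ.≤-refl) (σ-taylor s≼ iR≤½)))
          i²≤1 : i *ᵠ i ≤ 1ℚ
          i²≤1 = *-mono-≤ 0≤i 0≤1 i≤1 i≤1
          τ≼T : τ′ ≼ T
          τ≼T = ≼-mono (ℚ.+-monoˡ-≤ R (ℚ.≤-trans (*-monoˡ 0≤C₁ i²≤1) (ℚ.≤-reflexive (ℚ.*-identityʳ C₁)))) (≼-shift τ-a a≼R)
          x y : ℕ → Carrier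
          x j = 1# - τ′ * τ′ * (w a j * w a j)
          y j = 1# - a * a * (κ (ι⁻¹ j) * κ (ι⁻¹ j))
          module At (j : ℕ) (1≤j : 1 ℕ.≤ j) (j≤r : j ℕ.≤ r) where
            spec : σ (κ (frac d j)) * υ (frac d j) ≈ κ (frac d j) × υ (frac d j) ≼ ι 5 × υ (frac d j) - 1# ≼ ι 16 *ᵠ (frac d j *ᵠ frac d j)
            spec = υ-spec (0<frac d 1≤j) (frac≤½ j≤r)
            u k : Carrier
            u = υ (frac d j)
            k = κ (ι⁻¹ j)
            t q : ℚ
            t = frac d j
            q = ι⁻¹ j
            u≼ : u ≼ ι 5
            u≼ = proj₁ (proj₂ spec)
            k≼ : k ≼ q
            k≼ = κ≼ (0≤ι⁻¹ j 1≤j) ℚ.≤-refl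
            x≼ : x j ≼ growth c j
            x≼ = ≼-mono (ℚ.≤-trans (ℚ.≤-reflexive (solveᵠ 2 (λ T q → conᵠ 1ℚ :+ᵠ T :*ᵠ T :*ᵠ (conᵠ (ι 5) :*ᵠ q :*ᵠ (conᵠ (ι 5) :*ᵠ q)) :=ᵠ
                  conᵠ 1ℚ :+ᵠ conᵠ (ι 25) :*ᵠ (T :*ᵠ T) :*ᵠ (q :*ᵠ q)) ≡.refl T q)) (ℚ.+-monoʳ-≤ 1ℚ (*-monoʳ (0≤ι⁻² j) c≥)))
              (≼-- 1≼1 (≼-* (≼-* τ≼T τ≼T) (≼-* (≼-* u≼ k≼) (≼-* u≼ k≼))))
            R²≤c : R *ᵠ R ≤ ι c
            R²≤c = ℚ.≤-trans (*-mono-≤ 0≤R 0≤T R≤T R≤T) (ℚ.≤-trans (≤-diff (ι 24 *ᵠ (T *ᵠ T)) (0≤* (0≤ι 24) (0≤* 0≤T 0≤T))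
              (solveᵠ 1 (λ x → conᵠ (ι 25) :*ᵠ x :=ᵠ x :+ᵠ conᵠ (ι 24) :*ᵠ x) ≡.refl (T *ᵠ T))) c≥)
            y≼ : y j ≼ growth c j
            y≼ = ≼-mono (ℚ.+-monoʳ-≤ 1ℚ (*-monoʳ (0≤ι⁻² j) R²≤c)) (≼-- 1≼1 (≼-* (≼-* a≼R a≼R) (≼-* k≼ k≼)))
            -- The error 16t² of u grows with j, but the factor carries q² = 1/j², and (j/n)(1/j) =
            -- 1/n: this is where uniformity in j comes from.
            tq≡i : t *ᵠ q ≡ i
            tq≡i = lemma j 1≤j
              where
              lemma : ∀ j → 1 ℕ.≤ j → frac d j *ᵠ ι⁻¹ j ≡ i
              lemma (suc j) _ = ≡.trans (solveᵠ 3 (λ n i q → n :*ᵠ i :*ᵠ q :=ᵠ (q :*ᵠ n) :*ᵠ i) ≡.refl (ι (suc j)) i (ι⁻¹ (suc j)))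
                (≡.trans (cong (_*ᵠ i) (ι⁻¹-inverse j)) (ℚ.*-identityˡ i))
            difference : x j - y j ≼ C₂ *ᵠ (i *ᵠ i)
            difference = ≼-mono bound (≼-resp
                (solve 5 (λ o τ a u k → :- (((τ :- a) :* (τ :+ a)) :* (u :* u) :* (k :* k) :+ (a :* a) :* ((u :- o) :* (u :+ o)) :* (k :* k)) :+ (a :* a :* (k :* k)) :* ((con 1ℚ :- o) :* (con 1ℚ :+ o))
                   := (o :- τ :* τ :* (u :* k :* (u :* k))) :- (o :- a :* a :* (k :* k))) refl 1# τ′ a u k)
                (≼-resp (sym (trans (+-congˡ (trans (*-congˡ (trans (*-congʳ (trans (+-congʳ κ-1) (-‿inverseʳ 1#))) (zeroˡ _))) (zeroʳ _))) (+-identityʳ _)))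
                  (≼-‿ (≼-+ (≼-* (≼-* (≼-* τ-a (≼-+ τ≼T a≼R)) (≼-* u≼ u≼)) (≼-* k≼ k≼))
                    (≼-* (≼-* (≼-* a≼R a≼R) (≼-* (proj₂ (proj₂ spec)) (≼-+ u≼ 1≼1))) (≼-* k≼ k≼))))))
              where
              z : ℚ
              z = C₁ *ᵠ (i *ᵠ i) *ᵠ (T +ᵠ R) *ᵠ ι 25
              0≤z : 0ℚ ≤ z
              0≤z = 0≤* (0≤* (0≤* 0≤C₁ (0≤* 0≤i 0≤i)) (0≤+ 0≤T 0≤R)) (0≤ι 25)
              bound : C₁ *ᵠ (i *ᵠ i) *ᵠ (T +ᵠ R) *ᵠ (ι 5 *ᵠ ι 5) *ᵠ (q *ᵠ q) +ᵠ R *ᵠ R *ᵠ (ι 16 *ᵠ (t *ᵠ t) *ᵠ (ι 5 +ᵠ 1ℚ)) *ᵠ (q *ᵠ q) ≤ C₂ *ᵠ (i *ᵠ i)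
              bound = ℚ.≤-trans (ℚ.+-mono-≤ (ℚ.≤-trans (*-monoˡ 0≤z (ι⁻²≤1 j 1≤j)) (ℚ.≤-reflexive (ℚ.*-identityʳ z)))
                  (ℚ.≤-reflexive (≡.trans (solveᵠ 3 (λ R t q → R :*ᵠ R :*ᵠ (conᵠ (ι 16) :*ᵠ (t :*ᵠ t) :*ᵠ (conᵠ (ι 5) :+ᵠ conᵠ 1ℚ)) :*ᵠ (q :*ᵠ q) :=ᵠ
                      conᵠ (ι 96) :*ᵠ (R :*ᵠ R) :*ᵠ (t :*ᵠ q :*ᵠ (t :*ᵠ q))) ≡.refl R t q)
                    (cong (λ v → ι 96 *ᵠ (R *ᵠ R) *ᵠ (v *ᵠ v)) tq≡i))))
                (ℚ.≤-reflexive (solveᵠ 4 (λ c i tr R → c :*ᵠ (i :*ᵠ i) :*ᵠ tr :*ᵠ conᵠ (ι 25) :+ᵠ conᵠ (ι 96) :*ᵠ (R :*ᵠ R) :*ᵠ (i :*ᵠ i) :=ᵠ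
                  (conᵠ (ι 25) :*ᵠ (c :*ᵠ tr) :+ᵠ conᵠ (ι 96) :*ᵠ (R :*ᵠ R)) :*ᵠ (i :*ᵠ i)) ≡.refl C₁ i (T +ᵠ R) R))

          K : ℚ
          K = 4^ c
          total : euler a r - σ a ≼ (C₁ *ᵠ K +ᵠ R *ᵠ (C₂ *ᵠ K)) *ᵠ 1/suc r
          total = ≼-mono bound (≼-swap (≼-resp (sym split) (≼-+ (≼-* τ-a (≼-mono (Π-growth c r) (Π-≼ (0≤growth c) r At.x≼)))
              (≼-* a≼R (≼-mono (*-monoˡ (0≤* (0≤ι r) (0≤* 0≤C₂ (0≤* 0≤i 0≤i))) (Π-growth c r))
                (Π-difference {x} {y} (λ j → a≤a+b 1ℚ (0≤* (0≤ι c) (0≤ι⁻² j))) (0≤* 0≤C₂ (0≤* 0≤i 0≤i)) r At.x≼ At.y≼ At.difference))))))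
            where
            split : σ a - euler a r ≈ (τ′ - a) * Π x r + a * (Π x r - Π y r)
            split = trans (+-congʳ (finite-product a)) (solve 4 (λ t a p q → t :* p :- a :* q := (t :- a) :* p :+ a :* (p :- q)) refl τ′ a (Π x r) (Π y r))
            ir≤1 : ι r *ᵠ i ≤ 1ℚ
            ir≤1 = ℚ.≤-trans (*-monoʳ 0≤i (ι-mono-≤ (ℕ.≤-trans (ℕ.m≤m+n r r) (ℕ.n≤1+n d)))) (ℚ.≤-reflexive (≡.trans (ℚ.*-comm (ι n) i) in≡1))
            0≤K : 0ℚ ≤ K
            0≤K = 0≤4^ c
            coefficient : ℚ
            coefficient = C₁ *ᵠ K +ᵠ R *ᵠ (C₂ *ᵠ K)
            bound : C₁ *ᵠ (i *ᵠ i) *ᵠ K +ᵠ R *ᵠ (ι r *ᵠ (C₂ *ᵠ (i *ᵠ i)) *ᵠ K) ≤ coefficient *ᵠ 1/suc r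
            bound = ℚ.≤-trans (ℚ.≤-reflexive (solveᵠ 6 (λ c₁ i K R r c₂ → c₁ :*ᵠ (i :*ᵠ i) :*ᵠ K :+ᵠ R :*ᵠ (r :*ᵠ (c₂ :*ᵠ (i :*ᵠ i)) :*ᵠ K) :=ᵠ
                  (c₁ :*ᵠ K :*ᵠ i :+ᵠ R :*ᵠ (c₂ :*ᵠ K) :*ᵠ (r :*ᵠ i)) :*ᵠ i) ≡.refl C₁ i K R (ι r) C₂))
              (*-mono-≤ (0≤+ (0≤* (0≤* 0≤C₁ 0≤K) 0≤i) (0≤* 0≤RCK (0≤* (0≤ι r) 0≤i))) (ℚ.<⇒≤ (0<1/suc r))
                (ℚ.+-mono-≤ (ℚ.≤-trans (*-monoˡ (0≤* 0≤C₁ 0≤K) i≤1) (ℚ.≤-reflexive (ℚ.*-identityʳ (C₁ *ᵠ K))))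
                  (ℚ.≤-trans (*-monoˡ 0≤RCK ir≤1) (ℚ.≤-reflexive (ℚ.*-identityʳ (R *ᵠ (C₂ *ᵠ K))))))
                (1/suc-antitone (ℕ.m≤m+n r r)))
              where
              0≤RCK : 0ℚ ≤ R *ᵠ (C₂ *ᵠ K)
              0≤RCK = 0≤* 0≤R (0≤* 0≤C₂ 0≤K)

        conclude : (∃ λ c → ι 25 *ᵠ (T *ᵠ T) +ᵠ 1ℚ ≤ ι (suc c)) → (∃ λ M → R +ᵠ R +ᵠ 1ℚ ≤ ι (suc M)) → euler a ⇝ σ a
        conclude (c , c≥) (M , M≥) = ⇝-rate (C₁ *ᵠ 4^ (suc c) +ᵠ R *ᵠ (C₂ *ᵠ 4^ (suc c)))
          (0≤+ (0≤* 0≤C₁ (0≤4^ (suc c))) (0≤* 0≤R (0≤* 0≤C₂ (0≤4^ (suc c)))))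
          (M , λ r M≤r → AtStage.total (suc c) (ℚ.≤-trans (a≤a+b _ 0≤1) c≥) r
            (ℚ.≤-trans (a≤a+b _ 0≤1) (ℚ.≤-trans M≥ (ι-mono-≤ (ℕ.s≤s (ℕ.≤-trans M≤r (ℕ.m≤m+n r r)))))))

      go : (∃ λ R → a ≼ R) → euler a ⇝ σ a
      go (R , a≼R) = Bounds.conclude R a≼R
        (ι-above _ (0<+ (0≤* (0≤ι 25) (0≤x*x (Bounds.T R a≼R))) 0<1))
        (ι-above _ (0<+ (0≤+ (≼⇒0≤ a≼R) (≼⇒0≤ a≼R)) 0<1))

  -- Positive elements, and the symmetric products for the sine.

  module Positivity (A : Analysis) where
    open Analysis A hiding (zero)
    open Solver algebra using (solve; _:=_; _:*_; _:+_; _:-_; :-_)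
    open Estimates algebra
    open Polynomials algebra hiding (Π-∙; Π-cong)
    open Limits algebra
    open Sine A
    open EulerProduct A
    open RationalProducts using (ι⁻¹; ι⁻²; ι⁻¹-suc; Πᵠ)
    open Order

    -- Says at once that x is real and bounded away from 0, in an algebra that has no order: x is a
    -- limit of rationals above a fixed positive bound.
    record Positive (x : Carrier) : Set where
      constructor positive
      field
        lower  : ℚ
        0<lower : 0ℚ < lower
        approximation : ∀ ε → 0ℚ < ε → ∃ λ p → lower ≤ p × x - κ p ≼ ε

    Positive-resp : ∀ {x y} → x ≈ y → Positive x → Positive y
    Positive-resp x≈y (positive c 0<c h) = positive c 0<c λ ε 0<ε → go (h ε 0<ε)
      where
      go : ∀ {ε} → (∃ λ p → c ≤ p × _ - κ p ≼ ε) → ∃ λ p → c ≤ p × _ - κ p ≼ ε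
      go (p , c≤p , b) = p , c≤p , ≼-resp (+-congʳ x≈y) b

    Positive-κ : ∀ {p} → 0ℚ < p → Positive (κ p)
    Positive-κ {p} 0<p = positive p 0<p λ ε 0<ε → p , ℚ.≤-refl , ≼-mono (ℚ.<⇒≤ 0<ε) (≈⇒≼0 refl)

    Positive-1 : Positive 1#
    Positive-1 = Positive-resp κ-1 (Positive-κ 0<1)

    Positive-+ : ∀ {x y} → Positive x → Positive y → Positive (x + y)
    Positive-+ {x} {y} (positive c 0<c h) (positive d 0<d k) = positive (c +ᵠ d) (0<+ (ℚ.<⇒≤ 0<c) 0<d)
        λ ε 0<ε → go ε (h (½ *ᵠ ε) (0<* 0<½ 0<ε)) (k (½ *ᵠ ε) (0<* 0<½ 0<ε))
      where
      go : ∀ ε → (∃ λ p → c ≤ p × x - κ p ≼ ½ *ᵠ ε) → (∃ λ p → d ≤ p × y - κ p ≼ ½ *ᵠ ε) →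
        ∃ λ p → c +ᵠ d ≤ p × (x + y) - κ p ≼ ε
      go ε (p , c≤p , b) (q , d≤q , b′) = p +ᵠ q , ℚ.+-mono-≤ c≤p d≤q , ≼-≡ (½+½ ε) (≼-resp
        (trans (solve 4 (λ x p y q → (x :- p) :+ (y :- q) := (x :+ y) :- (p :+ q)) refl x (κ p) y (κ q)) (+-congˡ (-‿cong (sym (κ-+ p q))))) (≼-+ b b′))

    Positive-* : ∀ {x y} → Positive x → Positive y → Positive (x * y)
    Positive-* {x} {y} (positive c 0<c h) (positive d 0<d k) = positive (c *ᵠ d) (0<* 0<c 0<d) (λ ε 0<ε → go ε 0<ε (bounded x) (bounded y))
      where
      go : ∀ ε → 0ℚ < ε → (∃ λ r → x ≼ r) → (∃ λ s → y ≼ s) → ∃ λ p → c *ᵠ d ≤ p × x * y - κ p ≼ ε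
      go ε 0<ε (r , x≼) (s , y≼) = mid (shrink-unit K 0<K ε 0<ε)
        where
        K : ℚ
        K = r +ᵠ s +ᵠ 1ℚ
        0<K : 0ℚ < K
        0<K = 0<+ (0≤+ (≼⇒0≤ x≼) (≼⇒0≤ y≼)) 0<1
        mid : (∃ λ δ → 0ℚ < δ × δ ≤ 1ℚ × K *ᵠ δ ≤ ε) → ∃ λ p → c *ᵠ d ≤ p × x * y - κ p ≼ ε
        mid (δ , 0<δ , δ≤1 , Kδ≤ε) = fin (h δ 0<δ) (k δ 0<δ)
          where
          fin : (∃ λ p → c ≤ p × x - κ p ≼ δ) → (∃ λ p → d ≤ p × y - κ p ≼ δ) → ∃ λ p → c *ᵠ d ≤ p × x * y - κ p ≼ ε
          fin (p , c≤p , b) (q , d≤q , b′) = p *ᵠ q , *-mono-≤ (ℚ.<⇒≤ 0<c) (ℚ.≤-trans (ℚ.<⇒≤ 0<d) d≤q) c≤p d≤q ,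
            ≼-mono (ℚ.≤-trans bound Kδ≤ε) (≼-resp
              (trans (solve 4 (λ x p y q → (x :- p) :* y :+ x :* (y :- q) :- (x :- p) :* (y :- q) := x :* y :- p :* q) refl x (κ p) y (κ q)) (+-congˡ (-‿cong (sym (κ-* p q)))))
              (≼-- (≼-+ (≼-* b y≼) (≼-* x≼ b′)) (≼-* b b′)))
            where
            bound : δ *ᵠ s +ᵠ r *ᵠ δ +ᵠ δ *ᵠ δ ≤ K *ᵠ δ
            bound = ℚ.≤-trans (ℚ.+-monoʳ-≤ (δ *ᵠ s +ᵠ r *ᵠ δ) (*-monoʳ (ℚ.<⇒≤ 0<δ) δ≤1))
              (ℚ.≤-reflexive (solveᵠ 3 (λ d r s → d :*ᵠ s :+ᵠ r :*ᵠ d :+ᵠ conᵠ 1ℚ :*ᵠ d :=ᵠ (r :+ᵠ s :+ᵠ conᵠ 1ℚ) :*ᵠ d) ≡.refl δ r s))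

    Positive-Π : ∀ f n → (∀ j → 1 ℕ.≤ j → j ℕ.≤ n → Positive (f j)) → Positive (Π f n)
    Positive-Π f zero    h = Positive-1
    Positive-Π f (suc n) h = Positive-* (Positive-Π f n λ j 1≤j j≤n → h j 1≤j (ℕ.m≤n⇒m≤1+n j≤n)) (h (suc n) (ℕ.s≤s ℕ.z≤n) ℕ.≤-refl)

    Positive-limit : ∀ {f x c} → 0ℚ < c → (p : ℕ → ℚ) → (∀ n → f n ≈ κ (p n)) → (∀ n → c ≤ p n) → f ⇝ x → Positive x
    Positive-limit {f} {x} {c} 0<c p f≈ c≤ f⇝ = positive c 0<c λ ε 0<ε → go ε (converges f⇝ ε 0<ε)
      where
      go : ∀ ε → (∃ λ N → ∀ n → N ℕ.≤ n → f n - x ≼ ε) → ∃ λ q → c ≤ q × x - κ q ≼ ε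
      go ε (N , b) = p N , c≤ N , ≼-resp (+-congˡ (-‿cong (f≈ N))) (≼-swap (b N ℕ.≤-refl))

    -- For a rational p within c/2 ≤ p/2 of w, wv = 0 gives v = (1 - w/p)v with a coefficient of
    -- norm at most 1/2, and `selfbound` with constant term 0 forces v = 0.
    Positive-cancel : ∀ {w v} → Positive w → w * v ≈ 0# → v ≈ 0#
    Positive-cancel {w} {v} (positive c 0<c h) wv≈0 = go (h (½ *ᵠ c) (0<* 0<½ 0<c))
      where
      go : (∃ λ p → c ≤ p × w - κ p ≼ ½ *ᵠ c) → v ≈ 0#
      go (p , c≤p , b) = ≼0⇒≈0 (≼-≡ (ℚ.*-zeroʳ (ι 2)) (selfbound {v} {g} {0#} {½} {0ℚ} {ι 2} fixpoint g≼½ 0≼0 (0≤ι 2) (ℚ.≤ᵇ⇒≤ {1ℚ} {ι 2 *ᵠ (1ℚ -ᵠ ½)} _)))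
        where
        0<p : 0ℚ < p
        0<p = ℚ.<-≤-trans 0<c c≤p
        g : Carrier
        g = κ (inv p) * - (w - κ p)
        g≼½ : g ≼ ½
        g≼½ = ≼-mono (ℚ.≤-trans (*-monoˡ (0≤inv p 0<p) (*-monoˡ (ℚ.<⇒≤ 0<½) c≤p))
            (ℚ.≤-reflexive (≡.trans (solveᵠ 2 (λ i p → i :*ᵠ (conᵠ ½ :*ᵠ p) :=ᵠ conᵠ ½ :*ᵠ (i :*ᵠ p)) ≡.refl (inv p) p)
              (≡.trans (cong (½ *ᵠ_) (inv-inverse p 0<p)) (ℚ.*-identityʳ ½)))))
          (≼-* (κ≼ (0≤inv p 0<p) ℚ.≤-refl) (≼-‿ b))
        fixpoint : v ≈ g * v + 0#
        fixpoint = sym (trans (+-congˡ (sym (trans (*-congˡ wv≈0) (zeroʳ (κ (inv p))))))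
          (trans (solve 4 (λ i w p v → i :* (:- (w :- p)) :* v :+ i :* (w :* v) := i :* p :* v) refl (κ (inv p)) w (κ p) v)
            (trans (*-congʳ (κ-inverse (inv-inverse p 0<p))) (*-identityˡ v))))

    positive-square-unique : ∀ {x y} → Positive x → Positive y → x * x ≈ y * y → x ≈ y
    positive-square-unique {x} {y} px py h = trans (solve 2 (λ x y → x := (x :- y) :+ y) refl x y)
      (trans (+-congʳ (Positive-cancel (Positive-+ px py) (trans (solve 2 (λ x y → (x :+ y) :* (x :- y) := x :* x :- y :* y) refl x y)
        (trans (+-congʳ h) (-‿inverseʳ (y * y)))))) (+-identityˡ y))

    factorᵠ : ℚ → ℕ → ℚ
    factorᵠ b j = 1ℚ -ᵠ b *ᵠ b *ᵠ ι⁻² j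

    -- The wanted bound 1/2 is not inductive. The surplus 1/(2(k + 1)) pays for the next factor,
    -- which is at least 1 - 1/(4(k + 1)²) because b ≤ 1/2.
    Πᵠ-lower : ∀ {b} → 0ℚ ≤ b → b ≤ ½ → ∀ k → ½ *ᵠ (1ℚ +ᵠ 1/suc k) ≤ Πᵠ (factorᵠ b) k
    Πᵠ-lower 0≤b b≤½ zero = ℚ.≤ᵇ⇒≤ {½ *ᵠ (1ℚ +ᵠ 1/suc 0)} {1ℚ} _
    Πᵠ-lower {b} 0≤b b≤½ (suc k) = ℚ.≤-trans step (*-mono-≤ 0≤lhs 0≤fac (Πᵠ-lower 0≤b b≤½ k) fac≥)
      where
      y z ¼ : ℚ
      y = 1/suc k
      z = 1/suc (suc k)
      ¼ = ½ *ᵠ ½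
      0≤y : 0ℚ ≤ y
      0≤y = ℚ.<⇒≤ (0<1/suc k)
      0≤z : 0ℚ ≤ z
      0≤z = ℚ.<⇒≤ (0<1/suc (suc k))
      y≤1 : y ≤ 1ℚ
      y≤1 = 1/suc-antitone {0} {k} ℕ.z≤n
      0≤lhs : 0ℚ ≤ ½ *ᵠ (1ℚ +ᵠ y)
      0≤lhs = 0≤* (ℚ.<⇒≤ 0<½) (0≤+ 0≤1 0≤y)
      sq≤ : b *ᵠ b *ᵠ ι⁻² (suc k) ≤ ¼ *ᵠ (y *ᵠ y)
      sq≤ = subst (λ v → b *ᵠ b *ᵠ (v *ᵠ v) ≤ ¼ *ᵠ (y *ᵠ y)) (≡.sym (ι⁻¹-suc k)) (*-monoʳ (0≤* 0≤y 0≤y) (*-mono-≤ 0≤b (ℚ.<⇒≤ 0<½) b≤½ b≤½))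
      fac≥ : 1ℚ -ᵠ ¼ *ᵠ (y *ᵠ y) ≤ factorᵠ b (suc k)
      fac≥ = ℚ.+-monoʳ-≤ 1ℚ (ℚ.neg-antimono-≤ sq≤)
      0≤fac : 0ℚ ≤ factorᵠ b (suc k)
      0≤fac = ℚ.≤-trans (ℚ.≤-trans (ℚ.≤ᵇ⇒≤ {0ℚ} {1ℚ -ᵠ ¼ *ᵠ (1ℚ *ᵠ 1ℚ)} _)
        (ℚ.+-monoʳ-≤ 1ℚ (ℚ.neg-antimono-≤ (*-monoˡ (ℚ.≤ᵇ⇒≤ {0ℚ} {¼} _) (*-mono-≤ 0≤y 0≤1 y≤1 y≤1))))) fac≥
      y-z : y ≡ z +ᵠ y *ᵠ z
      y-z = ≡.trans (≡.trans (≡.sym (ℚ.*-identityʳ y)) (cong (y *ᵠ_) (≡.sym (≡.trans (cong (z *ᵠ_) (≡.sym (ι-suc (suc k)))) (1/suc-inverse (suc k))))))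
        (≡.trans (solveᵠ 3 (λ y z n → y :*ᵠ (z :*ᵠ (conᵠ 1ℚ :+ᵠ n)) :=ᵠ z :*ᵠ (y :*ᵠ n) :+ᵠ y :*ᵠ z) ≡.refl y z (ι (suc k)))
          (cong (_+ᵠ y *ᵠ z) (≡.trans (cong (z *ᵠ_) (1/suc-inverse k)) (ℚ.*-identityʳ z))))
      step : ½ *ᵠ (1ℚ +ᵠ z) ≤ ½ *ᵠ (1ℚ +ᵠ y) *ᵠ (1ℚ -ᵠ ¼ *ᵠ (y *ᵠ y))
      -- The difference of the two sides in a visibly nonnegative form, valid modulo y = z + yz,
      -- that is, 1/(k + 1) - 1/(k + 2) = 1/((k + 1)(k + 2)).
      step = ≤-diff (½ *ᵠ (y *ᵠ (½ *ᵠ (½ *ᵠ (y *ᵠ (1ℚ -ᵠ y))) +ᵠ ½ *ᵠ (z *ᵠ (1ℚ -ᵠ y)))))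
        (0≤* (ℚ.<⇒≤ 0<½) (0≤* 0≤y (0≤+ (0≤* (ℚ.<⇒≤ 0<½) (0≤* (ℚ.<⇒≤ 0<½) (0≤* 0≤y 0≤1-y))) (0≤* (ℚ.<⇒≤ 0<½) (0≤* 0≤z 0≤1-y)))))
        (expand y z y-z)
        where
        0≤1-y : 0ℚ ≤ 1ℚ -ᵠ y
        0≤1-y = subst (_≤ 1ℚ -ᵠ y) (ℚ.+-inverseʳ y) (ℚ.+-monoˡ-≤ (-ᵠ y) y≤1)
        expand : ∀ y z → y ≡ z +ᵠ y *ᵠ z → ½ *ᵠ (1ℚ +ᵠ y) *ᵠ (1ℚ -ᵠ ¼ *ᵠ (y *ᵠ y)) ≡
          ½ *ᵠ (1ℚ +ᵠ z) +ᵠ ½ *ᵠ (y *ᵠ (½ *ᵠ (½ *ᵠ (y *ᵠ (1ℚ -ᵠ y))) +ᵠ ½ *ᵠ (z *ᵠ (1ℚ -ᵠ y))))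
        expand y z h = ≡.trans
          (solveᵠ 2 (λ y z → conᵠ ½ :*ᵠ (conᵠ 1ℚ :+ᵠ y) :*ᵠ (conᵠ 1ℚ :-ᵠ conᵠ ½ :*ᵠ conᵠ ½ :*ᵠ (y :*ᵠ y)) :=ᵠ
            conᵠ ½ :*ᵠ (conᵠ 1ℚ :+ᵠ z) :+ᵠ conᵠ ½ :*ᵠ (y :*ᵠ (conᵠ ½ :*ᵠ (conᵠ ½ :*ᵠ (y :*ᵠ (conᵠ 1ℚ :-ᵠ y))) :+ᵠ conᵠ ½ :*ᵠ (z :*ᵠ (conᵠ 1ℚ :-ᵠ y))))
            :+ᵠ conᵠ ½ :*ᵠ (conᵠ ½ :*ᵠ y :-ᵠ conᵠ 1ℚ) :*ᵠ (z :+ᵠ y :*ᵠ z :-ᵠ y)) ≡.refl y z)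
          (≡.trans (cong (λ v → R +ᵠ ½ *ᵠ (½ *ᵠ y -ᵠ 1ℚ) *ᵠ v) (≡.trans (cong (_-ᵠ y) (≡.sym h)) (ℚ.+-inverseʳ y)))
            (≡.trans (cong (R +ᵠ_) (ℚ.*-zeroʳ (½ *ᵠ (½ *ᵠ y -ᵠ 1ℚ)))) (ℚ.+-identityʳ R)))
          where
          R : ℚ
          R = ½ *ᵠ (1ℚ +ᵠ z) +ᵠ ½ *ᵠ (y *ᵠ (½ *ᵠ (½ *ᵠ (y *ᵠ (1ℚ -ᵠ y))) +ᵠ ½ *ᵠ (z *ᵠ (1ℚ -ᵠ y))))

    euler-κ : ∀ b r → euler (κ b) r ≈ κ (b *ᵠ Πᵠ (factorᵠ b) r)
    euler-κ b r = trans (*-congˡ (products r)) (sym (κ-* b (Πᵠ (factorᵠ b) r)))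
      where
      products : ∀ r → Π (λ j → 1# - κ b * κ b * (κ (ι⁻¹ j) * κ (ι⁻¹ j))) r ≈ κ (Πᵠ (factorᵠ b) r)
      products zero    = sym κ-1
      products (suc r) = trans (*-cong (products r) step) (sym (κ-* (Πᵠ (factorᵠ b) r) (factorᵠ b (suc r))))
        where
        q : ℚ
        q = ι⁻¹ (suc r)
        step : 1# - κ b * κ b * (κ q * κ q) ≈ κ (factorᵠ b (suc r))
        step = sym (trans (κ-+ 1ℚ (-ᵠ (b *ᵠ b *ᵠ (q *ᵠ q)))) (+-cong κ-1 (trans (κ-‿ (b *ᵠ b *ᵠ (q *ᵠ q)))
          (-‿cong (trans (κ-* (b *ᵠ b) (q *ᵠ q)) (*-cong (κ-* b b) (κ-* q q)))))))

    -- Positivity is read off Euler's product, whose partial products at a rational point are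
    -- rational and at least b/2.
    Positive-σ : ∀ {b} → 0ℚ < b → b ≤ ½ → Positive (σ (κ b))
    Positive-σ {b} 0<b b≤½ = Positive-limit (0<* 0<b 0<½) (λ r → b *ᵠ Πᵠ (factorᵠ b) r) (euler-κ b)
      (λ r → *-monoˡ (ℚ.<⇒≤ 0<b) (ℚ.≤-trans (half≤ r) (Πᵠ-lower (ℚ.<⇒≤ 0<b) b≤½ r))) (euler⇝σ (κ b))
      where
      half≤ : ∀ r → ½ ≤ ½ *ᵠ (1ℚ +ᵠ 1/suc r)
      half≤ r = ≤-diff (½ *ᵠ 1/suc r) (0≤* (ℚ.<⇒≤ 0<½) (ℚ.<⇒≤ (0<1/suc r)))
        (solveᵠ 1 (λ y → conᵠ ½ :*ᵠ (conᵠ 1ℚ :+ᵠ y) :=ᵠ conᵠ ½ :+ᵠ conᵠ ½ :*ᵠ y) ≡.refl (1/suc r))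

    -- first a m and second a m are the factors of the symmetric product for
    -- sin(πa)/π at the integers -m and m + 1.
    first second : Carrier → ℕ → Carrier
    first a zero    = a
    first a (suc m) = 1# + a * κ (ι⁻¹ (suc m))
    second a m = 1# - a * κ (ι⁻¹ (suc m))

    symmetric : Carrier → ℕ → Carrier
    symmetric a zero    = 1#
    symmetric a (suc m) = symmetric a m * (first a m * second a m)

    -- The symmetric product covers the integers from -m to m + 1, one more on the right, because
    -- the block k = Mq + 1, ..., Mq + q yields the factors at -M and at M + 1. The excess factor
    -- `second a m` tends to 1.
    symmetric-euler : ∀ a m → symmetric a (suc m) ≈ euler a m * second a m
    symmetric-euler a zero    = trans (*-identityˡ (a * second a 0)) (*-congʳ (sym (*-identityʳ a)))
    symmetric-euler a (suc m) = trans (*-congʳ (symmetric-euler a m)) (trans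
      (solve 6 (λ a p o s k S → a :* p :* (o :- s) :* ((o :+ s) :* S) := a :* (p :* (o :* o :- s :* s)) :* S) refl
        a (Π (λ j → 1# - a * a * (κ (ι⁻¹ j) * κ (ι⁻¹ j))) m) 1# (a * k) k (second a (suc m)))
      (*-congʳ (*-congˡ (*-congˡ (+-cong (*-identityˡ 1#) (-‿cong (solve 2 (λ a k → a :* k :* (a :* k) := a :* a :* (k :* k)) refl a k)))))))
      where
      k : Carrier
      k = κ (ι⁻¹ (suc m))

    second⇝1 : ∀ a → second a ⇝ 1#
    second⇝1 a = go (bounded a)
      where
      go : (∃ λ R → a ≼ R) → second a ⇝ 1#
      go (R , a≼R) = ⇝-rate R (≼⇒0≤ a≼R) (0 , λ m _ → ≼-resp (solve 2 (λ o x → :- x := (o :- x) :- o) refl 1# (a * κ (ι⁻¹ (suc m))))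
        (≼-‿ (≼-* a≼R (subst (λ q → κ q ≼ 1/suc m) (≡.sym (ι⁻¹-suc m)) (κ≼ (ℚ.<⇒≤ (0<1/suc m)) ℚ.≤-refl)))))

    symmetric⇝σ : ∀ a → symmetric a ⇝ σ a
    symmetric⇝σ a = limit λ ε 0<ε → go ε (converges shifted ε 0<ε)
      where
      shifted : (λ m → symmetric a (suc m)) ⇝ σ a
      shifted = ⇝-resp (0 , λ m _ → sym (symmetric-euler a m)) (*-identityʳ (σ a)) (⇝-* (euler⇝σ a) (second⇝1 a))
      go : ∀ ε → (∃ λ N → ∀ n → N ℕ.≤ n → symmetric a (suc n) - σ a ≼ ε) → ∃ λ N → ∀ n → N ℕ.≤ n → symmetric a n - σ a ≼ ε
      go ε (N , b) = suc N , λ { (suc n) (ℕ.s≤s N≤n) → b n N≤n }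

  -- Prime powers and coprimality.

  module PrimePowers where
    open ℕC using (Coprime)

    prime≢1 : ∀ {p} → Prime p → p ≡ 1 → ∀ {A : Set} → A
    prime≢1 pp ≡.refl = contradiction (prime⇒nonTrivial pp) λ ()

    prime∣prime : ∀ {p r} → Prime p → Prime r → p ℕ.∣ r → p ≡ r
    prime∣prime pp pr p∣r = go (prime⇒irreducible pr p∣r)
      where
      go : _ ⊎ _ → _
      go (inj₁ p≡1) = prime≢1 pp p≡1
      go (inj₂ p≡r) = p≡r

    prime∣^ : ∀ {p r} → Prime p → Prime r → ∀ k → p ℕ.∣ r ℕ.^ k → p ≡ r
    prime∣^ pp pr zero    p∣1 = prime≢1 pp (ℕ.∣1⇒≡1 p∣1)
    prime∣^ {p} {r} pp pr (suc k) p∣ = go (euclidsLemma r (r ℕ.^ k) pp p∣)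
      where
      go : p ℕ.∣ r ⊎ p ℕ.∣ r ℕ.^ k → p ≡ r
      go (inj₁ p∣r)  = prime∣prime pp pr p∣r
      go (inj₂ p∣rᵏ) = prime∣^ pp pr k p∣rᵏ

    PrimePower-prime-unique : ∀ {p r} → Prime p → Prime r → ∀ k l → p ℕ.^ suc k ≡ r ℕ.^ suc l → p ≡ r
    PrimePower-prime-unique {p} pp pr k l eq = prime∣^ pp pr (suc l) (≡.subst (p ℕ.∣_) eq (ℕ.m∣m*n (p ℕ.^ k)))

    PrimePower-cancel : ∀ {p m} → Prime p → PrimePower (p ℕ.* m) → m ≡ 1 ⊎ PrimePower m × p ℕ.∣ m
    PrimePower-cancel {p} {m} pp (r , pr , k , eq) = go (prime∣^ pp pr (suc k) (≡.subst (p ℕ.∣_) eq (ℕ.m∣m*n m))) k eq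
      where
      go : p ≡ r → ∀ k → p ℕ.* m ≡ r ℕ.^ suc k → m ≡ 1 ⊎ PrimePower m × p ℕ.∣ m
      go ≡.refl k eq = split k (ℕ.*-cancelˡ-≡ m (p ℕ.^ k) p {{prime⇒nonZero pp}} eq)
        where
        split : ∀ k → m ≡ p ℕ.^ k → m ≡ 1 ⊎ PrimePower m × p ℕ.∣ m
        split zero    e = inj₁ e
        split (suc k) e = inj₂ ((p , pp , k , e) , ≡.subst (p ℕ.∣_) (≡.sym e) (ℕ.m∣m*n (p ℕ.^ k)))

    coprime-*⁻ : ∀ {j} p m → Coprime j (p ℕ.* m) → Coprime j m
    coprime-*⁻ p m c (d∣j , d∣m) = c (d∣j , ℕ.∣-trans d∣m (ℕ.n∣m*n p))

    coprime-*⇒∤ : ∀ {j p} m → Prime p → Coprime j (p ℕ.* m) → ¬ p ℕ.∣ j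
    coprime-*⇒∤ m pp c p∣j = prime≢1 pp (c (p∣j , ℕ.m∣m*n m))

    coprime-*⁺ : ∀ {j p m} → Prime p → Coprime j m → ¬ p ℕ.∣ j → Coprime j (p ℕ.* m)
    coprime-*⁺ {j} {p} {m} pp c p∤j {d} (d∣j , d∣pm) = c (d∣j , ℕC.coprime-divisor d⊥p d∣pm)
      where
      d⊥p : Coprime d p
      d⊥p (e∣d , e∣p) = go (prime⇒irreducible pp e∣p)
        where
        go : _ ⊎ _ → _
        go (inj₁ e≡1) = e≡1
        go (inj₂ e≡p) = contradiction (ℕ.∣-trans (≡.subst (ℕ._∣ d) e≡p e∣d) d∣j) p∤j

  -- Products over residues coprime to the modulus.

  module Selection (M : CommutativeMonoid 0ℓ 0ℓ) where
    open CommutativeMonoid M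
    open Products M

    -- Unwanted factors are replaced by the unit instead of being filtered out, so that the index
    -- range stays an interval and can be split, reversed and folded.
    select : ∀ {P : Set} → Dec P → Carrier → Carrier
    select (yes _) x = x
    select (no  _) x = ε

    select-yes : ∀ {P : Set} (d : Dec P) {x} → P → select d x ≈ x
    select-yes (yes _) p = refl
    select-yes (no ¬p) p = contradiction p ¬p

    select-no : ∀ {P : Set} (d : Dec P) {x} → ¬ P → select d x ≈ ε
    select-no (yes p) ¬p = contradiction p ¬p
    select-no (no  _) ¬p = refl

    select-cong : ∀ {P Q : Set} (d : Dec P) (e : Dec Q) {x y} → (P → Q) → (Q → P) → (P → x ≈ y) → select d x ≈ select e y
    select-cong (yes p) e f g h = trans (h p) (sym (select-yes e (f p)))
    select-cong (no ¬p) e f g h = sym (select-no e (λ q → ¬p (g q)))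

    select-∙ : ∀ {P : Set} (d : Dec P) x y → select d (x ∙ y) ≈ select d x ∙ select d y
    select-∙ (yes _) x y = refl
    select-∙ (no  _) x y = sym (identityˡ ε)

    coprimeOnly : ℕ → (ℕ → Carrier) → ℕ → Carrier
    coprimeOnly q f j = select (ℕC.coprime? j q) (f j)

    foldr-++ : ∀ xs ys → foldr _∙_ ε (xs ++ ys) ≈ foldr _∙_ ε xs ∙ foldr _∙_ ε ys
    foldr-++ []       ys = sym (identityˡ _)
    foldr-++ (x ∷ xs) ys = trans (∙-congˡ (foldr-++ xs ys)) (sym (assoc x (foldr _∙_ ε xs) (foldr _∙_ ε ys)))

    foldr-coprimesUpTo : ∀ f n q → foldr _∙_ ε (map f (coprimesUpTo n q)) ≈ Π (coprimeOnly q f) n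
    foldr-coprimesUpTo f zero    q = refl
    foldr-coprimesUpTo f (suc n) q = trans (reflexive (cong (foldr _∙_ ε) split))
      (trans (foldr-++ (map f (coprimesUpTo n q)) (map f (filter P? (suc n ∷ [])))) (∙-cong (foldr-coprimesUpTo f n q) (last (P? (suc n)))))
      where
      P? : ∀ j → Dec (ℕC.Coprime j q)
      P? j = ℕC.coprime? j q
      split : map f (coprimesUpTo (suc n) q) ≡ map f (coprimesUpTo n q) ++ map f (filter P? (suc n ∷ []))
      split = ≡.trans (cong (λ xs → map f (filter P? (map suc xs))) (≡.sym (upTo-∷ʳ n)))
        (≡.trans (cong (λ xs → map f (filter P? xs)) (map-++ suc (upTo n) (n ∷ [])))
          (≡.trans (cong (map f) (filter-++ P? (map suc (upTo n)) (suc n ∷ []))) (map-++ f (coprimesUpTo n q) (filter P? (suc n ∷ [])))))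
      last : (d : Dec (ℕC.Coprime (suc n) q)) → foldr _∙_ ε (map f (filter P? (suc n ∷ []))) ≈ select d (f (suc n))
      last (yes p) = trans (reflexive (cong (λ xs → foldr _∙_ ε (map f xs)) (filter-accept P? p))) (identityʳ (f (suc n)))
      last (no ¬p) = reflexive (cong (λ xs → foldr _∙_ ε (map f xs)) (filter-reject P? ¬p))

    -- Reflection j ↦ d + 1 - j has a fixed index only for odd d, which is why the middle factor is
    -- assumed trivial in that case alone.
    Π-half : ∀ d f → (∀ r → d ≡ suc (r ℕ.+ r) → f (suc r) ≈ ε) → Π f d ≈ Π (λ j → f j ∙ f (suc d ℕ.∸ j)) (d ℕ./ 2)
    Π-half d f middle = go (d ℕ.% 2) (ℕ.m%n<n d 2) (ℕ.m≡m%n+[m/n]*n d 2)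
      where
      r : ℕ
      r = d ℕ./ 2
      r*2 : r ℕ.* 2 ≡ r ℕ.+ r
      r*2 = ≡.trans (ℕ.*-comm r 2) (cong (r ℕ.+_) (ℕ.+-identityʳ r))
      go : ∀ s → s ℕ.< 2 → d ≡ s ℕ.+ r ℕ.* 2 → Π f d ≈ Π (λ j → f j ∙ f (suc d ℕ.∸ j)) r
      go zero _ e = even (≡.trans e r*2)
        where
        even : ∀ {d} → d ≡ r ℕ.+ r → Π f d ≈ Π (λ j → f j ∙ f (suc d ℕ.∸ j)) r
        even ≡.refl = Π-fold f r
      go (suc zero) _ e = odd (≡.trans e (cong suc r*2)) middle
        where
        odd : ∀ {d} → d ≡ suc (r ℕ.+ r) → (∀ r → d ≡ suc (r ℕ.+ r) → f (suc r) ≈ ε) → Π f d ≈ Π (λ j → f j ∙ f (suc d ℕ.∸ j)) r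
        odd ≡.refl mid = trans (reflexive (cong (Π f) (≡.sym (ℕ.+-suc r r)))) (trans (Π-split f r (suc r))
          (trans (∙-congˡ (trans (Π-head (λ j → f (r ℕ.+ j)) r) (trans (∙-congʳ (trans (reflexive (cong f (ℕ.+-comm r 1))) (mid r ≡.refl))) (identityˡ _))))
            (trans (∙-congˡ (trans (Π-reverse (λ j → f (r ℕ.+ suc j)) r) (Π-cong r λ j _ j≤r → reflexive (cong f (index j j≤r)))))
              (sym (Π-∙ f (λ j → f (suc (suc (r ℕ.+ r)) ℕ.∸ j)) r)))))
          where
          index : ∀ j → j ℕ.≤ r → r ℕ.+ suc (suc r ℕ.∸ j) ≡ suc (suc (r ℕ.+ r)) ℕ.∸ j
          index j j≤r = ≡.trans (ℕ.+-suc r (suc r ℕ.∸ j)) (≡.trans (cong suc (≡.trans (≡.sym (ℕ.+-∸-assoc r (ℕ.m≤n⇒m≤1+n j≤r))) (cong (ℕ._∸ j) (ℕ.+-suc r r))))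
            (≡.sym (ℕ.+-∸-assoc 1 (ℕ.m≤n⇒m≤1+n (ℕ.≤-trans j≤r (ℕ.m≤m+n r r))))))
      go (suc (suc s)) (ℕ.s≤s (ℕ.s≤s ())) _

  -- The value Φ_q(1) by sieving.

  module Sieve (A : Analysis) where
    open Analysis A hiding (zero)
    open Estimates algebra
    open Trigonometry A
    open Polynomials algebra
    open Cyclotomy A
    open Selection *-commutativeMonoid
    open PrimePowers
    open Order
    open Relation.Binary.Reasoning.Setoid setoid

    -- the product of 1 - ζʲ over 1 ≤ j ≤ d coprime to m, where ζ = exp(2πi/(d+1))
    Φ : ℕ → ℕ → Carrier
    Φ m d = Π (coprimeOnly m (λ j → 1# - Roots.ζ d j)) d

    Φ-1 : ∀ d → Φ 1 d ≈ κ (ι (suc d))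
    Φ-1 d = trans (Π-cong d λ j _ _ → select-yes (ℕC.coprime? j 1) (ℕC.sym (ℕC.1-coprimeTo j))) (Roots.Π-one-minus-ζ d)

    Π-multiples : ∀ p-1 g k → (∀ j → ¬ suc p-1 ℕ.∣ j → g j ≈ 1#) → Π g (suc p-1 ℕ.* k) ≈ Π (λ i → g (suc p-1 ℕ.* i)) k
    Π-multiples p-1 g zero    h = reflexive (cong (Π g) (ℕ.*-zeroʳ p-1))
    Π-multiples p-1 g (suc k) h = trans (reflexive (cong (Π g) size))
      (*-cong (trans (Π-split g (p ℕ.* k) p-1) (trans (*-congˡ (Π-ε p-1 λ j 1≤j j≤p-1 → h (p ℕ.* k ℕ.+ j) (not-multiple j 1≤j j≤p-1))) (trans (*-identityʳ _) (Π-multiples p-1 g k h))))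
        (reflexive (cong g (≡.sym size))))
      where
      p : ℕ
      p = suc p-1
      size : p ℕ.* suc k ≡ suc (p ℕ.* k ℕ.+ p-1)
      size = ≡.trans (ℕ.*-suc p k) (≡.trans (ℕ.+-comm p (p ℕ.* k)) (ℕ.+-suc (p ℕ.* k) p-1))
      not-multiple : ∀ j → 1 ℕ.≤ j → j ℕ.≤ p-1 → ¬ p ℕ.∣ p ℕ.* k ℕ.+ j
      not-multiple j 1≤j j≤p-1 d = ℕ.<⇒≱ (ℕ.s≤s j≤p-1) (ℕ.∣⇒≤ {{ℕ.>-nonZero 1≤j}} (ℕ.∣m+n∣m⇒∣n d (ℕ.m∣m*n k)))

    -- The index p · d′ + (p - 1) is the d with d + 1 = p(d′ + 1): multiples of p among the
    -- exponents give the roots of unity of order (d + 1)/p.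
    ζ-multiple : ∀ p-1 d′ i → Roots.ζ (suc p-1 ℕ.* d′ ℕ.+ p-1) (suc p-1 ℕ.* i) ≈ Roots.ζ d′ i
    ζ-multiple p-1 d′ i = *-cong E≈ E≈
      where
      p d : ℕ
      p = suc p-1
      d = p ℕ.* d′ ℕ.+ p-1
      n≡ : suc d ≡ p ℕ.* suc d′
      n≡ = ≡.sym (≡.trans (ℕ.*-suc p d′) (≡.trans (ℕ.+-comm p (p ℕ.* d′)) (ℕ.+-suc (p ℕ.* d′) p-1)))
      frac≡ : frac d (p ℕ.* i) ≡ frac d′ i
      frac≡ = ≡.trans (≡.sym (ℚ.*-identityʳ _)) (≡.trans (cong (frac d (p ℕ.* i) *ᵠ_) (≡.sym (1/suc-inverse d′)))
        (≡.trans (cong (λ v → v *ᵠ 1/suc d *ᵠ (1/suc d′ *ᵠ ι (suc d′))) (ι-* p i))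
          (≡.trans (solveᵠ 5 (λ p i x y n → p :*ᵠ i :*ᵠ x :*ᵠ (y :*ᵠ n) :=ᵠ (x :*ᵠ (p :*ᵠ n)) :*ᵠ (i :*ᵠ y)) ≡.refl (ι p) (ι i) (1/suc d) (1/suc d′) (ι (suc d′)))
            (≡.trans (cong (_*ᵠ frac d′ i) (≡.trans (cong (1/suc d *ᵠ_) (≡.trans (≡.sym (ι-* p (suc d′))) (cong ι (≡.sym n≡)))) (1/suc-inverse d))) (ℚ.*-identityˡ (frac d′ i))))))
      E≈ : e (κ (frac d (p ℕ.* i))) ≈ e (κ (frac d′ i))
      E≈ = e-cong (reflexive (cong κ frac≡))

    -- An index coprime to m is either prime to p, hence coprime to pm, or of the form pi with i
    -- coprime to m; the latter contribute the same product at the smaller modulus.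
    Φ-sieve : ∀ {m p-1} → Prime (suc p-1) → ¬ suc p-1 ℕ.∣ m → ∀ d′ → let d = suc p-1 ℕ.* d′ ℕ.+ p-1 in
      Φ m d ≈ Φ (suc p-1 ℕ.* m) d * Φ m d′
    Φ-sieve {m} {p-1} pp p∤m d′ = trans (Π-cong d λ j _ _ → split j)
        (trans (Π-∙ (coprimeOnly (p ℕ.* m) f) g d) (*-congˡ (trans (Π-split g (p ℕ.* d′) p-1)
          (trans (*-cong (Π-multiples p-1 g d′ (λ j p∤j → select-no (p ℕ.∣? j) p∤j)) (Π-ε p-1 λ j 1≤j j≤p-1 → select-no (p ℕ.∣? (p ℕ.* d′ ℕ.+ j)) (rest j 1≤j j≤p-1)))
            (trans (*-identityʳ _) (Π-cong d′ λ i _ _ → multiple i))))))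
      where
      p d : ℕ
      p = suc p-1
      d = p ℕ.* d′ ℕ.+ p-1
      f g : ℕ → Carrier
      f j = 1# - Roots.ζ d j
      g j = select (p ℕ.∣? j) (coprimeOnly m f j)
      rest : ∀ j → 1 ℕ.≤ j → j ℕ.≤ p-1 → ¬ p ℕ.∣ p ℕ.* d′ ℕ.+ j
      rest j 1≤j j≤p-1 h = ℕ.<⇒≱ (ℕ.s≤s j≤p-1) (ℕ.∣⇒≤ {{ℕ.>-nonZero 1≤j}} (ℕ.∣m+n∣m⇒∣n h (ℕ.m∣m*n d′)))
      split : ∀ j → coprimeOnly m f j ≈ coprimeOnly (p ℕ.* m) f j * g j
      split j = go (p ℕ.∣? j)
        where
        go : Dec (p ℕ.∣ j) → coprimeOnly m f j ≈ coprimeOnly (p ℕ.* m) f j * g j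
        go (yes p∣j) = sym (trans (*-cong (select-no (ℕC.coprime? j (p ℕ.* m)) (λ c → coprime-*⇒∤ m pp c p∣j)) (select-yes (p ℕ.∣? j) p∣j)) (*-identityˡ _))
        go (no p∤j)  = sym (trans (*-cong (select-cong (ℕC.coprime? j (p ℕ.* m)) (ℕC.coprime? j m) (coprime-*⁻ p m) (λ c → coprime-*⁺ pp c p∤j) (λ _ → refl))
          (select-no (p ℕ.∣? j) p∤j)) (*-identityʳ _))
      multiple : ∀ i → g (p ℕ.* i) ≈ coprimeOnly m (λ j → 1# - Roots.ζ d′ j) i
      multiple i = trans (select-yes (p ℕ.∣? (p ℕ.* i)) (ℕ.m∣m*n i)) (select-cong (ℕC.coprime? (p ℕ.* i) m) (ℕC.coprime? i m)
        (λ c → ℕC.sym (coprime-*⁻ p i (ℕC.sym c))) (λ c → ℕC.sym (coprime-*⁺ pp (ℕC.sym c) p∤m)) (λ _ → +-congˡ (-‿cong (ζ-multiple p-1 d′ i))))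

    Φ-repeated : ∀ {m p} → Prime p → p ℕ.∣ m → ∀ d → Φ (p ℕ.* m) d ≈ Φ m d
    Φ-repeated {m} {p} pp p∣m d = Π-cong d λ j _ _ → select-cong (ℕC.coprime? j (p ℕ.* m)) (ℕC.coprime? j m) (coprime-*⁻ p m)
      (λ c → coprime-*⁺ pp c (λ p∣j → prime≢1 pp (c (p∣j , p∣m)))) (λ _ → refl)

    -- The induction adds one prime to m at a time, and `Φ-sieve` compares two moduli, so the value
    -- is asserted for every modulus divisible by m. For m = 1 it is the modulus itself; a first
    -- prime p turns this into the ratio p of two moduli, repeating p changes nothing, and a second
    -- prime gives p/p = 1.
    data Value (m : ℕ) : Set where
      one   : m ≡ 1 → Value m
      power : ∀ p → Prime p → ∀ k → m ≡ p ℕ.^ suc k → (∀ d → m ℕ.∣ suc d → Φ m d ≈ κ (ι p)) → Value m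
      other : ¬ m ≡ 1 → ¬ PrimePower m → (∀ d → m ℕ.∣ suc d → Φ m d ≈ 1#) → Value m

    module _ {m p-1 : ℕ} (pp : Prime (suc p-1)) where
      private
        p : ℕ
        p = suc p-1
      divide : ∀ d → p ℕ.* m ℕ.∣ suc d → ∃ λ d′ → d ≡ p ℕ.* d′ ℕ.+ p-1 × m ℕ.∣ suc d′
      divide d pm∣ = go (ℕ.∣-trans (ℕ.m∣m*n m) pm∣)
        where
        go : p ℕ.∣ suc d → ∃ λ d′ → d ≡ p ℕ.* d′ ℕ.+ p-1 × m ℕ.∣ suc d′
        go (ℕ.divides (suc d′) e) = d′ , d≡ , ℕ.*-cancelˡ-∣ p (≡.subst (p ℕ.* m ℕ.∣_) (≡.trans e (ℕ.*-comm (suc d′) p)) pm∣)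
          where
          d≡ : d ≡ p ℕ.* d′ ℕ.+ p-1
          d≡ = ℕ.suc-injective (≡.trans e (≡.trans (ℕ.*-comm (suc d′) p) (≡.trans (ℕ.*-suc p d′) (≡.trans (ℕ.+-comm p (p ℕ.* d′)) (ℕ.+-suc (p ℕ.* d′) p-1)))))

      sieve : ¬ p ℕ.∣ m → ∀ x → (∀ d′ → m ℕ.∣ suc d′ → let d = p ℕ.* d′ ℕ.+ p-1 in m ℕ.∣ suc d → Unit (Φ m d′) × Φ m d ≈ x * Φ m d′) →
        ∀ d → p ℕ.* m ℕ.∣ suc d → Φ (p ℕ.* m) d ≈ x
      sieve p∤m x h d pm∣ = go (divide d pm∣) (ℕ.∣-trans (ℕ.n∣m*n p) pm∣)
        where
        go : (∃ λ d′ → d ≡ p ℕ.* d′ ℕ.+ p-1 × m ℕ.∣ suc d′) → m ℕ.∣ suc d → Φ (p ℕ.* m) d ≈ x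
        go (d′ , ≡.refl , m∣) m∣d = cancel (proj₁ (h d′ m∣ m∣d)) (trans (*-comm (Φ m d′) (Φ (p ℕ.* m) d))
          (trans (sym (Φ-sieve pp p∤m d′)) (trans (proj₂ (h d′ m∣ m∣d)) (*-comm x (Φ m d′)))))

    prime-*≢1 : ∀ {p m} → Prime p → ¬ p ℕ.* m ≡ 1
    prime-*≢1 {p} {m} pp e = prime≢1 pp (ℕ.m*n≡1⇒m≡1 p m e)

    Value-step : ∀ {m p} → Prime p → Value m → Value (p ℕ.* m)
    Value-step {m} {zero} pp _ = contradiction (prime⇒nonZero pp) λ ()
    Value-step {m} {suc p-1} pp = go (suc p-1 ℕ.∣? m)
      where
      p : ℕ
      p = suc p-1
      go : Dec (p ℕ.∣ m) → Value m → Value (p ℕ.* m)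
      go (yes p∣m) (one m≡1) = prime≢1 pp (ℕ.∣1⇒≡1 (≡.subst (p ℕ.∣_) m≡1 p∣m))
      go (yes p∣m) (power r pr k eq value) = power r pr (suc k)
        (cong₂ ℕ._*_ (prime∣^ pp pr (suc k) (≡.subst (p ℕ.∣_) eq p∣m)) eq)
        (λ d pm∣ → trans (Φ-repeated pp p∣m d) (value d (ℕ.∣-trans (ℕ.n∣m*n p) pm∣)))
      go (yes p∣m) (other m≢1 ¬pp value) = other (prime-*≢1 pp) not
        (λ d pm∣ → trans (Φ-repeated pp p∣m d) (value d (ℕ.∣-trans (ℕ.n∣m*n p) pm∣)))
        where
        not : ¬ PrimePower (p ℕ.* m)
        not h with PrimePower-cancel pp h
        ... | inj₁ m≡1      = m≢1 m≡1
        ... | inj₂ (ppm , _) = ¬pp ppm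
      go (no p∤m) (one ≡.refl) = power p pp 0 ≡.refl (sieve pp p∤m (κ (ι p)) λ d′ _ _ →
        Unit-resp (sym (Φ-1 d′)) (Unit-κ (0<ι-suc d′)) , trans (Φ-1 (p ℕ.* d′ ℕ.+ p-1)) (trans (trans (reflexive (cong κ (size d′))) (κ-* (ι p) (ι (suc d′)))) (*-congˡ (sym (Φ-1 d′)))))
        where
        size : ∀ d′ → ι (suc (p ℕ.* d′ ℕ.+ p-1)) ≡ ι p *ᵠ ι (suc d′)
        size d′ = ≡.trans (cong ι (≡.sym (≡.trans (ℕ.*-suc p d′) (≡.trans (ℕ.+-comm p (p ℕ.* d′)) (ℕ.+-suc (p ℕ.* d′) p-1))))) (ι-* p (suc d′))
      go (no p∤m) (power r pr k eq value) = other (prime-*≢1 pp) not (sieve pp p∤m 1# λ d′ m∣d′ m∣d →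
          Unit-resp (sym (value d′ m∣d′)) (Unit-κ (ℚ.<-≤-trans 0<1 (ι-mono-≤ (ℕ.>-nonZero⁻¹ r {{prime⇒nonZero pr}})))) ,
          trans (value (p ℕ.* d′ ℕ.+ p-1) m∣d) (trans (sym (value d′ m∣d′)) (sym (*-identityˡ _))))
        where
        not : ¬ PrimePower (p ℕ.* m)
        not h with PrimePower-cancel pp h
        ... | inj₁ m≡1       = prime≢1 pr (ℕ.m*n≡1⇒m≡1 r (r ℕ.^ k) (≡.trans (≡.sym eq) m≡1))
        ... | inj₂ (_ , p∣m) = p∤m p∣m
      go (no p∤m) (other m≢1 ¬pp value) = other (prime-*≢1 pp) not (sieve pp p∤m 1# λ d′ m∣d′ m∣d →
          Unit-resp (sym (value d′ m∣d′)) (1# , *-identityˡ 1#) ,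
          trans (value (p ℕ.* d′ ℕ.+ p-1) m∣d) (trans (sym (value d′ m∣d′)) (sym (*-identityˡ _))))
        where
        not : ¬ PrimePower (p ℕ.* m)
        not h with PrimePower-cancel pp h
        ... | inj₁ m≡1       = m≢1 m≡1
        ... | inj₂ (_ , p∣m) = p∤m p∣m

    Value-product : ∀ {ps} → All Prime ps → Value (product ps)
    Value-product []         = one ≡.refl
    Value-product (pp ∷ pps) = Value-step pp (Value-product pps)

    valueOf : ∀ q .{{_ : ℕ.NonZero q}} → Value q
    valueOf q = ≡.subst Value (≡.sym (PrimeFactorisation.isFactorisation (factorise q))) (Value-product (PrimeFactorisation.factorsPrime (factorise q)))

    Φ-primePower : ∀ {q p} → Prime p → ∀ k → suc q ≡ p ℕ.^ suc k → Φ (suc q) q ≈ κ (ι p)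
    Φ-primePower {q} {p} pp k eq = go (valueOf (suc q))
      where
      go : Value (suc q) → Φ (suc q) q ≈ κ (ι p)
      go (one q≡1) = prime≢1 pp (ℕ.m*n≡1⇒m≡1 p (p ℕ.^ k) (≡.trans (≡.sym eq) q≡1))
      go (power r pr l eq′ value) = trans (value q ℕ.∣-refl)
        (reflexive (cong (λ x → κ (ι x)) (PrimePower-prime-unique pr pp l k (≡.trans (≡.sym eq′) eq))))
      go (other _ ¬pp _) = contradiction (p , pp , k , eq) ¬pp

    Φ-notPrimePower : ∀ {q} → 1 ℕ.≤ q → ¬ PrimePower (suc q) → Φ (suc q) q ≈ 1#
    Φ-notPrimePower {q} 1≤q ¬pp = go (valueOf (suc q))
      where
      go : Value (suc q) → Φ (suc q) q ≈ 1#
      go (one q≡1) = contradiction (ℕ.suc-injective q≡1) (ℕ.m<n⇒n≢0 1≤q)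
      go (power r pr l eq _) = contradiction (r , pr , l , eq) ¬pp
      go (other _ _ value) = value q ℕ.∣-refl

  -- Euler's totient counted by reflection.

  module Totient (d : ℕ) (2≤d : 2 ℕ.≤ d) where
    open Selection ℕ.+-0-commutativeMonoid
    open Products ℕ.+-0-commutativeMonoid using () renaming (Π to Σ; Π-cong to Σ-cong; Π-∙ to Σ-+)

    q : ℕ
    q = suc d

    reflect-coprime : ∀ {j} → j ℕ.≤ q → Coprime j q → Coprime (q ℕ.∸ j) q
    reflect-coprime j≤q c {e} (e∣q-j , e∣q) = c (ℕ.∣m+n∣m⇒∣n (subst (e ℕ.∣_) (≡.sym (ℕ.m∸n+n≡m j≤q)) e∣q) e∣q-j , e∣q)

    reflect-coprime⁻ : ∀ {j} → j ℕ.≤ q → Coprime (q ℕ.∸ j) q → Coprime j q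
    reflect-coprime⁻ {j} j≤q c = subst (λ k → Coprime k q) (ℕ.m∸[m∸n]≡n j≤q) (reflect-coprime (ℕ.m∸n≤m q j) c)

    -- Here q = 2(r + 1), so r + 1 divides q and could be coprime to it only for r = 0, that is, q =
    -- 2. This is where q > 2 enters.
    ¬coprime-middle : ∀ r → d ≡ suc (r ℕ.+ r) → ¬ Coprime (suc r) q
    ¬coprime-middle r d≡ c = go r d≡ (c (ℕ.∣-refl , subst (suc r ℕ.∣_) double (ℕ.m∣m*n 2)))
      where
      double : suc r ℕ.* 2 ≡ q
      double = ≡.trans (ℕ.*-comm (suc r) 2) (≡.trans (cong (suc r ℕ.+_) (ℕ.+-identityʳ (suc r))) (cong suc (≡.trans (ℕ.+-suc r r) (≡.sym d≡))))
      go : ∀ r → d ≡ suc (r ℕ.+ r) → ¬ suc r ≡ 1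
      go zero d≡1 _ = ℕ.<⇒≱ (subst (ℕ._< 2) (≡.sym d≡1) (ℕ.n<1+n 1)) 2≤d

    ¬coprime-q : ∀ M → ¬ Coprime (M ℕ.* q ℕ.+ q) q
    ¬coprime-q M c = ℕ.<⇒≢ (ℕ.≤-trans 2≤d (ℕ.n≤1+n d)) (≡.sym (c (ℕ.∣m∣n⇒∣m+n (ℕ.n∣m*n M) ℕ.∣-refl , ℕ.∣-refl)))

    count : ℕ
    count = Σ (coprimeOnly q (λ _ → 1)) (d ℕ./ 2)

    length-foldr : ∀ (xs : List ℕ) → length xs ≡ foldr ℕ._+_ 0 (map (λ _ → 1) xs)
    length-foldr []       = ≡.refl
    length-foldr (x ∷ xs) = cong suc (length-foldr xs)

    half≤ : ∀ {j} → j ℕ.≤ d ℕ./ 2 → j ℕ.+ j ℕ.≤ d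
    half≤ {j} j≤ = ℕ.≤-trans (ℕ.+-mono-≤ j≤ j≤) (subst (ℕ._≤ d) (≡.trans (ℕ.*-comm (d ℕ./ 2) 2) (cong (d ℕ./ 2 ℕ.+_) (ℕ.+-identityʳ (d ℕ./ 2)))) (ℕ.m/n*n≤m d 2))

    φ-count : φ q ≡ count ℕ.* 2
    φ-count = begin
      φ q                                                ≡⟨ length-foldr (coprimesUpTo q q) ⟩
      foldr ℕ._+_ 0 (map (λ _ → 1) (coprimesUpTo q q))   ≡⟨ foldr-coprimesUpTo (λ _ → 1) q q ⟩
      Σ m d ℕ.+ m q                                      ≡⟨ cong (Σ m d ℕ.+_) (select-no (ℕC.coprime? q q) (¬coprime-q 0)) ⟩
      Σ m d ℕ.+ 0                                        ≡⟨ ℕ.+-identityʳ (Σ m d) ⟩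
      Σ m d                                              ≡⟨ Π-half d m (λ r d≡ → select-no (ℕC.coprime? (suc r) q) (¬coprime-middle r d≡)) ⟩
      Σ (λ j → m j ℕ.+ m (q ℕ.∸ j)) (d ℕ./ 2)            ≡⟨ Σ-cong (d ℕ./ 2) (λ j _ j≤ → cong (m j ℕ.+_) (same j (ℕ.≤-trans (ℕ.m≤m+n j j) (ℕ.≤-trans (half≤ j≤) (ℕ.n≤1+n d))))) ⟩
      Σ (λ j → m j ℕ.+ m j) (d ℕ./ 2)                    ≡⟨ Σ-+ m m (d ℕ./ 2) ⟩
      count ℕ.+ count                                    ≡⟨ cong (count ℕ.+_) (ℕ.+-identityʳ count) ⟨
      2 ℕ.* count                                        ≡⟨ ℕ.*-comm 2 count ⟩
      count ℕ.* 2                                        ∎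
      where
      open ≡.≡-Reasoning
      m : ℕ → ℕ
      m = coprimeOnly q (λ _ → 1)
      same : ∀ j → j ℕ.≤ q → m (q ℕ.∸ j) ≡ m j
      same j j≤q = select-cong (ℕC.coprime? (q ℕ.∸ j) q) (ℕC.coprime? j q) (reflect-coprime⁻ j≤q) (reflect-coprime j≤q) (λ _ → ≡.refl)

    φ/2 : φ q ℕ./ 2 ≡ count
    φ/2 = ≡.trans (cong (ℕ._/ 2) φ-count) (ℕ.m*n/n≡m count 2)

  -- The product over a character.

  module Assembly (A : Analysis) where
    open Analysis A hiding (zero)
    open Solver algebra using (solve; _:=_; _:*_; _:+_; _:-_; :-_; con)
    open Estimates algebra
    open Trigonometry A
    open Polynomials algebra
    open Limits algebra
    open Sine A
    open Cyclotomy A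
    open EulerProduct A
    open Positivity A
    open Sieve A
    open Selection *-commutativeMonoid
    open RationalProducts using (ι⁻¹; ι⁻¹-suc; ι⁻¹-inverse)
    open Order

    Π-⇝ : ∀ (f : ℕ → ℕ → Carrier) L n → (∀ j → 1 ℕ.≤ j → j ℕ.≤ n → (λ M → f M j) ⇝ L j) → (λ M → Π (f M) n) ⇝ Π L n
    Π-⇝ f L zero    h = ⇝-const 1#
    Π-⇝ f L (suc n) h = ⇝-* (Π-⇝ f L n λ j 1≤j j≤n → h j 1≤j (ℕ.m≤n⇒m≤1+n j≤n)) (h (suc n) (ℕ.s≤s ℕ.z≤n) ℕ.≤-refl)

    select-⇝ : ∀ {P : Set} (p : Dec P) {f L} → f ⇝ L → (λ M → select p (f M)) ⇝ select p L
    select-⇝ (yes _) h = h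
    select-⇝ (no  _) h = ⇝-const 1#

    Unit-select : ∀ {P : Set} (p : Dec P) {x} → Unit x → Unit (select p x)
    Unit-select (yes _) u = u
    Unit-select (no  _) u = 1# , *-identityˡ 1#

    Positive-select : ∀ {P : Set} (p : Dec P) {x} → Positive x → Positive (select p x)
    Positive-select (yes _) h = h
    Positive-select (no  _) h = Positive-1

    Unit-Π : ∀ f n → (∀ j → 1 ℕ.≤ j → j ℕ.≤ n → Unit (f j)) → Unit (Π f n)
    Unit-Π f zero    h = 1# , *-identityˡ 1#
    Unit-Π f (suc n) h = Unit-* (Unit-Π f n λ j 1≤j j≤n → h j 1≤j (ℕ.m≤n⇒m≤1+n j≤n)) (h (suc n) (ℕ.s≤s ℕ.z≤n) ℕ.≤-refl)

    ⇝-residues : ∀ {f L} d → (∀ s → (λ M → f (M ℕ.* suc d ℕ.+ s)) ⇝ L) → f ⇝ L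
    ⇝-residues {f} {L} d h = limit λ ε 0<ε → go ε (common ε 0<ε q)
      where
      q : ℕ
      q = suc d
      common : ∀ ε → 0ℚ < ε → ∀ k → ∃ λ N → ∀ s → s ℕ.< k → ∀ M → N ℕ.≤ M → f (M ℕ.* q ℕ.+ s) - L ≼ ε
      common ε 0<ε zero    = 0 , λ s ()
      common ε 0<ε (suc k) = join (common ε 0<ε k) (converges (h k) ε 0<ε)
        where
        join : (∃ λ N → ∀ s → s ℕ.< k → ∀ M → N ℕ.≤ M → f (M ℕ.* q ℕ.+ s) - L ≼ ε) →
          (∃ λ N → ∀ M → N ℕ.≤ M → f (M ℕ.* q ℕ.+ k) - L ≼ ε) → ∃ λ N → ∀ s → s ℕ.< suc k → ∀ M → N ℕ.≤ M → f (M ℕ.* q ℕ.+ s) - L ≼ ε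
        join (N₁ , b₁) (N₂ , b₂) = N₁ ℕ.⊔ N₂ , λ s s<1+k M N≤M → choose s M N≤M (ℕ.m≤n⇒m<n∨m≡n (ℕ.s≤s⁻¹ s<1+k))
          where
          choose : ∀ s M → N₁ ℕ.⊔ N₂ ℕ.≤ M → s ℕ.< k ⊎ s ≡ k → f (M ℕ.* q ℕ.+ s) - L ≼ ε
          choose s M N≤M (inj₁ s<k)    = b₁ s s<k M (ℕ.m⊔n≤o⇒m≤o N₁ N₂ N≤M)
          choose s M N≤M (inj₂ ≡.refl) = b₂ M (ℕ.m⊔n≤o⇒n≤o N₁ N₂ N≤M)
      go : ∀ ε → (∃ λ N → ∀ s → s ℕ.< q → ∀ M → N ℕ.≤ M → f (M ℕ.* q ℕ.+ s) - L ≼ ε) → ∃ λ N → ∀ n → N ℕ.≤ n → f n - L ≼ ε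
      go ε (N , b) = N ℕ.* q , λ n Nq≤n → subst (λ k → f k - L ≼ ε)
        (≡.sym (≡.trans (ℕ.m≡m%n+[m/n]*n n q) (ℕ.+-comm (n ℕ.% q) (n ℕ./ q ℕ.* q))))
        (b (n ℕ.% q) (ℕ.m%n<n n q) (n ℕ./ q) (ℕ.≤-trans (ℕ.≤-reflexive (≡.sym (ℕ.m*n/n≡m N q))) (ℕ./-monoˡ-≤ q Nq≤n)))

    sine : Carrier → Carrier
    sine x = D x * (- ı * κ ½)

    sine-σ : ∀ x → sine x ≈ π * σ x
    sine-σ x = trans (*-congʳ (D-σ x)) (trans
      (solve 3 (λ s j p → s :* (con (ι 2) :* (j :* p)) :* (:- j :* con ½) := :- (j :* j) :* (p :* s)) refl (σ x) ı π)
      (trans (*-congʳ (trans (-‿cong (trans ı*ı (-‿cong (sym κ-1)))) (trans (solve 0 (:- :- con 1ℚ := con 1ℚ) refl) κ-1))) (*-identityˡ _)))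

    -- `X` is the character on natural numbers. The residue -j appears as q - j, so oddness is
    -- assumed jointly with periodicity, as `X-reflect`. In what follows c also includes k = 1,
    -- whose factor is 1 - z.
    module Character (d : ℕ) (2≤d : 2 ℕ.≤ d) (X : ℕ → Carrier) (z : Carrier)
      (X-1 : X 1 ≈ 1#) (X-0 : ∀ k → ¬ Coprime k (suc d) → X k ≈ 0#)
      (X-period : ∀ M j → X (M ℕ.* suc d ℕ.+ j) ≈ X j)
      (X-reflect : ∀ M j → j ℕ.≤ suc d → X (M ℕ.* suc d ℕ.+ (suc d ℕ.∸ j)) ≈ - X j) where

      open Totient d 2≤d
      open Roots d

      r : ℕ
      r = d ℕ./ 2

      c : ℕ → Carrier
      c k = 1# - X k * (z * κ (ι⁻¹ k))

      a b : ℕ → Carrier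
      a j = (κ (ι j) - X j * z) * κ (1/suc d)
      b j = κ (ι j) * κ (1/suc d)

      b-frac : ∀ j → b j ≈ κ (frac d j)
      b-frac j = sym (κ-* (ι j) (1/suc d))

      frac≤½ : ∀ {j} → j ℕ.≤ r → frac d j ≤ ½
      frac≤½ {j} j≤r = j+j≤n⇒frac≤½ d {j} (ℕ.m≤n⇒m≤1+n (half≤ j≤r))

      j≤q : ∀ {j} → j ℕ.≤ r → j ℕ.≤ q
      j≤q {j} j≤r = ℕ.≤-trans (ℕ.m≤m+n j j) (ℕ.≤-trans (half≤ j≤r) (ℕ.n≤1+n d))

      Q Q′ : Carrier
      Q  = κ (1/suc d)
      Q′ = κ (ι q)

      QQ′ : Q * Q′ ≈ 1#
      QQ′ = κ-1/suc d

      κι⁻¹ : ∀ {k} → 1 ℕ.≤ k → κ (ι⁻¹ k) * κ (ι k) ≈ 1#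
      κι⁻¹ {suc k} _ = κ-inverse (ι⁻¹-inverse k)

      κι-+ : ∀ M j → κ (ι (M ℕ.* q ℕ.+ j)) ≈ κ (ι M) * Q′ + κ (ι j)
      κι-+ M j = trans (reflexive (cong κ (≡.trans (ι-+ (M ℕ.* q) j) (cong (_+ᵠ ι j) (ι-* M q)))))
        (trans (κ-+ (ι M *ᵠ ι q) (ι j)) (+-congʳ (κ-* (ι M) (ι q))))

      -- For k = Mq + j one has k = q(M + b_j) and k - χ(k)z = q(M + a_j), so c(k) is the ratio of M
      -- + a_j to M + b_j; both are divided by M when M > 0.
      first-ratio : ∀ M j → 1 ℕ.≤ j → c (M ℕ.* q ℕ.+ j) * first (b j) M ≈ first (a j) M
      first-ratio zero j 1≤j = trans (solve 6 (λ o x z k J Q → (o :- x :* (z :* k)) :* (J :* Q) := (o :* J :- x :* z :* (k :* J)) :* Q) refl 1# (X j) z (κ (ι⁻¹ j)) (κ (ι j)) Q)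
        (*-congʳ (+-cong (*-identityˡ _) (-‿cong (trans (*-congˡ (κι⁻¹ 1≤j)) (*-identityʳ _)))))
      first-ratio (suc M-1) j 1≤j = begin
        (1# - X k * (z * p)) * (1# + b j * m)        ≈⟨ *-cong (+-congˡ (-‿cong (*-congʳ (X-period M j)))) b-step ⟩
        (1# - x * (z * p)) * (κ (ι k) * (Q * m))     ≈⟨ solve 6 (λ o x z p k Q → (o :- x :* (z :* p)) :* (k :* Q) := o :* k :* Q :- x :* z :* (p :* k) :* Q) refl 1# x z p (κ (ι k)) (Q * m) ⟩
        1# * κ (ι k) * (Q * m) - x * z * (p * κ (ι k)) * (Q * m)
          ≈⟨ +-cong (*-congʳ (trans (*-identityˡ _) (κι-+ M j))) (-‿cong (*-congʳ (trans (*-congˡ (κι⁻¹ 1≤k)) (*-identityʳ _)))) ⟩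
        (κ (ι M) * Q′ + J) * (Q * m) - x * z * (Q * m)
          ≈⟨ solve 6 (λ M Q′ J Q m x → (M :* Q′ :+ J) :* (Q :* m) :- x :* (Q :* m) := (m :* M) :* (Q :* Q′) :+ (J :- x) :* Q :* m) refl (κ (ι M)) Q′ J Q m (x * z) ⟩
        m * κ (ι M) * (Q * Q′) + (J - x * z) * Q * m
          ≈⟨ +-congʳ (trans (*-cong (κι⁻¹ {M} (ℕ.s≤s ℕ.z≤n)) QQ′) (*-identityˡ 1#)) ⟩
        1# + a j * m                                 ∎
        where
        open Relation.Binary.Reasoning.Setoid setoid
        M k : ℕ
        M = suc M-1
        k = M ℕ.* q ℕ.+ j
        p m x J : Carrier
        p = κ (ι⁻¹ k)
        m = κ (ι⁻¹ M)
        x = X j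
        J = κ (ι j)
        1≤k : 1 ℕ.≤ k
        1≤k = ℕ.≤-trans 1≤j (ℕ.m≤n+m j (M ℕ.* q))
        b-step : 1# + b j * m ≈ κ (ι k) * (Q * m)
        b-step = sym (trans (*-congʳ (κι-+ M j)) (trans (solve 5 (λ M Q′ J Q m → (M :* Q′ :+ J) :* (Q :* m) := (m :* M) :* (Q :* Q′) :+ J :* Q :* m) refl (κ (ι M)) Q′ J Q m)
          (+-congʳ (trans (*-cong (κι⁻¹ {M} (ℕ.s≤s ℕ.z≤n)) QQ′) (*-identityˡ 1#)))))

      -- For k = Mq + q - j oddness gives χ(k) = -χ(j), so k = q(M + 1 - b_j) and k - χ(k)z = q(M +
      -- 1 - a_j): the same a_j occurs with the opposite sign, which is what turns the pair into a
      -- sine.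
      second-ratio : ∀ M j → j ℕ.≤ d → c (M ℕ.* q ℕ.+ (q ℕ.∸ j)) * second (b j) M ≈ second (a j) M
      second-ratio M j j≤d = begin
        (1# - X k * (z * p)) * (1# - b j * m)        ≈⟨ *-cong (+-congˡ (-‿cong (*-congʳ (X-reflect M j (ℕ.m≤n⇒m≤1+n j≤d))))) b-step ⟩
        (1# - - x * (z * p)) * (κ (ι k) * (Q * m))   ≈⟨ solve 6 (λ o x z p k Q → (o :- :- x :* (z :* p)) :* (k :* Q) := o :* k :* Q :+ x :* z :* (p :* k) :* Q) refl 1# x z p (κ (ι k)) (Q * m) ⟩
        1# * κ (ι k) * (Q * m) + x * z * (p * κ (ι k)) * (Q * m)
          ≈⟨ +-cong (*-congʳ (trans (*-identityˡ _) k≈)) (*-congʳ (trans (*-congˡ (κι⁻¹ 1≤k)) (*-identityʳ _))) ⟩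
        (S * Q′ - J) * (Q * m) + x * z * (Q * m)
          ≈⟨ solve 6 (λ M Q′ J Q m x → (M :* Q′ :- J) :* (Q :* m) :+ x :* (Q :* m) := (m :* M) :* (Q :* Q′) :- (J :- x) :* Q :* m) refl S Q′ J Q m (x * z) ⟩
        m * S * (Q * Q′) - (J - x * z) * Q * m
          ≈⟨ +-congʳ (trans (*-cong (κι⁻¹ {suc M} (ℕ.s≤s ℕ.z≤n)) QQ′) (*-identityˡ 1#)) ⟩
        1# - a j * m                                 ∎
        where
        open Relation.Binary.Reasoning.Setoid setoid
        k : ℕ
        k = M ℕ.* q ℕ.+ (q ℕ.∸ j)
        p m x J S : Carrier
        p = κ (ι⁻¹ k)
        m = κ (ι⁻¹ (suc M))
        x = X j
        J = κ (ι j)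
        S = κ (ι (suc M))
        1≤k : 1 ℕ.≤ k
        1≤k = ℕ.≤-trans (ℕ.m<n⇒0<n∸m (ℕ.s≤s j≤d)) (ℕ.m≤n+m (q ℕ.∸ j) (M ℕ.* q))
        k+j : k ℕ.+ j ≡ suc M ℕ.* q ℕ.+ 0
        k+j = ≡.trans (ℕ.+-assoc (M ℕ.* q) (q ℕ.∸ j) j) (≡.trans (cong (M ℕ.* q ℕ.+_) (ℕ.m∸n+n≡m (ℕ.m≤n⇒m≤1+n j≤d))) (≡.trans (ℕ.+-comm (M ℕ.* q) q) (≡.sym (ℕ.+-identityʳ (q ℕ.+ M ℕ.* q)))))
        k≈ : κ (ι k) ≈ S * Q′ - J
        k≈ = trans (solve 2 (λ k j → k := (k :+ j) :- j) refl (κ (ι k)) J) (+-congʳ (trans (sym (κ-+ (ι k) (ι j)))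
          (trans (reflexive (cong κ (≡.trans (≡.sym (ι-+ k j)) (cong ι k+j)))) (trans (κι-+ (suc M) 0) (trans (+-congˡ κ-0) (+-identityʳ _))))))
        b-step : 1# - b j * m ≈ κ (ι k) * (Q * m)
        b-step = sym (trans (*-congʳ k≈) (trans (solve 5 (λ M Q′ J Q m → (M :* Q′ :- J) :* (Q :* m) := (m :* M) :* (Q :* Q′) :- J :* Q :* m) refl S Q′ J Q m)
          (+-congʳ (trans (*-cong (κι⁻¹ {suc M} (ℕ.s≤s ℕ.z≤n)) QQ′) (*-identityˡ 1#)))))

      c-trivial : ∀ k → ¬ Coprime k q → c k ≈ 1#
      c-trivial k nc = trans (+-congˡ (-‿cong (trans (*-congʳ (X-0 k nc)) (zeroˡ _)))) (trans (+-congˡ (trans (-‿cong (sym κ-0)) (trans (solve 0 (:- con 0ℚ := con 0ℚ) refl) κ-0))) (+-identityʳ 1#))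

      coprime-shift : ∀ M j → Coprime (M ℕ.* q ℕ.+ j) q → Coprime j q
      coprime-shift M j c (e∣j , e∣q) = c (ℕ.∣m∣n⇒∣m+n (ℕ.∣-trans e∣q (ℕ.n∣m*n M)) e∣j , e∣q)

      block : ∀ M → Π (λ i → c (M ℕ.* q ℕ.+ i)) q * Π (coprimeOnly q (λ j → first (b j) M * second (b j) M)) r ≈
        Π (coprimeOnly q (λ j → first (a j) M * second (a j) M)) r
      block M = trans (*-congʳ (trans (*-cong (trans (Π-half d f middle) (Π-cong r λ j 1≤j j≤r → pairs j j≤r)) (c-trivial (M ℕ.* q ℕ.+ q) (¬coprime-q M))) (*-identityʳ _)))
        (trans (sym (Π-∙ _ _ r)) (Π-cong r λ j 1≤j j≤r → trans (sym (select-∙ (ℕC.coprime? j q) _ _))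
          (select-cong (ℕC.coprime? j q) (ℕC.coprime? j q) (λ p → p) (λ p → p) λ _ → ratio j 1≤j j≤r)))
        where
        f : ℕ → Carrier
        f i = c (M ℕ.* q ℕ.+ i)
        middle : ∀ r → d ≡ suc (r ℕ.+ r) → f (suc r) ≈ 1#
        middle r d≡ = c-trivial (M ℕ.* q ℕ.+ suc r) (λ cp → ¬coprime-middle r d≡ (coprime-shift M (suc r) cp))
        pairs : ∀ j → j ℕ.≤ r → f j * f (q ℕ.∸ j) ≈ coprimeOnly q (λ j → f j * f (q ℕ.∸ j)) j
        pairs j j≤r = go (ℕC.coprime? j q)
          where
          go : (p : Dec (Coprime j q)) → f j * f (q ℕ.∸ j) ≈ select p (f j * f (q ℕ.∸ j))
          go (yes _)  = refl
          go (no ncp) = trans (*-cong (c-trivial (M ℕ.* q ℕ.+ j) (λ cp → ncp (coprime-shift M j cp)))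
            (c-trivial (M ℕ.* q ℕ.+ (q ℕ.∸ j)) (λ cp → ncp (reflect-coprime⁻ (j≤q j≤r) (coprime-shift M (q ℕ.∸ j) cp))))) (*-identityˡ 1#)
        ratio : ∀ j → 1 ℕ.≤ j → j ℕ.≤ r → f j * f (q ℕ.∸ j) * (first (b j) M * second (b j) M) ≈ first (a j) M * second (a j) M
        ratio j 1≤j j≤r = trans (solve 4 (λ p q s t → p :* q :* (s :* t) := (p :* s) :* (q :* t)) refl (f j) (f (q ℕ.∸ j)) (first (b j) M) (second (b j) M))
          (*-cong (first-ratio M j 1≤j) (second-ratio M j (ℕ.≤-trans (ℕ.m≤m+n j j) (half≤ j≤r))))

      select-Π : (ℕ → Carrier) → Carrier
      select-Π f = Π (coprimeOnly q f) r

      select-Π-* : ∀ f g → select-Π (λ j → f j * g j) ≈ select-Π f * select-Π g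
      select-Π-* f g = trans (Π-cong r λ j _ _ → select-∙ (ℕC.coprime? j q) (f j) (g j)) (Π-∙ (coprimeOnly q f) (coprimeOnly q g) r)

      select-Π-cong : ∀ {f g} → (∀ j → 1 ℕ.≤ j → j ℕ.≤ r → f j ≈ g j) → select-Π f ≈ select-Π g
      select-Π-cong h = Π-cong r λ j 1≤j j≤r → select-cong (ℕC.coprime? j q) (ℕC.coprime? j q) (λ p → p) (λ p → p) λ _ → h j 1≤j j≤r

      -- Left undivided for `⇝-quotient`, which asks only the limit of the second factor to be
      -- invertible.
      blocks : ∀ M → Π c (M ℕ.* q) * select-Π (λ j → symmetric (b j) M) ≈ select-Π (λ j → symmetric (a j) M)
      blocks zero    = *-identityˡ _
      blocks (suc M) = begin
        Π c (q ℕ.+ M ℕ.* q) * select-Π (λ j → symmetric (b j) M * (first (b j) M * second (b j) M))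
          ≈⟨ *-cong (trans (reflexive (cong (Π c) (ℕ.+-comm q (M ℕ.* q)))) (Π-split c (M ℕ.* q) q)) (select-Π-* (λ j → symmetric (b j) M) (λ j → first (b j) M * second (b j) M)) ⟩
        Π c (M ℕ.* q) * Π (λ i → c (M ℕ.* q ℕ.+ i)) q * (select-Π (λ j → symmetric (b j) M) * select-Π (λ j → first (b j) M * second (b j) M))
          ≈⟨ solve 4 (λ p s t u → p :* s :* (t :* u) := (p :* t) :* (s :* u)) refl (Π c (M ℕ.* q)) (Π (λ i → c (M ℕ.* q ℕ.+ i)) q) (select-Π (λ j → symmetric (b j) M)) (select-Π (λ j → first (b j) M * second (b j) M)) ⟩
        (Π c (M ℕ.* q) * select-Π (λ j → symmetric (b j) M)) * (Π (λ i → c (M ℕ.* q ℕ.+ i)) q * select-Π (λ j → first (b j) M * second (b j) M))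
          ≈⟨ *-cong (blocks M) (block M) ⟩
        select-Π (λ j → symmetric (a j) M) * select-Π (λ j → first (a j) M * second (a j) M)
          ≈⟨ select-Π-* (λ j → symmetric (a j) M) (λ j → first (a j) M * second (a j) M) ⟨
        select-Π (λ j → symmetric (a j) M * (first (a j) M * second (a j) M)) ∎
        where open Relation.Binary.Reasoning.Setoid setoid

      select-Π-⇝ : ∀ (x : ℕ → Carrier) → (λ M → select-Π (λ j → symmetric (x j) M)) ⇝ select-Π (λ j → σ (x j))
      select-Π-⇝ x = Π-⇝ (λ M → coprimeOnly q (λ j → symmetric (x j) M)) (coprimeOnly q (λ j → σ (x j))) r
        λ j _ _ → select-⇝ (ℕC.coprime? j q) (symmetric⇝σ (x j))

      positive-σ-b : ∀ j → 1 ℕ.≤ j → j ℕ.≤ r → Positive (σ (b j))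
      positive-σ-b j 1≤j j≤r = Positive-resp (σ-cong (sym (b-frac j))) (Positive-σ (0<frac d 1≤j) (frac≤½ j≤r))

      unit-σ-b : Unit (select-Π (λ j → σ (b j)))
      unit-σ-b = Unit-Π (coprimeOnly q (λ j → σ (b j))) r λ j 1≤j j≤r → Unit-select (ℕC.coprime? j q)
        (Unit-resp (*-congʳ (D-cong (sym (b-frac j)))) (Unit-* (Unit-D½ (frac d j) (0<frac d 1≤j) (frac≤½ j≤r)) (ω , trans (*-comm ω⁻¹ ω) ω-inverse)))

      L : Carrier
      L = select-Π (λ j → σ (a j)) * proj₁ unit-σ-b

      Πc-multiples⇝ : (λ M → Π c (M ℕ.* q)) ⇝ L
      Πc-multiples⇝ = ⇝-quotient blocks (select-Π-⇝ b) (proj₂ unit-σ-b) (select-Π-⇝ a)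

      c⇝1 : ∀ s → (λ M → c (M ℕ.* q ℕ.+ suc s)) ⇝ 1#
      c⇝1 s = go (bounded (X (suc s) * z))
        where
        go : (∃ λ R → X (suc s) * z ≼ R) → (λ M → c (M ℕ.* q ℕ.+ suc s)) ⇝ 1#
        go (R , xz≼R) = ⇝-rate R (≼⇒0≤ xz≼R) (0 , λ M _ → ≼-mono (*-monoˡ (≼⇒0≤ xz≼R) (1/suc-antitone (M≤ M)))
          (≼-resp (rearrange M) (≼-‿ (≼-* xz≼R (small M)))))
          where
          M≤ : ∀ M → M ℕ.≤ M ℕ.* q ℕ.+ s
          M≤ M = ℕ.≤-trans (ℕ.m≤m*n M q) (ℕ.m≤m+n (M ℕ.* q) s)
          small : ∀ M → κ (ι⁻¹ (M ℕ.* q ℕ.+ suc s)) ≼ 1/suc (M ℕ.* q ℕ.+ s)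
          small M = subst (λ k → κ k ≼ 1/suc (M ℕ.* q ℕ.+ s)) (≡.sym (≡.trans (cong ι⁻¹ (ℕ.+-suc (M ℕ.* q) s)) (ι⁻¹-suc (M ℕ.* q ℕ.+ s)))) (κ≼ (ℚ.<⇒≤ (0<1/suc (M ℕ.* q ℕ.+ s))) ℚ.≤-refl)
          rearrange : ∀ M → - (X (suc s) * z * κ (ι⁻¹ (M ℕ.* q ℕ.+ suc s))) ≈ c (M ℕ.* q ℕ.+ suc s) - 1#
          rearrange M = trans (solve 4 (λ o x z k → :- (x :* z :* k) := (o :- x :* (z :* k)) :- o) refl 1# (X (suc s)) z (κ (ι⁻¹ (M ℕ.* q ℕ.+ suc s))))
            (+-congʳ (+-congˡ (-‿cong (*-congʳ (sym (X-period M (suc s)))))))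

      -- Going from Mq to Mq + s appends s factors, each tending to 1. With all residues s treated,
      -- `⇝-residues` covers every partial product.
      Πc-residue⇝ : ∀ s → (λ M → Π c (M ℕ.* q ℕ.+ s)) ⇝ L
      Πc-residue⇝ zero    = ⇝-resp (0 , λ M _ → reflexive (cong (Π c) (≡.sym (ℕ.+-identityʳ (M ℕ.* q))))) refl Πc-multiples⇝
      Πc-residue⇝ (suc s) = ⇝-resp (0 , λ M _ → sym (trans (reflexive (cong (Π c) (ℕ.+-suc (M ℕ.* q) s))) (*-congˡ (reflexive (cong c (≡.sym (ℕ.+-suc (M ℕ.* q) s)))))))
        (*-identityʳ L) (⇝-* (Πc-residue⇝ s) (c⇝1 s))

      Πc⇝ : Π c ⇝ L
      Πc⇝ = ⇝-residues d Πc-residue⇝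

      two-sines : ℕ → Carrier
      two-sines j = κ (ι 2) * sine (b j)

      select-Π-2 : select-Π (λ _ → κ (ι 2)) ≈ κ (ι (2 ℕ.^ count))
      select-Π-2 = go r
        where
        open Products ℕ.+-0-commutativeMonoid using () renaming (Π to Σ)
        module ℕSelection = Selection ℕ.+-0-commutativeMonoid
        step : ∀ {P : Set} (p : Dec P) n → κ (ι (2 ℕ.^ n)) * select p (κ (ι 2)) ≈ κ (ι (2 ℕ.^ (n ℕ.+ ℕSelection.select p 1)))
        step (yes _) n = trans (sym (κ-* (ι (2 ℕ.^ n)) (ι 2))) (reflexive (cong κ (≡.trans (≡.sym (ι-* (2 ℕ.^ n) 2)) (cong ι (≡.sym (ℕ.^-distribˡ-+-* 2 n 1))))))
        step (no _)  n = trans (*-identityʳ _) (reflexive (cong (λ k → κ (ι (2 ℕ.^ k))) (≡.sym (ℕ.+-identityʳ n))))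
        go : ∀ n → Π (coprimeOnly q (λ _ → κ (ι 2))) n ≈ κ (ι (2 ℕ.^ Σ (ℕSelection.coprimeOnly q (λ _ → 1)) n))
        go zero    = sym κ-1
        go (suc n) = trans (*-congʳ (go n)) (step (ℕC.coprime? (suc n) q) (Σ (ℕSelection.coprimeOnly q (λ _ → 1)) n))

      -- Both sides are 2 - ζ - ζ⁻¹. This turns Φ_q(1), folded at the middle, into the square of a
      -- product of sines over j < q/2.
      two-sines-square : ∀ j → j ℕ.≤ q → two-sines j * two-sines j ≈ (1# - ζ j) * (1# - ζ (q ℕ.∸ j))
      two-sines-square j j≤ = begin
        κ (ι 2) * (D (b j) * (- ı * κ ½)) * (κ (ι 2) * (D (b j) * (- ı * κ ½)))
          ≈⟨ solve 2 (λ d i → con (ι 2) :* (d :* (:- i :* con ½)) :* (con (ι 2) :* (d :* (:- i :* con ½))) := (i :* i) :* (d :* d)) refl (D (b j)) ı ⟩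
        ı * ı * (D (b j) * D (b j))
          ≈⟨ *-cong (trans ı*ı (-‿cong (sym κ-1))) (*-cong (D-cong (b-frac j)) (D-cong (b-frac j))) ⟩
        - κ 1ℚ * ((E j - F j) * (E j - F j))
          ≈⟨ solve 2 (λ e f → :- con 1ℚ :* ((e :- f) :* (e :- f)) := (e :* f :- e :* e) :* (e :* f :- f :* f) :+ (e :* f :- con 1ℚ) :* ((e :* e :+ f :* f) :- con (ι 2) :* (e :* f))) refl (E j) (F j) ⟩
        (E j * F j - E j * E j) * (E j * F j - F j * F j) + (E j * F j - κ 1ℚ) * (E j * E j + F j * F j - κ (ι 2) * (E j * F j))
          ≈⟨ +-cong (*-cong (+-congʳ (EF j)) (+-cong (EF j) (-‿cong (sym (ζ-reflect j j≤))))) (trans (*-congʳ (trans (+-cong (EF j) (-‿cong κ-1)) (-‿inverseʳ 1#))) (zeroˡ _)) ⟩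
        (1# - ζ j) * (1# - ζ (q ℕ.∸ j)) + 0#
          ≈⟨ +-identityʳ _ ⟩
        (1# - ζ j) * (1# - ζ (q ℕ.∸ j)) ∎
        where open Relation.Binary.Reasoning.Setoid setoid

      Φ-half : Φ q d ≈ select-Π two-sines * select-Π two-sines
      Φ-half = trans (Π-half d f (λ r d≡ → select-no (ℕC.coprime? (suc r) q) (¬coprime-middle r d≡)))
        (trans (Π-cong r λ j _ j≤r → trans (*-congˡ (mirror j (j≤q j≤r))) (trans (sym (select-∙ (ℕC.coprime? j q) _ _))
          (select-cong (ℕC.coprime? j q) (ℕC.coprime? j q) (λ p → p) (λ p → p) λ _ → sym (two-sines-square j (j≤q j≤r)))))
          (select-Π-* two-sines two-sines))
        where
        f : ℕ → Carrier
        f = coprimeOnly q (λ j → 1# - ζ j)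
        mirror : ∀ j → j ℕ.≤ q → f (q ℕ.∸ j) ≈ select (ℕC.coprime? j q) (1# - ζ (q ℕ.∸ j))
        mirror j j≤ = select-cong (ℕC.coprime? (q ℕ.∸ j) q) (ℕC.coprime? j q) (reflect-coprime⁻ j≤) (reflect-coprime j≤) (λ _ → refl)

      positive-two-sines : Positive π → Positive (select-Π two-sines)
      positive-two-sines π>0 = Positive-Π (coprimeOnly q two-sines) r λ j 1≤j j≤r → Positive-select (ℕC.coprime? j q)
        (Positive-resp (*-congˡ (sym (sine-σ (b j)))) (Positive-* (Positive-κ (0<ι-suc 1)) (Positive-* π>0 (positive-σ-b j 1≤j j≤r))))

      -- S plays the part of ε(q), characterised by its sign and square so that √p and 1 need no
      -- separate treatment; R is the inverse of the denominator, and `Q₀` is the product that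
      -- starts at k = 2.
      module _ (π>0 : Positive π) (S : Carrier) (S>0 : Positive S) (S² : S * S ≈ Φ q d) (R : Carrier) (R-inverse : R * ((1# - z) * S) ≈ 1#)
        (Q₀ : ℕ → Carrier) (Q₀-spec : ∀ n → Q₀ (suc n) * (1# - z) ≈ Π c (suc n)) where

        -- S and the product of 2 sin(πj/q) are positive with the same square. The factor σ(b_j)
        -- obtained here cancels the inverse in `L`, and the powers of 2 and π are those of the
        -- claimed limit.
        S≈ : S ≈ κ (ι (2 ℕ.^ count)) * select-Π (λ _ → π) * select-Π (λ j → σ (b j))
        S≈ = trans (positive-square-unique S>0 (positive-two-sines π>0) (trans S² Φ-half))
          (trans (select-Π-cong λ j _ _ → trans (*-congˡ (sine-σ (b j))) (sym (*-assoc (κ (ι 2)) π (σ (b j)))))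
            (trans (select-Π-* (λ _ → κ (ι 2) * π) (λ j → σ (b j))) (*-congʳ (trans (select-Π-* (λ _ → κ (ι 2)) (λ _ → π)) (*-congʳ select-Π-2)))))

        Q₀⇝ : Q₀ ⇝ κ (ι (2 ℕ.^ (φ q ℕ./ 2))) * R * select-Π (λ j → sine (a j))
        Q₀⇝ = ⇝-resp (1 , λ { (suc n) _ → sym (Q₀≈ n) }) limit≈ (⇝-* Πc⇝ (⇝-const (S * R)))
          where
          open Relation.Binary.Reasoning.Setoid setoid
          inverse : (1# - z) * (S * R) ≈ 1#
          inverse = trans (solve 3 (λ z s r → z :* (s :* r) := r :* (z :* s)) refl (1# - z) S R) R-inverse
          Q₀≈ : ∀ n → Q₀ (suc n) ≈ Π c (suc n) * (S * R)
          Q₀≈ n = sym (trans (*-congʳ (sym (Q₀-spec n))) (trans (*-assoc (Q₀ (suc n)) (1# - z) (S * R)) (trans (*-congˡ inverse) (*-identityʳ _))))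
          u : Carrier
          u = proj₁ unit-σ-b
          P : Carrier
          P = select-Π (λ _ → π)
          limit≈ : L * (S * R) ≈ κ (ι (2 ℕ.^ (φ q ℕ./ 2))) * R * select-Π (λ j → sine (a j))
          limit≈ = begin
            select-Π (λ j → σ (a j)) * u * (S * R)
              ≈⟨ *-congˡ (*-congʳ S≈) ⟩
            select-Π (λ j → σ (a j)) * u * (κ (ι (2 ℕ.^ count)) * P * select-Π (λ j → σ (b j)) * R)
              ≈⟨ solve 6 (λ s u k p t r → s :* u :* (k :* p :* t :* r) := k :* r :* (p :* s) :* (t :* u)) refl (select-Π (λ j → σ (a j))) u (κ (ι (2 ℕ.^ count))) P (select-Π (λ j → σ (b j))) R ⟩
            κ (ι (2 ℕ.^ count)) * R * (P * select-Π (λ j → σ (a j))) * (select-Π (λ j → σ (b j)) * u)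
              ≈⟨ trans (*-congˡ (proj₂ unit-σ-b)) (*-identityʳ _) ⟩
            κ (ι (2 ℕ.^ count)) * R * (P * select-Π (λ j → σ (a j)))
              ≈⟨ *-cong (*-congʳ (reflexive (cong (λ k → κ (ι (2 ℕ.^ k))) (≡.sym φ/2)))) (trans (sym (select-Π-* (λ _ → π) (λ j → σ (a j)))) (select-Π-cong λ j _ _ → sym (sine-σ (a j)))) ⟩
            κ (ι (2 ℕ.^ (φ q ℕ./ 2))) * R * select-Π (λ j → sine (a j)) ∎

open Theory
open import Defs

-- The commutative ring of Gaussian rationals.

module GaussianRationals where
  open import Data.Rational
  open import Data.Rational.Properties
  open import Data.Rational.Solver using (module +-*-Solver)
  open +-*-Solver

  infix 8 ⊝_
  ⊝_ : ℚ[i] → ℚ[i]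
  ⊝ (a , b) = - a , - b

  0ᵢ 1ᵢ : ℚ[i]
  0ᵢ = 0ℚ , 0ℚ
  1ᵢ = 1ℚ , 0ℚ

  ⊖-tele : ∀ x y z → (x ⊖ y) ⊕ (y ⊖ z) ≡ x ⊖ z
  ⊖-tele (a , a′) (b , b′) (c , c′) = cong₂ _,_ (lem a b c) (lem a′ b′ c′)
    where
    lem : ∀ a b c → (a - b) + (b - c) ≡ a - c
    lem = solve 3 (λ a b c → (a :- b) :+ (b :- c) := a :- c) ≡.refl

  ⊖-swap : ∀ x y → ⊝ (x ⊖ y) ≡ y ⊖ x
  ⊖-swap (a , a′) (b , b′) = cong₂ _,_ (lem a b) (lem a′ b′)
    where
    lem : ∀ a b → - (a - b) ≡ b - a
    lem = solve 2 (λ a b → :- (a :- b) := b :- a) ≡.refl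

  ⊖-⊕ : ∀ x y u v → (x ⊖ y) ⊕ (u ⊖ v) ≡ (x ⊕ u) ⊖ (y ⊕ v)
  ⊖-⊕ (a , a′) (b , b′) (c , c′) (d , d′) = cong₂ _,_ (lem a b c d) (lem a′ b′ c′ d′)
    where
    lem : ∀ a b c d → (a - b) + (c - d) ≡ (a + c) - (b + d)
    lem = solve 4 (λ a b c d → (a :- b) :+ (c :- d) := (a :+ c) :- (b :+ d)) ≡.refl

  ⊝-⊖ : ∀ x y → ⊝ (x ⊖ y) ≡ ⊝ x ⊖ ⊝ y
  ⊝-⊖ (a , a′) (b , b′) = cong₂ _,_ (lem a b) (lem a′ b′)
    where
    lem : ∀ a b → - (a - b) ≡ - a - - b
    lem = solve 2 (λ a b → :- (a :- b) := :- a :- :- b) ≡.refl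

  ⊗-⊖ : ∀ x y u v → ((x ⊖ y) ⊗ u) ⊕ (y ⊗ (u ⊖ v)) ≡ (x ⊗ u) ⊖ (y ⊗ v)
  ⊗-⊖ (a , a′) (b , b′) (c , c′) (d , d′) = cong₂ _,_
    (solve 8 (λ a a′ b b′ c c′ d d′ →
       ((a :- b) :* c :- (a′ :- b′) :* c′) :+ (b :* (c :- d) :- b′ :* (c′ :- d′))
       := (a :* c :- a′ :* c′) :- (b :* d :- b′ :* d′)) ≡.refl a a′ b b′ c c′ d d′)
    (solve 8 (λ a a′ b b′ c c′ d d′ →
       ((a :- b) :* c′ :+ (a′ :- b′) :* c) :+ (b :* (c′ :- d′) :+ b′ :* (c :- d))
       := (a :* c′ :+ a′ :* c) :- (b :* d′ :+ b′ :* d)) ≡.refl a a′ b b′ c c′ d d′)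

  κ-⊗ : ∀ p q → (p * q , 0ℚ) ≡ (p , 0ℚ) ⊗ (q , 0ℚ)
  κ-⊗ p q = cong₂ _,_
    (solve 2 (λ p q → p :* q := p :* q :- con 0ℚ :* con 0ℚ) ≡.refl p q)
    (solve 2 (λ p q → con 0ℚ := p :* con 0ℚ :+ con 0ℚ :* q) ≡.refl p q)

  ⊖-⊕-cancel : ∀ x y → x ≡ (x ⊖ y) ⊕ y
  ⊖-⊕-cancel (a , a′) (b , b′) = cong₂ _,_ (lem a b) (lem a′ b′)
    where
    lem : ∀ a b → a ≡ (a - b) + b
    lem = solve 2 (λ a b → a := (a :- b) :+ b) ≡.refl

  ⊕-⊖-cancel : ∀ x y → x ⊕ (⊝ (x ⊖ y)) ≡ y
  ⊕-⊖-cancel (a , a′) (b , b′) = cong₂ _,_ (lem a b) (lem a′ b′)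
    where
    lem : ∀ a b → a + (- (a - b)) ≡ b
    lem = solve 2 (λ a b → a :+ (:- (a :- b)) := b) ≡.refl

  ⊖-identityʳ : ∀ x → x ⊖ 0ᵢ ≡ x
  ⊖-identityʳ (a , a′) = cong₂ _,_ (lem a) (lem a′)
    where
    lem : ∀ a → a - 0ℚ ≡ a
    lem = solve 1 (λ a → a :- con 0ℚ := a) ≡.refl

  ⊕-assoc : ∀ x y z → (x ⊕ y) ⊕ z ≡ x ⊕ (y ⊕ z)
  ⊕-assoc (a , a′) (b , b′) (c , c′) = cong₂ _,_ (+-assoc a b c) (+-assoc a′ b′ c′)

  ⊕-comm : ∀ x y → x ⊕ y ≡ y ⊕ x
  ⊕-comm (a , a′) (b , b′) = cong₂ _,_ (+-comm a b) (+-comm a′ b′)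

  ⊕-identityˡ : ∀ x → 0ᵢ ⊕ x ≡ x
  ⊕-identityˡ (a , a′) = cong₂ _,_ (+-identityˡ a) (+-identityˡ a′)

  ⊕-identityʳ : ∀ x → x ⊕ 0ᵢ ≡ x
  ⊕-identityʳ (a , a′) = cong₂ _,_ (+-identityʳ a) (+-identityʳ a′)

  ⊝-inverseˡ : ∀ x → ⊝ x ⊕ x ≡ 0ᵢ
  ⊝-inverseˡ (a , a′) = cong₂ _,_ (+-inverseˡ a) (+-inverseˡ a′)

  ⊝-inverseʳ : ∀ x → x ⊕ ⊝ x ≡ 0ᵢ
  ⊝-inverseʳ (a , a′) = cong₂ _,_ (+-inverseʳ a) (+-inverseʳ a′)

  ⊗-assoc : ∀ x y z → (x ⊗ y) ⊗ z ≡ x ⊗ (y ⊗ z)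
  ⊗-assoc (a , a′) (b , b′) (c , c′) = cong₂ _,_
    (solve 6 (λ a a′ b b′ c c′ → (a :* b :- a′ :* b′) :* c :- (a :* b′ :+ a′ :* b) :* c′
       := a :* (b :* c :- b′ :* c′) :- a′ :* (b :* c′ :+ b′ :* c)) ≡.refl a a′ b b′ c c′)
    (solve 6 (λ a a′ b b′ c c′ → (a :* b :- a′ :* b′) :* c′ :+ (a :* b′ :+ a′ :* b) :* c
       := a :* (b :* c′ :+ b′ :* c) :+ a′ :* (b :* c :- b′ :* c′)) ≡.refl a a′ b b′ c c′)

  ⊗-comm : ∀ x y → x ⊗ y ≡ y ⊗ x
  ⊗-comm (a , a′) (b , b′) = cong₂ _,_
    (solve 4 (λ a a′ b b′ → a :* b :- a′ :* b′ := b :* a :- b′ :* a′) ≡.refl a a′ b b′)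
    (solve 4 (λ a a′ b b′ → a :* b′ :+ a′ :* b := b :* a′ :+ b′ :* a) ≡.refl a a′ b b′)

  ⊗-identityˡ : ∀ x → 1ᵢ ⊗ x ≡ x
  ⊗-identityˡ (a , a′) = cong₂ _,_
    (solve 2 (λ a a′ → con 1ℚ :* a :- con 0ℚ :* a′ := a) ≡.refl a a′)
    (solve 2 (λ a a′ → con 1ℚ :* a′ :+ con 0ℚ :* a := a′) ≡.refl a a′)

  ⊗-identityʳ : ∀ x → x ⊗ 1ᵢ ≡ x
  ⊗-identityʳ x = ≡.trans (⊗-comm x 1ᵢ) (⊗-identityˡ x)

  ⊗-distribˡ : ∀ x y z → x ⊗ (y ⊕ z) ≡ (x ⊗ y) ⊕ (x ⊗ z)
  ⊗-distribˡ (a , a′) (b , b′) (c , c′) = cong₂ _,_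
    (solve 6 (λ a a′ b b′ c c′ → a :* (b :+ c) :- a′ :* (b′ :+ c′) := (a :* b :- a′ :* b′) :+ (a :* c :- a′ :* c′)) ≡.refl a a′ b b′ c c′)
    (solve 6 (λ a a′ b b′ c c′ → a :* (b′ :+ c′) :+ a′ :* (b :+ c) := (a :* b′ :+ a′ :* b) :+ (a :* c′ :+ a′ :* c)) ≡.refl a a′ b b′ c c′)

  ⊗-distribʳ : ∀ x y z → (y ⊕ z) ⊗ x ≡ (y ⊗ x) ⊕ (z ⊗ x)
  ⊗-distribʳ x y z = ≡.trans (⊗-comm (y ⊕ z) x) (≡.trans (⊗-distribˡ x y z) (cong₂ _⊕_ (⊗-comm x y) (⊗-comm x z)))

  ℚ[i]-ring : CommutativeRing 0ℓ 0ℓ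
  ℚ[i]-ring = record
    { Carrier = ℚ[i] ; _≈_ = _≡_ ; _+_ = _⊕_ ; _*_ = _⊗_ ; -_ = ⊝_ ; 0# = 0ᵢ ; 1# = 1ᵢ
    ; isCommutativeRing = record
      { isRing = record
        { +-isAbelianGroup = record
          { isGroup = record
            { isMonoid = record
              { isSemigroup = record
                { isMagma = record { isEquivalence = ≡.isEquivalence ; ∙-cong = cong₂ _⊕_ }
                ; assoc = ⊕-assoc }
              ; identity = ⊕-identityˡ , ⊕-identityʳ }
            ; inverse = ⊝-inverseˡ , ⊝-inverseʳ
            ; ⁻¹-cong = cong ⊝_ }
          ; comm = ⊕-comm }
        ; *-cong = cong₂ _⊗_
        ; *-assoc = ⊗-assoc
        ; *-identity = ⊗-identityˡ , ⊗-identityʳ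
        ; distrib = ⊗-distribˡ , ⊗-distribʳ }
      ; *-comm = ⊗-comm } }

-- The complex numbers as a normed algebra.

module ComplexNorm where
  open import Data.Rational
  open import Data.Rational.Properties
  open import Data.Rational.Solver using (module +-*-Solver)
  open +-*-Solver
  open Order
  open GaussianRationals

  at : ℂ → ℕ → ℚ[i]
  at w n = seq (re w) n , seq (im w) n

  Eventually : (ℕ → Set) → Set
  Eventually P = ∃ λ N → ∀ n → N ℕ.≤ n → P n

  infixr 2 _∧_
  _∧_ : ∀ {P Q} → Eventually P → Eventually Q → Eventually (λ n → P n × Q n)
  (N , p) ∧ (M , q) = N ℕ.⊔ M , λ n h → p n (ℕ.m⊔n≤o⇒m≤o N M h) , q n (ℕ.m⊔n≤o⇒n≤o N M h)

  eventually : ∀ {P Q : ℕ → Set} → (∀ n → P n → Q n) → Eventually P → Eventually Q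
  eventually f (N , p) = N , λ n h → f n (p n h)

  infix 4 _≼_ _≋_
  -- A bound on a tail, up to every ε, so that it depends only on the limit. The norm |re| + |im| is
  -- submultiplicative and, unlike the modulus, rational on Gaussian rationals.
  record _≼_ (x : ℂ) (r : ℚ) : Set where
    constructor bound
    field within : ∀ ε → 0ℚ < ε → Eventually λ n → ‖ at x n ‖ ≤ r + ε
  open _≼_ public

  ≼-from : ∀ {x r} K → 0ℚ < K →
    (∀ ε → 0ℚ < ε → ε ≤ 1ℚ → Eventually λ n → ‖ at x n ‖ ≤ r + K * ε) → x ≼ r
  ≼-from {r = r} K 0<K h = bound λ ε 0<ε → let δ , 0<δ , δ≤1 , Kδ≤ε = shrink-unit K 0<K ε 0<ε in
    eventually (λ n b → ≤-trans b (+-monoʳ-≤ r Kδ≤ε)) (h δ 0<δ δ≤1)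

  ≼-pointwise : ∀ {x r} → (∀ n → ‖ at x n ‖ ≤ r) → x ≼ r
  ≼-pointwise {r = r} h = bound λ ε 0<ε → 0 , λ n _ → ≤-trans (h n) (a≤a+b r (<⇒≤ 0<ε))

  ‖-‖ : ∀ a b → ‖ - a , - b ‖ ≡ ‖ a , b ‖
  ‖-‖ a b = cong₂ _+_ (∣-p∣≡∣p∣ a) (∣-p∣≡∣p∣ b)

  ≼⇒0≤ : ∀ {x r} → x ≼ r → 0ℚ ≤ r
  ≼⇒0≤ {x} {r} h = ≤-closed 1ℚ 0<1 λ ε 0<ε _ → let N , b = within h ε 0<ε in
    ≤-trans (0≤‖‖ (at x N)) (≤-trans (b N ℕ.≤-refl) (≤-reflexive (cong (r +_) (≡.sym (*-identityˡ ε)))))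

  ≼-mono : ∀ {x r s} → r ≤ s → x ≼ r → x ≼ s
  ≼-mono r≤s h = bound λ ε 0<ε → eventually (λ n b → ≤-trans b (+-monoˡ-≤ ε r≤s)) (within h ε 0<ε)

  0<2 : 0ℚ < 1ℚ + 1ℚ
  0<2 = 0<ι-suc 1

  ≼-closed : ∀ {x r} → (∀ ε → 0ℚ < ε → x ≼ r + ε) → x ≼ r
  ≼-closed {x} {r} h = ≼-from (1ℚ + 1ℚ) 0<2 λ ε 0<ε _ →
    eventually (λ n b → ≤-trans b (≤-reflexive
      (solve 2 (λ r e → r :+ e :+ e := r :+ (con 1ℚ :+ con 1ℚ) :* e) ≡.refl r ε))) (within (h ε 0<ε) ε 0<ε)

  record _≋_ (x y : ℂ) : Set where
    constructor approx
    field within : ∀ ε → 0ℚ < ε → Eventually λ n → ‖ at x n ⊖ at y n ‖ ≤ 0ℚ + ε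

  infixl 6 _⊞_
  infixl 7 _⊠_
  infix  8 ⊟_
  opaque
    -- The operations are opaque and known through their values `at` each n; ring reasoning
    -- therefore never meets the Cauchy proofs inside a real number.
    _⊞_ _⊠_ : ℂ → ℂ → ℂ
    _⊞_ = _+ℂ_
    _⊠_ = _*ℂ_

    ⊟_ : ℂ → ℂ
    ⊟_ = -ℂ_

    κ : ℚ → ℂ
    κ p = fromℝ (constℝ p)

    κ-def : ∀ p → κ p ≡ fromℝ (constℝ p)
    κ-def p = ≡.refl

    at-⊞ : ∀ x y n → at (x ⊞ y) n ≡ at x n ⊕ at y n
    at-⊞ x y n = ≡.refl

    at-⊠ : ∀ x y n → at (x ⊠ y) n ≡ at x n ⊗ at y n
    at-⊠ x y n = ≡.refl

    at-⊟ : ∀ x n → at (⊟ x) n ≡ ⊝ at x n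
    at-⊟ x n = ≡.refl

    at-κ : ∀ p n → at (κ p) n ≡ (p , 0ℚ)
    at-κ p n = ≡.refl

  at-⊖ : ∀ x y n → at (x ⊞ ⊟ y) n ≡ at x n ⊖ at y n
  at-⊖ x y n = ≡.trans (at-⊞ x (⊟ y) n) (cong (at x n ⊕_) (at-⊟ y n))

  ‖‖-reflexive : ∀ {u v} → u ≡ v → ‖ u ‖ ≤ ‖ v ‖
  ‖‖-reflexive e = ≤-reflexive (cong ‖_‖ e)

  ≼-+ : ∀ {x y r s} → x ≼ r → y ≼ s → x ⊞ y ≼ r + s
  ≼-+ {x} {y} {r} {s} hx hy = ≼-from (1ℚ + 1ℚ) 0<2 λ ε 0<ε _ →
    eventually (λ n (bx , by) → ≤-trans (‖‖-reflexive (at-⊞ x y n)) (≤-trans (‖⊕‖ (at x n) (at y n)) (≤-trans (+-mono-≤ bx by) (≤-reflexive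
      (solve 3 (λ r s e → (r :+ e) :+ (s :+ e) := r :+ s :+ (con 1ℚ :+ con 1ℚ) :* e) ≡.refl r s ε)))))
      (within hx ε 0<ε ∧ within hy ε 0<ε)

  ≼-* : ∀ {x y r s} → x ≼ r → y ≼ s → x ⊠ y ≼ r * s
  ≼-* {x} {y} {r} {s} hx hy = ≼-from (r + s + 1ℚ) (0<+ (0≤+ 0≤r 0≤s) 0<1) λ ε 0<ε ε≤1 →
    eventually (λ n (bx , by) → ≤-trans (‖‖-reflexive (at-⊠ x y n)) (≤-trans (‖⊗‖ (at x n) (at y n))
      (≤-trans (*-mono-≤ (0≤‖‖ (at x n)) (0≤+ 0≤s (<⇒≤ 0<ε)) bx by) (arith 0<ε ε≤1))))
      (within hx ε 0<ε ∧ within hy ε 0<ε)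
    where
    0≤r = ≼⇒0≤ hx
    0≤s = ≼⇒0≤ hy
    arith : ∀ {ε} → 0ℚ < ε → ε ≤ 1ℚ → (r + ε) * (s + ε) ≤ r * s + (r + s + 1ℚ) * ε
    arith {ε} 0<ε ε≤1 = ≤-trans (≤-reflexive
      (solve 3 (λ r s e → (r :+ e) :* (s :+ e) := r :* s :+ ((r :+ s) :* e :+ e :* e)) ≡.refl r s ε))
      (+-monoʳ-≤ (r * s) (≤-trans (+-monoʳ-≤ ((r + s) * ε) (*-monoʳ (<⇒≤ 0<ε) ε≤1))
        (≤-reflexive (≡.sym (*-distribʳ-+ ε (r + s) 1ℚ)))))

  ≼-‿ : ∀ {x r} → x ≼ r → ⊟ x ≼ r
  ≼-‿ {x} {r} h = bound λ ε 0<ε →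
    eventually (λ n → subst (_≤ r + ε) (≡.trans (≡.sym (‖-‖ (seq (re x) n) (seq (im x) n))) (cong ‖_‖ (≡.sym (at-⊟ x n))))) (within h ε 0<ε)

  ≼-κ : ∀ p → κ p ≼ ∣ p ∣
  ≼-κ p = ≼-pointwise λ n → ≤-trans (‖‖-reflexive (at-κ p n)) (≤-reflexive (+-identityʳ ∣ p ∣))

  ≼-pointwise-≡ : ∀ {x y r} → (∀ n → at x n ≡ at y n) → x ≼ r → y ≼ r
  ≼-pointwise-≡ {r = r} h b = bound λ ε 0<ε →
    eventually (λ n → subst (λ w → ‖ w ‖ ≤ r + ε) (h n)) (within b ε 0<ε)

  bounded-ℂ : ∀ x → ∃ λ r → x ≼ r
  bounded-ℂ x = let R , _ , bR = bounded {seq (re x)} (cauchy (re x))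
                    I , _ , bI = bounded {seq (im x)} (cauchy (im x))
    in R + I , ≼-pointwise λ n → +-mono-≤ (bR n) (bI n)

  difference : ∀ {x y} → x ≋ y → x ⊞ ⊟ y ≼ 0ℚ
  difference {x} {y} (approx h) = bound λ ε 0<ε → eventually (λ n → ≤-trans (‖‖-reflexive (at-⊖ x y n))) (h ε 0<ε)

  close : ∀ {x y} → x ⊞ ⊟ y ≼ 0ℚ → x ≋ y
  close {x} {y} (bound h) = approx λ ε 0<ε → eventually (λ n → ≤-trans (‖‖-reflexive (≡.sym (at-⊖ x y n)))) (h ε 0<ε)

  ≈⇒≋ : ∀ {x y} → x ≈ℂ y → x ≋ y
  ≈⇒≋ {x} {y} (er , ei) = close (≼-from (1ℚ + 1ℚ) 0<2 λ ε 0<ε _ → eventually (λ n → ≤-trans (‖‖-reflexive (at-⊖ x y n))) (both ε (er ε 0<ε) (ei ε 0<ε)))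
    where
    sum : ∀ {a b} ε → a < ε → b < ε → a + b ≤ 0ℚ + (1ℚ + 1ℚ) * ε
    sum ε a<ε b<ε = ≤-trans (+-mono-≤ (<⇒≤ a<ε) (<⇒≤ b<ε)) (≤-reflexive
      (solve 1 (λ e → e :+ e := con 0ℚ :+ (con 1ℚ :+ con 1ℚ) :* e) ≡.refl ε))
    both : ∀ ε → Eventually (λ n → ∣ seq (re x) n - seq (re y) n ∣ < ε) →
           Eventually (λ n → ∣ seq (im x) n - seq (im y) n ∣ < ε) →
           Eventually (λ n → ‖ at x n ⊖ at y n ‖ ≤ 0ℚ + (1ℚ + 1ℚ) * ε)
    both ε p q = eventually (λ n (bx , by) → sum ε bx by) (p ∧ q)

  pointwise : ∀ {x y} → (∀ n → at x n ≡ at y n) → x ≋ y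
  pointwise {x} {y} h = close (≼-pointwise λ n →
    ≤-trans (‖‖-reflexive (at-⊖ x y n)) (≤-reflexive (≡.trans (cong₂ (λ a b → ∣ a ∣ + ∣ b ∣) (zero′ (cong proj₁ (h n))) (zero′ (cong proj₂ (h n))))
      (+-identityˡ 0ℚ))))
    where
    zero′ : ∀ {a b} → a ≡ b → a - b ≡ 0ℚ
    zero′ {a} ≡.refl = +-inverseʳ a

  ≋-refl : ∀ {x} → x ≋ x
  ≋-refl = pointwise λ _ → ≡.refl

  -- Pointwise, ‖x‖ ≤ ρ‖x‖ + r up to multiples of ε; rearranging and multiplying by s ≥ 1/(1 - ρ)
  -- gives the bound. A crude bound b on x is needed first, to control the term ε‖x‖.
  selfbound-ℂ : ∀ {x h c ρ r s} → x ≋ h ⊠ x ⊞ c → h ≼ ρ → c ≼ r → 0ℚ ≤ s →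
                1ℚ ≤ s * (1ℚ - ρ) → x ≼ s * r
  selfbound-ℂ {x} {h} {c} {ρ} {r} {s} x≋ h≼ρ c≼r 0≤s 1≤ = go (bounded-ℂ x)
    where
    expand : ∀ n → at (h ⊠ x ⊞ c) n ≡ (at h n ⊗ at x n) ⊕ at c n
    expand n = ≡.trans (at-⊞ (h ⊠ x) c n) (cong (_⊕ at c n) (at-⊠ h x n))
    go : (∃ λ b → x ≼ b) → x ≼ s * r
    go (b , x≼b) = ≼-from K 0<K λ ε 0<ε ε≤1 → eventually
        (λ n (p , q , t , u) → estimate ε n (<⇒≤ 0<ε) ε≤1 p q t u)
        (eventually (λ n → ≤-trans (‖‖-reflexive (cong (at x n ⊖_) (≡.sym (expand n))))) (_≋_.within x≋ ε 0<ε) ∧ within h≼ρ ε 0<ε ∧ within c≼r ε 0<ε ∧ within x≼b ε 0<ε)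
      where
      -- b + 3 collects (b + 1)ε from the error in h and one ε each from the equation and from c.
      K = s * (b + ι 3) + 1ℚ
      0≤b+3 : 0ℚ ≤ b + ι 3
      0≤b+3 = 0≤+ (≼⇒0≤ x≼b) (0≤ι 3)
      0<K : 0ℚ < K
      0<K = 0<+ (0≤* 0≤s 0≤b+3) 0<1
      estimate : ∀ ε n → 0ℚ ≤ ε → ε ≤ 1ℚ → ‖ at x n ⊖ ((at h n ⊗ at x n) ⊕ at c n) ‖ ≤ 0ℚ + ε →
        ‖ at h n ‖ ≤ ρ + ε → ‖ at c n ‖ ≤ r + ε → ‖ at x n ‖ ≤ b + ε → ‖ at x n ‖ ≤ s * r + K * ε
      estimate ε n 0≤ε ε≤1 p q t u = begin
        X                             ≡⟨ *-identityˡ X ⟨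
        1ℚ * X                        ≤⟨ *-monoʳ 0≤X 1≤ ⟩
        s * (1ℚ - ρ) * X              ≡⟨ solve 3 (λ s ρ X → s :* (con 1ℚ :- ρ) :* X := s :* (X :- ρ :* X)) ≡.refl s ρ X ⟩
        s * (X - ρ * X)               ≤⟨ *-monoˡ 0≤s (+-monoˡ-≤ (- (ρ * X)) X≤) ⟩
        s * (ρ * X + r + (b + ι 3) * ε - ρ * X) ≡⟨ solve 5 (λ s y r b e → s :* (y :+ r :+ b :* e :- y) := s :* r :+ s :* b :* e) ≡.refl s (ρ * X) r (b + ι 3) ε ⟩
        s * r + s * (b + ι 3) * ε     ≤⟨ +-monoʳ-≤ (s * r) (*-monoʳ 0≤ε (a≤a+b (s * (b + ι 3)) 0≤1)) ⟩
        s * r + K * ε                 ∎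
        where
        open ≤-Reasoning
        X = ‖ at x n ‖
        0≤X = 0≤‖‖ (at x n)
        y = (at h n ⊗ at x n) ⊕ at c n
        back : at x n ≡ (at x n ⊖ y) ⊕ y
        back = ⊖-⊕-cancel (at x n) y
        X≤ : X ≤ ρ * X + r + (b + ι 3) * ε
        X≤ = begin
          X                                   ≡⟨ cong ‖_‖ back ⟩
          ‖ (at x n ⊖ y) ⊕ y ‖                ≤⟨ ‖⊕‖ (at x n ⊖ y) y ⟩
          ‖ at x n ⊖ y ‖ + ‖ y ‖              ≤⟨ +-mono-≤ p (≤-trans (‖⊕‖ (at h n ⊗ at x n) (at c n))
                                                   (+-mono-≤ (≤-trans (‖⊗‖ (at h n) (at x n)) (*-monoʳ 0≤X q)) t)) ⟩
          0ℚ + ε + ((ρ + ε) * X + (r + ε))    ≡⟨ solve 4 (λ e ρ X r → con 0ℚ :+ e :+ ((ρ :+ e) :* X :+ (r :+ e)) :=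
                                                   ρ :* X :+ r :+ (X :* e :+ (e :+ e))) ≡.refl ε ρ X r ⟩
          ρ * X + r + (X * ε + (ε + ε))       ≤⟨ +-monoʳ-≤ (ρ * X + r) (+-monoˡ-≤ (ε + ε) (*-monoʳ 0≤ε (≤-trans u (+-monoʳ-≤ b ε≤1)))) ⟩
          ρ * X + r + ((b + 1ℚ) * ε + (ε + ε)) ≡⟨ solve 3 (λ z b e → z :+ ((b :+ con 1ℚ) :* e :+ (e :+ e)) := z :+ (b :+ con (ι 3)) :* e) ≡.refl (ρ * X + r) b ε ⟩
          ρ * X + r + (b + ι 3) * ε           ∎

  -- Exactly the factor by which `_÷ℂ_[_]` multiplies, so the quotient in the theorem is literally a
  -- product with it.
  recip : (w : ℂ) → Nonzero w → ℂ
  recip w nz = (re w *ℝ r) +i (-ℝ (im w *ℝ r))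
    where r = normSq w ⁻¹[ nz ]

  recip-inverse : ∀ w nz → w ⊠ recip w nz ≋ κ 1ℚ
  recip-inverse w nz@(η , 0<η , N , h) = approx λ ε 0<ε → N , λ n N≤n →
    let a = seq (re w) n
        b = seq (im w) n
    in subst (λ v → ‖ v ‖ ≤ 0ℚ + ε) (≡.sym (≡.trans (cong₂ _⊖_ (at-⊠ w (recip w nz) n) (at-κ 1ℚ n)) (zero-at a b (<-≤-trans 0<η (subst (_≤ _) (+-identityˡ η) (h n N≤n))))))
         (≤-trans (≤-reflexive (+-identityˡ 0ℚ)) (≤-trans (<⇒≤ 0<ε) (≤-reflexive (≡.sym (+-identityˡ ε)))))
    where
    zero-at : ∀ a b → 0ℚ < a * a + b * b →
      ((a , b) ⊗ (a * inv (a * a + b * b) , - (b * inv (a * a + b * b)))) ⊖ 1ᵢ ≡ 0ᵢ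
    zero-at a b 0<p = cong₂ _,_
      (≡.trans (solve 3 (λ a b r → (a :* (a :* r) :- b :* (:- (b :* r))) :- con 1ℚ := r :* (a :* a :+ b :* b) :- con 1ℚ) ≡.refl a b r)
        (≡.trans (cong (_- 1ℚ) (inv-inverse (a * a + b * b) 0<p)) (+-inverseʳ 1ℚ)))
      (solve 3 (λ a b r → (a :* (:- (b :* r)) :+ b :* (a :* r)) :- con 0ℚ := con 0ℚ) ≡.refl a b r)
      where r = inv (a * a + b * b)

  -- The real part is eventually at least half of 1 - ρ: the other half absorbs the slack in
  -- `h ≼ ρ`.
  one+-nonzero : ∀ {h ρ} → h ≼ ρ → ρ < 1ℚ → Nonzero (1ℂ +ℂ h)
  one+-nonzero {h} {ρ} h≼ρ ρ<1 = nz
    where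
    g = ½ * (1ℚ - ρ)
    0<g : 0ℚ < g
    0<g = 0<* 0<½ (subst (_< 1ℚ - ρ) (+-inverseʳ ρ) (+-monoˡ-< (- ρ) ρ<1))
    lower : ∀ a b → ∣ a ∣ + ∣ b ∣ ≤ ρ + g → 0ℚ + g * g ≤ (1ℚ + a) * (1ℚ + a) + (0ℚ + b) * (0ℚ + b)
    lower a b le = ≤-trans (≤-reflexive (+-identityˡ (g * g)))
      (≤-trans (*-mono-≤ (<⇒≤ 0<g) (≤-trans (<⇒≤ 0<g) g≤) g≤ g≤) (a≤a+b _ (0≤x*x (0ℚ + b))))
      where
      -a≤ : - (ρ + g) ≤ a
      -a≤ = ∣∣-upper (≤-trans (a≤a+b ∣ a ∣ (0≤∣p∣ b)) le)
      g≤ : g ≤ 1ℚ + a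
      g≤ = ≤-trans (≤-reflexive (solve 1 (λ ρ → con ½ :* (con 1ℚ :- ρ) := con 1ℚ :- (ρ :+ con ½ :* (con 1ℚ :- ρ))) ≡.refl ρ))
        (+-monoʳ-≤ 1ℚ -a≤)
    nz : Nonzero (1ℂ +ℂ h)
    nz = let N , b = within h≼ρ g 0<g in
      g * g , 0<* 0<g 0<g , N , λ n N≤n → lower (seq (re h) n) (seq (im h) n) (b n N≤n)

  -- A positive real ε eventually exceeds a rational η. Aiming at norm δ = η/2 leaves |a n - L|² +
  -- δ² ≤ 2δ² ≤ η² ≤ ε², and the spare δ² witnesses the strict inequality between reals.
  ⟶-from : ∀ {a L} → (∀ ε → 0ℚ < ε → ∃ λ N → ∀ n → N ℕ.≤ n → a n ⊞ ⊟ L ≼ ε) → a ⟶ L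
  ⟶-from {a} {L} conv ε (η , 0<η , N₀ , η≤) = let N , c = conv (½ * δ) (0<* 0<½ 0<δ) in
    N , λ n N≤n → δ * δ , 0<* 0<δ 0<δ , combine n (eventually (λ m → ≤-trans (‖‖-reflexive (≡.sym (at-⊖ (a n) L m)))) (within (c n N≤n) (½ * δ) (0<* 0<½ 0<δ)))
    where
    δ = ½ * η
    0<δ : 0ℚ < δ
    0<δ = 0<* 0<½ 0<η
    below : ∀ x y e → ∣ x ∣ + ∣ y ∣ ≤ ½ * δ + ½ * δ → 0ℚ + η ≤ e → x * x + y * y + δ * δ ≤ e * e
    below x y e xy≤ η≤e = begin
      x * x + y * y + δ * δ                 ≡⟨ cong (λ t → t + δ * δ) (cong₂ _+_ (abs-square x) (abs-square y)) ⟨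
      ∣ x ∣ * ∣ x ∣ + ∣ y ∣ * ∣ y ∣ + δ * δ ≤⟨ +-monoˡ-≤ (δ * δ) square≤ ⟩
      t * t + δ * δ                         ≤⟨ +-monoˡ-≤ (δ * δ) (*-mono-≤ 0≤t (<⇒≤ 0<δ) t≤ t≤) ⟩
      δ * δ + δ * δ                         ≤⟨ a≤a+b _ (0≤+ (0≤* 0≤δ 0≤δ) (0≤* 0≤δ 0≤δ)) ⟩
      δ * δ + δ * δ + (δ * δ + δ * δ)       ≡⟨ solve 1 (λ h → let d = con ½ :* h in d :* d :+ d :* d :+ (d :* d :+ d :* d) := h :* h) ≡.refl η ⟩
      η * η                                 ≤⟨ *-mono-≤ (<⇒≤ 0<η) (≤-trans (<⇒≤ 0<η) η≤e′) η≤e′ η≤e′ ⟩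
      e * e                                 ∎
      where
      open ≤-Reasoning
      t = ∣ x ∣ + ∣ y ∣
      0≤δ = <⇒≤ 0<δ
      0≤t : 0ℚ ≤ t
      0≤t = 0≤+ (0≤∣p∣ x) (0≤∣p∣ y)
      t≤ : t ≤ δ
      t≤ = ≤-trans xy≤ (≤-reflexive (½+½ δ))
      η≤e′ : η ≤ e
      η≤e′ = subst (_≤ e) (+-identityˡ η) η≤e
      square≤ : ∣ x ∣ * ∣ x ∣ + ∣ y ∣ * ∣ y ∣ ≤ t * t
      square≤ = ≤-diff (∣ x ∣ * ∣ y ∣ + ∣ x ∣ * ∣ y ∣) (0≤+ (0≤* (0≤∣p∣ x) (0≤∣p∣ y)) (0≤* (0≤∣p∣ x) (0≤∣p∣ y)))
        (solve 2 (λ x y → (x :+ y) :* (x :+ y) := x :* x :+ y :* y :+ (x :* y :+ x :* y)) ≡.refl ∣ x ∣ ∣ y ∣)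
    combine : ∀ n → Eventually (λ m → ‖ at (a n) m ⊖ at L m ‖ ≤ ½ * δ + ½ * δ) →
      ∃ λ N → ∀ m → N ℕ.≤ m → seq (normSq (a n -ℂ L)) m + δ * δ ≤ seq ε m * seq ε m
    combine n b = eventually
      (λ m (p , q) → below (seq (re (a n)) m - seq (re L) m) (seq (im (a n)) m - seq (im L) m) (seq ε m) p q)
      (b ∧ (N₀ , η≤))

  opaque
    unfolding _⊞_ _⊠_ ⊟_ κ

    ≋-trans : ∀ {x y z} → x ≋ y → y ≋ z → x ≋ z
    ≋-trans {x} {y} {z} p q = close (≼-pointwise-≡
      (λ n → ⊖-tele (at x n) (at y n) (at z n)) (≼-+ (difference p) (difference q)))

    ≋-sym : ∀ {x y} → x ≋ y → y ≋ x
    ≋-sym {x} {y} p = close (≼-pointwise-≡ (λ n → ⊖-swap (at x n) (at y n)) (≼-‿ (difference p)))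

    ⊞-cong : ∀ {x y u v} → x ≋ y → u ≋ v → x ⊞ u ≋ y ⊞ v
    ⊞-cong {x} {y} {u} {v} p q = close (≼-pointwise-≡
      (λ n → ⊖-⊕ (at x n) (at y n) (at u n) (at v n)) (≼-+ (difference p) (difference q)))

    ⊟-cong : ∀ {x y} → x ≋ y → ⊟ x ≋ ⊟ y
    ⊟-cong {x} {y} p = close (≼-pointwise-≡ (λ n → ⊝-⊖ (at x n) (at y n)) (≼-‿ (difference p)))

    ⊠-cong : ∀ {x y u v} → x ≋ y → u ≋ v → x ⊠ u ≋ y ⊠ v
    ⊠-cong {x} {y} {u} {v} p q =
      let r , hu = bounded-ℂ u
          s , hy = bounded-ℂ y
      in close (≼-mono
        (≤-reflexive (solve 2 (λ r s → con 0ℚ :* r :+ s :* con 0ℚ := con 0ℚ) ≡.refl r s))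
        (≼-pointwise-≡ (λ n → ⊗-⊖ (at x n) (at y n) (at u n) (at v n))
          (≼-+ (≼-* (difference p) hu) (≼-* hy (difference q)))))

    κ-+ : ∀ p q → κ (p + q) ≋ κ p ⊞ κ q
    κ-+ p q = pointwise λ n → cong (p + q ,_) (≡.sym (+-identityˡ 0ℚ))

    κ-* : ∀ p q → κ (p * q) ≋ κ p ⊠ κ q
    κ-* p q = pointwise λ n → κ-⊗ p q

    κ-‿ : ∀ p → κ (- p) ≋ ⊟ κ p
    κ-‿ p = pointwise λ n → ≡.refl

    ≼-resp : ∀ {x y r} → x ≋ y → x ≼ r → y ≼ r
    ≼-resp {x} {y} {r} x≋y x≼r = ≼-mono (≤-reflexive (+-identityʳ r))
      (≼-pointwise-≡ (λ n → ⊕-⊖-cancel (at x n) (at y n)) (≼-+ x≼r (≼-‿ (difference x≋y))))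

    ≼0⇒≋0 : ∀ {x} → x ≼ 0ℚ → x ≋ κ 0ℚ
    ≼0⇒≋0 {x} h = close (≼-pointwise-≡ (λ n → ≡.sym (⊖-identityʳ (at x n))) h)

    ⊞-assoc : ∀ x y z → (x ⊞ y) ⊞ z ≋ x ⊞ (y ⊞ z)
    ⊞-assoc x y z = pointwise λ n → ⊕-assoc (at x n) (at y n) (at z n)

    ⊞-comm : ∀ x y → x ⊞ y ≋ y ⊞ x
    ⊞-comm x y = pointwise λ n → ⊕-comm (at x n) (at y n)

    ⊞-identityˡ : ∀ x → κ 0ℚ ⊞ x ≋ x
    ⊞-identityˡ x = pointwise λ n → ⊕-identityˡ (at x n)

    ⊞-identityʳ : ∀ x → x ⊞ κ 0ℚ ≋ x
    ⊞-identityʳ x = pointwise λ n → ⊕-identityʳ (at x n)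

    ⊟-inverseˡ : ∀ x → ⊟ x ⊞ x ≋ κ 0ℚ
    ⊟-inverseˡ x = pointwise λ n → ⊝-inverseˡ (at x n)

    ⊟-inverseʳ : ∀ x → x ⊞ ⊟ x ≋ κ 0ℚ
    ⊟-inverseʳ x = pointwise λ n → ⊝-inverseʳ (at x n)

    ⊠-assoc : ∀ x y z → (x ⊠ y) ⊠ z ≋ x ⊠ (y ⊠ z)
    ⊠-assoc x y z = pointwise λ n → ⊗-assoc (at x n) (at y n) (at z n)

    ⊠-comm : ∀ x y → x ⊠ y ≋ y ⊠ x
    ⊠-comm x y = pointwise λ n → ⊗-comm (at x n) (at y n)

    ⊠-identityˡ : ∀ x → κ 1ℚ ⊠ x ≋ x
    ⊠-identityˡ x = pointwise λ n → ⊗-identityˡ (at x n)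

    ⊠-identityʳ : ∀ x → x ⊠ κ 1ℚ ≋ x
    ⊠-identityʳ x = pointwise λ n → ⊗-identityʳ (at x n)

    ⊠-distribˡ : ∀ x y z → x ⊠ (y ⊞ z) ≋ x ⊠ y ⊞ x ⊠ z
    ⊠-distribˡ x y z = pointwise λ n → ⊗-distribˡ (at x n) (at y n) (at z n)

    ⊠-distribʳ : ∀ x y z → (y ⊞ z) ⊠ x ≋ y ⊠ x ⊞ z ⊠ x
    ⊠-distribʳ x y z = pointwise λ n → ⊗-distribʳ (at x n) (at y n) (at z n)

  neumann-ℂ : ∀ {h ρ} → h ≼ ρ → ρ < 1ℚ → ∃ λ u → (κ 1ℚ ⊞ h) ⊠ u ≋ κ 1ℚ
  neumann-ℂ {h} h≼ρ ρ<1 = invert (one+-nonzero h≼ρ ρ<1)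
    where
    invert : Nonzero (1ℂ +ℂ h) → ∃ λ u → (κ 1ℚ ⊞ h) ⊠ u ≋ κ 1ℚ
    invert nz = recip (1ℂ +ℂ h) nz , ≋-trans (⊠-cong (pointwise same) (≋-refl {recip (1ℂ +ℂ h) nz})) (recip-inverse (1ℂ +ℂ h) nz)
      where
      same : ∀ n → at (κ 1ℚ ⊞ h) n ≡ at (1ℂ +ℂ h) n
      same n = ≡.trans (at-⊞ (κ 1ℚ) h n) (cong (_⊕ at h n) (at-κ 1ℚ n))

  ℂ-ring : CommutativeRing 0ℓ 0ℓ
  ℂ-ring = record
    { Carrier = ℂ ; _≈_ = _≋_ ; _+_ = _⊞_ ; _*_ = _⊠_ ; -_ = ⊟_ ; 0# = κ 0ℚ ; 1# = κ 1ℚ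
    ; isCommutativeRing = record
      { isRing = record
        { +-isAbelianGroup = record
          { isGroup = record
            { isMonoid = record
              { isSemigroup = record
                { isMagma = record
                  { isEquivalence = record { refl = ≋-refl ; sym = ≋-sym ; trans = ≋-trans }
                  ; ∙-cong = ⊞-cong }
                ; assoc = ⊞-assoc }
              ; identity = ⊞-identityˡ , ⊞-identityʳ }
            ; inverse = ⊟-inverseˡ , ⊟-inverseʳ
            ; ⁻¹-cong = ⊟-cong }
          ; comm = ⊞-comm }
        ; *-cong = ⊠-cong
        ; *-assoc = ⊠-assoc
        ; *-identity = ⊠-identityˡ , ⊠-identityʳ
        ; distrib = ⊠-distribˡ , ⊠-distribʳ }
      ; *-comm = ⊠-comm } }

  ℂ-algebra : NormedAlgebra
  ℂ-algebra = record
    { ring = ℂ-ring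
    ; κ = κ ; κ-+ = κ-+ ; κ-* = κ-* ; κ-‿ = κ-‿
    ; κ-0 = ≋-refl
    ; κ-1 = ≋-refl
    ; _≼_ = _≼_
    ; ≼-resp = ≼-resp
    ; ≼-+ = ≼-+ ; ≼-* = ≼-* ; ≼-‿ = ≼-‿ ; ≼-κ = ≼-κ ; ≼-mono = ≼-mono ; ≼-closed = ≼-closed ; ≼⇒0≤ = ≼⇒0≤
    ; ≼0⇒≈0 = ≼0⇒≋0
    ; bounded = bounded-ℂ
    ; selfbound = selfbound-ℂ
    ; neumann = neumann-ℂ }

-- Taylor estimates for the exponential series.

module Exponential where
  open import Data.Rational
  open import Data.Rational.Properties
  open import Data.Rational.Solver using (module +-*-Solver)
  open +-*-Solver
  open Order
  open GaussianRationals
  open ComplexNorm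
  private
    module G = Algebra.Solver.Ring.Simple (ACR.fromCommutativeRing ℚ[i]-ring) (×.≡-dec _≟_ _≟_)

  •-⊗ : ∀ r v → r • v ≡ (r , 0ℚ) ⊗ v
  •-⊗ r (a , b) = cong₂ _,_
    (solve 3 (λ r a b → r :* a := r :* a :- con 0ℚ :* b) ≡.refl r a b)
    (solve 3 (λ r a b → r :* b := r :* b :+ con 0ℚ :* a) ≡.refl r a b)

  -- the derivative of wᵏ/k!
  expTerm′ : ℚ[i] → ℕ → ℚ[i]
  expTerm′ w zero    = 0ᵢ
  expTerm′ w (suc k) = expTerm w k

  remainder : ℚ[i] → ℚ[i] → ℕ → ℚ[i]
  remainder w h k = expTerm (w ⊕ h) k ⊖ (expTerm w k ⊕ (h ⊗ expTerm′ w k))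

  κᵢ : ℕ → ℚ[i]
  κᵢ n = ι n , 0ℚ

  κᵢ-suc : ∀ n → κᵢ (suc n) ≡ 1ᵢ ⊕ κᵢ n
  κᵢ-suc n = cong₂ _,_ (ι-suc n) (≡.sym (+-identityˡ 0ℚ))

  1/suc-κᵢ : ∀ k → (1/suc k , 0ℚ) ⊗ κᵢ (suc k) ≡ 1ᵢ
  1/suc-κᵢ k = ≡.trans (≡.sym (κ-⊗ (1/suc k) (ι (suc k)))) (cong (_, 0ℚ) (1/suc-inverse k))

  expTerm′-⊗ : ∀ w k → expTerm′ w k ⊗ w ≡ κᵢ k ⊗ expTerm w k
  expTerm′-⊗ w zero    = ≡.trans (G.solve 1 (λ w → G.con 0ᵢ G.:* w G.:= G.con 0ᵢ) ≡.refl w) (≡.sym (⊗-identityʳ 0ᵢ))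
  expTerm′-⊗ w (suc k) = ≡.sym (≡.trans (cong (κᵢ (suc k) ⊗_) (•-⊗ (1/suc k) (expTerm w k ⊗ w)))
    (≡.trans (G.solve 3 (λ n k⁻¹ x → n G.:* (k⁻¹ G.:* x) G.:= (k⁻¹ G.:* n) G.:* x) ≡.refl (κᵢ (suc k)) (1/suc k , 0ℚ) (expTerm w k ⊗ w))
      (≡.trans (cong (_⊗ (expTerm w k ⊗ w)) (1/suc-κᵢ k)) (⊗-identityˡ (expTerm w k ⊗ w)))))

  -- Expresses the first-order remainder of (w + h)ᵏ⁺¹/(k + 1)! through that of degree k, with h² as
  -- an explicit factor of the new part; the quadratic bound then follows by induction, without the
  -- binomial theorem.
  remainder-suc : ∀ w h k → remainder w h (suc k) ≡
    1/suc k • (((h ⊗ h) ⊗ expTerm′ w k) ⊕ (remainder w h k ⊗ (w ⊕ h)))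
  remainder-suc w h k = begin
    (1/suc k • (S ⊗ (w ⊕ h))) ⊖ ((1/suc k • (T ⊗ w)) ⊕ (h ⊗ T))
      ≡⟨ cong₂ _⊖_ (•-⊗ (1/suc k) (S ⊗ (w ⊕ h))) (cong₂ _⊕_ (•-⊗ (1/suc k) (T ⊗ w)) hT) ⟩
    (k⁻¹ ⊗ (S ⊗ (w ⊕ h))) ⊖ ((k⁻¹ ⊗ (T ⊗ w)) ⊕ (k⁻¹ ⊗ (h ⊗ (T ⊕ (P ⊗ w)))))
      ≡⟨ G.solve 6 (λ k⁻¹ S T P w h →
           (k⁻¹ G.:* (S G.:* (w G.:+ h))) G.:- ((k⁻¹ G.:* (T G.:* w)) G.:+ (k⁻¹ G.:* (h G.:* (T G.:+ (P G.:* w))))) G.:=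
           k⁻¹ G.:* (((h G.:* h) G.:* P) G.:+ ((S G.:- (T G.:+ (h G.:* P))) G.:* (w G.:+ h)))) ≡.refl k⁻¹ S T P w h ⟩
    k⁻¹ ⊗ (((h ⊗ h) ⊗ P) ⊕ ((S ⊖ (T ⊕ (h ⊗ P))) ⊗ (w ⊕ h)))
      ≡⟨ •-⊗ (1/suc k) (((h ⊗ h) ⊗ P) ⊕ ((S ⊖ (T ⊕ (h ⊗ P))) ⊗ (w ⊕ h))) ⟨
    1/suc k • (((h ⊗ h) ⊗ P) ⊕ ((S ⊖ (T ⊕ (h ⊗ P))) ⊗ (w ⊕ h))) ∎
    where
    open ≡.≡-Reasoning
    S T P k⁻¹ : ℚ[i]
    S = expTerm (w ⊕ h) k
    T = expTerm w k
    P = expTerm′ w k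
    k⁻¹ = 1/suc k , 0ℚ
    hT : h ⊗ T ≡ k⁻¹ ⊗ (h ⊗ (T ⊕ (P ⊗ w)))
    hT = begin
      h ⊗ T                        ≡⟨ ⊗-identityˡ (h ⊗ T) ⟨
      1ᵢ ⊗ (h ⊗ T)                 ≡⟨ cong (_⊗ (h ⊗ T)) (1/suc-κᵢ k) ⟨
      (k⁻¹ ⊗ κᵢ (suc k)) ⊗ (h ⊗ T)   ≡⟨ cong (λ n → (k⁻¹ ⊗ n) ⊗ (h ⊗ T)) (κᵢ-suc k) ⟩
      (k⁻¹ ⊗ (1ᵢ ⊕ κᵢ k)) ⊗ (h ⊗ T)  ≡⟨ G.solve 4 (λ k⁻¹ n h T → (k⁻¹ G.:* (G.con 1ᵢ G.:+ n)) G.:* (h G.:* T) G.:=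
                                        k⁻¹ G.:* (h G.:* (T G.:+ (n G.:* T)))) ≡.refl k⁻¹ (κᵢ k) h T ⟩
      k⁻¹ ⊗ (h ⊗ (T ⊕ (κᵢ k ⊗ T)))   ≡⟨ cong (λ x → k⁻¹ ⊗ (h ⊗ (T ⊕ x))) (expTerm′-⊗ w k) ⟨
      k⁻¹ ⊗ (h ⊗ (T ⊕ (P ⊗ w)))      ∎

  module Taylor (M : ℕ) {w h : ℚ[i]} (w≤B : ‖ w ‖ ≤ ι (suc M)) (w+h≤B : ‖ w ⊕ h ‖ ≤ ι (suc M)) where
    open ExpEstimates M
    private
      B : ℚ
      B = ι (suc M)
      b c : ℕ → ℚ
      b = expBound B
      c = expBound′ B
      H² : ℚ
      H² = ‖ h ‖ * ‖ h ‖
      0≤H² : 0ℚ ≤ H²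
      0≤H² = 0≤* (0≤‖‖ h) (0≤‖‖ h)

    ‖expTerm′‖ : ∀ k → ‖ expTerm′ w k ‖ ≤ c k
    ‖expTerm′‖ zero    = ≤-reflexive (+-identityˡ 0ℚ)
    ‖expTerm′‖ (suc k) = term-bound w≤B k

    remainder-zero : remainder w h 0 ≡ 0ᵢ
    remainder-zero = G.solve 1 (λ h → G.con 1ᵢ G.:- (G.con 1ᵢ G.:+ (h G.:* G.con 0ᵢ)) G.:= G.con 0ᵢ) ≡.refl h

    remainder-step : ∀ k x → ‖ remainder w h k ‖ ≤ H² * x →
      ‖ remainder w h (suc k) ‖ ≤ 1/suc k * (H² * (c k + x * B))
    remainder-step k x ih = begin
      ‖ remainder w h (suc k) ‖  ≡⟨ cong ‖_‖ (remainder-suc w h k) ⟩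
      ‖ 1/suc k • (u ⊕ v) ‖      ≡⟨ ‖•‖ (1/suc k) (u ⊕ v) (<⇒≤ (0<1/suc k)) ⟩
      1/suc k * ‖ u ⊕ v ‖        ≤⟨ *-monoˡ (<⇒≤ (0<1/suc k)) (≤-trans (‖⊕‖ u v) (+-mono-≤ u≤ v≤)) ⟩
      1/suc k * (H² * c k + H² * x * B) ≡⟨ cong (1/suc k *_) (solve 4 (λ H c x B → H :* c :+ H :* x :* B := H :* (c :+ x :* B)) ≡.refl H² (c k) x B) ⟩
      1/suc k * (H² * (c k + x * B)) ∎
      where
      open ≤-Reasoning
      u v : ℚ[i]
      u = (h ⊗ h) ⊗ expTerm′ w k
      v = remainder w h k ⊗ (w ⊕ h)
      u≤ : ‖ u ‖ ≤ H² * c k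
      u≤ = ≤-trans (‖⊗‖ (h ⊗ h) (expTerm′ w k)) (*-mono-≤ (0≤‖‖ (h ⊗ h)) (0≤c k) (‖⊗‖ h h) (‖expTerm′‖ k))
      v≤ : ‖ v ‖ ≤ H² * x * B
      v≤ = ≤-trans (‖⊗‖ (remainder w h k) (w ⊕ h)) (*-mono-≤ (0≤‖‖ (remainder w h k)) (0≤ι (suc M)) ih w+h≤B)

    remainder-bound : ∀ k → ‖ remainder w h (suc k) ‖ ≤ H² * c k
    remainder-bound zero = ≤-trans (remainder-step 0 0ℚ (≤-trans (‖‖-reflexive remainder-zero)
        (≤-reflexive (≡.trans (+-identityˡ 0ℚ) (≡.sym (*-zeroʳ H²))))))
      (≤-reflexive (solve 3 (λ k⁻¹ H B → k⁻¹ :* (H :* (con 0ℚ :+ con 0ℚ :* B)) := H :* con 0ℚ) ≡.refl (1/suc 0) H² B))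
    remainder-bound (suc m) = begin
      ‖ remainder w h (suc (suc m)) ‖     ≤⟨ remainder-step (suc m) (c m) (remainder-bound m) ⟩
      k⁻¹ * (H² * (b m + c m * B))          ≡⟨ cong (λ y → k⁻¹ * (H² * (b m + y))) (c*B m) ⟩
      k⁻¹ * (H² * (b m + ι m * b m))        ≡⟨ solve 4 (λ k⁻¹ H b n → k⁻¹ :* (H :* (b :+ n :* b)) := (H :* b) :* (k⁻¹ :* (con 1ℚ :+ n))) ≡.refl k⁻¹ H² (b m) (ι m) ⟩
      (H² * b m) * (k⁻¹ * (1ℚ + ι m))       ≤⟨ *-monoˡ (0≤* 0≤H² (0≤b m)) (*-monoˡ (<⇒≤ (0<1/suc (suc m)))
                                               (≤-trans (≤-reflexive (≡.sym (ι-suc m))) (ι-mono-≤ (ℕ.n≤1+n (suc m))))) ⟩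
      (H² * b m) * (k⁻¹ * ι (suc (suc m)))  ≡⟨ cong ((H² * b m) *_) (1/suc-inverse (suc m)) ⟩
      (H² * b m) * 1ℚ                     ≡⟨ *-identityʳ (H² * b m) ⟩
      H² * b m                            ∎
      where
      open ≤-Reasoning
      k⁻¹ : ℚ
      k⁻¹ = 1/suc (suc m)

    -- The lengths differ by one because the derivative of the partial sum with m + 1 terms is the
    -- one with m terms.
    sum-remainder : ∀ m → ‖ expSum (w ⊕ h) (suc m) ⊖ (expSum w (suc m) ⊕ (h ⊗ expSum w m)) ‖ ≤ H² * ∑ c m
    sum-remainder zero = ≤-reflexive (≡.trans
      (cong ‖_‖ (G.solve 1 (λ h → (G.con 0ᵢ G.:+ G.con 1ᵢ) G.:- ((G.con 0ᵢ G.:+ G.con 1ᵢ) G.:+ (h G.:* G.con 0ᵢ)) G.:= G.con 0ᵢ) ≡.refl h))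
      (≡.trans (+-identityˡ 0ℚ) (≡.sym (*-zeroʳ H²))))
    sum-remainder (suc m) = begin
      ‖ (expSum (w ⊕ h) (suc m) ⊕ T′) ⊖ ((expSum w (suc m) ⊕ T) ⊕ (h ⊗ (expSum w m ⊕ expTerm w m))) ‖
        ≡⟨ cong ‖_‖ (G.solve 7 (λ a b c d e f h → (a G.:+ b) G.:- ((c G.:+ d) G.:+ (h G.:* (e G.:+ f))) G.:=
             (a G.:- (c G.:+ (h G.:* e))) G.:+ (b G.:- (d G.:+ (h G.:* f)))) ≡.refl
             (expSum (w ⊕ h) (suc m)) T′ (expSum w (suc m)) T (expSum w m) (expTerm w m) h) ⟩
      ‖ (expSum (w ⊕ h) (suc m) ⊖ (expSum w (suc m) ⊕ (h ⊗ expSum w m))) ⊕ remainder w h (suc m) ‖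
        ≤⟨ ‖⊕‖ (expSum (w ⊕ h) (suc m) ⊖ (expSum w (suc m) ⊕ (h ⊗ expSum w m))) (remainder w h (suc m)) ⟩
      ‖ expSum (w ⊕ h) (suc m) ⊖ (expSum w (suc m) ⊕ (h ⊗ expSum w m)) ‖ + ‖ remainder w h (suc m) ‖
        ≤⟨ +-mono-≤ (sum-remainder m) (remainder-bound m) ⟩
      H² * ∑ c m + H² * c m
        ≡⟨ *-distribˡ-+ H² (∑ c m) (c m) ⟨
      H² * (∑ c m + c m) ∎
      where
      open ≤-Reasoning
      T T′ : ℚ[i]
      T  = expTerm w (suc m)
      T′ = expTerm (w ⊕ h) (suc m)

    -- The diagonal definition of exp uses the same length in every place, so one term is added
    -- back; its bound ‖h‖Bᵐ/m! vanishes in the limit.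
    remainder-total : ∀ m → ‖ expSum (w ⊕ h) (suc m) ⊖ (expSum w (suc m) ⊕ (h ⊗ expSum w (suc m))) ‖ ≤
      H² * ∑ c m + ‖ h ‖ * b m
    remainder-total m = begin
      ‖ A ⊖ (E ⊕ (h ⊗ (expSum w m ⊕ expTerm w m))) ‖
        ≡⟨ cong ‖_‖ (G.solve 5 (λ a e s t h → a G.:- (e G.:+ (h G.:* (s G.:+ t))) G.:=
             (a G.:- (e G.:+ (h G.:* s))) G.:+ (G.:- (h G.:* t))) ≡.refl A E (expSum w m) (expTerm w m) h) ⟩
      ‖ (A ⊖ (E ⊕ (h ⊗ expSum w m))) ⊕ (⊝ (h ⊗ expTerm w m)) ‖
        ≤⟨ ‖⊕‖ (A ⊖ (E ⊕ (h ⊗ expSum w m))) (⊝ (h ⊗ expTerm w m)) ⟩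
      ‖ A ⊖ (E ⊕ (h ⊗ expSum w m)) ‖ + ‖ ⊝ (h ⊗ expTerm w m) ‖
        ≤⟨ +-mono-≤ (sum-remainder m) (≤-trans (≤-reflexive (‖-‖ (proj₁ (h ⊗ expTerm w m)) (proj₂ (h ⊗ expTerm w m))))
             (≤-trans (‖⊗‖ h (expTerm w m)) (*-monoˡ (0≤‖‖ h) (term-bound w≤B m)))) ⟩
      H² * ∑ c m + ‖ h ‖ * b m ∎
      where
      open ≤-Reasoning
      A E : ℚ[i]
      A = expSum (w ⊕ h) (suc m)
      E = expSum w (suc m)

  opaque
    Exp : ℂ → ℂ
    Exp = exp

    Exp-def : ∀ w → Exp w ≡ exp w
    Exp-def w = ≡.refl

    at-Exp : ∀ w n → at (Exp w) n ≡ expSum (at w n) n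
    at-Exp w n = ≡.refl

  above : ∀ B → ∃ λ M → ∣ B ∣ + 1ℚ ≤ ι (suc M)
  above B = ι-above (∣ B ∣ + 1ℚ) (0<+ (0≤∣p∣ B) 0<1)

  under : ∀ M {w B} → ∣ B ∣ + 1ℚ ≤ ι (suc M) → w ≼ B → Eventually λ n → ‖ at w n ‖ ≤ ι (suc M)
  under M {B = B} le w≼B = eventually (λ n b → ≤-trans b (≤-trans (+-monoˡ-≤ 1ℚ (p≤∣p∣ B)) le)) (within w≼B 1ℚ 0<1)

  Exp-cong : ∀ {w v} → w ≋ v → Exp w ≋ Exp v
  Exp-cong {w} {v} w≋v = go (bounded-ℂ w) (bounded-ℂ v)
    where
    main : ∀ M L → 0ℚ < L → (∀ n → ∣ ∑ (expBound′ (ι (suc M))) n ∣ ≤ L) →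
      (Eventually λ n → ‖ at w n ‖ ≤ ι (suc M)) → (Eventually λ n → ‖ at v n ‖ ≤ ι (suc M)) → Exp w ≋ Exp v
    main M L 0<L c≤ w≤ v≤ = close (≼-from L 0<L λ ε 0<ε _ → eventually
      (λ n (p , q , t) → estimate ε n p q t) (w≤ ∧ v≤ ∧ _≋_.within w≋v ε 0<ε))
      where
      estimate : ∀ ε n → ‖ at w n ‖ ≤ ι (suc M) → ‖ at v n ‖ ≤ ι (suc M) → ‖ at w n ⊖ at v n ‖ ≤ 0ℚ + ε →
        ‖ at (Exp w ⊞ ⊟ Exp v) n ‖ ≤ 0ℚ + L * ε
      estimate ε n p q t = begin
        ‖ at (Exp w ⊞ ⊟ Exp v) n ‖
          ≡⟨ cong ‖_‖ (≡.trans (at-⊖ (Exp w) (Exp v) n) (cong₂ _⊖_ (at-Exp w n) (at-Exp v n))) ⟩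
        ‖ expSum (at w n) n ⊖ expSum (at v n) n ‖
          ≤⟨ ExpEstimates.sum-lipschitz M p q n ⟩
        ‖ at w n ⊖ at v n ‖ * ∑ (expBound′ (ι (suc M))) n
          ≤⟨ *-mono-≤ (0≤‖‖ (at w n ⊖ at v n)) (<⇒≤ 0<L) t (≤-trans (p≤∣p∣ _) (c≤ n)) ⟩
        (0ℚ + ε) * L
          ≡⟨ solve 2 (λ e l → (con 0ℚ :+ e) :* l := con 0ℚ :+ l :* e) ≡.refl ε L ⟩
        0ℚ + L * ε ∎
        where open ≤-Reasoning
    mid : ∀ {r s} → w ≼ r → v ≼ s → (∃ λ M → ∣ r + s ∣ + 1ℚ ≤ ι (suc M)) → Exp w ≋ Exp v
    mid {r} {s} w≼r v≼s (M , le) = fin (bounded {∑ (expBound′ (ι (suc M)))} (ExpEstimates.∑c-cauchy M))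
      where
      fin : (∃ λ L → 0ℚ < L × ∀ n → ∣ ∑ (expBound′ (ι (suc M))) n ∣ ≤ L) → Exp w ≋ Exp v
      fin (L , 0<L , c≤) = main M L 0<L c≤
        (under M le (≼-mono (a≤a+b r (≼⇒0≤ v≼s)) w≼r))
        (under M le (≼-mono (≤-diff r (≼⇒0≤ w≼r) (+-comm r s)) v≼s))
    go : (∃ λ r → w ≼ r) → (∃ λ s → v ≼ s) → Exp w ≋ Exp v
    go (r , w≼r) (s , v≼s) = mid w≼r v≼s (above (r + s))

  Exp-bound : ∀ B → ∃ λ E → ∀ {w} → w ≼ B → Exp w ≼ E
  Exp-bound B = go (above B)
    where
    go : (∃ λ M → ∣ B ∣ + 1ℚ ≤ ι (suc M)) → ∃ λ E → ∀ {w} → w ≼ B → Exp w ≼ E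
    go (M , le) = fin (bounded {∑ b} (ExpEstimates.∑b-cauchy M))
      where
      b : ℕ → ℚ
      b = expBound (ι (suc M))
      fin : (∃ λ L → 0ℚ < L × ∀ n → ∣ ∑ b n ∣ ≤ L) → ∃ λ E → ∀ {w} → w ≼ B → Exp w ≼ E
      fin (L , 0<L , b≤) = L , λ {w} w≼B → bound λ ε 0<ε → eventually (λ n → estimate w ε n (<⇒≤ 0<ε)) (under M le w≼B)
        where
        estimate : ∀ w ε n → 0ℚ ≤ ε → ‖ at w n ‖ ≤ ι (suc M) → ‖ at (Exp w) n ‖ ≤ L + ε
        estimate w ε n 0≤ε p = begin
          ‖ at (Exp w) n ‖           ≡⟨ cong ‖_‖ (≡.trans (at-Exp w n) (≡.sym (⊖-identityʳ (expSum (at w n) n)))) ⟩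
          ‖ expSum (at w n) n ⊖ 0ᵢ ‖ ≤⟨ ExpEstimates.sum-tail M p {0} {n} ℕ.z≤′n ⟩
          ∑ b n - 0ℚ                 ≡⟨ +-identityʳ (∑ b n) ⟩
          ∑ b n                      ≤⟨ ≤-trans (p≤∣p∣ (∑ b n)) (b≤ n) ⟩
          L                          ≤⟨ a≤a+b L 0≤ε ⟩
          L + ε                      ∎
          where open ≤-Reasoning

  Exp-taylor₁ : ∀ B → ∃ λ C → 0ℚ ≤ C × (∀ {w h r} → w ≼ B → w ⊞ h ≼ B → h ≼ r →
    Exp (w ⊞ h) ⊞ ⊟ (Exp w ⊞ h ⊠ Exp w) ≼ C * (r * r))
  Exp-taylor₁ B = go (above B)
    where
    main : ∀ M → ∣ B ∣ + 1ℚ ≤ ι (suc M) → ∀ L → 0ℚ < L → (∀ n → ∣ ∑ (expBound′ (ι (suc M))) n ∣ ≤ L) →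
      ∀ {w h r} → w ≼ B → w ⊞ h ≼ B → h ≼ r → Exp (w ⊞ h) ⊞ ⊟ (Exp w ⊞ h ⊠ Exp w) ≼ L * (r * r)
    main M le L 0<L c≤ {w} {h} {r} w≼B w+h≼B h≼r = ≼-from K 0<K λ ε 0<ε ε≤1 →
      step ε 0<ε ε≤1 (ExpEstimates.∑b-cauchy M ε 0<ε)
      where
      b c : ℕ → ℚ
      b = expBound (ι (suc M))
      c = expBound′ (ι (suc M))
      0≤r : 0ℚ ≤ r
      0≤r = ≼⇒0≤ h≼r
      K : ℚ
      K = L * (r + r + 1ℚ) + (r + 1ℚ)
      0<r+1 : 0ℚ < r + 1ℚ
      0<r+1 = 0<+ 0≤r 0<1
      0<K : 0ℚ < K
      0<K = 0<+ (0≤* (<⇒≤ 0<L) (0≤+ (0≤+ 0≤r 0≤r) 0≤1)) 0<r+1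
      -- A single term is the difference of consecutive partial sums, so the Cauchy property makes
      -- it small.
      small : ∀ ε m → ∣ ∑ b (suc m) - ∑ b m ∣ < ε → b m ≤ ε
      small ε m lt = ≤-trans (≤-reflexive (solve 2 (λ s b → b := (s :+ b) :- s) ≡.refl (∑ b m) (b m)))
        (≤-trans (p≤∣p∣ _) (<⇒≤ lt))
      estimate : ∀ m ε → 0ℚ ≤ ε → ε ≤ 1ℚ → ‖ at w (suc m) ‖ ≤ ι (suc M) → ‖ at w (suc m) ⊕ at h (suc m) ‖ ≤ ι (suc M) →
        ‖ at h (suc m) ‖ ≤ r + ε → b m ≤ ε →
        ‖ at (Exp (w ⊞ h) ⊞ ⊟ (Exp w ⊞ h ⊠ Exp w)) (suc m) ‖ ≤ L * (r * r) + K * ε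
      estimate m ε 0≤ε ε≤1 p q t s = begin
        ‖ at (Exp (w ⊞ h) ⊞ ⊟ (Exp w ⊞ h ⊠ Exp w)) (suc m) ‖
          ≡⟨ cong ‖_‖ expand ⟩
        ‖ expSum (w′ ⊕ h′) (suc m) ⊖ (expSum w′ (suc m) ⊕ (h′ ⊗ expSum w′ (suc m))) ‖
          ≤⟨ Taylor.remainder-total M p q m ⟩
        ‖ h′ ‖ * ‖ h′ ‖ * ∑ c m + ‖ h′ ‖ * b m
          ≤⟨ +-mono-≤ (*-mono-≤ (0≤* (0≤‖‖ h′) (0≤‖‖ h′)) (<⇒≤ 0<L) (*-mono-≤ (0≤‖‖ h′) 0≤r+ε t t) (≤-trans (p≤∣p∣ _) (c≤ m)))
               (*-mono-≤ (0≤‖‖ h′) 0≤ε t s) ⟩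
        (r + ε) * (r + ε) * L + (r + ε) * ε
          ≡⟨ solve 3 (λ r e L → (r :+ e) :* (r :+ e) :* L :+ (r :+ e) :* e :=
               L :* (r :* r) :+ (L :* (r :+ r :+ e) :+ (r :+ e)) :* e) ≡.refl r ε L ⟩
        L * (r * r) + (L * (r + r + ε) + (r + ε)) * ε
          ≤⟨ +-monoʳ-≤ (L * (r * r)) (*-monoʳ 0≤ε (+-mono-≤ (*-monoˡ (<⇒≤ 0<L) (+-monoʳ-≤ (r + r) ε≤1)) (+-monoʳ-≤ r ε≤1))) ⟩
        L * (r * r) + K * ε ∎
        where
        open ≤-Reasoning
        w′ h′ : ℚ[i]
        w′ = at w (suc m)
        h′ = at h (suc m)
        0≤r+ε : 0ℚ ≤ r + ε
        0≤r+ε = 0≤+ 0≤r 0≤ε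
        expand : at (Exp (w ⊞ h) ⊞ ⊟ (Exp w ⊞ h ⊠ Exp w)) (suc m) ≡
          expSum (w′ ⊕ h′) (suc m) ⊖ (expSum w′ (suc m) ⊕ (h′ ⊗ expSum w′ (suc m)))
        expand = ≡.trans (at-⊖ (Exp (w ⊞ h)) (Exp w ⊞ h ⊠ Exp w) (suc m)) (cong₂ _⊖_
          (≡.trans (at-Exp (w ⊞ h) (suc m)) (cong (λ v → expSum v (suc m)) (at-⊞ w h (suc m))))
          (≡.trans (at-⊞ (Exp w) (h ⊠ Exp w) (suc m)) (cong₂ _⊕_ (at-Exp w (suc m))
            (≡.trans (at-⊠ h (Exp w) (suc m)) (cong (h′ ⊗_) (at-Exp w (suc m)))))))
      step : ∀ ε → 0ℚ < ε → ε ≤ 1ℚ → (∃ λ N → ∀ m n → N ℕ.≤ m → N ℕ.≤ n → ∣ ∑ b m - ∑ b n ∣ < ε) →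
        Eventually λ n → ‖ at (Exp (w ⊞ h) ⊞ ⊟ (Exp w ⊞ h ⊠ Exp w)) n ‖ ≤ L * (r * r) + K * ε
      step ε 0<ε ε≤1 (N , b-small) = eventually
        (λ { (suc m) (p , q , t , sN≤n) → estimate m ε (<⇒≤ 0<ε) ε≤1 p
               (≤-trans (‖‖-reflexive (≡.sym (at-⊞ w h (suc m)))) q) t
               (small ε m (b-small (suc m) m (ℕ.≤-trans (ℕ.n≤1+n N) sN≤n) (ℕ.s≤s⁻¹ sN≤n)))
           ; zero (_ , _ , _ , ()) })
        (under M le w≼B ∧ under M le w+h≼B ∧ within h≼r ε 0<ε ∧ (suc N , λ _ z → z))
    go : (∃ λ M → ∣ B ∣ + 1ℚ ≤ ι (suc M)) → ∃ λ C → 0ℚ ≤ C × (∀ {w h r} → w ≼ B → w ⊞ h ≼ B → h ≼ r →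
      Exp (w ⊞ h) ⊞ ⊟ (Exp w ⊞ h ⊠ Exp w) ≼ C * (r * r))
    go (M , le) = fin (bounded {∑ (expBound′ (ι (suc M)))} (ExpEstimates.∑c-cauchy M))
      where
      fin : (∃ λ L → 0ℚ < L × ∀ n → ∣ ∑ (expBound′ (ι (suc M))) n ∣ ≤ L) →
        ∃ λ C → 0ℚ ≤ C × (∀ {w h r} → w ≼ B → w ⊞ h ≼ B → h ≼ r →
          Exp (w ⊞ h) ⊞ ⊟ (Exp w ⊞ h ⊠ Exp w) ≼ C * (r * r))
      fin (L , 0<L , c≤) = L , <⇒≤ 0<L , λ {w} {h} {r} → main M le L 0<L c≤ {w} {h} {r}

  ‖expTerm‖ : ∀ {w r} → ‖ w ‖ ≤ r → 0ℚ ≤ r → ∀ k → ‖ expTerm w k ‖ ≤ expBound r k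
  ‖expTerm‖ w≤r 0≤r zero = ≤-reflexive (+-identityʳ 1ℚ)
  ‖expTerm‖ {w} {r} w≤r 0≤r (suc k) = ≤-trans (≤-reflexive (‖•‖ (1/suc k) (expTerm w k ⊗ w) (<⇒≤ (0<1/suc k))))
    (*-monoˡ (<⇒≤ (0<1/suc k)) (≤-trans (‖⊗‖ (expTerm w k) w)
      (*-mono-≤ (0≤‖‖ (expTerm w k)) 0≤r (‖expTerm‖ w≤r 0≤r k) w≤r)))

  0≤expBound : ∀ {r} → 0ℚ ≤ r → ∀ k → 0ℚ ≤ expBound r k
  0≤expBound 0≤r zero    = 0≤1
  0≤expBound 0≤r (suc k) = 0≤* (<⇒≤ (0<1/suc k)) (0≤* (0≤expBound 0≤r k) 0≤r)

  -- For r ≤ 5/3 the terms rᵏ/k! with k ≥ 3 shrink by at least 5/12 = (5/3)/4, so their sum is at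
  -- most 12/7 = 1/(1 - 5/12) times r³/6, which is 2/7 · r³. The margin 5/3 - 8/5 = 1/15 leaves room
  -- for rational approximations that exceed the radius 8/5.
  12/7 5/12 2/7 5/3 8/5 1/15 ¼ : ℚ
  12/7 = ℤ.+ 12 / 7
  5/12 = ℤ.+ 5 / 12
  2/7  = ℤ.+ 2 / 7
  5/3  = ℤ.+ 5 / 3
  8/5  = ℤ.+ 8 / 5
  1/15 = ℤ.+ 1 / 15
  ¼    = ℤ.+ 1 / 4

  expBound-decay : ∀ {r} → 0ℚ ≤ r → r ≤ 5/3 → ∀ n → expBound r (4 ℕ.+ n) ≤ 5/12 * expBound r (3 ℕ.+ n)
  expBound-decay {r} 0≤r r≤ n = begin
    1/suc k * (expBound r k * r)   ≤⟨ *-mono-≤ (<⇒≤ (0<1/suc k)) (0≤* (0≤expBound 0≤r k) 0≤5/3)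
                                        (1/suc-antitone {3} {k} (ℕ.m≤m+n 3 n)) (*-monoˡ (0≤expBound 0≤r k) r≤) ⟩
    1/suc 3 * (expBound r k * 5/3) ≡⟨ solve 1 (λ b → con ¼ :* (b :* con 5/3) := con 5/12 :* b) ≡.refl (expBound r k) ⟩
    5/12 * expBound r k            ∎
    where
    open ≤-Reasoning
    k : ℕ
    k = 3 ℕ.+ n
    0≤5/3 : 0ℚ ≤ 5/3
    0≤5/3 = ≤ᵇ⇒≤ _

  -- The second summand on the left bounds the terms still to come; keeping it makes the geometric
  -- estimate inductive, by 1 + 12/7 · 5/12 = 12/7.
  expSum-tail₃ : ∀ {w r} → ‖ w ‖ ≤ r → 0ℚ ≤ r → r ≤ 5/3 → ∀ n →
    ‖ expSum w (3 ℕ.+ n) ⊖ expSum w 3 ‖ + 12/7 * expBound r (3 ℕ.+ n) ≤ 12/7 * expBound r 3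
  expSum-tail₃ {w} {r} w≤r 0≤r r≤ zero = ≤-reflexive (≡.trans
    (cong (λ v → ‖ v ‖ + 12/7 * expBound r 3) (⊝-inverseʳ (expSum w 3)))
    (≡.trans (cong (_+ 12/7 * expBound r 3) (+-identityˡ 0ℚ)) (+-identityˡ (12/7 * expBound r 3))))
  expSum-tail₃ {w} {r} w≤r 0≤r r≤ (suc n) = begin
    ‖ (E ⊕ T) ⊖ E₃ ‖ + 12/7 * expBound r (4 ℕ.+ n)
      ≡⟨ cong (λ v → ‖ v ‖ + 12/7 * expBound r (4 ℕ.+ n)) (G.solve 3 (λ e t s → (e G.:+ t) G.:- s G.:= (e G.:- s) G.:+ t) ≡.refl E T E₃) ⟩
    ‖ (E ⊖ E₃) ⊕ T ‖ + 12/7 * expBound r (4 ℕ.+ n)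
      ≤⟨ +-mono-≤ (≤-trans (‖⊕‖ (E ⊖ E₃) T) (+-monoʳ-≤ ‖ E ⊖ E₃ ‖ (‖expTerm‖ w≤r 0≤r (3 ℕ.+ n))))
           (*-monoˡ (≤ᵇ⇒≤ {0ℚ} {12/7} _) (expBound-decay 0≤r r≤ n)) ⟩
    ‖ E ⊖ E₃ ‖ + b + 12/7 * (5/12 * b)
      ≡⟨ solve 2 (λ x b → x :+ b :+ con 12/7 :* (con 5/12 :* b) := x :+ con 12/7 :* b) ≡.refl ‖ E ⊖ E₃ ‖ b ⟩
    ‖ E ⊖ E₃ ‖ + 12/7 * b
      ≤⟨ expSum-tail₃ w≤r 0≤r r≤ n ⟩
    12/7 * expBound r 3 ∎
    where
    open ≤-Reasoning
    E T E₃ : ℚ[i]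
    E  = expSum w (3 ℕ.+ n)
    T  = expTerm w (3 ℕ.+ n)
    E₃ = expSum w 3
    b : ℚ
    b = expBound r (3 ℕ.+ n)

  expSum-3 : ∀ w → expSum w 3 ≡ (1ᵢ ⊕ w) ⊕ ((½ , 0ℚ) ⊗ (w ⊗ w))
  expSum-3 w = ≡.trans
    (cong (λ t → ((0ᵢ ⊕ 1ᵢ) ⊕ t) ⊕ (1/suc 1 • (t ⊗ w))) T₁)
    (≡.trans (cong (((0ᵢ ⊕ 1ᵢ) ⊕ w) ⊕_) (•-⊗ ½ (w ⊗ w)))
      (cong (_⊕ ((½ , 0ℚ) ⊗ (w ⊗ w))) (cong (_⊕ w) (⊕-identityˡ 1ᵢ))))
    where
    T₁ : 1/suc 0 • (1ᵢ ⊗ w) ≡ w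
    T₁ = ≡.trans (•-⊗ 1ℚ (1ᵢ ⊗ w)) (≡.trans (⊗-identityˡ (1ᵢ ⊗ w)) (⊗-identityˡ w))

  expSum-taylor₂ : ∀ {w r} → ‖ w ‖ ≤ r → r ≤ 5/3 → ∀ n →
    ‖ expSum w (3 ℕ.+ n) ⊖ ((1ᵢ ⊕ w) ⊕ ((½ , 0ℚ) ⊗ (w ⊗ w))) ‖ ≤ 2/7 * (r * r * r)
  expSum-taylor₂ {w} {r} w≤r r≤ n = begin
    ‖ expSum w (3 ℕ.+ n) ⊖ ((1ᵢ ⊕ w) ⊕ ((½ , 0ℚ) ⊗ (w ⊗ w))) ‖
      ≡⟨ cong (λ v → ‖ expSum w (3 ℕ.+ n) ⊖ v ‖) (expSum-3 w) ⟨
    ‖ expSum w (3 ℕ.+ n) ⊖ expSum w 3 ‖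
      ≤⟨ a≤a+b _ (0≤* (≤ᵇ⇒≤ {0ℚ} {12/7} _) (0≤expBound 0≤r (3 ℕ.+ n))) ⟩
    ‖ expSum w (3 ℕ.+ n) ⊖ expSum w 3 ‖ + 12/7 * expBound r (3 ℕ.+ n)
      ≤⟨ expSum-tail₃ w≤r 0≤r r≤ n ⟩
    12/7 * (1/suc 2 * (1/suc 1 * (1/suc 0 * (1ℚ * r) * r) * r))
      ≡⟨ solve 1 (λ r → con 12/7 :* (con (1/suc 2) :* (con ½ :* (con 1ℚ :* (con 1ℚ :* r) :* r) :* r)) := con 2/7 :* (r :* r :* r)) ≡.refl r ⟩
    2/7 * (r * r * r) ∎
    where
    open ≤-Reasoning
    0≤r : 0ℚ ≤ r
    0≤r = ≤-trans (0≤‖‖ w) w≤r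

  Exp-taylor₂ : ∀ {w r} → w ≼ r → r ≤ 8/5 → Exp w ⊞ ⊟ (κ 1ℚ ⊞ w ⊞ κ ½ ⊠ (w ⊠ w)) ≼ 2/7 * (r * r * r)
  Exp-taylor₂ {w} {r} w≼r r≤ = ≼-from K 0<K λ ε 0<ε ε≤1 → eventually
    (λ { n (p , 3≤n) → estimate ε (<⇒≤ 0<ε) ε≤1 n p 3≤n })
    -- With slack ε/15 and ε ≤ 1 the approximations stay within 8/5 + 1/15 = 5/3.
    (within w≼r (1/15 * ε) (0<* (0<1/suc 14) 0<ε) ∧ (3 , λ _ z → z))
    where
    0≤r : 0ℚ ≤ r
    0≤r = ≼⇒0≤ w≼r
    K : ℚ
    K = r * r + r + 1ℚ
    0<K : 0ℚ < K
    0<K = 0<+ (0≤+ (0≤* 0≤r 0≤r) 0≤r) 0<1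
    expand : ∀ n → at (Exp w ⊞ ⊟ (κ 1ℚ ⊞ w ⊞ κ ½ ⊠ (w ⊠ w))) n ≡
      expSum (at w n) n ⊖ ((1ᵢ ⊕ at w n) ⊕ ((½ , 0ℚ) ⊗ (at w n ⊗ at w n)))
    expand n = ≡.trans (at-⊖ (Exp w) (κ 1ℚ ⊞ w ⊞ κ ½ ⊠ (w ⊠ w)) n) (cong₂ _⊖_ (at-Exp w n)
      (≡.trans (at-⊞ (κ 1ℚ ⊞ w) (κ ½ ⊠ (w ⊠ w)) n) (cong₂ _⊕_
        (≡.trans (at-⊞ (κ 1ℚ) w n) (cong (_⊕ at w n) (at-κ 1ℚ n)))
        (≡.trans (at-⊠ (κ ½) (w ⊠ w) n) (cong₂ _⊗_ (at-κ ½ n) (at-⊠ w w n))))))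
    estimate : ∀ ε → 0ℚ ≤ ε → ε ≤ 1ℚ → ∀ n → ‖ at w n ‖ ≤ r + 1/15 * ε → 3 ℕ.≤ n →
      ‖ at (Exp w ⊞ ⊟ (κ 1ℚ ⊞ w ⊞ κ ½ ⊠ (w ⊠ w))) n ‖ ≤ 2/7 * (r * r * r) + K * ε
    estimate _ _ _ 1 _ (ℕ.s≤s ())
    estimate _ _ _ 2 _ (ℕ.s≤s (ℕ.s≤s ()))
    estimate ε 0≤ε ε≤1 (suc (suc (suc n))) p _ = begin
      ‖ at (Exp w ⊞ ⊟ (κ 1ℚ ⊞ w ⊞ κ ½ ⊠ (w ⊠ w))) (3 ℕ.+ n) ‖
        ≤⟨ ‖‖-reflexive (expand (3 ℕ.+ n)) ⟩
      ‖ expSum v (3 ℕ.+ n) ⊖ ((1ᵢ ⊕ v) ⊕ ((½ , 0ℚ) ⊗ (v ⊗ v))) ‖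
        ≤⟨ expSum-taylor₂ p s≤ n ⟩
      2/7 * (s * s * s)
        ≡⟨ solve 2 (λ r e → let d = con 1/15 :* e ; s = r :+ d in con 2/7 :* (s :* s :* s) :=
             con 2/7 :* (r :* r :* r) :+ con 2/7 :* con 1/15 :* (con (ι 3) :* (r :* r) :+ con (ι 3) :* con 1/15 :* r :* e :+ con 1/15 :* con 1/15 :* (e :* e)) :* e) ≡.refl r ε ⟩
      2/7 * (r * r * r) + 2/7 * 1/15 * (ι 3 * (r * r) + ι 3 * 1/15 * r * ε + 1/15 * 1/15 * (ε * ε)) * ε
        ≤⟨ +-monoʳ-≤ (2/7 * (r * r * r)) (*-monoʳ 0≤ε coefficient) ⟩
      2/7 * (r * r * r) + K * ε ∎
      where
      open ≤-Reasoning
      v : ℚ[i]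
      v = at w (3 ℕ.+ n)
      s : ℚ
      s = r + 1/15 * ε
      s≤ : s ≤ 5/3
      s≤ = +-mono-≤ r≤ (*-monoˡ (≤ᵇ⇒≤ {0ℚ} {1/15} _) ε≤1)
      coefficient : 2/7 * 1/15 * (ι 3 * (r * r) + ι 3 * 1/15 * r * ε + 1/15 * 1/15 * (ε * ε)) ≤ K
      coefficient = begin
        2/7 * 1/15 * (ι 3 * (r * r) + ι 3 * 1/15 * r * ε + 1/15 * 1/15 * (ε * ε))
          ≤⟨ *-monoˡ (≤ᵇ⇒≤ {0ℚ} {2/7 * 1/15} _) (+-mono-≤ (+-monoʳ-≤ (ι 3 * (r * r))
               (*-monoˡ (0≤* (≤ᵇ⇒≤ {0ℚ} {ι 3 * 1/15} _) 0≤r) ε≤1))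
               (*-monoˡ (≤ᵇ⇒≤ {0ℚ} {1/15 * 1/15} _) (*-mono-≤ 0≤ε 0≤1 ε≤1 ε≤1))) ⟩
        2/7 * 1/15 * (ι 3 * (r * r) + ι 3 * 1/15 * r * 1ℚ + 1/15 * 1/15 * (1ℚ * 1ℚ))
          ≤⟨ ≤-diff (c₁ * (r * r) + c₂ * r + c₃)
               (0≤+ (0≤+ (0≤* (≤ᵇ⇒≤ {0ℚ} {c₁} _) (0≤* 0≤r 0≤r)) (0≤* (≤ᵇ⇒≤ {0ℚ} {c₂} _) 0≤r)) (≤ᵇ⇒≤ {0ℚ} {c₃} _))
               (solve 1 (λ r → r :* r :+ r :+ con 1ℚ :=
                 con 2/7 :* con 1/15 :* (con (ι 3) :* (r :* r) :+ con (ι 3) :* con 1/15 :* r :* con 1ℚ :+ con 1/15 :* con 1/15 :* (con 1ℚ :* con 1ℚ))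
                 :+ (con c₁ :* (r :* r) :+ con c₂ :* r :+ con c₃)) ≡.refl r) ⟩
        K ∎
        where
        c₁ c₂ c₃ : ℚ
        c₁ = 1ℚ - 2/7 * 1/15 * ι 3
        c₂ = 1ℚ - 2/7 * 1/15 * (ι 3 * 1/15)
        c₃ = 1ℚ - 2/7 * 1/15 * (1/15 * 1/15)

-- The arctangent series and an approximation of π.

module Arctangent where
  open import Data.Rational
  open import Data.Rational.Properties
  open import Data.Rational.Solver using (module +-*-Solver)
  open +-*-Solver
  open Order
  open GaussianRationals
  open ComplexNorm

  2⁻ : ℕ → ℚ
  2⁻ zero    = 1ℚ
  2⁻ (suc k) = ½ * 2⁻ k

  0≤2⁻ : ∀ k → 0ℚ ≤ 2⁻ k
  0≤2⁻ zero    = 0≤1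
  0≤2⁻ (suc k) = 0≤* (<⇒≤ 0<½) (0≤2⁻ k)

  2⁻-vanish : ∀ k → 2⁻ k ≤ 1/suc k
  2⁻-vanish k = subst (2⁻ k ≤_) (*-identityˡ (1/suc k))
    (Dominated.vanish 2⁻ 2⁻ (λ j → ≤-reflexive (0≤p⇒∣p∣≡p (0≤2⁻ j))) 0 (λ j _ → ≤-refl) k)

  2⁻-small : ∀ ε → 0ℚ < ε → Eventually λ n → 2⁻ n ≤ ε
  2⁻-small ε 0<ε = go (archimedean ε 0<ε)
    where
    go : (∃ λ n → 1/suc n < ε) → Eventually λ n → 2⁻ n ≤ ε
    go (N , lt) = N , λ n N≤n → ≤-trans (2⁻-vanish n) (≤-trans (1/suc-antitone N≤n) (<⇒≤ lt))

  ∑-2⁻ : ∀ n → ∑ 2⁻ n ≤ ι 2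
  ∑-2⁻ n = ≤-diff (ι 2 * 2⁻ n) (0≤* (0≤ι 2) (0≤2⁻ n)) (≡.sym (total n))
    where
    total : ∀ n → ∑ 2⁻ n + ι 2 * 2⁻ n ≡ ι 2
    total zero    = ≤ᵇ-refl
      where
      ≤ᵇ-refl : 0ℚ + ι 2 * 1ℚ ≡ ι 2
      ≤ᵇ-refl = ≡.trans (+-identityˡ (ι 2 * 1ℚ)) (*-identityʳ (ι 2))
    total (suc n) = ≡.trans (solve 2 (λ s p → (s :+ p) :+ con (ι 2) :* (con ½ :* p) := s :+ con (ι 2) :* p) ≡.refl (∑ 2⁻ n) (2⁻ n))
      (total n)

  ∣∑∣ : ∀ {f g : ℕ → ℚ} → (∀ k → ∣ f k ∣ ≤ g k) → ∀ n → ∣ ∑ f n ∣ ≤ ∑ g n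
  ∣∑∣ h zero    = ≤-refl
  ∣∑∣ {f} h (suc n) = ≤-trans (∣p+q∣≤∣p∣+∣q∣ (∑ f n) (f n)) (+-mono-≤ (∣∑∣ h n) (h n))

  ∑-scale : ∀ c f n → ∑ (λ k → c * f k) n ≡ c * ∑ f n
  ∑-scale c f zero    = ≡.sym (*-zeroʳ c)
  ∑-scale c f (suc n) = ≡.trans (cong (_+ c * f n) (∑-scale c f n)) (≡.sym (*-distribˡ-+ c (∑ f n) (f n)))

  -- the derivative of (-1)ᵏ t²ᵏ⁺¹ / (2k+1)
  evenPower : ℚ → ℕ → ℚ
  evenPower t zero    = 1ℚ
  evenPower t (suc k) = - (t * t) * evenPower t k

  oddPower-evenPower : ∀ t k → oddPower t k ≡ t * evenPower t k
  oddPower-evenPower t zero    = ≡.sym (*-identityʳ t)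
  oddPower-evenPower t (suc k) = ≡.trans (cong (- (t * t) *_) (oddPower-evenPower t k))
    (solve 2 (λ t e → :- (t :* t) :* (t :* e) := t :* (:- (t :* t) :* e)) ≡.refl t (evenPower t k))

  ∣square∣≤ : ∀ {t} → 0ℚ ≤ t → t ≤ ½ → ∣ - (t * t) ∣ ≤ ½ * ½
  ∣square∣≤ {t} 0≤t t≤ = subst (_≤ ½ * ½) (≡.sym (≡.trans (∣-p∣≡∣p∣ (t * t)) (0≤p⇒∣p∣≡p (0≤* 0≤t 0≤t))))
    (*-mono-≤ 0≤t (<⇒≤ 0<½) t≤ t≤)

  ½*½≤½ : ½ * ½ ≤ ½
  ½*½≤½ = ≤ᵇ⇒≤ {½ * ½} {½} _

  ∣evenPower∣ : ∀ {t} → 0ℚ ≤ t → t ≤ ½ → ∀ k → ∣ evenPower t k ∣ ≤ 2⁻ k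
  ∣evenPower∣ 0≤t t≤ zero = ≤-refl
  ∣evenPower∣ {t} 0≤t t≤ (suc k) = subst (_≤ ½ * 2⁻ k) (≡.sym (∣p*q∣≡∣p∣*∣q∣ (- (t * t)) (evenPower t k)))
    (*-mono-≤ (0≤∣p∣ (- (t * t))) (0≤2⁻ k) (≤-trans (∣square∣≤ 0≤t t≤) ½*½≤½) (∣evenPower∣ 0≤t t≤ k))

  ∑-evenPower : ∀ t r → r * (1ℚ + t * t) ≡ 1ℚ → ∀ n → ∑ (evenPower t) n ≡ r * (1ℚ - evenPower t n)
  ∑-evenPower t r inverse zero = ≡.sym (solve 1 (λ r → r :* (con 1ℚ :- con 1ℚ) := con 0ℚ) ≡.refl r)
  ∑-evenPower t r inverse (suc n) = begin
    ∑ (evenPower t) n + e                    ≡⟨ cong₂ _+_ (∑-evenPower t r inverse n) (≡.sym (*-identityˡ e)) ⟩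
    r * (1ℚ - e) + 1ℚ * e                    ≡⟨ cong (λ x → r * (1ℚ - e) + x * e) inverse ⟨
    r * (1ℚ - e) + r * (1ℚ + t * t) * e      ≡⟨ solve 3 (λ r e t → r :* (con 1ℚ :- e) :+ r :* (con 1ℚ :+ t :* t) :* e := r :* (con 1ℚ :- :- (t :* t) :* e)) ≡.refl r e t ⟩
    r * (1ℚ - - (t * t) * e)                 ∎
    where
    open ≡.≡-Reasoning
    e : ℚ
    e = evenPower t n

  module Difference {t δ : ℚ} (0≤t : 0ℚ ≤ t) (0≤δ : 0ℚ ≤ δ) (s≤½ : t + δ ≤ ½) where
    private
      s : ℚ
      s = t + δ
      t≤s : t ≤ s
      t≤s = a≤a+b t 0≤δ
      t≤½ : t ≤ ½
      t≤½ = ≤-trans t≤s s≤½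
      0≤s : 0ℚ ≤ s
      0≤s = ≤-trans 0≤t t≤s
      odd : ℕ → ℚ
      odd k = ι (suc (2 ℕ.* k))
      0≤δ² : 0ℚ ≤ δ * δ
      0≤δ² = 0≤* 0≤δ 0≤δ

    odd-suc : ∀ k → odd (suc k) ≡ 1ℚ + 1ℚ + odd k
    odd-suc k = ≡.trans (cong ι (cong suc (ℕ.*-suc 2 k))) (ι-+ 2 (suc (2 ℕ.* k)))

    -- (-1)ᵏ times the first-order remainder of t²ᵏ⁺¹ at t with increment δ.
    defect : ℕ → ℚ
    defect k = oddPower s k - oddPower t k - odd k * δ * evenPower t k

    defect-suc : ∀ k → defect (suc k) ≡ - (s * s) * defect k - δ * δ * (t + odd k * (t + s)) * evenPower t k
    defect-suc k = begin
      - (s * s) * oS - - (t * t) * oddPower t k - odd (suc k) * δ * (- (t * t) * e)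
        ≡⟨ cong₂ (λ o n → - (s * s) * oS - - (t * t) * o - n * δ * (- (t * t) * e)) (oddPower-evenPower t k) (odd-suc k) ⟩
      - (s * s) * oS - - (t * t) * (t * e) - (1ℚ + 1ℚ + odd k) * δ * (- (t * t) * e)
        ≡⟨ solve 5 (λ o t d e n → let s = t :+ d in
             :- (s :* s) :* o :- :- (t :* t) :* (t :* e) :- (con 1ℚ :+ con 1ℚ :+ n) :* d :* (:- (t :* t) :* e) :=
             :- (s :* s) :* (o :- t :* e :- n :* d :* e) :- d :* d :* (t :+ n :* (t :+ s)) :* e) ≡.refl oS t δ e (odd k) ⟩
      - (s * s) * (oS - t * e - odd k * δ * e) - δ * δ * (t + odd k * (t + s)) * e
        ≡⟨ cong (λ o → - (s * s) * (oS - o - odd k * δ * e) - δ * δ * (t + odd k * (t + s)) * e) (oddPower-evenPower t k) ⟨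
      - (s * s) * defect k - δ * δ * (t + odd k * (t + s)) * e ∎
      where
      open ≡.≡-Reasoning
      oS e : ℚ
      oS = oddPower s k
      e  = evenPower t k

    -- In the recursion of `defect-suc` the old remainder is multiplied by s² ≤ 1/4, stronger than
    -- the required decay 1/2, and the room left absorbs the new δ² term. The factor 2k + 1 is later
    -- cancelled by the denominator of the arctangent term.
    ∣defect∣ : ∀ k → ∣ defect k ∣ ≤ ι 4 * (δ * δ) * odd k * 2⁻ k
    ∣defect∣ zero = ≤-trans (≤-reflexive (cong ∣_∣
        (solve 2 (λ t d → (t :+ d) :- t :- con 1ℚ :* d :* con 1ℚ := con 0ℚ) ≡.refl t δ)))
      (0≤* (0≤* (0≤* (0≤ι 4) 0≤δ²) (0≤ι 1)) 0≤1)
    ∣defect∣ (suc k) = begin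
      ∣ defect (suc k) ∣                        ≡⟨ cong ∣_∣ (defect-suc k) ⟩
      ∣ - (s * s) * defect k - v * e ∣          ≤⟨ ∣p-q∣≤∣p∣+∣q∣ (- (s * s) * defect k) (v * e) ⟩
      ∣ - (s * s) * defect k ∣ + ∣ v * e ∣      ≡⟨ cong₂ _+_ (∣p*q∣≡∣p∣*∣q∣ (- (s * s)) (defect k)) (∣p*q∣≡∣p∣*∣q∣ v e) ⟩
      ∣ - (s * s) ∣ * ∣ defect k ∣ + ∣ v ∣ * ∣ e ∣
        ≤⟨ +-mono-≤ (*-mono-≤ (0≤∣p∣ (- (s * s))) (0≤* (0≤* (0≤* (0≤ι 4) 0≤δ²) 0≤n) (0≤2⁻ k)) (∣square∣≤ 0≤s s≤½) (∣defect∣ k))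
             (*-mono-≤ (0≤∣p∣ v) (0≤2⁻ k) ∣v∣≤ (∣evenPower∣ 0≤t t≤½ k)) ⟩
      ½ * ½ * (ι 4 * (δ * δ) * n * p) + δ * δ * (1ℚ + n) * p
        ≤⟨ ≤-diff (ι 3 * ((δ * δ) * p)) (0≤* (0≤ι 3) (0≤* 0≤δ² (0≤2⁻ k)))
             (solve 3 (λ d n p → con (ι 4) :* d :* (con 1ℚ :+ con 1ℚ :+ n) :* (con ½ :* p) :=
               con ½ :* con ½ :* (con (ι 4) :* d :* n :* p) :+ d :* (con 1ℚ :+ n) :* p :+ con (ι 3) :* (d :* p)) ≡.refl (δ * δ) n p) ⟩
      ι 4 * (δ * δ) * (1ℚ + 1ℚ + n) * (½ * p)
        ≡⟨ cong (λ m → ι 4 * (δ * δ) * m * (½ * p)) (odd-suc k) ⟨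
      ι 4 * (δ * δ) * odd (suc k) * (½ * p)     ∎
      where
      open ≤-Reasoning
      e n p v : ℚ
      e = evenPower t k
      n = odd k
      p = 2⁻ k
      v = δ * δ * (t + n * (t + s))
      0≤n : 0ℚ ≤ n
      0≤n = 0≤ι (suc (2 ℕ.* k))
      t+s≤1 : t + s ≤ 1ℚ
      t+s≤1 = +-mono-≤ t≤½ s≤½
      0≤u : 0ℚ ≤ t + n * (t + s)
      0≤u = 0≤+ 0≤t (0≤* 0≤n (0≤+ 0≤t 0≤s))
      ∣v∣≤ : ∣ v ∣ ≤ δ * δ * (1ℚ + n)
      ∣v∣≤ = ≤-trans (≤-reflexive (0≤p⇒∣p∣≡p (0≤* 0≤δ² 0≤u)))
        (*-monoˡ 0≤δ² (+-mono-≤ (≤-trans t≤½ (≤ᵇ⇒≤ {½} {1ℚ} _)) (≤-trans (*-monoˡ 0≤n t+s≤1) (≤-reflexive (*-identityʳ n)))))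

    ∣term∣ : ∀ k → ∣ arctanTerm s k - arctanTerm t k - δ * evenPower t k ∣ ≤ ι 4 * (δ * δ) * 2⁻ k
    ∣term∣ k = begin
      ∣ oddPower s k * k⁻¹ - oddPower t k * k⁻¹ - δ * evenPower t k ∣
        ≡⟨ cong ∣_∣ (≡.trans (cong (λ x → oddPower s k * k⁻¹ - oddPower t k * k⁻¹ - x) one)
             (solve 5 (λ a b k⁻¹ n e → a :* k⁻¹ :- b :* k⁻¹ :- k⁻¹ :* n :* e := k⁻¹ :* (a :- b :- n :* e)) ≡.refl (oddPower s k) (oddPower t k) k⁻¹ (odd k) (δ * evenPower t k))) ⟩
      ∣ k⁻¹ * (oddPower s k - oddPower t k - odd k * (δ * evenPower t k)) ∣
        ≡⟨ cong (λ x → ∣ k⁻¹ * (oddPower s k - oddPower t k - x) ∣) (*-assoc (odd k) δ (evenPower t k)) ⟨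
      ∣ k⁻¹ * defect k ∣      ≡⟨ ∣p*q∣≡∣p∣*∣q∣ k⁻¹ (defect k) ⟩
      ∣ k⁻¹ ∣ * ∣ defect k ∣  ≡⟨ cong (_* ∣ defect k ∣) (0≤p⇒∣p∣≡p 0≤i) ⟩
      k⁻¹ * ∣ defect k ∣      ≤⟨ *-monoˡ 0≤i (∣defect∣ k) ⟩
      k⁻¹ * (ι 4 * (δ * δ) * odd k * 2⁻ k)
        ≡⟨ solve 4 (λ k⁻¹ c n p → k⁻¹ :* (c :* n :* p) := (k⁻¹ :* n) :* (c :* p)) ≡.refl k⁻¹ (ι 4 * (δ * δ)) (odd k) (2⁻ k) ⟩
      k⁻¹ * odd k * (ι 4 * (δ * δ) * 2⁻ k)
        ≡⟨ ≡.trans (cong (_* (ι 4 * (δ * δ) * 2⁻ k)) (1/suc-inverse (2 ℕ.* k))) (*-identityˡ _) ⟩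
      ι 4 * (δ * δ) * 2⁻ k  ∎
      where
      open ≤-Reasoning
      k⁻¹ : ℚ
      k⁻¹ = 1/suc (2 ℕ.* k)
      0≤i : 0ℚ ≤ k⁻¹
      0≤i = <⇒≤ (0<1/suc (2 ℕ.* k))
      one : δ * evenPower t k ≡ k⁻¹ * odd k * (δ * evenPower t k)
      one = ≡.sym (≡.trans (cong (_* (δ * evenPower t k)) (1/suc-inverse (2 ℕ.* k))) (*-identityˡ _))

    ∑-split : ∀ n → ∑ (arctanTerm s) n - (∑ (arctanTerm t) n + δ * ∑ (evenPower t) n) ≡
      ∑ (λ k → arctanTerm s k - arctanTerm t k - δ * evenPower t k) n
    ∑-split zero    = solve 1 (λ d → con 0ℚ :- (con 0ℚ :+ d :* con 0ℚ) := con 0ℚ) ≡.refl δ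
    ∑-split (suc n) = ≡.trans
      (solve 7 (λ a x b y d c z → (a :+ x) :- ((b :+ y) :+ d :* (c :+ z)) := (a :- (b :+ d :* c)) :+ (x :- y :- d :* z)) ≡.refl
        (∑ (arctanTerm s) n) (arctanTerm s n) (∑ (arctanTerm t) n) (arctanTerm t n) δ (∑ (evenPower t) n) (evenPower t n))
      (cong (_+ (arctanTerm s n - arctanTerm t n - δ * evenPower t n)) (∑-split n))

    -- 8 = 4 · 2 is the coefficient of `∣term∣` times the sum of all 2⁻ᵏ. The last summand pays for
    -- replacing the truncated geometric series by its limit 1/(1 + t²), and vanishes as n grows.
    ∑-difference : ∀ r → r * (1ℚ + t * t) ≡ 1ℚ → ∀ n →
      ∣ ∑ (arctanTerm s) n - (∑ (arctanTerm t) n + δ * r) ∣ ≤ ι 8 * (δ * δ) + ∣ δ * r ∣ * 2⁻ n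
    ∑-difference r inverse n = begin
      ∣ ∑ (arctanTerm s) n - (∑ (arctanTerm t) n + δ * r) ∣
        ≡⟨ cong ∣_∣ (≡.trans (solve 5 (λ a b d r e → a :- (b :+ d :* r) := (a :- (b :+ d :* (r :* (con 1ℚ :- e)))) :- (d :* r) :* e) ≡.refl
             (∑ (arctanTerm s) n) (∑ (arctanTerm t) n) δ r (evenPower t n))
             (cong (λ x → ∑ (arctanTerm s) n - (∑ (arctanTerm t) n + δ * x) - δ * r * evenPower t n) (≡.sym (∑-evenPower t r inverse n)))) ⟩
      ∣ ∑ (arctanTerm s) n - (∑ (arctanTerm t) n + δ * ∑ (evenPower t) n) - δ * r * evenPower t n ∣
        ≡⟨ cong (λ x → ∣ x - δ * r * evenPower t n ∣) (∑-split n) ⟩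
      ∣ ∑ f n - δ * r * evenPower t n ∣
        ≤⟨ ∣p-q∣≤∣p∣+∣q∣ (∑ f n) (δ * r * evenPower t n) ⟩
      ∣ ∑ f n ∣ + ∣ δ * r * evenPower t n ∣
        ≤⟨ +-mono-≤ (∣∑∣ ∣term∣ n) (≤-trans (≤-reflexive (∣p*q∣≡∣p∣*∣q∣ (δ * r) (evenPower t n)))
             (*-monoˡ (0≤∣p∣ (δ * r)) (∣evenPower∣ 0≤t t≤½ n))) ⟩
      ∑ (λ k → ι 4 * (δ * δ) * 2⁻ k) n + ∣ δ * r ∣ * 2⁻ n
        ≤⟨ +-monoˡ-≤ (∣ δ * r ∣ * 2⁻ n) (≤-trans (≤-reflexive (∑-scale (ι 4 * (δ * δ)) 2⁻ n))
             (≤-trans (*-monoˡ (0≤* (0≤ι 4) 0≤δ²) (∑-2⁻ n))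
               (≤-reflexive (solve 1 (λ d → con (ι 4) :* d :* con (ι 2) := con (ι 8) :* d) ≡.refl (δ * δ))))) ⟩
      ι 8 * (δ * δ) + ∣ δ * r ∣ * 2⁻ n ∎
      where
      open ≤-Reasoning
      f : ℕ → ℚ
      f k = arctanTerm s k - arctanTerm t k - δ * evenPower t k

  -- arctan made total, with the junk value 0 where the series is not used
  arctan-dec : ∀ t → Dec (t * t ≤ ½) → ℝ
  arctan-dec t (yes p) = arctan t p
  arctan-dec t (no  _) = 0ℝ

  opaque
    Arctan : ℚ → ℂ
    Arctan t = fromℝ (arctan-dec t (t * t ≤? ½))

    at-Arctan : ∀ t → t * t ≤ ½ → ∀ n → at (Arctan t) n ≡ (∑ (arctanTerm t) n , 0ℚ)
    at-Arctan t tt≤½ n = cong (_, 0ℚ) (lemma (t * t ≤? ½))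
      where
      lemma : (d : Dec (t * t ≤ ½)) → seq (arctan-dec t d) n ≡ ∑ (arctanTerm t) n
      lemma (yes _) = ≡.refl
      lemma (no ¬p) = contradiction tt≤½ ¬p

  square≤½ : ∀ {t} → 0ℚ ≤ t → t ≤ ½ → t * t ≤ ½
  square≤½ 0≤t t≤ = ≤-trans (*-mono-≤ 0≤t (<⇒≤ 0<½) t≤ t≤) ½*½≤½

  Arctan-0 : Arctan 0ℚ ≋ κ 0ℚ
  Arctan-0 = pointwise λ n → ≡.trans (at-Arctan 0ℚ (square≤½ ≤-refl (<⇒≤ 0<½)) n)
    (≡.trans (cong (_, 0ℚ) (vanish n)) (≡.sym (at-κ 0ℚ n)))
    where
    odd≡0 : ∀ k → oddPower 0ℚ k ≡ 0ℚ
    odd≡0 k = ≡.trans (oddPower-evenPower 0ℚ k) (*-zeroˡ (evenPower 0ℚ k))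
    vanish : ∀ n → ∑ (arctanTerm 0ℚ) n ≡ 0ℚ
    vanish zero    = ≡.refl
    vanish (suc n) = ≡.trans (cong₂ _+_ (vanish n)
      (≡.trans (cong (_* 1/suc (2 ℕ.* n)) (odd≡0 n)) (*-zeroˡ (1/suc (2 ℕ.* n))))) (+-identityˡ 0ℚ)

  Arctan-taylor : ∀ {t δ r} → 0ℚ ≤ t → 0ℚ ≤ δ → t + δ ≤ ½ → r * (1ℚ + t * t) ≡ 1ℚ →
    Arctan (t + δ) ⊞ ⊟ (Arctan t ⊞ κ (δ * r)) ≼ ι 8 * (δ * δ)
  Arctan-taylor {t} {δ} {r} 0≤t 0≤δ s≤½ inverse = ≼-from K 0<K λ ε 0<ε _ →
    eventually (λ n → estimate ε n) (2⁻-small ε 0<ε)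
    where
    K : ℚ
    K = ∣ δ * r ∣ + 1ℚ
    0<K : 0ℚ < K
    0<K = 0<+ (0≤∣p∣ (δ * r)) 0<1
    t≤s : t ≤ t + δ
    t≤s = a≤a+b t 0≤δ
    expand : ∀ n → at (Arctan (t + δ) ⊞ ⊟ (Arctan t ⊞ κ (δ * r))) n ≡
      (∑ (arctanTerm (t + δ)) n - (∑ (arctanTerm t) n + δ * r) , 0ℚ - (0ℚ + 0ℚ))
    expand n = ≡.trans (at-⊖ (Arctan (t + δ)) (Arctan t ⊞ κ (δ * r)) n) (cong₂ _⊖_
      (at-Arctan (t + δ) (square≤½ (≤-trans 0≤t t≤s) s≤½) n)
      (≡.trans (at-⊞ (Arctan t) (κ (δ * r)) n) (cong₂ _⊕_ (at-Arctan t (square≤½ 0≤t (≤-trans t≤s s≤½)) n) (at-κ (δ * r) n))))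
    estimate : ∀ ε n → 2⁻ n ≤ ε → ‖ at (Arctan (t + δ) ⊞ ⊟ (Arctan t ⊞ κ (δ * r))) n ‖ ≤ ι 8 * (δ * δ) + K * ε
    estimate ε n small = ≤-trans (‖‖-reflexive (expand n)) (≤-trans (≤-reflexive (≡.trans (cong (λ x → d + ∣ x ∣) zero-im) (+-identityʳ d)))
      (≤-trans (Difference.∑-difference 0≤t 0≤δ s≤½ r inverse n) (+-monoʳ-≤ (ι 8 * (δ * δ))
        (*-mono-≤ (0≤∣p∣ (δ * r)) (≤-trans (0≤2⁻ n) small) (a≤a+b ∣ δ * r ∣ 0≤1) small))))
      where
      d : ℚ
      d = ∣ ∑ (arctanTerm (t + δ)) n - (∑ (arctanTerm t) n + δ * r) ∣
      zero-im : 0ℚ - (0ℚ + 0ℚ) ≡ 0ℚ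
      zero-im = ≡.refl

  -- 4⁻ᵏ/2 dominates the terms t²ᵏ⁺¹/(2k + 1) for t ≤ 1/2; the weaker 2⁻ᵏ would not locate π well
  -- enough with four terms.
  ½4⁻ : ℕ → ℚ
  ½4⁻ zero    = ½
  ½4⁻ (suc k) = ½ * ½ * ½4⁻ k

  0≤½4⁻ : ∀ k → 0ℚ ≤ ½4⁻ k
  0≤½4⁻ zero    = <⇒≤ 0<½
  0≤½4⁻ (suc k) = 0≤* (≤ᵇ⇒≤ {0ℚ} {½ * ½} _) (0≤½4⁻ k)

  ∣oddPower∣ : ∀ {t} → 0ℚ ≤ t → t ≤ ½ → ∀ k → ∣ oddPower t k ∣ ≤ ½4⁻ k
  ∣oddPower∣ {t} 0≤t t≤ zero = ≤-trans (≤-reflexive (0≤p⇒∣p∣≡p 0≤t)) t≤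
  ∣oddPower∣ {t} 0≤t t≤ (suc k) = subst (_≤ ½ * ½ * ½4⁻ k) (≡.sym (∣p*q∣≡∣p∣*∣q∣ (- (t * t)) (oddPower t k)))
    (*-mono-≤ (0≤∣p∣ (- (t * t))) (0≤½4⁻ k) (∣square∣≤ 0≤t t≤) (∣oddPower∣ 0≤t t≤ k))

  ∣arctanTerm∣ : ∀ {t} → 0ℚ ≤ t → t ≤ ½ → ∀ k → ∣ arctanTerm t k ∣ ≤ ½4⁻ k
  ∣arctanTerm∣ {t} 0≤t t≤ k = ≤-trans (≤-reflexive (∣p*q∣≡∣p∣*∣q∣ (oddPower t k) k⁻¹))
    (≤-trans (*-mono-≤ (0≤∣p∣ (oddPower t k)) 0≤1 (∣oddPower∣ 0≤t t≤ k)
      (≤-trans (≤-reflexive (0≤p⇒∣p∣≡p (<⇒≤ (0<1/suc (2 ℕ.* k))))) (1/suc-antitone {0} {2 ℕ.* k} ℕ.z≤n)))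
      (≤-reflexive (*-identityʳ (½4⁻ k))))
    where
    k⁻¹ : ℚ
    k⁻¹ = 1/suc (2 ℕ.* k)

  arctan-tail : ∀ {t} → 0ℚ ≤ t → t ≤ ½ → ∀ n → 4 ℕ.≤ n → ∣ ∑ (arctanTerm t) n - ∑ (arctanTerm t) 4 ∣ ≤ ½4⁻ 4 + ½4⁻ 4
  arctan-tail {t} 0≤t t≤ n 4≤n = ≤-trans (a≤a+b _ (0≤+ (0≤½4⁻ n) (0≤½4⁻ n)))
    (Dominated.tail (arctanTerm t) ½4⁻ (∣arctanTerm∣ 0≤t t≤) 0
      (λ k _ → *-monoʳ (0≤½4⁻ k) ½*½≤½) ℕ.z≤n (ℕ.≤⇒≤′ 4≤n))

  ⅓ 63/20 1/20 : ℚ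
  ⅓     = ℤ.+ 1 / 3
  63/20 = ℤ.+ 63 / 20
  1/20  = ℤ.+ 1 / 20

  opaque
    Pi : ℂ
    Pi = fromℝ π

    Pi-def : Pi ≡ fromℝ π
    Pi-def = ≡.refl

    at-Pi : ∀ n → at Pi n ≡ (ι 4 * (∑ (arctanTerm ½) n + ∑ (arctanTerm ⅓) n) , 0ℚ)
    at-Pi n = ≡.refl

  0≤⅓ : 0ℚ ≤ ⅓
  0≤⅓ = ≤ᵇ⇒≤ {0ℚ} {⅓} _

  ⅓≤½ : ⅓ ≤ ½
  ⅓≤½ = ≤ᵇ⇒≤ {⅓} {½} _

  Pi-Arctan : Pi ≋ κ (ι 4) ⊠ (Arctan ½ ⊞ Arctan ⅓)
  Pi-Arctan = pointwise λ n → ≡.trans (at-Pi n) (≡.sym (≡.trans (at-⊠ (κ (ι 4)) (Arctan ½ ⊞ Arctan ⅓) n)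
    (≡.trans (cong₂ _⊗_ (at-κ (ι 4) n) (≡.trans (at-⊞ (Arctan ½) (Arctan ⅓) n) (cong₂ _⊕_
        (at-Arctan ½ ½*½≤½ n) (at-Arctan ⅓ (square≤½ 0≤⅓ ⅓≤½) n))))
      (≡.trans (cong (λ z → (ι 4 , 0ℚ) ⊗ (∑ (arctanTerm ½) n + ∑ (arctanTerm ⅓) n , z)) (+-identityˡ 0ℚ))
        (≡.sym (κ-⊗ (ι 4) (∑ (arctanTerm ½) n + ∑ (arctanTerm ⅓) n)))))))

  -- Beyond four terms each arctangent changes by at most T = 4⁻⁴, hence π by at most 8/256 = 1/32.
  -- The distance of the four-term value from 63/20 is a closed rational, and the total is checked
  -- by evaluation.
  Pi-approx : Pi ⊞ ⊟ κ 63/20 ≼ 1/20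
  Pi-approx = bound λ ε 0<ε → 4 , λ n 4≤n → estimate ε n (<⇒≤ 0<ε) 4≤n
    where
    P₄ T : ℚ
    P₄ = ι 4 * (∑ (arctanTerm ½) 4 + ∑ (arctanTerm ⅓) 4)
    T = ½4⁻ 4 + ½4⁻ 4
    estimate : ∀ ε n → 0ℚ ≤ ε → 4 ℕ.≤ n → ‖ at (Pi ⊞ ⊟ κ 63/20) n ‖ ≤ 1/20 + ε
    estimate ε n 0≤ε 4≤n = begin
      ‖ at (Pi ⊞ ⊟ κ 63/20) n ‖      ≡⟨ cong ‖_‖ (≡.trans (at-⊖ Pi (κ 63/20) n) (cong₂ _⊖_ (at-Pi n) (at-κ 63/20 n))) ⟩
      ∣ ι 4 * (a + b) - 63/20 ∣ + 0ℚ ≡⟨ +-identityʳ _ ⟩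
      ∣ ι 4 * (a + b) - 63/20 ∣      ≡⟨ cong ∣_∣ (solve 5 (λ a b c d e → con (ι 4) :* (a :+ b) :- e :=
                                          con (ι 4) :* ((a :- c) :+ (b :- d)) :+ (con (ι 4) :* (c :+ d) :- e)) ≡.refl a b a₄ b₄ 63/20) ⟩
      ∣ ι 4 * ((a - a₄) + (b - b₄)) + (P₄ - 63/20) ∣
        ≤⟨ ∣p+q∣≤∣p∣+∣q∣ (ι 4 * ((a - a₄) + (b - b₄))) (P₄ - 63/20) ⟩
      ∣ ι 4 * ((a - a₄) + (b - b₄)) ∣ + ∣ P₄ - 63/20 ∣
        ≤⟨ +-monoˡ-≤ ∣ P₄ - 63/20 ∣ (≤-trans (≤-reflexive (∣p*q∣≡∣p∣*∣q∣ (ι 4) ((a - a₄) + (b - b₄))))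
             (*-monoˡ (0≤ι 4) (≤-trans (∣p+q∣≤∣p∣+∣q∣ (a - a₄) (b - b₄))
               (+-mono-≤ (arctan-tail (<⇒≤ 0<½) ≤-refl n 4≤n) (arctan-tail 0≤⅓ ⅓≤½ n 4≤n))))) ⟩
      ι 4 * (T + T) + ∣ P₄ - 63/20 ∣ ≤⟨ ≤ᵇ⇒≤ {ι 4 * (T + T) + ∣ P₄ - 63/20 ∣} {1/20} _ ⟩
      1/20                           ≤⟨ a≤a+b 1/20 0≤ε ⟩
      1/20 + ε                       ∎
      where
      open ≤-Reasoning
      a b a₄ b₄ : ℚ
      a  = ∑ (arctanTerm ½) n
      b  = ∑ (arctanTerm ⅓) n
      a₄ = ∑ (arctanTerm ½) 4
      b₄ = ∑ (arctanTerm ⅓) 4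

-- Square roots of natural numbers.

module SquareRoot where
  open import Data.Rational
  open import Data.Rational.Properties
  open import Data.Rational.Solver using (module +-*-Solver)
  open +-*-Solver
  open Order
  open GaussianRationals
  open ComplexNorm

  opaque
    Sqrt : ℕ → ℂ
    Sqrt a = fromℝ (√ a)

    Sqrt-def : ∀ a → Sqrt a ≡ fromℝ (√ a)
    Sqrt-def a = ≡.refl

    at-Sqrt : ∀ a n → at (Sqrt a) n ≡ (√-seq a n , 0ℚ)
    at-Sqrt a n = ≡.refl

  Sqrt-approx : ∀ a → 0 ℕ.< a → ∀ ε → 0ℚ < ε → ∃ λ p → 1ℚ ≤ p × (Sqrt a ⊞ ⊟ κ p ≼ ε)
  Sqrt-approx (suc a) _ ε 0<ε = go (√-cauchy (suc a) ε 0<ε)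
    where
    s : ℕ → ℚ
    s = √-seq (suc a)
    go : (∃ λ N → ∀ m n → N ℕ.≤ m → N ℕ.≤ n → ∣ s m - s n ∣ < ε) → ∃ λ p → 1ℚ ≤ p × (Sqrt (suc a) ⊞ ⊟ κ p ≼ ε)
    go (N , h) = s N , 1≤√-seq a N , bound λ δ 0<δ → N , λ n N≤n →
      ≤-trans (‖‖-reflexive (≡.trans (at-⊖ (Sqrt (suc a)) (κ (s N)) n) (cong₂ _⊖_ (at-Sqrt (suc a) n) (at-κ (s N) n))))
        (≤-trans (≤-reflexive (+-identityʳ _)) (≤-trans (<⇒≤ (h n N N≤n ℕ.≤-refl)) (a≤a+b ε (<⇒≤ 0<δ))))

  Sqrt-square : ∀ a → Sqrt a ⊠ Sqrt a ≋ κ (ι a)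
  Sqrt-square a = go (bounded {√-seq a} (√-cauchy a))
    where
    s : ℕ → ℚ
    s = √-seq a
    go : (∃ λ B → 0ℚ < B × ∀ n → ∣ s n ∣ ≤ B) → Sqrt a ⊠ Sqrt a ≋ κ (ι a)
    go (B , 0<B , s≤) = close (≼-from K 0<K λ ε 0<ε _ → step ε (archimedean ε 0<ε))
      where
      K : ℚ
      K = B + B + 1ℚ
      0<K : 0ℚ < K
      0<K = 0<+ (0≤+ (<⇒≤ 0<B) (<⇒≤ 0<B)) 0<1
      expand : ∀ n → at (Sqrt a ⊠ Sqrt a ⊞ ⊟ κ (ι a)) n ≡ (s n * s n - ι a , 0ℚ)
      expand n = ≡.trans (at-⊖ (Sqrt a ⊠ Sqrt a) (κ (ι a)) n) (≡.trans (cong₂ _⊖_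
        (≡.trans (at-⊠ (Sqrt a) (Sqrt a) n) (≡.trans (cong₂ _⊗_ (at-Sqrt a n) (at-Sqrt a n)) (≡.sym (κ-⊗ (s n) (s n))))) (at-κ (ι a) n))
        (cong (s n * s n - ι a ,_) (+-inverseʳ 0ℚ)))
      near : ∀ n → ∣ s n * s n - ι a ∣ ≤ K * 1/suc n
      near n = ∣-∣-≤ (≤-trans (√-lower a n) (a≤a+b (ι a) (0≤* (<⇒≤ 0<K) (<⇒≤ (0<1/suc n)))))
        (begin
          ι a                                  ≤⟨ <⇒≤ (√-upper a n) ⟩
          (s n + d) * (s n + d)                ≡⟨ solve 2 (λ s d → (s :+ d) :* (s :+ d) := s :* s :+ (s :+ s :+ d) :* d) ≡.refl (s n) d ⟩
          s n * s n + (s n + s n + d) * d      ≤⟨ +-monoʳ-≤ (s n * s n) (*-monoʳ (<⇒≤ (0<1/suc n)) (+-mono-≤ (+-mono-≤ sn≤ sn≤) (1/suc-antitone {0} {n} ℕ.z≤n))) ⟩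
          s n * s n + K * d                    ∎)
        where
        open ≤-Reasoning
        d : ℚ
        d = 1/suc n
        sn≤ : s n ≤ B
        sn≤ = ≤-trans (p≤∣p∣ (s n)) (s≤ n)
      step : ∀ ε → (∃ λ N → 1/suc N < ε) → Eventually λ n → ‖ at (Sqrt a ⊠ Sqrt a ⊞ ⊟ κ (ι a)) n ‖ ≤ 0ℚ + K * ε
      step ε (N , lt) = N , λ n N≤n → ≤-trans (‖‖-reflexive (expand n)) (≤-trans (≤-reflexive (+-identityʳ _))
        (≤-trans (near n) (≤-trans (*-monoˡ (<⇒≤ 0<K) (≤-trans (1/suc-antitone N≤n) (<⇒≤ lt))) (≤-reflexive (≡.sym (+-identityˡ (K * ε)))))))

open import Data.Nat using (NonZero; _<_; _∸_; _^_; _/_)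
open import Data.Integer using (+_)

-- The complex instance, characters, and the product formula.

module ComplexAnalysis where
  open import Data.Rational using (ℚ; 0ℚ; 1ℚ; ½) renaming (_≤_ to _≤ᵠ_; _<_ to _<ᵠ_; _-_ to _-ᵠ_)
  open Order
  open GaussianRationals
  open ComplexNorm
  open Exponential
  open Arctangent
  open SquareRoot

  opaque
    I : ℂ
    I = i

    I-def : I ≡ i
    I-def = ≡.refl

    at-I : ∀ n → at I n ≡ (0ℚ , 1ℚ)
    at-I n = ≡.refl

  I-square : I ⊠ I ≋ ⊟ κ 1ℚ
  I-square = pointwise λ n → ≡.trans (at-⊠ I I n) (≡.trans (cong₂ _⊗_ (at-I n) (at-I n))
    (≡.sym (≡.trans (at-⊟ (κ 1ℚ) n) (cong ⊝_ (at-κ 1ℚ n)))))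

  I≼1 : I ≼ 1ℚ
  I≼1 = ≼-pointwise λ n → ℚ.≤-trans (‖‖-reflexive (at-I n)) ℚ.≤-refl

  ℂ-analysis : Analysis
  ℂ-analysis = record
    { algebra = ℂ-algebra
    ; ı = I ; ı*ı = I-square ; ı≼1 = I≼1
    ; exp = Exp ; exp-cong = Exp-cong ; exp-bound = Exp-bound ; exp-taylor₁ = Exp-taylor₁ ; exp-taylor₂ = Exp-taylor₂
    ; arctan = Arctan ; arctan-0 = Arctan-0 ; arctan-taylor = Arctan-taylor
    ; π = Pi ; π-arctan = Pi-Arctan ; π-approx = Pi-approx }

  open NormedAlgebra ℂ-algebra using (refl; sym; trans; reflexive; *-identityˡ; *-identityʳ)
  open Estimates ℂ-algebra using (Unit; cancel)
  open Positivity ℂ-analysis using (Positive; positive; Positive-1)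
  open Limits ℂ-algebra using (_⇝_; converges)
  open Sieve ℂ-analysis using (Φ; Φ-primePower; Φ-notPrimePower)
  open Assembly ℂ-analysis using (sine; module Character)
  open Selection (NormedAlgebra.*-commutativeMonoid ℂ-algebra) using (foldr-coprimesUpTo; coprimeOnly)
  open Polynomials ℂ-algebra using (Π)

  Positive-Pi : Positive Pi
  Positive-Pi = positive 1ℚ 0<1 λ ε 0<ε → go ε 0<ε (cauchy π ε 0<ε) (within Pi-approx 1ℚ 0<1)
    where
    go : ∀ ε → 0ℚ <ᵠ ε → (∃ λ N → ∀ m n → N ℕ.≤ m → N ℕ.≤ n → ℚ.∣ seq π m -ᵠ seq π n ∣ <ᵠ ε) →
      (∃ λ M → ∀ n → M ℕ.≤ n → ‖ at (Pi ⊞ ⊟ κ 63/20) n ‖ ≤ᵠ 1/20 ℚ.+ 1ℚ) → ∃ λ p → 1ℚ ≤ᵠ p × Pi ⊞ ⊟ κ p ≼ ε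
    go ε 0<ε (N , h) (M , b) = p k , lower , bound λ δ 0<δ → N , λ n N≤n → ℚ.≤-trans (‖‖-reflexive (expand (p k) n))
        (ℚ.≤-trans (ℚ.≤-reflexive (ℚ.+-identityʳ _)) (ℚ.≤-trans (ℚ.<⇒≤ (h n k N≤n (ℕ.m≤m⊔n N M))) (a≤a+b ε (ℚ.<⇒≤ 0<δ))))
      where
      k : ℕ
      k = N ℕ.⊔ M
      p : ℕ → ℚ
      p n = ι 4 ℚ.* (∑ (arctanTerm ½) n ℚ.+ ∑ (arctanTerm ⅓) n)
      expand : ∀ c n → at (Pi ⊞ ⊟ κ c) n ≡ (p n -ᵠ c , 0ℚ)
      expand c n = ≡.trans (at-⊖ Pi (κ c) n) (cong₂ _⊖_ (at-Pi n) (at-κ c n))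
      near : ℚ.∣ p k -ᵠ 63/20 ∣ ≤ᵠ 1/20 ℚ.+ 1ℚ
      near = ℚ.≤-trans (a≤a+b _ (ℚ.0≤∣p∣ 0ℚ)) (ℚ.≤-trans (‖‖-reflexive (≡.sym (expand 63/20 k))) (b k (ℕ.m≤n⊔m N M)))
      -- At an index where the approximation is within 1/20 + 1 of 63/20, it is at least 21/10.
      lower : 1ℚ ≤ᵠ p k
      lower = ℚ.≤-trans (ℚ.≤ᵇ⇒≤ {1ℚ} {ℚ.- (1/20 ℚ.+ 1ℚ) ℚ.+ 63/20} _) (ℚ.≤-trans (ℚ.+-monoˡ-≤ 63/20 (∣∣-upper near))
        (ℚ.≤-reflexive (solveᵠ 2 (λ p c → p :-ᵠ c :+ᵠ c :=ᵠ p) ≡.refl (p k) 63/20)))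

  Positive-Sqrt : ∀ a → 0 ℕ.< a → Positive (Sqrt a)
  Positive-Sqrt a 0<a = positive 1ℚ 0<1 (Sqrt-approx a 0<a)

  -- Defs' operations are compared with the opaque ones pointwise, so that the
  -- proofs of the Cauchy property inside real numbers are never unfolded.
  ⊠-at : ∀ {x} u v → (∀ n → at x n ≡ at u n ⊗ at v n) → x ≋ u ⊠ v
  ⊠-at u v h = pointwise λ n → ≡.trans (h n) (≡.sym (at-⊠ u v n))

  ⊖-at : ∀ {x} u v → (∀ n → at x n ≡ at u n ⊖ at v n) → x ≋ u ⊞ ⊟ v
  ⊖-at u v h = pointwise λ n → ≡.trans (h n) (≡.sym (at-⊖ u v n))

  *ℂ-⊠ : ∀ x y → x *ℂ y ≋ x ⊠ y
  *ℂ-⊠ x y = ⊠-at x y λ n → ≡.refl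

  -ℂ-⊟ : ∀ x → -ℂ x ≋ ⊟ x
  -ℂ-⊟ x = pointwise λ n → ≡.sym (at-⊟ x n)

  -ℂ-⊞ : ∀ x y → x -ℂ y ≋ x ⊞ ⊟ y
  -ℂ-⊞ x y = ⊖-at x y λ n → ≡.refl

  fromℝ-κ : ∀ p → fromℝ (constℝ p) ≋ κ p
  fromℝ-κ p = reflexive (≡.sym (κ-def p))

  /ℕ-⊠ : ∀ x k .{{_ : NonZero k}} → x /ℕ k ≋ x ⊠ κ (+ 1 ℚ./ k)
  /ℕ-⊠ x k = trans (⊠-at x (fromℝ (constℝ (+ 1 ℚ./ k))) λ n → ≡.refl) (⊠-cong refl (fromℝ-κ (+ 1 ℚ./ k)))

  ∏-foldr : ∀ {f g : ℕ → ℂ} → (∀ j → f j ≋ g j) → ∀ xs → ∏ (map f xs) ≋ foldr _⊠_ (κ 1ℚ) (map g xs)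
  ∏-foldr h []       = pointwise λ n → ≡.sym (at-κ 1ℚ n)
  ∏-foldr {f} h (x ∷ xs) = trans (⊠-at (f x) (∏ (map f xs)) λ n → ≡.refl) (⊠-cong (h x) (∏-foldr h xs))

  exp-Exp : ∀ x {w} → x ≋ w → exp x ≋ Exp w
  exp-Exp x p = trans (reflexive (≡.sym (Exp-def x))) (Exp-cong p)

  sin-Exp : ∀ w {v} → i *ℂ w ≋ v → sin w ≋ (Exp v ⊞ ⊟ Exp (⊟ v)) ⊠ (⊟ I ⊠ κ ½)
  sin-Exp w {v} p = trans (⊠-at (exp (i *ℂ w) -ℂ exp (-ℂ (i *ℂ w))) ((-ℂ i) /ℕ 2) λ n → ≡.refl)
    (⊠-cong (trans (-ℂ-⊞ (exp (i *ℂ w)) (exp (-ℂ (i *ℂ w)))) (⊞-cong (exp-Exp (i *ℂ w) p) (⊟-cong (exp-Exp (-ℂ (i *ℂ w)) (trans (-ℂ-⊟ (i *ℂ w)) (⊟-cong p))))))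
      (trans (/ℕ-⊠ (-ℂ i) 2) (⊠-cong (trans (-ℂ-⊟ i) (⊟-cong (reflexive (≡.sym I-def)))) refl)))

  sin-sine : ∀ x {w} → x ≋ w → sin (fromℝ π *ℂ x) ≋ sine w
  sin-sine x {w} p = trans (sin-Exp (fromℝ π *ℂ x) (trans (*ℂ-⊠ i (fromℝ π *ℂ x)) (⊠-cong (reflexive (≡.sym I-def))
      (trans (*ℂ-⊠ (fromℝ π) x) (⊠-cong (reflexive (≡.sym Pi-def)) p)))))
    (⊠-cong (⊞-cong refl (⊟-cong (Exp-cong (solve 3 (λ i p w → :- (i :* (p :* w)) := i :* (p :* (:- w))) refl I Pi w)))) refl)
    where open Solver ℂ-algebra using (solve; _:=_; _:*_; :-_)

  -- The two possible values of `ϵ q` with their reasons, as a family over the real number, so that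
  -- the case distinction never has to abstract `primePower? q` from the goal.
  data Isϵ (q : ℕ) : ℝ → Set where
    root : ∀ p → Prime p → ∀ k → q ≡ p ^ suc k → Isϵ q (√ p)
    one  : ¬ PrimePower q → Isϵ q 1ℝ

  ϵ-Isϵ : ∀ q → Isϵ q (ϵ q)
  ϵ-Isϵ q with primePower? q
  ... | yes (p , pp , k , eq) = root p pp k eq
  ... | no ¬pp                = one ¬pp

  module _ {d : ℕ} (χ : DirichletCharacter (suc d)) where

    open DirichletCharacter χ using (periodic; multiplicative; coprime⇒nonzero; ¬coprime⇒zero)

    q : ℕ
    q = suc d

    X : ℕ → ℂ
    X j = χ ⟨ + j ⟩

    χ-* : ∀ m n → χ ⟨ m ℤ.* n ⟩ ≋ χ ⟨ m ⟩ ⊠ χ ⟨ n ⟩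
    χ-* m n = trans (≈⇒≋ (multiplicative m n)) (*ℂ-⊠ (χ ⟨ m ⟩) (χ ⟨ n ⟩))

    -- χ(1)² = χ(1), and χ(1) is invertible because 1 is coprime to q.
    χ-1 : X 1 ≋ κ 1ℚ
    χ-1 = cancel unit (trans (sym (χ-* (+ 1) (+ 1))) (sym (*-identityʳ (X 1))))
      where
      unit : Unit (X 1)
      unit = recip (X 1) nz , recip-inverse (X 1) nz
        where
        nz : Nonzero (X 1)
        nz = coprime⇒nonzero (+ 1) (ℕC.1-coprimeTo q)

    χ-0 : ∀ k → ¬ ℕC.Coprime k q → X k ≋ κ 0ℚ
    χ-0 k nc = trans (≈⇒≋ (¬coprime⇒zero (+ k) nc)) (fromℝ-κ 0ℚ)

    χ-periodic : ∀ n → χ ⟨ n ℤ.+ + q ⟩ ≋ χ ⟨ n ⟩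
    χ-periodic n = ≈⇒≋ (periodic n)

    X-period : ∀ M j → X (M ℕ.* q ℕ.+ j) ≋ X j
    X-period zero    j = refl
    X-period (suc M) j = trans (reflexive (cong X (≡.trans (ℕ.+-assoc q (M ℕ.* q) j) (ℕ.+-comm q (M ℕ.* q ℕ.+ j)))))
      (trans (χ-periodic (+ (M ℕ.* q ℕ.+ j))) (X-period M j))

    module _ (odd : Odd χ) where

      χ-neg : ∀ j → χ ⟨ ℤ.- + j ⟩ ≋ ⊟ X j
      χ-neg j = trans (reflexive (cong (χ ⟨_⟩) (≡.sym (ℤ.-1*i≡-i (+ j))))) (trans (χ-* (ℤ.- + 1) (+ j))
        (trans (⊠-cong (trans (≈⇒≋ odd) (trans (-ℂ-⊟ 1ℂ) (⊟-cong (fromℝ-κ 1ℚ)))) refl)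
          (solve 1 (λ x → :- con 1ℚ :* x := :- x) refl (X j))))
        where open Solver ℂ-algebra using (solve; _:=_; _:*_; :-_; con)

      X-reflect : ∀ M j → j ℕ.≤ q → X (M ℕ.* q ℕ.+ (q ℕ.∸ j)) ≋ ⊟ X j
      X-reflect M j j≤q = trans (X-period M (q ℕ.∸ j)) (trans (reflexive (cong (χ ⟨_⟩) (≡.sym (≡.trans (ℤ.-m+n≡n⊖m j q) (ℤ.⊖-≥ j≤q)))))
        (trans (χ-periodic (ℤ.- + j)) (χ-neg j)))

  module _ {d : ℕ} (χ : DirichletCharacter (suc d)) (z : ℂ) where

    Q₀ : ℕ → ℂ
    Q₀ = partialProduct χ z

    factor′ : ℕ → ℂ
    factor′ k = κ 1ℚ ⊞ ⊟ (X χ k ⊠ (z ⊠ κ (inv (ι k))))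

    /ℕ-inv : ∀ k → z /ℕ suc k ≋ z ⊠ κ (inv (ι (suc k)))
    /ℕ-inv k = trans (/ℕ-⊠ z (suc k)) (⊠-cong refl (reflexive (cong κ (≡.sym (RationalProducts.ι⁻¹-suc k)))))

    Q₀-suc : ∀ n → Q₀ (suc (suc n)) ≋ Q₀ (suc n) ⊠ factor′ (suc (suc n))
    Q₀-suc n = trans (⊠-at (Q₀ (suc n)) (1ℂ -ℂ X χ (suc (suc n)) *ℂ (z /ℕ suc (suc n))) λ m → ≡.refl)
      (⊠-cong refl (trans (-ℂ-⊞ 1ℂ (X χ (suc (suc n)) *ℂ (z /ℕ suc (suc n)))) (⊞-cong (fromℝ-κ 1ℚ)
        (⊟-cong (trans (*ℂ-⊠ (X χ (suc (suc n))) (z /ℕ suc (suc n))) (⊠-cong refl (/ℕ-inv (suc n))))))))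

    -- The partial product starts at k = 2; the factor 1 - z is the missing one at k = 1, where χ(1)
    -- = 1.
    Q₀-Π : ∀ n → Q₀ (suc n) ⊠ (κ 1ℚ ⊞ ⊟ z) ≋ Π factor′ (suc n)
    Q₀-Π zero = (⊠-cong (fromℝ-κ 1ℚ) (⊞-cong refl (⊟-cong (sym (trans (⊠-cong (χ-1 χ) (trans (⊠-cong refl κ⁻¹-1) (*-identityʳ z))) (*-identityˡ z))))))
      where
      κ⁻¹-1 : κ (inv (ι 1)) ≋ κ 1ℚ
      κ⁻¹-1 = reflexive (cong κ (RationalProducts.ι⁻¹-suc 0))
    Q₀-Π (suc n) = trans (⊠-cong (Q₀-suc n) refl) (trans (solve 3 (λ a b c → a :* b :* c := a :* c :* b) refl (Q₀ (suc n)) (factor′ (suc (suc n))) (κ 1ℚ ⊞ ⊟ z))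
      (⊠-cong (Q₀-Π n) refl))
      where open Solver ℂ-algebra using (solve; _:=_; _:*_)

    angle : ℕ → ℂ
    angle j = (κ (ι j) ⊞ ⊟ (X χ j ⊠ z)) ⊠ κ (1/suc d)

    angle-≋ : .{{nz : NonZero (suc d)}} → ∀ j → _/ℕ_ (fromℕ j -ℂ χ ⟨ + j ⟩ *ℂ z) (suc d) {{nz}} ≋ angle j
    angle-≋ {{nz}} j = trans (/ℕ-⊠ (fromℕ j -ℂ χ ⟨ + j ⟩ *ℂ z) (suc d) {{nz}}) (⊠-cong (trans (-ℂ-⊞ (fromℕ j) (χ ⟨ + j ⟩ *ℂ z))
      (⊞-cong (fromℝ-κ (ι j)) (⊟-cong (*ℂ-⊠ (χ ⟨ + j ⟩) z)))) refl)

    sines-≋ : .{{nz : NonZero (suc d)}} → ∏ (map (λ j → sin (fromℝ π *ℂ (_/ℕ_ (fromℕ j -ℂ χ ⟨ + j ⟩ *ℂ z) (suc d) {{nz}}))) (coprimesUpTo ((suc d ∸ 1) / 2) (suc d))) ≋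
      Π (coprimeOnly (suc d) (λ j → sine (angle j))) ((suc d ∸ 1) / 2)
    sines-≋ {{nz}} = trans (∏-foldr (λ j → sin-sine (_/ℕ_ (fromℕ j -ℂ χ ⟨ + j ⟩ *ℂ z) (suc d) {{nz}}) (angle-≋ {{nz}} j)) (coprimesUpTo ((suc d ∸ 1) / 2) (suc d)))
      (foldr-coprimesUpTo (λ j → sine (angle j)) ((suc d ∸ 1) / 2) (suc d))

    -- `W`, `sines` and `L` stand for the denominator, the product of sines and the claimed limit.
    -- They are variables, tied to the intended terms only by `sines≋` and by their Gaussian
    -- rational approximations.
    module Generic (odd : Odd χ) (2≤d : 2 ℕ.≤ d)
      (W : ℂ) (nz : Nonzero W) (W-at : ∀ n → at W n ≡ at (1ℂ -ℂ z) n ⊗ at (fromℝ (ϵ (suc d))) n)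
      (sines : ℂ) (sines≋ : sines ≋ Π (coprimeOnly (suc d) (λ j → sine (angle j))) (d / 2))
      (L : ℂ) (L-at : ∀ n → at L n ≡ (at (fromℕ (2 ^ (φ (suc d) / 2))) n ⊗ at (recip W nz) n) ⊗ at sines n) where

      open Character d 2≤d (X χ) z (χ-1 χ) (χ-0 χ) (X-period χ) (X-reflect χ odd) using (Q₀⇝)

      lim : ℂ
      lim = κ (ι (2 ^ (φ (suc d) / 2))) ⊠ recip W nz ⊠ Π (coprimeOnly (suc d) (λ j → sine (angle j))) (d / 2)

      L≋ : L ≋ lim
      L≋ = trans (⊠-at (fromℕ (2 ^ (φ (suc d) / 2)) ⊠ recip W nz) sines λ n →
          ≡.trans (L-at n) (cong (_⊗ at sines n) (≡.sym (at-⊠ (fromℕ (2 ^ (φ (suc d) / 2))) (recip W nz) n))))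
        (⊠-cong (⊠-cong (fromℝ-κ (ι (2 ^ (φ (suc d) / 2)))) refl) sines≋)

      conclude : ∀ S → S ≋ fromℝ (ϵ (suc d)) → Positive S → S ⊠ S ≋ Φ (suc d) d → Q₀ ⟶ L
      conclude S S≋ S>0 S² = ⟶-from {Q₀} {L} λ ε 0<ε → transfer ε (converges converges-to ε 0<ε)
        where
        W≋ : W ≋ (κ 1ℚ ⊞ ⊟ z) ⊠ S
        W≋ = trans (⊠-at (1ℂ -ℂ z) (fromℝ (ϵ (suc d))) W-at) (⊠-cong (trans (-ℂ-⊞ 1ℂ z) (⊞-cong (fromℝ-κ 1ℚ) refl)) (sym S≋))
        R-inverse : recip W nz ⊠ ((κ 1ℚ ⊞ ⊟ z) ⊠ S) ≋ κ 1ℚ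
        R-inverse = trans (⊠-comm (recip W nz) ((κ 1ℚ ⊞ ⊟ z) ⊠ S)) (trans (⊠-cong (sym W≋) refl) (recip-inverse W nz))
        converges-to : Q₀ ⇝ lim
        converges-to = Q₀⇝ Positive-Pi S S>0 S² (recip W nz) R-inverse Q₀ Q₀-Π
        transfer : ∀ ε → (∃ λ N → ∀ n → N ℕ.≤ n → Q₀ n ⊞ ⊟ lim ≼ ε) → ∃ λ N → ∀ n → N ℕ.≤ n → Q₀ n ⊞ ⊟ L ≼ ε
        transfer ε (N , h) = N , λ n N≤n → ≼-resp (⊞-cong refl (⊟-cong (sym L≋))) (h n N≤n)

      finish : Q₀ ⟶ L
      finish = go (ϵ-Isϵ (suc d)) refl
        where
        go : ∀ {x} → Isϵ (suc d) x → fromℝ x ≋ fromℝ (ϵ (suc d)) → Q₀ ⟶ L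
        go (root p pp k eq) x≋ = conclude (Sqrt p) (trans (reflexive (Sqrt-def p)) x≋)
          (Positive-Sqrt p (ℕ.>-nonZero⁻¹ p {{prime⇒nonZero pp}})) (trans (Sqrt-square p) (sym (Φ-primePower pp k eq)))
        go (one ¬pp) x≋ = conclude (κ 1ℚ) (trans (sym (fromℝ-κ 1ℚ)) x≋)
          Positive-1 (trans (*-identityˡ (κ 1ℚ)) (sym (Φ-notPrimePower (ℕ.≤-trans (ℕ.n≤1+n 1) 2≤d) ¬pp)))

  -- There are no odd characters modulo 2, where -1 ≡ 1.
  modulo-2 : ∀ {d} → d ≡ 1 → (χ : DirichletCharacter (suc d)) → Odd χ → ∀ a L → a ⟶ L
  modulo-2 ≡.refl χ odd a L = ⟶-from {a} {L} λ ε 0<ε → 0 , λ n _ → ≼-mono (ℚ.<⇒≤ 0<ε) (≼-resp (sym (collapse (a n ⊞ ⊟ L))) zero≼)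
    where
    open Solver ℂ-algebra using (solve; _:=_; _:*_; _:+_; :-_; con)
    zero≼ : κ 0ℚ ≼ 0ℚ
    zero≼ = ≼-κ 0ℚ
    1≋-1 : κ 1ℚ ≋ ⊟ κ 1ℚ
    1≋-1 = trans (sym (χ-1 χ)) (trans (χ-periodic χ (ℤ.- + 1)) (trans (χ-neg χ odd 1) (⊟-cong (χ-1 χ))))
    collapse : ∀ x → x ≋ κ 0ℚ
    collapse x = trans (solve 1 (λ x → x := con ½ :* (con 1ℚ :* x :+ con 1ℚ :* x)) refl x)
      (trans (⊠-cong refl (⊞-cong (⊠-cong 1≋-1 refl) refl)) (solve 1 (λ x → con ½ :* (:- con 1ℚ :* x :+ con 1ℚ :* x) := con 0ℚ) refl x))

open ComplexAnalysis using (modulo-2; sines-≋; module Generic)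

-- The modulus is d + 1. The alternative `1 ≡ d` is the modulus 2, where 1 and -1 are the same
-- residue and the pairing argument does not apply.
product-formula : (d : ℕ) .{{nz : NonZero (suc d)}} → 1 < d ⊎ 1 ≡ d →
    (χ : DirichletCharacter (suc d)) → Odd χ → (z : ℂ) (z≠1 : z # 1ℂ) →
    partialProduct χ z ⟶
    ((fromℕ (2 ^ (φ (suc d) / 2)) ÷ℂ (1ℂ -ℂ z) *ℂ fromℝ (ϵ (suc d)) [ denominator-nonzero (suc d) {z} z≠1 ])
    *ℂ ∏ (map (λ j → sin (fromℝ π *ℂ (_/ℕ_ (fromℕ j -ℂ χ ⟨ + j ⟩ *ℂ z) (suc d) {{nz}})))
    (coprimesUpTo ((suc d ∸ 1) / 2) (suc d))))
product-formula d {{nz}} (inj₁ 1<d) χ odd z z≠1 = Generic.finish χ z odd 1<d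
    ((1ℂ -ℂ z) *ℂ fromℝ (ϵ (suc d))) (denominator-nonzero (suc d) {z} z≠1) (λ n → ≡.refl)
    (∏ (map (λ j → sin (fromℝ π *ℂ (_/ℕ_ (fromℕ j -ℂ χ ⟨ + j ⟩ *ℂ z) (suc d) {{nz}}))) (coprimesUpTo ((suc d ∸ 1) / 2) (suc d)))) (sines-≋ χ z {{nz}})
    ((fromℕ (2 ^ (φ (suc d) / 2)) ÷ℂ (1ℂ -ℂ z) *ℂ fromℝ (ϵ (suc d)) [ denominator-nonzero (suc d) {z} z≠1 ])
    *ℂ ∏ (map (λ j → sin (fromℝ π *ℂ (_/ℕ_ (fromℕ j -ℂ χ ⟨ + j ⟩ *ℂ z) (suc d) {{nz}})))
    (coprimesUpTo ((suc d ∸ 1) / 2) (suc d))))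
    (λ n → ≡.refl)
product-formula d {{nz}} (inj₂ 1≡d) χ odd z z≠1 = modulo-2 (≡.sym 1≡d) χ odd (partialProduct χ z)
    ((fromℕ (2 ^ (φ (suc d) / 2)) ÷ℂ (1ℂ -ℂ z) *ℂ fromℝ (ϵ (suc d)) [ denominator-nonzero (suc d) {z} z≠1 ])
    *ℂ ∏ (map (λ j → sin (fromℝ π *ℂ (_/ℕ_ (fromℕ j -ℂ χ ⟨ + j ⟩ *ℂ z) (suc d) {{nz}})))
    (coprimesUpTo ((suc d ∸ 1) / 2) (suc d))))

theorem2 : (q : ℕ) .{{_ : NonZero q}} → 1 < q →
    (χ : DirichletCharacter q) → Primitive χ → Odd χ →
    (z : ℂ) (z≠1 : z # 1ℂ) →
    partialProduct χ z ⟶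
    (fromℕ (2 ^ (φ q / 2)) ÷ℂ (1ℂ -ℂ z) *ℂ fromℝ (ϵ q) [ denominator-nonzero q {z} z≠1 ])
    *ℂ ∏ (map (λ j → sin (fromℝ π *ℂ ((fromℕ j -ℂ χ ⟨ + j ⟩ *ℂ z) /ℕ q)))
    (coprimesUpTo ((q ∸ 1) / 2) q))
theorem2 (suc d) {{nz}} 1<q χ _ odd z z≠1 = product-formula d {{nz}} (ℕ.m≤n⇒m<n∨m≡n (ℕ.s≤s⁻¹ 1<q)) χ odd z z≠1
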